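{- Let $(W,S)$ and $(W',S')$ be finite irreducible Coxeter systems such that $W$ folds to $W'$ via $\mathrm{fold}:S\to S'$ and $\mathrm{unfold}:W'\to W$. Let $c'$ be a bipartite Coxeter element of $W'$ and $c=\mathrm{unfold}(c')$ (a Coxeter element of $W$). Then for every $w'\in W'$ and every integer $k\ge 0$, \[\mathrm{unfold}\big(\mathsf{Pop}_{T'}^k(w',c')\big)=\mathsf{Pop}_T^k(\mathrm{unfold}(w'),c).\]
   Context: $W$ folds to $W'$ if there is a surjective map $\mathrm{fold}:S\to S'$ such that for each $s'\in S'$ the elements of $\mathrm{fold}^{ -1}(s')$ pairwise commute, and an injective group homomorphism $\mathrm{unfold}:W'\to W$ with $\mathrm{unfold}(s')=\prod_{s\in\mathrm{fold}^{ -1}(s')}s$ for all $s'\in S'$. A bipartite Coxeter element of $W'$ is $c'=c'_+c'_-$, where $S'=S'_+\sqcup S'_-$ with the elements of each part pairwise commuting and $c'_\pm$ the product of the elements of $S'_\pm$. $T$, $T'$ are the sets of reflections (conjugates of simple reflections) of $W$, $W'$. For a Coxeter group $G$ with reflections $R$ and Coxeter element $d$: $\ell_R(w)$ is the minimal number of reflections with product $w$; absolute order $v\le_R w$ iff $\ell_R(wv^{ -1})=\ell_R(w)-\ell_R(v)$; $\mathrm{NC}(G,d)=[e,d]$ in absolute order, a lattice; $\pi_R(w,d)=\bigvee_{t\in R,\ t\le_R w}t$ (join in $\mathrm{NC}(G,d)$, empty join $=e$); $\mathsf{Pop}_R(w,d)=w\,\pi_R(w,d)^{ -1}$. A Coxeter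 element is a regular element of order equal to the Coxeter number. -}

module Defs where

open import Level using (Level; _⊔_) renaming (suc to lsuc)
import Level
open import Data.Nat using (ℕ; zero; suc; _+_; _≤_)
open import Data.Fin using (Fin; _≟_)
open import Data.Bool using (Bool; true; false)
open import Data.List using (List; []; _∷_; foldr; map; length; allFin)
open import Data.List.Relation.Unary.All using (All)
open import Data.List.Relation.Unary.Any using (Any)
open import Data.Product using (Σ; ∃; _×_; _,_)
open import Relation.Nullary using (yes; no; ¬_)
import Relation.Nullary.Decidable
import Data.Bool
open import Relation.Binary.PropositionalEquality using (_≡_; _≢_)
open import Relation.Binary.Construct.Closure.ReflexiveTransitive using (Star)
open import Algebra.Bundles using (Group)
open import Algebra.Morphism.Structures using (module GroupMorphisms)

module GroupOps {a ℓ : Level} (G : Group a ℓ) where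
  open Group G

  pow : Carrier → ℕ → Carrier
  pow x zero    = ε
  pow x (suc k) = x ∙ pow x k

  prod : List Carrier → Carrier
  prod = foldr _∙_ ε

open GroupOps public

-- Coxeter systems (W,S), given by the Coxeter presentation.
-- S = { gen i | i : Fin rank }, Coxeter matrix m (entries in ℕ; finite
-- entries suffice here since only finite Coxeter groups are considered).

record CoxeterSystem (a ℓ : Level) : Set (lsuc (a ⊔ ℓ)) where
  field
    group : Group a ℓ
  open Group group
  field
    rank      : ℕ
    gen       : Fin rank → Carrier
    m         : Fin rank → Fin rank → ℕ
    m-diag    : ∀ i → m i i ≡ 1
    m-sym     : ∀ i j → m i j ≡ m j i
    m-off     : ∀ i j → i ≢ j → 2 ≤ m i j
    relations : ∀ i j → pow group (gen i ∙ gen j) (m i j) ≈ ε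
    generated : ∀ w → ∃ λ (is : List (Fin rank)) → w ≈ prod group (map gen is)
    universal : (H : Group a ℓ) (f : Fin rank → Group.Carrier H) →
                (∀ i j → Group._≈_ H (pow H (Group._∙_ H (f i) (f j)) (m i j)) (Group.ε H)) →
                ∃ λ (φ : Carrier → Group.Carrier H) →
                  GroupMorphisms.IsGroupHomomorphism (Group.rawGroup group) (Group.rawGroup H) φ
                  × (∀ i → Group._≈_ H (φ (gen i)) (f i))

module CoxeterNotions {a ℓ : Level} (C : CoxeterSystem a ℓ) where
  open CoxeterSystem C public
  open Group group public

  IsFinite : Set (a ⊔ ℓ)
  IsFinite = ∃ λ (xs : List Carrier) → ∀ w → Any (w ≈_) xs

  Edge : Fin rank → Fin rank → Set
  Edge i j = 3 ≤ m i j

  IsIrreducible : Set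
  IsIrreducible = ∀ i j → Star Edge i j

  IsReflection : Carrier → Set (a ⊔ ℓ)
  IsReflection t = ∃ λ g → ∃ λ i → t ≈ (g ∙ gen i) ∙ g ⁻¹

  ReflLength : Carrier → ℕ → Set (a ⊔ ℓ)
  ReflLength w k =
    (∃ λ (ts : List Carrier) → All IsReflection ts × length ts ≡ k × w ≈ prod group ts)
    × (∀ (ts : List Carrier) → All IsReflection ts → w ≈ prod group ts → k ≤ length ts)

  _≤T_ : Carrier → Carrier → Set (a ⊔ ℓ)
  v ≤T w = ∃ λ lw → ∃ λ lv → ∃ λ lq →
             ReflLength w lw × ReflLength v lv × ReflLength (w ∙ v ⁻¹) lq × lq + lv ≡ lw

  IsJoinNC : (d : Carrier) → (Carrier → Set (a ⊔ ℓ)) → Carrier → Set (a ⊔ ℓ)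
  IsJoinNC d P j =
    j ≤T d
    × (∀ t → P t → t ≤T j)
    × (∀ u → u ≤T d → (∀ t → P t → t ≤T u) → j ≤T u)

  IsPi : Carrier → Carrier → Carrier → Set (a ⊔ ℓ)
  IsPi w d p = IsJoinNC d (λ t → IsReflection t × t ≤T w) p

  IsPop : Carrier → Carrier → Carrier → Set (a ⊔ ℓ)
  IsPop w d y = ∃ λ p → IsPi w d p × y ≈ w ∙ p ⁻¹

  IsPopIter : ℕ → Carrier → Carrier → Carrier → Set (a ⊔ ℓ)
  IsPopIter zero    w d y = Level.Lift (a ⊔ ℓ) (y ≈ w)
  IsPopIter (suc k) w d y = ∃ λ z → IsPopIter k w d z × IsPop z d y

  prodGenWhere : (Fin rank → Bool) → Carrier
  prodGenWhere A = prod group (go (allFin rank))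
    where
      go : List (Fin rank) → List Carrier
      go [] = []
      go (i ∷ is) with A i
      ... | true  = gen i ∷ go is
      ... | false = go is

  IsBipartiteCoxeterElement : Carrier → Set ℓ
  IsBipartiteCoxeterElement c =
    ∃ λ (side : Fin rank → Bool) →
      (∀ i j → side i ≡ side j → gen i ∙ gen j ≈ gen j ∙ gen i)
      × c ≈ prodGenWhere side ∙ prodGenWhere (λ i → Data.Bool.not (side i))

record Folding {a ℓ a' ℓ' : Level} (W : CoxeterSystem a ℓ) (W' : CoxeterSystem a' ℓ')
       : Set (a ⊔ ℓ ⊔ a' ⊔ ℓ') where
  private
    module W  = CoxeterNotions W
    module W' = CoxeterNotions W'
  field
    fold         : Fin W.rank → Fin W'.rank
    fold-surj    : ∀ j → ∃ λ i → fold i ≡ j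
    fold-commute : ∀ i j → fold i ≡ fold j → W.gen i W.∙ W.gen j W.≈ W.gen j W.∙ W.gen i
    unfold       : W'.Carrier → W.Carrier
    unfold-hom   : GroupMorphisms.IsGroupHomomorphism W'.rawGroup W.rawGroup unfold
    unfold-inj   : ∀ x y → unfold x W.≈ unfold y → x W'.≈ y
    unfold-gen   : ∀ j → unfold (W'.gen j) W.≈
                     W.prodGenWhere (λ i → Relation.Nullary.Decidable.⌊ fold i ≟ j ⌋)

{-# OPTIONS --safe #-}
module Submission where

-- Everything is read off the geometric representation of W, over an ordered ring containing elements that behave
-- like 2 cos(π/m).  For a Coxeter element c = s₁ ⋯ sₙ the Euler form E, a triangular half of the invariant form,
-- controls NC(W, c): if c = u v is a reduced factorisation, then t ≤ u iff the root of t is E-orthogonal to the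
-- roots of the factors of v.  Rotating the word s₁ ⋯ sₙ moves any given reflection to its end, and there
-- E-orthogonality to it says that one simple coordinate vanishes.  Meets of the cones spanned by the positive roots
-- below u show that the joins defining Pop exist.
--
-- For the folding, unfold sends reduced words to reduced words, because the longest elements of W and W′ are
-- alternating products of c₊ and c₋ with the same number of factors.  Hence unfold(w′) preserves the coordinate of
-- s ∈ fold⁻¹(s′) iff w′ lies in the parabolic subgroup omitting s′.  Rotating only by the blocks unfold(s′), this
-- translates both defining properties of the join π_{T′}(w′, c′) into those of π_T(unfold(w′), c), so that unfold
-- commutes with π, and therefore with Pop.

open import Defs
open import Level using (Level; 0ℓ; Lift; lift; lower)
open import Data.Nat as ℕ using (ℕ; zero; suc; _≤_; _<_; z≤n; s≤s)
import Data.Nat.Properties as ℕₚ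
open import Data.Nat.ListAction using (sum)
open import Data.Integer as ℤ using (ℤ; -[1+_]) renaming (+_ to ℤ+_)
import Data.Integer.Properties as ℤₚ
import Data.Sign as Sign
open import Data.Bool as Bool using (Bool; true; false; not)
import Data.Bool.Properties as Boolₚ
open import Data.Fin as Fin using (Fin; zero; suc; toℕ)
import Data.Fin.Properties as Finₚ
open import Data.Vec as Vec using (Vec)
open import Data.Maybe using (Maybe; just; nothing)
open import Data.List as List using (List; []; _∷_; _++_; _∷ʳ_; map; length; foldr; reverse; concatMap; filter; filterᵇ; allFin; initLast; _∷ʳ′_)
import Data.List.Properties as Listₚ
open import Data.List.Relation.Unary.All as All using (All; []; _∷_)
import Data.List.Relation.Unary.All.Properties as Allₚ
open import Data.List.Relation.Unary.Any as Any using (Any; here; there)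
import Data.List.Relation.Unary.Any.Properties as Anyₚ
open import Data.List.Relation.Unary.AllPairs as AllPairs using (AllPairs; []; _∷_)
import Data.List.Relation.Unary.AllPairs.Properties as AllPairsₚ
open import Data.List.Relation.Unary.Unique.Propositional using (Unique)
import Data.List.Relation.Unary.Unique.Propositional.Properties as Uniqueₚ
open import Data.List.Relation.Binary.Sublist.Propositional using (_⊆_; []; _∷_; ⊆-refl; ⊆-trans) renaming (_∷ʳ_ to _∷ˢ_)
open import Data.List.Relation.Binary.Sublist.Propositional.Properties using (++⁺)
open import Data.List.Membership.Propositional using (_∈_; _∉_; lose; find)
open import Data.List.Membership.Propositional.Properties using (∈-++⁺ˡ; ∈-++⁺ʳ; ∈-++⁻; ∈-filter⁺; ∈-filter⁻; ∈-allFin; ∈-∃++; ∈-map⁺; ∈-map⁻; ∈-lookup)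
open import Data.List.Membership.DecPropositional using () renaming (_∈?_ to mem?)
open import Data.Product using (Σ; ∃; _×_; _,_; proj₁; proj₂)
open import Data.Sum using (_⊎_; inj₁; inj₂)
open import Data.Unit using (⊤; tt)
open import Data.Empty using (⊥; ⊥-elim)
open import Function using (_∘_; id)
open import Relation.Nullary using (¬_; Dec; yes; no)
open import Relation.Nullary.Decidable using (_×-dec_; _→-dec_; ¬?; decidable-stable; map′; does; isYes≗does)
open import Relation.Binary.Bundles using (Setoid)
open import Relation.Binary.Definitions using (tri<; tri≈; tri>)
open import Relation.Binary.Construct.Closure.ReflexiveTransitive using (Star; _◅_) renaming (ε to ◾)
open import Relation.Binary.PropositionalEquality as ≡ using (_≡_; _≢_; refl; cong; cong₂; subst; subst₂; sym; trans)
import Relation.Binary.Reasoning.Setoid as SetoidReasoning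
import Relation.Binary.Reflection as Reflection
open import Axiom.UniquenessOfIdentityProofs using (module Decidable⇒UIP)
open import Algebra.Bundles using (Group; AbelianGroup; CommutativeRing)
open import Algebra.Morphism.Structures using (module GroupMorphisms)
import Algebra.Construct.Pointwise as Pointwise
import Algebra.Properties.AbelianGroup as AbelianGroupProperties
import Algebra.Properties.Ring as RingProperties
import Algebra.Properties.Semiring.Mult.TCOptimised as Mult
import Algebra.Solver.Ring as RingSolver
open import Algebra.Solver.Ring.AlmostCommutativeRing using (fromCommutativeRing; _-Raw-AlmostCommutative⟶_)

-- The ordered ring is not a field, its order is only partial and its equality is not decided, so
-- nothing can be argued by ranks, dimensions or division. Three substitutes shape the proof. Signs
-- of roots come from word length: `sgn` compares `ℓ g` with `ℓ (g · s i)`, and case distinctions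
-- are made on group elements. Reflection length is controlled by paths in the group: Hurwitz moves
-- remove the peaks of the word length along a reduced factorisation, and the exchange condition
-- then deletes letters one at a time. Termination of the rotations comes from positivity: a vector
-- supported on the letters of c that stays positive through enough rotations vanishes, since its
-- sum over the powers of c is fixed by every letter. Finiteness is given by a list covering W up to
-- an equality that need not be decidable. Coset enumeration therefore first replaces W by an
-- isomorphic group with decidable equality, where lengths and orders can be computed by search.

module IntegerSolver (R : CommutativeRing 0ℓ 0ℓ) where
  open CommutativeRing R renaming (refl to ≈-refl; sym to ≈-sym; trans to ≈-trans)
  open RingProperties ring using (-‿distribˡ-*; -‿distribʳ-*; -0#≈0#; -‿involutive)
  open AbelianGroupProperties +-abelianGroup using () renaming (⁻¹-∙-comm to neg-+)
  open Mult semiring using (1+×; ×-homo-+; ×1-homo-*) renaming (_×_ to _•_)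
  open SetoidReasoning setoid

  -- Integers serve as coefficients because the normaliser has to compare coefficients, while
  -- equality in `R` is a bare relation.
  ι : ℤ → Carrier
  ι (ℤ+ n)    = n • 1#
  ι -[1+ n ] = - (suc n • 1#)

  ι-⊖ : ∀ m n → ι (m ℤ.⊖ n) ≈ m • 1# - n • 1#
  ι-⊖ m zero = ≈-sym (≈-trans (+-congˡ -0#≈0#) (+-identityʳ _))
  ι-⊖ zero (suc n) = ≈-sym (+-identityˡ _)
  ι-⊖ (suc m) (suc n) = begin
    ι (suc m ℤ.⊖ suc n)                ≡⟨ cong ι (ℤₚ.[1+m]⊖[1+n]≡m⊖n m n) ⟩
    ι (m ℤ.⊖ n)                        ≈⟨ ι-⊖ m n ⟩
    m • 1# - n • 1#                    ≈⟨ +-congʳ (+-identityʳ _) ⟨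
    (m • 1# + 0#) - n • 1#             ≈⟨ +-congʳ (+-congˡ (-‿inverseʳ 1#)) ⟨
    (m • 1# + (1# - 1#)) - n • 1#      ≈⟨ +-congʳ (≈-trans (≈-sym (+-assoc _ _ _)) (+-congʳ (+-comm _ _))) ⟩
    ((1# + m • 1#) - 1#) - n • 1#      ≈⟨ +-assoc _ _ _ ⟩
    (1# + m • 1#) + (- 1# - n • 1#)    ≈⟨ +-congˡ (neg-+ _ _) ⟩
    (1# + m • 1#) - (1# + n • 1#)      ≈⟨ +-cong (1+× m 1#) (-‿cong (1+× n 1#)) ⟨
    suc m • 1# - suc n • 1#            ∎

  ι-+ : ∀ x y → ι (x ℤ.+ y) ≈ ι x + ι y
  ι-+ (ℤ+ m) (ℤ+ n) = ×-homo-+ 1# m n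
  ι-+ (ℤ+ m) -[1+ n ] = ι-⊖ m (suc n)
  ι-+ -[1+ m ] (ℤ+ n) = ≈-trans (ι-⊖ n (suc m)) (+-comm _ _)
  ι-+ -[1+ m ] -[1+ n ] = begin
    - (suc (suc (m ℕ.+ n)) • 1#)           ≡⟨ cong (λ k → - (suc k • 1#)) (≡.sym (ℕₚ.+-suc m n)) ⟩
    - ((suc m ℕ.+ suc n) • 1#)             ≈⟨ -‿cong (×-homo-+ 1# (suc m) (suc n)) ⟩
    - (suc m • 1# + suc n • 1#)            ≈⟨ neg-+ _ _ ⟨
    - (suc m • 1#) - suc n • 1#            ∎

  ι-◃+ : ∀ k → ι (Sign.+ ℤ.◃ k) ≈ k • 1#
  ι-◃+ zero = ≈-refl
  ι-◃+ (suc k) = ≈-refl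

  ι-◃- : ∀ k → ι (Sign.- ℤ.◃ k) ≈ - (k • 1#)
  ι-◃- zero = ≈-sym -0#≈0#
  ι-◃- (suc k) = ≈-refl

  ι-* : ∀ x y → ι (x ℤ.* y) ≈ ι x * ι y
  ι-* (ℤ+ m) (ℤ+ n) = ≈-trans (ι-◃+ (m ℕ.* n)) (×1-homo-* m n)
  ι-* (ℤ+ m) -[1+ n ] = ≈-trans (ι-◃- (m ℕ.* suc n)) (≈-trans (-‿cong (×1-homo-* m (suc n))) (-‿distribʳ-* _ _))
  ι-* -[1+ m ] (ℤ+ n) = ≈-trans (ι-◃- (suc m ℕ.* n)) (≈-trans (-‿cong (×1-homo-* (suc m) n)) (-‿distribˡ-* _ _))
  ι-* -[1+ m ] -[1+ n ] = begin
    ι (Sign.+ ℤ.◃ (suc m ℕ.* suc n))  ≈⟨ ι-◃+ (suc m ℕ.* suc n) ⟩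
    (suc m ℕ.* suc n) • 1#            ≈⟨ ×1-homo-* (suc m) (suc n) ⟩
    (suc m • 1#) * (suc n • 1#)       ≈⟨ -‿involutive _ ⟨
    - - ((suc m • 1#) * (suc n • 1#)) ≈⟨ -‿cong (-‿distribˡ-* _ _) ⟩
    - (- (suc m • 1#) * (suc n • 1#)) ≈⟨ -‿distribʳ-* _ _ ⟩
    - (suc m • 1#) * - (suc n • 1#)   ∎

  ι-neg : ∀ x → ι (ℤ.- x) ≈ - ι x
  ι-neg (ℤ+ zero) = ≈-sym -0#≈0#
  ι-neg (ℤ+ suc n) = ≈-refl
  ι-neg -[1+ n ] = ≈-sym (-‿involutive _)

  ℤ⟶R : ℤ.+-*-rawRing -Raw-AlmostCommutative⟶ fromCommutativeRing R
  ℤ⟶R = record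
    { ⟦_⟧ = ι ; +-homo = ι-+ ; *-homo = ι-* ; -‿homo = ι-neg ; 0-homo = ≈-refl ; 1-homo = ≈-refl }

  dec : ∀ x y → Maybe (ι x ≈ ι y)
  dec x y with x ℤ.≟ y
  ... | yes p = just (reflexive (cong ι p))
  ... | no _  = nothing

  open RingSolver ℤ.+-*-rawRing (fromCommutativeRing R) ℤ⟶R dec public
    using (solve; _:=_; _:+_; _:*_; _:-_; :-_; con)

-- Group identities are decided by free reduction.
module GroupSolver {G : Set} (_·_ : G → G → G) (e : G) (inv : G → G)
  (assoc : ∀ x y z → ((x · y) · z) ≡ (x · (y · z)))
  (idˡ : ∀ x → (e · x) ≡ x) (idʳ : ∀ x → (x · e) ≡ x)
  (invˡ : ∀ x → (inv x · x) ≡ e) (invʳ : ∀ x → (x · inv x) ≡ e) where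

  infixl 7 _⊙_
  data GExpr (k : ℕ) : Set where
    var  : Fin k → GExpr k
    ε    : GExpr k
    _⊙_  : GExpr k → GExpr k → GExpr k
    _⁻   : GExpr k → GExpr k

  ⟦_⟧ : ∀ {k} → GExpr k → Vec G k → G
  ⟦ var i ⟧ ρ = Vec.lookup ρ i
  ⟦ ε ⟧     ρ = e
  ⟦ a ⊙ b ⟧ ρ = ⟦ a ⟧ ρ · ⟦ b ⟧ ρ
  ⟦ a ⁻ ⟧   ρ = inv (⟦ a ⟧ ρ)

  Lit : ℕ → Set
  Lit k = Bool × Fin k

  ⟦_⟧ᴸ : ∀ {k} → Lit k → Vec G k → G
  ⟦ true  , i ⟧ᴸ ρ = Vec.lookup ρ i
  ⟦ false , i ⟧ᴸ ρ = inv (Vec.lookup ρ i)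

  ⟦_⟧* : ∀ {k} → List (Lit k) → Vec G k → G
  ⟦ [] ⟧*     ρ = e
  ⟦ l ∷ ls ⟧* ρ = ⟦ l ⟧ᴸ ρ · ⟦ ls ⟧* ρ

  push : ∀ {k} → Lit k → List (Lit k) → List (Lit k)
  push l [] = l ∷ []
  push (true , i) ((false , j) ∷ ls) with i Fin.≟ j
  ... | yes _ = ls
  ... | no  _ = (true , i) ∷ (false , j) ∷ ls
  push (false , i) ((true , j) ∷ ls) with i Fin.≟ j
  ... | yes _ = ls
  ... | no  _ = (false , i) ∷ (true , j) ∷ ls
  push (true , i) ((true , j) ∷ ls) = (true , i) ∷ (true , j) ∷ ls
  push (false , i) ((false , j) ∷ ls) = (false , i) ∷ (false , j) ∷ ls

  flat : ∀ {k} → Bool → GExpr k → List (Lit k) → List (Lit k)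
  flat b (var i)     acc = push (b , i) acc
  flat b ε           acc = acc
  flat true  (a ⊙ c) acc = flat true a (flat true c acc)
  flat false (a ⊙ c) acc = flat false c (flat false a acc)
  flat b (a ⁻)       acc = flat (not b) a acc

  private
    cancelˡ : ∀ x y → x · (inv x · y) ≡ y
    cancelˡ x y = ≡.trans (≡.sym (assoc x (inv x) y)) (≡.trans (cong (_· y) (invʳ x)) (idˡ y))
    cancelʳ : ∀ x y → inv x · (x · y) ≡ y
    cancelʳ x y = ≡.trans (≡.sym (assoc (inv x) x y)) (≡.trans (cong (_· y) (invˡ x)) (idˡ y))

  inv-unique : ∀ x y → x · y ≡ e → y ≡ inv x
  inv-unique x y p = ≡.trans (≡.sym (cancelʳ x y)) (≡.trans (cong (inv x ·_) p) (idʳ (inv x)))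

  inv-· : ∀ x y → inv (x · y) ≡ inv y · inv x
  inv-· x y = ≡.sym (inv-unique (x · y) (inv y · inv x)
    (≡.trans (assoc x y _) (≡.trans (cong (x ·_) (cancelˡ y (inv x))) (invʳ x))))

  inv-inv : ∀ x → inv (inv x) ≡ x
  inv-inv x = ≡.sym (inv-unique (inv x) x (invˡ x))

  inv-e : inv e ≡ e
  inv-e = ≡.sym (inv-unique e e (idˡ e))

  push-ok : ∀ {k} (l : Lit k) ls ρ → ⟦ push l ls ⟧* ρ ≡ ⟦ l ⟧ᴸ ρ · ⟦ ls ⟧* ρ
  push-ok l [] ρ = ≡.refl
  push-ok (true , i) ((false , j) ∷ ls) ρ with i Fin.≟ j
  ... | yes ≡.refl = ≡.sym (cancelˡ _ _)
  ... | no  _ = ≡.refl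
  push-ok (false , i) ((true , j) ∷ ls) ρ with i Fin.≟ j
  ... | yes ≡.refl = ≡.sym (cancelʳ _ _)
  ... | no  _ = ≡.refl
  push-ok (true , i) ((true , j) ∷ ls) ρ = ≡.refl
  push-ok (false , i) ((false , j) ∷ ls) ρ = ≡.refl

  signed : Bool → G → G
  signed true  x = x
  signed false x = inv x

  flat-ok : ∀ {k} b (a : GExpr k) acc ρ → ⟦ flat b a acc ⟧* ρ ≡ signed b (⟦ a ⟧ ρ) · ⟦ acc ⟧* ρ
  flat-ok true (var i) acc ρ = push-ok _ acc ρ
  flat-ok false (var i) acc ρ = push-ok _ acc ρ
  flat-ok true ε acc ρ = ≡.sym (idˡ _)
  flat-ok false ε acc ρ = ≡.sym (≡.trans (cong (_· ⟦ acc ⟧* ρ) inv-e) (idˡ _))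
  flat-ok true (a ⊙ c) acc ρ = ≡.trans (flat-ok true a _ ρ) (≡.trans (cong (_ ·_) (flat-ok true c acc ρ)) (≡.sym (assoc _ _ _)))
  flat-ok false (a ⊙ c) acc ρ = ≡.trans (flat-ok false c _ ρ) (≡.trans (cong (_ ·_) (flat-ok false a acc ρ))
    (≡.trans (≡.sym (assoc _ _ _)) (cong (_· ⟦ acc ⟧* ρ) (≡.sym (inv-· _ _)))))
  flat-ok true (a ⁻) acc ρ = flat-ok false a acc ρ
  flat-ok false (a ⁻) acc ρ = ≡.trans (flat-ok true a acc ρ) (cong (_· ⟦ acc ⟧* ρ) (≡.sym (inv-inv _)))

  open Reflection (≡.setoid G) var ⟦_⟧ (λ a ρ → ⟦ flat true a [] ⟧* ρ)
    (λ a ρ → ≡.trans (flat-ok true a [] ρ) (idʳ _)) public using (solve; _⊜_)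

-- Scalars that behave like 2 cos(π/m)

chebOp : (A : AbelianGroup 0ℓ 0ℓ) → let open AbelianGroup A in
         (Carrier → Carrier) → ℕ → Carrier → Carrier
chebOp A o zero          x = AbelianGroup.ε A
chebOp A o (suc zero)    x = x
chebOp A o (suc (suc k)) x = AbelianGroup._-_ A (o (chebOp A o (suc k) x)) (chebOp A o k x)

module AG (A : AbelianGroup 0ℓ 0ℓ) where
  open AbelianGroup A public
    renaming (_∙_ to _+_; ε to 0#; _⁻¹ to -_; ∙-cong to +-cong; ⁻¹-cong to neg-cong;
              identityˡ to +-identityˡ; identityʳ to +-identityʳ; assoc to +-assoc;
              comm to +-comm; inverseˡ to +-inverseˡ; inverseʳ to +-inverseʳ;
              refl to ≈-refl; sym to ≈-sym; trans to ≈-trans; reflexive to ≈-reflexive)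
  open AbelianGroupProperties A public using ()
    renaming (⁻¹-∙-comm to neg-+; ⁻¹-involutive to neg-neg; ε⁻¹≈ε to neg-0;
              ∙-cancelʳ to +-cancelʳ; inverseˡ-unique to neg-unique)

  module Additive (o : Carrier → Carrier) (o-cong : ∀ {x y} → x ≈ y → o x ≈ o y)
                  (o-+ : ∀ x y → o (x + y) ≈ o x + o y) where
    o-0 : o 0# ≈ 0#
    o-0 = +-cancelʳ (o 0#) (o 0#) 0# (≈-trans (≈-sym (o-+ 0# 0#)) (≈-trans (o-cong (+-identityʳ 0#)) (≈-sym (+-identityˡ (o 0#)))))
    o-neg : ∀ x → o (- x) ≈ - o x
    o-neg x = neg-unique (o (- x)) (o x) (≈-trans (≈-sym (o-+ (- x) x)) (≈-trans (o-cong (+-inverseˡ x)) o-0))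
    o-sub : ∀ x y → o (x - y) ≈ o x - o y
    o-sub x y = ≈-trans (o-+ x (- y)) (+-cong ≈-refl (o-neg y))

  interchange : ∀ a b c d → (a + b) + (c + d) ≈ (a + c) + (b + d)
  interchange a b c d = begin
    (a + b) + (c + d) ≈⟨ +-assoc a b (c + d) ⟩
    a + (b + (c + d)) ≈⟨ +-cong rf (≈-trans (≈-sym (+-assoc b c d)) (≈-trans (+-cong (+-comm b c) rf) (+-assoc c b d))) ⟩
    a + (c + (b + d)) ≈⟨ +-assoc a c (b + d) ⟨
    (a + c) + (b + d) ∎
    where open SetoidReasoning setoid
          rf : ∀ {x} → x ≈ x
          rf = ≈-refl

  sub-add : ∀ x y → (x - y) + y ≈ x
  sub-add x y = ≈-trans (+-assoc x (- y) y) (≈-trans (+-cong (≈-refl) (+-inverseˡ y)) (+-identityʳ x))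

  module Cheb (o : Carrier → Carrier) (o-cong : ∀ {x y} → x ≈ y → o x ≈ o y)
              (o-+ : ∀ x y → o (x + y) ≈ o x + o y) where
    open Additive o o-cong o-+ public
    P : ℕ → Carrier → Carrier
    P = chebOp A o
    P-cong : ∀ k {x y} → x ≈ y → P k x ≈ P k y
    P-cong zero e = ≈-refl
    P-cong (suc zero) e = e
    P-cong (suc (suc k)) e = +-cong (o-cong (P-cong (suc k) e)) (neg-cong (P-cong k e))
    -- Applied twice in `P-comm`: with `o` for `q`, so that `o` commutes with p_k(o), and then with
    -- p_k(o) for `q`.
    P-nat : (q : Carrier → Carrier) (q-cong : ∀ {x y} → x ≈ y → q x ≈ q y)
            (q-+ : ∀ x y → q (x + y) ≈ q x + q y) (oq : ∀ x → o (q x) ≈ q (o x)) →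
            ∀ k x → P k (q x) ≈ q (P k x)
    P-nat q q-cong q-+ oq zero x = ≈-sym (Additive.o-0 q q-cong q-+)
    P-nat q q-cong q-+ oq (suc zero) x = ≈-refl
    P-nat q q-cong q-+ oq (suc (suc k)) x =
      ≈-trans (+-cong (≈-trans (o-cong (P-nat q q-cong q-+ oq (suc k) x)) (oq _)) (neg-cong (P-nat q q-cong q-+ oq k x)))
            (≈-sym (Additive.o-sub q q-cong q-+ _ _))
    P-+ : ∀ k x y → P k (x + y) ≈ P k x + P k y
    P-+ zero x y = ≈-sym (+-identityʳ 0#)
    P-+ (suc zero) x y = ≈-refl
    P-+ (suc (suc k)) x y =
      ≈-trans (+-cong (≈-trans (o-cong (P-+ (suc k) x y)) (o-+ _ _)) (≈-trans (neg-cong (P-+ k x y)) (≈-sym (neg-+ _ _))))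
            (interchange _ _ _ _)
    P-comm : ∀ j k x → P j (P k x) ≈ P k (P j x)
    P-comm j k x = P-nat (P k) (P-cong k) (P-+ k) (λ y → ≈-sym (P-nat o o-cong o-+ (λ _ → ≈-refl) k y)) j x

-- `op i` stands for multiplication by 2 cos(π/(i+2)). The recursion of `chebOp` is that of sin kθ /
-- sin θ in the variable 2 cos θ, which for θ = π/m is nonnegative for k ≤ m and vanishes at k = m;
-- these are the facts about cosines that enter. `split` says that `Nn` generates the group, and
-- `one` keeps the module nonzero.
record OMod (b : ℕ) : Set₁ where
  field
    A : AbelianGroup 0ℓ 0ℓ
  open AG A public
  field
    Nn        : Carrier → Set
    Nn-resp   : ∀ {x y} → x ≈ y → Nn x → Nn y
    Nn-0      : Nn 0#
    Nn-+      : ∀ {x y} → Nn x → Nn y → Nn (x + y)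
    Nn-anti   : ∀ {x} → Nn x → Nn (- x) → x ≈ 0#
    split     : ∀ x → ∃ λ a → ∃ λ b → Nn a × Nn b × x ≈ a - b
    one       : Carrier
    Nn-one    : Nn one
    one≉0     : ¬ one ≈ 0#
    op        : ℕ → Carrier → Carrier
    op-cong   : ∀ i {x y} → x ≈ y → op i x ≈ op i y
    op-+      : ∀ i x y → op i (x + y) ≈ op i x + op i y
    op-comm   : ∀ i j x → op i (op j x) ≈ op j (op i x)
    op-pos    : ∀ i → i ℕ.< b → ∀ k → k ℕ.≤ suc (suc i) → ∀ {x} → Nn x → Nn (chebOp A (op i) k x)
    op-zero   : ∀ i → i ℕ.< b → ∀ x → chebOp A (op i) (suc (suc i)) x ≈ 0#

ℤ-mod : OMod 0
ℤ-mod = record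
  { A = ℤₚ.+-0-abelianGroup
  ; Nn = λ x → ℤ.0ℤ ℤ.≤ x
  ; Nn-resp = λ { refl p → p }
  ; Nn-0 = ℤₚ.≤-refl
  ; Nn-+ = λ p q → ℤₚ.+-mono-≤ p q
  ; Nn-anti = λ p q → ℤₚ.≤-antisym (≡.subst (ℤ._≤ ℤ.0ℤ) (ℤₚ.neg-involutive _) (ℤₚ.neg-mono-≤ q)) p
  ; split = λ { (ℤ.+ n) → ℤ.+ n , ℤ.0ℤ , ℤ.+≤+ z≤n , ℤₚ.≤-refl , ≡.sym (ℤₚ.+-identityʳ _)
              ; (ℤ.-[1+ n ]) → ℤ.0ℤ , ℤ.+ (suc n) , ℤₚ.≤-refl , ℤ.+≤+ z≤n , refl }
  ; one = ℤ.1ℤ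
  ; Nn-one = ℤ.+≤+ z≤n
  ; one≉0 = λ ()
  ; op = λ _ _ → ℤ.0ℤ
  ; op-cong = λ _ _ → refl
  ; op-+ = λ _ _ _ → refl
  ; op-comm = λ _ _ _ → refl
  ; op-pos = λ _ ()
  ; op-zero = λ _ ()
  }

-- `Λ` is the adjacency operator of the path with n vertices. Its characteristic polynomial is the
-- Chebyshev polynomial p_(n+1) and its largest eigenvalue is 2 cos(π/(n+1)), so it can stand in for
-- that number: p_(n+1)(Λ) = 0, and p_k(Λ) is a nonnegative matrix for k ≤ n+1.
module Path {b : ℕ} (M : OMod b) (n : ℕ) where
  open OMod M
  private
    rf : ∀ {x} → x ≈ x
    rf = ≈-refl

  at : ∀ {n} → (Fin n → Carrier) → ℕ → Carrier
  at {zero}  f k       = 0#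
  at {suc n} f zero    = f zero
  at {suc n} f (suc k) = at (f ∘ suc) k

  -- Positions on the path are numbered 1, …, n; the function vanishes outside.
  ext : ∀ {n} → (Fin n → Carrier) → ℕ → Carrier
  ext f zero    = 0#
  ext f (suc k) = at f k

  at-toℕ : ∀ {n} (f : Fin n → Carrier) i → at f (toℕ i) ≡ f i
  at-toℕ f zero    = refl
  at-toℕ f (suc i) = at-toℕ (f ∘ suc) i

  at-≥ : ∀ {n} (f : Fin n → Carrier) k → n ℕ.≤ k → at f k ≡ 0#
  at-≥ {zero}  f k le = refl
  at-≥ {suc n} f (suc k) (s≤s le) = at-≥ (f ∘ suc) k le

  at-cong : ∀ {n} {f g : Fin n → Carrier} → (∀ i → f i ≈ g i) → ∀ k → at f k ≈ at g k
  at-cong {zero}  e k = rf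
  at-cong {suc n} e zero = e zero
  at-cong {suc n} e (suc k) = at-cong (e ∘ suc) k

  at-map₂ : ∀ {n} (_⊕_ : Carrier → Carrier → Carrier) → 0# ⊕ 0# ≈ 0# → (f g : Fin n → Carrier) →
            ∀ k → at (λ i → f i ⊕ g i) k ≈ at f k ⊕ at g k
  at-map₂ {zero} _⊕_ e f g k = ≈-sym e
  at-map₂ {suc n} _⊕_ e f g zero = rf
  at-map₂ {suc n} _⊕_ e f g (suc k) = at-map₂ _⊕_ e (f ∘ suc) (g ∘ suc) k

  at-map : ∀ {n} (h : Carrier → Carrier) → h 0# ≈ 0# → (f : Fin n → Carrier) →
           ∀ k → at (λ i → h (f i)) k ≈ h (at f k)
  at-map h e f k = at-map₂ (λ x _ → h x) e f f k

  F : AbelianGroup 0ℓ 0ℓ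
  F = Pointwise.abelianGroup (Fin n) A

  private module F = AbelianGroup F

  Λ : F.Carrier → F.Carrier
  Λ f i = ext f (toℕ i) + at f (suc (toℕ i))

  ext-cong : {f g : F.Carrier} → f F.≈ g → ∀ k → ext f k ≈ ext g k
  ext-cong e zero = rf
  ext-cong e (suc k) = at-cong e k

  ext-+ : (f g : F.Carrier) → ∀ k → ext (f F.∙ g) k ≈ ext f k + ext g k
  ext-+ f g zero = ≈-sym (+-identityʳ 0#)
  ext-+ f g (suc k) = at-map₂ _+_ (+-identityʳ 0#) f g k

  ext-map : (h : Carrier → Carrier) → h 0# ≈ 0# → (f : F.Carrier) → ∀ k → ext (λ i → h (f i)) k ≈ h (ext f k)
  ext-map h e f zero = ≈-sym e
  ext-map h e f (suc k) = at-map h e f k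

  ext-0 : ∀ k → ext F.ε k ≈ 0#
  ext-0 k = ext-map (λ _ → 0#) rf F.ε k

  Λ-cong : {f g : F.Carrier} → f F.≈ g → Λ f F.≈ Λ g
  Λ-cong e i = +-cong (ext-cong e (toℕ i)) (at-cong e (suc (toℕ i)))

  Λ-+ : ∀ f g → Λ (f F.∙ g) F.≈ Λ f F.∙ Λ g
  Λ-+ f g i = ≈-trans (+-cong (ext-+ f g (toℕ i)) (ext-+ f g (suc (suc (toℕ i))))) (interchange _ _ _ _)

  lift-Λ : (h : Carrier → Carrier) → (∀ {x y} → x ≈ y → h x ≈ h y) → (∀ x y → h (x + y) ≈ h x + h y) →
           ∀ f i → Λ (λ i → h (f i)) i ≈ h (Λ f i)
  lift-Λ h h-cong h-+ f i =
    ≈-trans (+-cong (ext-map h h0 f (toℕ i)) (ext-map h h0 f (suc (suc (toℕ i))))) (≈-sym (h-+ _ _))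
    where h0 = Additive.o-0 h h-cong h-+

  at-Λ : ∀ f j → j ℕ.< n → at (Λ f) j ≈ ext f j + at f (suc j)
  at-Λ f j j<n = ≡.subst (λ j → at (Λ f) j ≈ ext f j + at f (suc j)) (Finₚ.toℕ-fromℕ< j<n)
                   (≈-reflexive (at-toℕ (Λ f) (Fin.fromℕ< j<n)))

  module W where
    P : ℕ → F.Carrier → F.Carrier
    P = chebOp F Λ

    u : ℕ → F.Carrier → ℕ → Carrier
    u k f j = ext (P k f) j

    u-rec : ∀ k f j → j ℕ.< n → u (suc (suc k)) f (suc j) + u k f (suc j) ≈ u (suc k) f j + u (suc k) f (suc (suc j))
    u-rec k f j j<n = begin
      at (P (suc (suc k)) f) j + at (P k f) j ≈⟨ ext-+ (P (suc (suc k)) f) (P k f) (suc j) ⟨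
      at (P (suc (suc k)) f F.∙ P k f) j      ≈⟨ ext-cong {P (suc (suc k)) f F.∙ P k f} {Λ (P (suc k) f)} (λ i → sub-add _ _) (suc j) ⟩
      at (Λ (P (suc k) f)) j                  ≈⟨ at-Λ (P (suc k) f) j j<n ⟩
      ext (P (suc k) f) j + at (P (suc k) f) (suc j) ∎
      where open SetoidReasoning setoid

    -- Two first integrals of the discrete wave equation u-rec.
    u-right : ∀ k f j → suc j ℕ.+ k ℕ.≤ suc n → u (suc k) f (suc j) ≈ u k f j + ext f (suc j ℕ.+ k)
    u-right zero f j le = ≈-sym (≈-trans (+-cong (ext-0 j) rf) (≈-trans (+-identityˡ _)
      (≈-reflexive (≡.cong (at f) (ℕₚ.+-identityʳ j)))))
    u-right (suc k) f j le = +-cancelʳ (u k f (suc j)) _ _ (begin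
      u (suc (suc k)) f (suc j) + u k f (suc j)
        ≈⟨ u-rec k f j (ℕₚ.≤-pred (ℕₚ.≤-trans (s≤s (s≤s (ℕₚ.m≤m+n j k))) (≡.subst (ℕ._≤ suc n) (≡.cong suc (ℕₚ.+-suc j k)) le))) ⟩
      u (suc k) f j + u (suc k) f (suc (suc j))
        ≈⟨ +-cong rf (u-right k f (suc j) (≡.subst (ℕ._≤ suc n) (≡.cong suc (ℕₚ.+-suc j k)) le)) ⟩
      u (suc k) f j + (u k f (suc j) + ext f (suc (suc j) ℕ.+ k))
        ≈⟨ +-cong rf (+-comm _ _) ⟩
      u (suc k) f j + (ext f (suc (suc j) ℕ.+ k) + u k f (suc j))
        ≈⟨ +-assoc _ _ _ ⟨
      (u (suc k) f j + ext f (suc (suc j) ℕ.+ k)) + u k f (suc j)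
        ≈⟨ +-cong (+-cong rf (≈-reflexive (≡.cong (ext f ∘ suc) (≡.sym (ℕₚ.+-suc j k))))) rf ⟩
      (u (suc k) f j + ext f (suc j ℕ.+ suc k)) + u k f (suc j) ∎)
      where open SetoidReasoning setoid

    u-left : ∀ k f d → k ℕ.+ d ℕ.≤ n → u (suc k) f (k ℕ.+ d) ≈ u k f (suc (k ℕ.+ d)) + ext f d
    u-left zero f d le = ≈-sym (≈-trans (+-cong (ext-0 (suc d)) rf) (+-identityˡ _))
    u-left (suc k) f d le = +-cancelʳ (u k f (suc (k ℕ.+ d))) _ _ (begin
      u (suc (suc k)) f (suc k ℕ.+ d) + u k f (suc (k ℕ.+ d))
        ≈⟨ u-rec k f (k ℕ.+ d) le ⟩
      u (suc k) f (k ℕ.+ d) + u (suc k) f (suc (suc (k ℕ.+ d)))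
        ≈⟨ +-cong (u-left k f d (ℕₚ.<⇒≤ le)) rf ⟩
      (u k f (suc (k ℕ.+ d)) + ext f d) + u (suc k) f (suc (suc (k ℕ.+ d)))
        ≈⟨ +-assoc _ _ _ ⟩
      u k f (suc (k ℕ.+ d)) + (ext f d + u (suc k) f (suc (suc (k ℕ.+ d))))
        ≈⟨ +-comm _ _ ⟩
      (ext f d + u (suc k) f (suc (suc (k ℕ.+ d)))) + u k f (suc (k ℕ.+ d))
        ≈⟨ +-cong (+-comm _ _) rf ⟩
      (u (suc k) f (suc (suc (k ℕ.+ d))) + ext f d) + u k f (suc (k ℕ.+ d)) ∎)
      where open SetoidReasoning setoid

    -- Evaluation at the first vertex turns the index of the polynomial into a position on the path.
    u-1 : ∀ k f → k ℕ.≤ suc n → u k f 1 ≈ ext f k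
    u-1 zero f le = ext-0 1
    u-1 (suc k) f le = ≈-trans (u-right k f 0 le) (+-identityˡ _)

  module Positive where
    private module A-F = AG F
    open W
    open A-F.Cheb Λ Λ-cong Λ-+ using (P-comm)
    -- Both sides are the value at vertex 1 of p_j(Λ) p_k(Λ) f.
    u-sym : ∀ j k f → j ℕ.≤ suc n → k ℕ.≤ suc n → u k f j ≈ u j f k
    u-sym j k f j≤ k≤ = ≈-trans (≈-sym (u-1 j (P k f) j≤)) (≈-trans (ext-cong (P-comm j k f) 1) (u-1 k (P j f) k≤))

    ext-n : ∀ f → ext f (suc n) ≈ 0#
    ext-n f = ≈-reflexive (at-≥ f n ℕₚ.≤-refl)

    -- By `u-sym`, the value of p_(n+1)(Λ) f at a vertex j is the value of p_j(Λ) f at position n+1,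
    -- which lies off the path.
    P-zero : ∀ f i → P (suc n) f i ≈ 0#
    P-zero f i = ≈-trans (≈-reflexive (≡.sym (at-toℕ (P (suc n) f) i)))
      (≈-trans (u-sym (suc (toℕ i)) (suc n) f (s≤s (ℕₚ.<⇒≤ (Finₚ.toℕ<n i))) ℕₚ.≤-refl) (ext-n (P (suc (toℕ i)) f)))

    NnF : F.Carrier → Set
    NnF f = ∀ i → Nn (f i)

    Nn-at : ∀ {n} (f : Fin n → Carrier) → (∀ i → Nn (f i)) → ∀ k → Nn (at f k)
    Nn-at {zero} f p k = Nn-0
    Nn-at {suc n} f p zero = p zero
    Nn-at {suc n} f p (suc k) = Nn-at (f ∘ suc) (p ∘ suc) k

    Nn-ext : ∀ f → NnF f → ∀ k → Nn (ext f k)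
    Nn-ext f p zero = Nn-0
    Nn-ext f p (suc k) = Nn-at f p k

    -- At positions ≥ k, `u-left` writes the value as a sum without subtraction, so induction on k
    -- preserves nonnegativity. Positions below k are reflected into this case by `u-sym`.
    u-diag : ∀ k f → NnF f → ∀ d → Nn (u k f (k ℕ.+ d))
    u-diag zero f p d = Nn-resp (≈-sym (ext-0 d)) Nn-0
    u-diag (suc k) f p d with ℕₚ.≤-total (suc k ℕ.+ d) n
    ... | inj₁ le = ≡.subst (λ j → Nn (u (suc k) f j)) (ℕₚ.+-suc k d)
            (Nn-resp (≈-sym (u-left k f (suc d) (≡.subst (ℕ._≤ n) (≡.sym (ℕₚ.+-suc k d)) le)))
              (Nn-+ (≡.subst (λ j → Nn (u k f j)) (ℕₚ.+-suc k (suc d)) (u-diag k f p (suc (suc d)))) (Nn-ext f p (suc d))))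
    ... | inj₂ ge with ℕₚ.m≤n⇒m<n∨m≡n ge
    ... | inj₂ eq = ≡.subst (λ j → Nn (u (suc k) f j)) (ℕₚ.+-suc k d)
            (Nn-resp (≈-sym (u-left k f (suc d) (ℕₚ.≤-reflexive (≡.trans (ℕₚ.+-suc k d) (≡.sym eq)))))
              (Nn-+ (≡.subst (λ j → Nn (u k f j)) (ℕₚ.+-suc k (suc d)) (u-diag k f p (suc (suc d)))) (Nn-ext f p (suc d))))
    ... | inj₁ (s≤s lt) = Nn-resp (≈-reflexive (≡.sym (at-≥ (P (suc k) f) (k ℕ.+ d) lt))) Nn-0

    P-pos : ∀ k → k ℕ.≤ suc n → ∀ f → NnF f → NnF (P k f)
    P-pos k k≤ f p i with ℕₚ.≤-total k (suc (toℕ i))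
    ... | inj₁ le = ≡.subst Nn (≡.trans (≡.cong (ext (P k f)) (ℕₚ.m+[n∸m]≡n le)) (at-toℕ (P k f) i))
                      (u-diag k f p (suc (toℕ i) ℕ.∸ k))
    ... | inj₂ ge = ≡.subst Nn (at-toℕ (P k f) i)
            (Nn-resp (≈-sym (u-sym (suc (toℕ i)) k f (s≤s (ℕₚ.<⇒≤ (Finₚ.toℕ<n i))) k≤))
              (≡.subst (λ j → Nn (u (suc (toℕ i)) f j)) (ℕₚ.m+[n∸m]≡n ge) (u-diag (suc (toℕ i)) f p (k ℕ.∸ suc (toℕ i)))))

-- The new operator acts along a path with b+1 vertices and thus imitates 2 cos(π/(b+2)); the old
-- operators act on the values at the vertices and therefore commute with it.
adjoin : ∀ {b} → OMod b → OMod (suc b)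
adjoin {b} M = record
  { A = F
  ; Nn = NnF
  ; Nn-resp = λ e p i → Nn-resp (e i) (p i)
  ; Nn-0 = λ i → Nn-0
  ; Nn-+ = λ p q i → Nn-+ (p i) (q i)
  ; Nn-anti = λ p q i → Nn-anti (p i) (q i)
  ; split = λ f → (λ i → proj₁ (split (f i))) , (λ i → proj₁ (proj₂ (split (f i))))
                , (λ i → proj₁ (proj₂ (proj₂ (split (f i))))) , (λ i → proj₁ (proj₂ (proj₂ (proj₂ (split (f i))))))
                , (λ i → proj₂ (proj₂ (proj₂ (proj₂ (split (f i))))))
  ; one = λ _ → one
  ; Nn-one = λ _ → Nn-one
  ; one≉0 = λ e → one≉0 (e zero)
  ; op = opF
  ; op-cong = opF-cong
  ; op-+ = opF-+
  ; op-comm = opF-comm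
  ; op-pos = opF-pos
  ; op-zero = opF-zero
  }
  where
  open OMod M
  open Path M (suc b)
  open Positive
  module F = AbelianGroup F

  opF : ℕ → F.Carrier → F.Carrier
  opF i f with i ℕ.≟ b
  ... | yes _ = Λ f
  ... | no  _ = λ x → op i (f x)

  opF-cong : ∀ i {f g} → f F.≈ g → opF i f F.≈ opF i g
  opF-cong i e with i ℕ.≟ b
  ... | yes _ = Λ-cong e
  ... | no  _ = λ x → op-cong i (e x)

  opF-+ : ∀ i f g → opF i (f F.∙ g) F.≈ opF i f F.∙ opF i g
  opF-+ i f g with i ℕ.≟ b
  ... | yes _ = Λ-+ f g
  ... | no  _ = λ x → op-+ i (f x) (g x)

  opF-comm : ∀ i j f → opF i (opF j f) F.≈ opF j (opF i f)
  opF-comm i j f with i ℕ.≟ b | j ℕ.≟ b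
  ... | yes _ | yes _ = F.refl
  ... | yes _ | no  _ = lift-Λ (op j) (op-cong j) (op-+ j) f
  ... | no  _ | yes _ = λ x → ≈-sym (lift-Λ (op i) (op-cong i) (op-+ i) f x)
  ... | no  _ | no  _ = λ x → op-comm i j (f x)

  cheb-lift : ∀ (o : Carrier → Carrier) k f x → chebOp F (λ g y → o (g y)) k f x ≡ chebOp A o k (f x)
  cheb-lift o zero f x = refl
  cheb-lift o (suc zero) f x = refl
  cheb-lift o (suc (suc k)) f x = ≡.cong₂ (λ p q → o p - q) (cheb-lift o (suc k) f x) (cheb-lift o k f x)

  opF-pos : ∀ i → i ℕ.< suc b → ∀ k → k ℕ.≤ suc (suc i) → ∀ {f} → NnF f → NnF (chebOp F (opF i) k f)
  opF-pos i i< k k≤ {f} p with i ℕ.≟ b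
  ... | yes refl = P-pos k k≤ f p
  ... | no  i≢b  = λ x → ≡.subst Nn (≡.sym (cheb-lift (op i) k f x)) (op-pos i (ℕₚ.≤∧≢⇒< (ℕₚ.≤-pred i<) i≢b) k k≤ (p x))

  opF-zero : ∀ i → i ℕ.< suc b → ∀ f → chebOp F (opF i) (suc (suc i)) f F.≈ F.ε
  opF-zero i i< f with i ℕ.≟ b
  ... | yes refl = P-zero f
  ... | no  i≢b  = λ x → ≈-trans (≈-reflexive (cheb-lift (op i) (suc (suc i)) f x)) (op-zero i (ℕₚ.≤∧≢⇒< (ℕₚ.≤-pred i<) i≢b) (f x))

tower : ∀ b → OMod b
tower zero    = ℤ-mod
tower (suc b) = adjoin (tower b)

cheb : (R : CommutativeRing 0ℓ 0ℓ) → let open CommutativeRing R in ℕ → Carrier → Carrier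
cheb R zero          x = CommutativeRing.0# R
cheb R (suc zero)    x = CommutativeRing.1# R
cheb R (suc (suc k)) x = x * cheb R (suc k) x - cheb R k x
  where open CommutativeRing R

-- A partially ordered commutative ring containing, for 2 ≤ m ≤ b + 1, an element lam m that
-- behaves like 2 cos(π/m): pₖ(lam m) ≥ 0 for k ≤ m and pₘ(lam m) = 0.
record Scalars (b : ℕ) : Set₁ where
  field
    R : CommutativeRing 0ℓ 0ℓ
  open CommutativeRing R
  field
    Nonneg    : Carrier → Set
    nn-resp   : ∀ {x y} → x ≈ y → Nonneg x → Nonneg y
    nn-0      : Nonneg 0#
    nn-1      : Nonneg 1#
    nn-+      : ∀ {x y} → Nonneg x → Nonneg y → Nonneg (x + y)
    nn-*      : ∀ {x y} → Nonneg x → Nonneg y → Nonneg (x * y)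
    nn-anti   : ∀ {x} → Nonneg x → Nonneg (- x) → x ≈ 0#
    nn-nontrivial : ¬ (1# ≈ 0#)
    lam       : ℕ → Carrier
    lam-pos   : ∀ m → 2 ℕ.≤ m → m ℕ.≤ suc b → ∀ k → k ℕ.≤ m → Nonneg (cheb R k (lam m))
    lam-zero  : ∀ m → 2 ℕ.≤ m → m ℕ.≤ suc b → cheb R m (lam m) ≈ 0#

-- Elements are polynomial expressions in the operators, compared as functions on the module.
-- Keeping the syntax makes additivity and commutativity provable by induction; arbitrary
-- endofunctions have neither.
module OperatorRing {b : ℕ} (M : OMod b) where
  private module M = OMod M

  infixl 6 _⊕_
  infixl 7 _⊗_
  data Expr : Set where
    `0 `1 : Expr
    _⊕_ _⊗_ : Expr → Expr → Expr
    ⊖_  : Expr → Expr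
    var : ℕ → Expr

  ⟦_⟧ : Expr → M.Carrier → M.Carrier
  ⟦ `0 ⟧    x = M.0#
  ⟦ `1 ⟧    x = x
  ⟦ d ⊕ e ⟧ x = ⟦ d ⟧ x M.+ ⟦ e ⟧ x
  ⟦ d ⊗ e ⟧ x = ⟦ d ⟧ (⟦ e ⟧ x)
  ⟦ ⊖ e ⟧   x = M.- ⟦ e ⟧ x
  ⟦ var i ⟧ x = M.op i x

  ⟦⟧-cong : ∀ e {x y} → x M.≈ y → ⟦ e ⟧ x M.≈ ⟦ e ⟧ y
  ⟦⟧-cong `0 p = M.≈-refl
  ⟦⟧-cong `1 p = p
  ⟦⟧-cong (d ⊕ e) p = M.+-cong (⟦⟧-cong d p) (⟦⟧-cong e p)
  ⟦⟧-cong (d ⊗ e) p = ⟦⟧-cong d (⟦⟧-cong e p)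
  ⟦⟧-cong (⊖ e) p = M.neg-cong (⟦⟧-cong e p)
  ⟦⟧-cong (var i) p = M.op-cong i p

  ⟦⟧-+ : ∀ e x y → ⟦ e ⟧ (x M.+ y) M.≈ ⟦ e ⟧ x M.+ ⟦ e ⟧ y
  ⟦⟧-+ `0 x y = M.≈-sym (M.+-identityʳ M.0#)
  ⟦⟧-+ `1 x y = M.≈-refl
  ⟦⟧-+ (d ⊕ e) x y = M.≈-trans (M.+-cong (⟦⟧-+ d x y) (⟦⟧-+ e x y)) (M.interchange _ _ _ _)
  ⟦⟧-+ (d ⊗ e) x y = M.≈-trans (⟦⟧-cong d (⟦⟧-+ e x y)) (⟦⟧-+ d _ _)
  ⟦⟧-+ (⊖ e) x y = M.≈-trans (M.neg-cong (⟦⟧-+ e x y)) (M.≈-sym (M.neg-+ _ _))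
  ⟦⟧-+ (var i) x y = M.op-+ i x y

  private module Add e = M.Additive ⟦ e ⟧ (⟦⟧-cong e) (⟦⟧-+ e)

  op-⟦⟧ : ∀ i e x → M.op i (⟦ e ⟧ x) M.≈ ⟦ e ⟧ (M.op i x)
  op-⟦⟧ i `0 x = Add.o-0 (var i)
  op-⟦⟧ i `1 x = M.≈-refl
  op-⟦⟧ i (d ⊕ e) x = M.≈-trans (M.op-+ i _ _) (M.+-cong (op-⟦⟧ i d x) (op-⟦⟧ i e x))
  op-⟦⟧ i (d ⊗ e) x = M.≈-trans (op-⟦⟧ i d _) (⟦⟧-cong d (op-⟦⟧ i e x))
  op-⟦⟧ i (⊖ e) x = M.≈-trans (Add.o-neg (var i) _) (M.neg-cong (op-⟦⟧ i e x))
  op-⟦⟧ i (var j) x = M.op-comm i j x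

  ⟦⟧-comm : ∀ d e x → ⟦ d ⟧ (⟦ e ⟧ x) M.≈ ⟦ e ⟧ (⟦ d ⟧ x)
  ⟦⟧-comm `0 e x = M.≈-sym (Add.o-0 e)
  ⟦⟧-comm `1 e x = M.≈-refl
  ⟦⟧-comm (c ⊕ d) e x = M.≈-trans (M.+-cong (⟦⟧-comm c e x) (⟦⟧-comm d e x)) (M.≈-sym (⟦⟧-+ e _ _))
  ⟦⟧-comm (c ⊗ d) e x = M.≈-trans (⟦⟧-cong c (⟦⟧-comm d e x)) (⟦⟧-comm c e _)
  ⟦⟧-comm (⊖ d) e x = M.≈-trans (M.neg-cong (⟦⟧-comm d e x)) (M.≈-sym (Add.o-neg e _))
  ⟦⟧-comm (var i) e x = op-⟦⟧ i e x

  infix 4 _≋_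
  _≋_ : Expr → Expr → Set
  d ≋ e = ∀ x → ⟦ d ⟧ x M.≈ ⟦ e ⟧ x

  operatorRing : CommutativeRing 0ℓ 0ℓ
  operatorRing = record
    { Carrier = Expr ; _≈_ = _≋_ ; _+_ = _⊕_ ; _*_ = _⊗_ ; -_ = ⊖_ ; 0# = `0 ; 1# = `1
    ; isCommutativeRing = record
      { isRing = record
        { +-isAbelianGroup = record
          { isGroup = record
            { isMonoid = record
              { isSemigroup = record
                { isMagma = record
                  { isEquivalence = record
                    { refl = λ _ → M.≈-refl ; sym = λ p x → M.≈-sym (p x) ; trans = λ p q x → M.≈-trans (p x) (q x) }
                  ; ∙-cong = λ p q x → M.+-cong (p x) (q x) }
                ; assoc = λ a b c x → M.+-assoc _ _ _ }
              ; identity = (λ a x → M.+-identityˡ _) , (λ a x → M.+-identityʳ _) }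
            ; inverse = (λ a x → M.+-inverseˡ _) , (λ a x → M.+-inverseʳ _)
            ; ⁻¹-cong = λ p x → M.neg-cong (p x) }
          ; comm = λ a b x → M.+-comm _ _ }
        ; *-cong = λ {a} {b} {c} {d} p q x → M.≈-trans (⟦⟧-cong a (q x)) (p _)
        ; *-assoc = λ a b c x → M.≈-refl
        ; *-identity = (λ a x → M.≈-refl) , (λ a x → M.≈-refl)
        ; distrib = (λ a b c x → ⟦⟧-+ a _ _) , (λ a b c x → M.≈-refl) }
      ; *-comm = λ a b x → ⟦⟧-comm a b x } }

  cheb-op : ∀ k i x → ⟦ cheb operatorRing k (var i) ⟧ x ≡ chebOp M.A (M.op i) k x
  cheb-op zero i x = refl
  cheb-op (suc zero) i x = refl
  cheb-op (suc (suc k)) i x = ≡.cong₂ (λ p q → M.op i p M.- q) (cheb-op (suc k) i x) (cheb-op k i x)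

  operatorScalars : Scalars b
  operatorScalars = record
    { R = operatorRing
    ; Nonneg = λ e → ∀ x → M.Nn x → M.Nn (⟦ e ⟧ x)
    ; nn-resp = λ e p x q → M.Nn-resp (e x) (p x q)
    ; nn-0 = λ _ _ → M.Nn-0
    ; nn-1 = λ _ p → p
    ; nn-+ = λ p q x r → M.Nn-+ (p x r) (q x r)
    ; nn-* = λ p q x r → p _ (q x r)
    ; nn-anti = λ {e} → anti {e}
    ; nn-nontrivial = λ p → M.one≉0 (p M.one)
    -- Operator i belongs to order i+2; `lam-pos` and `lam-zero` only speak of m ≥ 2, where the
    -- truncated subtraction is exact.
    ; lam = λ m → var (m ℕ.∸ 2)
    ; lam-pos = λ { (suc (suc m)) (s≤s (s≤s _)) (s≤s m<) k k≤ x p →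
                    ≡.subst M.Nn (≡.sym (cheb-op k m x)) (M.op-pos m m< k k≤ p) }
    ; lam-zero = λ { (suc (suc m)) (s≤s (s≤s _)) (s≤s m<) x →
                    M.≈-trans (M.≈-reflexive (cheb-op (suc (suc m)) m x)) (M.op-zero m m< x) }
    }
    where
    -- Positivity of both operators only yields vanishing on nonnegative arguments; `split` extends
    -- it to all arguments.
    anti : ∀ {e} → (∀ x → M.Nn x → M.Nn (⟦ e ⟧ x)) → (∀ x → M.Nn x → M.Nn (⟦ ⊖ e ⟧ x)) → e ≋ `0
    anti {e} p q x with M.split x
    ... | a , b , na , nb , x≈ =
      M.≈-trans (⟦⟧-cong e x≈) (M.≈-trans (Add.o-sub e a b)
        (M.≈-trans (M.+-cong (M.Nn-anti (p a na) (q a na)) (M.neg-cong (M.Nn-anti (p b nb) (q b nb)))) (M.+-inverseʳ _)))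

scalars : ∀ b → Scalars b
scalars b = OperatorRing.operatorScalars (tower b)

-- Finite Coxeter groups with decidable equality

relator : ∀ {n} → Fin n → Fin n → ℕ → List (Fin n)
relator i j zero    = []
relator i j (suc k) = i ∷ j ∷ relator i j k

-- The presentation of the group enters only through univ.
record Cox : Set₁ where
  infixl 7 _·_
  field
    G    : Set
    _·_  : G → G → G
    e    : G
    inv  : G → G
    assoc : ∀ x y z → (x · y) · z ≡ x · (y · z)
    idˡ  : ∀ x → e · x ≡ x
    idʳ  : ∀ x → x · e ≡ x
    invˡ : ∀ x → inv x · x ≡ e
    invʳ : ∀ x → x · inv x ≡ e
    n    : ℕ
    s    : Fin n → G
    m    : Fin n → Fin n → ℕ
    m-diag : ∀ i → m i i ≡ 1
    m-sym  : ∀ i j → m i j ≡ m j i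
    m-off  : ∀ i j → i ≢ j → 2 ℕ.≤ m i j
    _≟_  : (x y : G) → Dec (x ≡ y)
    elems : List G
    complete : ∀ x → x ∈ elems

  Π : List (Fin n) → G
  Π = foldr (λ i g → s i · g) e

  field
    rel  : ∀ i j → Π (relator i j (m i j)) ≡ e
    gen  : ∀ x → ∃ λ w → x ≡ Π w
    univ : (H : Group 0ℓ 0ℓ) (f : Fin n → Group.Carrier H) →
           (∀ i j → Group._≈_ H (pow H (Group._∙_ H (f i) (f j)) (m i j)) (Group.ε H)) →
           ∀ w w′ → Π w ≡ Π w′ → Group._≈_ H (prod H (map f w)) (prod H (map f w′))

-- `universal` quantifies over groups at the levels of W, whereas the groups of permutations and of
-- automorphisms used below live at level zero.
liftGroup : ∀ a ℓ → Group 0ℓ 0ℓ → Group a ℓ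
liftGroup a ℓ H = record
  { Carrier = Lift a H.Carrier
  ; _≈_ = λ x y → Lift ℓ (lower x H.≈ lower y)
  ; _∙_ = λ x y → lift (lower x H.∙ lower y)
  ; ε = lift H.ε
  ; _⁻¹ = λ x → lift (lower x H.⁻¹)
  ; isGroup = record
    { isMonoid = record
      { isSemigroup = record
        { isMagma = record
          { isEquivalence = record
            { refl = lift H.refl
            ; sym = λ p → lift (H.sym (lower p))
            ; trans = λ p q → lift (H.trans (lower p) (lower q)) }
          ; ∙-cong = λ p q → lift (H.∙-cong (lower p) (lower q)) }
        ; assoc = λ x y z → lift (H.assoc _ _ _) }
      ; identity = (λ x → lift (H.identityˡ _)) , (λ x → lift (H.identityʳ _)) }
    ; inverse = (λ x → lift (H.inverseˡ _)) , (λ x → lift (H.inverseʳ _))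
    ; ⁻¹-cong = λ p → lift (H.⁻¹-cong (lower p)) } }
  where module H = Group H

-- The covering list may repeat elements, and `idx` picks an entry for each element without
-- respecting `≈`. The aim is a normal form in a finite set that both respects and reflects `≈`.
module FiniteSystem {a ℓ : Level} (C : CoxeterSystem a ℓ) (fin : CoxeterNotions.IsFinite C) where
  open CoxeterNotions C hiding (refl; sym; trans)
  private
    module W = Group group
    xs = proj₁ fin
    N = length xs

    el : Fin N → Carrier
    el = List.lookup xs

    idx : Carrier → Fin N
    idx w = Any.index (proj₂ fin w)

    el-idx : ∀ w → w ≈ el (idx w)
    el-idx w = Anyₚ.lookup-index (proj₂ fin w)

    f : Fin rank → Fin N → Fin N
    f i k = idx (gen i ∙ el k)

    el-f : ∀ i k → el (f i k) ≈ gen i ∙ el k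
    el-f i k = W.sym (el-idx _)

    run : List (Fin rank) → Fin N → Fin N
    run is k = foldr f k is

    el-run : ∀ is k → el (run is k) ≈ prod group (map gen is) ∙ el k
    el-run [] k = W.sym (W.identityˡ _)
    el-run (i ∷ is) k = W.trans (el-f i _) (W.trans (W.∙-cong W.refl (el-run is k)) (W.sym (W.assoc _ _ _)))

    prod-relator : ∀ i j k → prod group (map gen (relator i j k)) ≈ pow group (gen i ∙ gen j) k
    prod-relator i j zero = W.refl
    prod-relator i j (suc k) = W.trans (W.sym (W.assoc _ _ _)) (W.∙-cong W.refl (prod-relator i j k))

    -- Coset enumeration: a quotient of Fin N all of whose identifications hold in W.
    record Quot (M : ℕ) : Set ℓ where
      field
        q     : Fin N → Fin M
        sound : ∀ {k l} → q k ≡ q l → el k ≈ el l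

    module _ {M : ℕ} (Q : Quot M) where
      open Quot Q
      Closed : Set
      Closed = (∀ {k l} i → q k ≡ q l → q (f i k) ≡ q (f i l))
             × (∀ i j k → q (run (relator i j (m i j)) k) ≡ q k)

      Clash : Set ℓ
      Clash = ∃ λ k → ∃ λ l → el k ≈ el l × q k ≢ q l

      -- A failed test exhibits two entries that are equal in W but separated by `q`; merging them
      -- lowers M, so the enumeration terminates.
      check : Closed ⊎ Clash
      check with Finₚ.any? (λ k → Finₚ.any? (λ l → Finₚ.any? (λ i →
                   (q k Fin.≟ q l) ×-dec ¬? (q (f i k) Fin.≟ q (f i l)))))
      ... | yes (k , l , i , p , np) = inj₂ (f i k , f i l ,
              W.trans (el-f i k) (W.trans (W.∙-cong W.refl (sound p)) (W.sym (el-f i l))) , np)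
      ... | no ¬1 with Finₚ.any? (λ i → Finₚ.any? (λ j → Finₚ.any? (λ k →
                   ¬? (q (run (relator i j (m i j)) k) Fin.≟ q k))))
      ...   | yes (i , j , k , np) = inj₂ (run (relator i j (m i j)) k , k ,
              W.trans (el-run (relator i j (m i j)) k)
                (W.trans (W.∙-cong (W.trans (prod-relator i j (m i j)) (relations i j)) W.refl) (W.identityˡ _)) , np)
      ...   | no ¬2 = inj₁ ((λ {k} {l} i p → decidable-stable (_ Fin.≟ _) λ np → ¬1 (k , l , i , p , np))
                          , (λ i j k → decidable-stable (_ Fin.≟ _) λ np → ¬2 (i , j , k , np)))

    merge : ∀ {M} (Q : Quot (suc M)) → Clash Q → Quot M
    merge {M} Q (x , y , x≈y , qx≢qy) = record { q = q′ ; sound = sound′ }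
      where
      open Quot Q
      r : Fin N → Fin N
      r z with q z Fin.≟ q y
      ... | yes _ = x
      ... | no  _ = z
      r≢ : ∀ z → q y ≢ q (r z)
      r≢ z with q z Fin.≟ q y
      ... | yes _ = λ p → qx≢qy (≡.sym p)
      ... | no np = λ p → np (≡.sym p)
      el-r : ∀ z → el z ≈ el (r z)
      el-r z with q z Fin.≟ q y
      ... | yes p = W.trans (sound p) (W.sym x≈y)
      ... | no  _ = W.refl
      q′ : Fin N → Fin M
      q′ z = Fin.punchOut (r≢ z)
      sound′ : ∀ {k l} → q′ k ≡ q′ l → el k ≈ el l
      sound′ {k} {l} p = W.trans (el-r k) (W.trans (sound (Finₚ.punchOut-injective (r≢ k) (r≢ l) p)) (W.sym (el-r l)))

    enumerate : ∀ M → Quot M → ∃ λ M′ → Σ (Quot M′) Closed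
    enumerate M Q with check Q
    ... | inj₁ cl = M , Q , cl
    enumerate zero    Q | inj₂ (k , _) with Quot.q Q k
    ... | ()
    enumerate (suc M) Q | inj₂ c = enumerate M (merge Q c)

    abstract
      enumerated : ∃ λ M → Σ (Quot M) Closed
      enumerated = enumerate N (record { q = id ; sound = λ p → W.reflexive (cong el p) })

    M : ℕ
    M = proj₁ enumerated
    Q : Quot M
    Q = proj₁ (proj₂ enumerated)
    closed : Closed Q
    closed = proj₂ (proj₂ enumerated)
    open Quot Q

    -- Permutations of the classes of `q`, represented on entries, which avoids choosing a
    -- representative of each class.
    record Perm : Set where
      field
        to from   : Fin N → Fin N
        to-cong   : ∀ {k l} → q k ≡ q l → q (to k) ≡ q (to l)
        from-cong : ∀ {k l} → q k ≡ q l → q (from k) ≡ q (from l)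
        to-from   : ∀ k → q (to (from k)) ≡ q k
        from-to   : ∀ k → q (from (to k)) ≡ q k
    open Perm

    permGroup : Group 0ℓ 0ℓ
    permGroup = record
      { Carrier = Perm
      ; _≈_ = λ p r → ∀ k → q (to p k) ≡ q (to r k)
      ; _∙_ = λ p r → record
          { to = to p ∘ to r ; from = from r ∘ from p
          ; to-cong = to-cong p ∘ to-cong r ; from-cong = from-cong r ∘ from-cong p
          ; to-from = λ k → ≡.trans (to-cong p (to-from r _)) (to-from p k)
          ; from-to = λ k → ≡.trans (from-cong r (from-to p _)) (from-to r k) }
      ; ε = record { to = id ; from = id ; to-cong = id ; from-cong = id ; to-from = λ _ → refl ; from-to = λ _ → refl }
      ; _⁻¹ = λ p → record { to = from p ; from = to p ; to-cong = from-cong p ; from-cong = to-cong p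
                           ; to-from = from-to p ; from-to = to-from p }
      ; isGroup = record
        { isMonoid = record
          { isSemigroup = record
            { isMagma = record
              { isEquivalence = record { refl = λ _ → refl ; sym = λ h k → ≡.sym (h k) ; trans = λ h h′ k → ≡.trans (h k) (h′ k) }
              ; ∙-cong = λ {p} {p′} {r} {r′} h h′ k → ≡.trans (to-cong p (h′ k)) (h (to r′ k)) }
            ; assoc = λ _ _ _ _ → refl }
          ; identity = (λ _ _ → refl) , (λ _ _ → refl) }
        ; inverse = from-to , to-from
        ; ⁻¹-cong = λ {p} {r} h k → ≡.trans (≡.sym (from-cong p (to-from r k)))
                      (≡.trans (≡.sym (from-cong p (h (from r k)))) (from-to p (from r k))) } }

    perm : Fin rank → Perm
    perm i = record { to = f i ; from = f i ; to-cong = proj₁ closed i ; from-cong = proj₁ closed i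
                    ; to-from = involutive ; from-to = involutive }
      where
      involutive : ∀ k → q (f i (f i k)) ≡ q k
      involutive k = subst (λ l → q (run (relator i i l) k) ≡ q k) (m-diag i) (proj₂ closed i i k)

    to-pow : ∀ i j l k → to (pow permGroup (Group._∙_ permGroup (perm i) (perm j)) l) k ≡ run (relator i j l) k
    to-pow i j zero k = refl
    to-pow i j (suc l) k = cong (f i ∘ f j) (to-pow i j l k)

    act = universal (liftGroup a ℓ permGroup) (λ i → lift (perm i)) λ i j →
            subst (λ x → Group._≈_ (liftGroup a ℓ permGroup) x (Group.ε (liftGroup a ℓ permGroup))) (≡.sym (lift-pow i j (m i j)))
              (lift (λ k → ≡.trans (cong q (to-pow i j (m i j) k)) (proj₂ closed i j k)))
      where
      lift-pow : ∀ i j k → pow (liftGroup a ℓ permGroup) (lift (Group._∙_ permGroup (perm i) (perm j))) k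
                         ≡ lift (pow permGroup (Group._∙_ permGroup (perm i) (perm j)) k)
      lift-pow i j zero = refl
      lift-pow i j (suc k) = cong (λ x → lift (Group._∙_ permGroup (Group._∙_ permGroup (perm i) (perm j)) (lower x))) (lift-pow i j k)

    φ : Carrier → Perm
    φ w = lower (proj₁ act w)
    module φ = GroupMorphisms.IsGroupHomomorphism (proj₁ (proj₂ act))

    base = idx W.ε

    φ-word : ∀ is k → q (to (φ (prod group (map gen is))) k) ≡ q (run is k)
    φ-word [] k = lower φ.ε-homo k
    φ-word (i ∷ is) k = ≡.trans (lower (φ.homo (gen i) _) k)
      (≡.trans (to-cong (φ (gen i)) (φ-word is k)) (lower (proj₂ (proj₂ act) i) (run is k)))

    -- Words act on the class of the identity by left multiplication, so the class reached from it
    -- determines the element; this is the injectivity of `nf`.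
    el-φ : ∀ w → el (to (φ w) base) ≈ w
    el-φ w with generated w
    ... | is , w≈ = W.trans (sound (≡.trans (lower (φ.⟦⟧-cong w≈) base) (φ-word is base)))
      (W.trans (el-run is base) (W.trans (W.∙-cong W.refl (W.sym (el-idx W.ε))) (W.trans (W.identityʳ _) (W.sym w≈))))

    nf : Carrier → Fin M
    nf w = q (to (φ w) base)

    nf-cong : ∀ {w v} → w ≈ v → nf w ≡ nf v
    nf-cong p = lower (φ.⟦⟧-cong p) base

    nf-inj : ∀ {w v} → nf w ≡ nf v → w ≈ v
    nf-inj {w} {v} p = W.trans (W.sym (el-φ w)) (W.trans (sound p) (el-φ v))

    rp : Fin M → Carrier
    rp j with Finₚ.any? (λ k → nf (el k) Fin.≟ j)
    ... | yes (k , _) = el k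
    ... | no _ = W.ε

    nf-rp : ∀ w → nf (rp (nf w)) ≡ nf w
    nf-rp w with Finₚ.any? (λ k → nf (el k) Fin.≟ nf w)
    ... | yes (_ , p) = p
    ... | no np = ⊥-elim (np (idx w , nf-cong (W.sym (el-idx w))))

    -- The condition singles out the classes that are normal forms. It is an equation in a finite
    -- set, hence a proposition, so equality in `G₀` is equality of indices.
    G₀ : Set
    G₀ = Σ (Fin M) λ j → nf (rp j) ≡ j

    G₀-ext : ∀ {x y : G₀} → proj₁ x ≡ proj₁ y → x ≡ y
    G₀-ext {x , p} {.x , r} refl = cong (x ,_) (Decidable⇒UIP.≡-irrelevant Fin._≟_ p r)

  mk : Carrier → G₀
  mk w = nf w , nf-rp w

  un : G₀ → Carrier
  un (j , _) = rp j

  mk-cong : ∀ {w v} → w ≈ v → mk w ≡ mk v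
  mk-cong p = G₀-ext (nf-cong p)

  mk-inj : ∀ {w v} → mk w ≡ mk v → w ≈ v
  mk-inj p = nf-inj (cong proj₁ p)

  mk-un : ∀ x → mk (un x) ≡ x
  mk-un (j , p) = G₀-ext p

  un-mk : ∀ w → un (mk w) ≈ w
  un-mk w = mk-inj (mk-un (mk w))

  private
    _·₀_ : G₀ → G₀ → G₀
    x ·₀ y = mk (un x ∙ un y)

  mk-∙ : ∀ w v → mk (w ∙ v) ≡ mk w ·₀ mk v
  mk-∙ w v = mk-cong (W.sym (W.∙-cong (un-mk w) (un-mk v)))

  word-mk : ∀ is → foldr (λ i g → mk (gen i) ·₀ g) (mk W.ε) is ≡ mk (prod group (map gen is))
  word-mk [] = refl
  word-mk (i ∷ is) = ≡.trans (cong (mk (gen i) ·₀_) (word-mk is)) (≡.sym (mk-∙ _ _))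

  cox : Cox
  cox = record
    { G = G₀ ; _·_ = _·₀_ ; e = mk W.ε ; inv = λ x → mk (un x ⁻¹)
    ; assoc = λ x y z → mk-cong (W.trans (W.∙-cong (un-mk _) W.refl) (W.trans (W.assoc _ _ _) (W.∙-cong W.refl (W.sym (un-mk _)))))
    ; idˡ = λ x → ≡.trans (mk-cong (W.trans (W.∙-cong (un-mk _) W.refl) (W.identityˡ _))) (mk-un x)
    ; idʳ = λ x → ≡.trans (mk-cong (W.trans (W.∙-cong W.refl (un-mk _)) (W.identityʳ _))) (mk-un x)
    ; invˡ = λ x → mk-cong (W.trans (W.∙-cong (un-mk _) W.refl) (W.inverseˡ _))
    ; invʳ = λ x → mk-cong (W.trans (W.∙-cong W.refl (un-mk _)) (W.inverseʳ _))
    ; n = rank ; s = λ i → mk (gen i) ; m = m ; m-diag = m-diag ; m-sym = m-sym ; m-off = m-off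
    ; _≟_ = λ x y → map′ G₀-ext (cong proj₁) (proj₁ x Fin.≟ proj₁ y)
    ; elems = map mk xs
    ; complete = λ x → subst (_∈ map mk xs) (≡.trans (mk-cong (W.sym (el-idx (un x)))) (mk-un x)) (∈-map⁺ mk (∈-lookup (idx (un x))))
    ; rel = λ i j → ≡.trans (word-mk (relator i j (m i j))) (mk-cong (W.trans (prod-relator i j (m i j)) (relations i j)))
    ; gen = λ x → proj₁ (generated (un x)) , ≡.trans (≡.sym (mk-un x)) (≡.trans (mk-cong (proj₂ (generated (un x)))) (≡.sym (word-mk (proj₁ (generated (un x))))))
    ; univ = univ₀
    }
    where
    univ₀ : (H : Group 0ℓ 0ℓ) (h : Fin rank → Group.Carrier H) →
            (∀ i j → Group._≈_ H (pow H (Group._∙_ H (h i) (h j)) (m i j)) (Group.ε H)) →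
            ∀ w w′ → foldr (λ i g → mk (gen i) ·₀ g) (mk W.ε) w ≡ foldr (λ i g → mk (gen i) ·₀ g) (mk W.ε) w′ →
            Group._≈_ H (prod H (map h w)) (prod H (map h w′))
    univ₀ H h hr w w′ p = H.trans (H.sym (ψ-word w)) (H.trans (lower (ψ.⟦⟧-cong
        (mk-inj (≡.trans (≡.sym (word-mk w)) (≡.trans p (word-mk w′)))))) (ψ-word w′))
      where
      module H = Group H
      lift-pow : ∀ x k → pow (liftGroup a ℓ H) (lift x) k ≡ lift (pow H x k)
      lift-pow x zero = refl
      lift-pow x (suc k) = cong (λ y → lift (x H.∙ lower y)) (lift-pow x k)
      U = universal (liftGroup a ℓ H) (λ i → lift (h i))
            (λ i j → subst (λ x → Group._≈_ (liftGroup a ℓ H) x (lift H.ε)) (≡.sym (lift-pow _ (m i j))) (lift (hr i j)))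
      module ψ = GroupMorphisms.IsGroupHomomorphism (proj₁ (proj₂ U))
      ψ-word : ∀ is → lower (proj₁ U (prod group (map gen is))) H.≈ prod H (map h is)
      ψ-word [] = lower ψ.ε-homo
      ψ-word (i ∷ is) = H.trans (lower (ψ.homo _ _)) (H.∙-cong (lower (proj₂ (proj₂ U) i)) (ψ-word is))

-- Word length and dihedral suffixes

least : {P : ℕ → Set} → (∀ k → Dec (P k)) → ∃ P → ∃ λ k → P k × (∀ j → P j → k ≤ j)
least {P} P? (b , pb) = go b 0 (λ j lt _ → ⊥-elim (ℕₚ.n≮0 lt)) (subst P (sym (ℕₚ.+-identityʳ b)) pb)
  where
  go : ∀ f k → (∀ j → j < k → ¬ P j) → P (f ℕ.+ k) → ∃ λ k → P k × (∀ j → P j → k ≤ j)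
  go zero k low p = k , p , λ j pj → ℕₚ.≮⇒≥ (λ lt → low j lt pj)
  go (suc f) k low p with P? k
  ... | yes pk = k , pk , λ j pj → ℕₚ.≮⇒≥ (λ lt → low j lt pj)
  ... | no ¬pk = go f (suc k) low′ (subst P (sym (ℕₚ.+-suc f k)) p)
    where
    low′ : ∀ j → j < suc k → ¬ P j
    low′ j (s≤s lt) pj with ℕₚ.m≤n⇒m<n∨m≡n lt
    ... | inj₁ l = low j l pj
    ... | inj₂ refl = ¬pk pj

module Groups (C : Cox) where
  open Cox C public
  private
    module GS = GroupSolver _·_ e inv assoc idˡ idʳ invˡ invʳ
  open GS public using (inv-·; inv-inv; inv-e; inv-unique; _⊜_; _⊙_; _⁻; ε) renaming (solve to gsolve)

  ss : ∀ i → s i · s i ≡ e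
  ss i = trans (cong (s i ·_) (sym (idʳ (s i)))) (subst (λ k → Π (relator i i k) ≡ e) (m-diag i) (rel i i))

  inv-s : ∀ i → inv (s i) ≡ s i
  inv-s i = sym (inv-unique (s i) (s i) (ss i))

  s-cancelʳ : ∀ g i → (g · s i) · s i ≡ g
  s-cancelʳ g i = trans (assoc g (s i) (s i)) (trans (cong (g ·_) (ss i)) (idʳ g))

  s-cancelˡ : ∀ g i → s i · (s i · g) ≡ g
  s-cancelˡ g i = trans (sym (assoc (s i) (s i) g)) (trans (cong (_· g) (ss i)) (idˡ g))

  Π-++ : ∀ u v → Π (u ++ v) ≡ Π u · Π v
  Π-++ [] v = sym (idˡ (Π v))
  Π-++ (i ∷ u) v = trans (cong (s i ·_) (Π-++ u v)) (sym (assoc (s i) (Π u) (Π v)))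

  Π-∷ʳ : ∀ u i → Π (u ∷ʳ i) ≡ Π u · s i
  Π-∷ʳ u i = trans (Π-++ u (i ∷ [])) (cong (Π u ·_) (idʳ (s i)))

  private
    -- Existence of a word of given length, by recursion on the length so that it is visibly
    -- decidable.
    Wd : ℕ → G → Set
    Wd zero    g = g ≡ e
    Wd (suc k) g = ∃ λ i → Wd k (s i · g)

    Wd? : ∀ k g → Dec (Wd k g)
    Wd? zero g = g ≟ e
    Wd? (suc k) g = Finₚ.any? (λ i → Wd? k (s i · g))

    fromWd : ∀ k g → Wd k g → ∃ λ w → length w ≡ k × g ≡ Π w
    fromWd zero g p = [] , refl , p
    fromWd (suc k) g (i , p) with fromWd k (s i · g) p
    ... | w , l , q = i ∷ w , cong suc l , trans (sym (s-cancelˡ g i)) (cong (s i ·_) q)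

    toWd : ∀ w → Wd (length w) (Π w)
    toWd [] = refl
    toWd (i ∷ w) = i , subst (Wd (length w)) (sym (s-cancelˡ (Π w) i)) (toWd w)

    leastWd : ∀ g → ∃ λ k → Wd k g × (∀ j → Wd j g → k ≤ j)
    leastWd g = least (λ k → Wd? k g) (length (proj₁ (gen g)) , subst (Wd _) (sym (proj₂ (gen g))) (toWd (proj₁ (gen g))))

  abstract
    ℓ : G → ℕ
    ℓ g = proj₁ (leastWd g)

    word : G → List (Fin n)
    word g = proj₁ (fromWd _ g (proj₁ (proj₂ (leastWd g))))

    length-word : ∀ g → length (word g) ≡ ℓ g
    length-word g = proj₁ (proj₂ (fromWd _ g (proj₁ (proj₂ (leastWd g)))))

    Π-word : ∀ g → g ≡ Π (word g)
    Π-word g = proj₂ (proj₂ (fromWd _ g (proj₁ (proj₂ (leastWd g)))))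

    ℓ-min : ∀ w → ℓ (Π w) ≤ length w
    ℓ-min w = proj₂ (proj₂ (leastWd (Π w))) _ (toWd w)

  ℓ-≤ : ∀ g w → g ≡ Π w → ℓ g ≤ length w
  ℓ-≤ g w p = subst (λ x → ℓ x ≤ length w) (sym p) (ℓ-min w)

  ℓ-e : ℓ e ≡ 0
  ℓ-e = ℕₚ.n≤0⇒n≡0 (ℓ-min [])

  ℓ-·s : ∀ g i → ℓ (g · s i) ≤ suc (ℓ g)
  ℓ-·s g i = ℕₚ.≤-trans (ℓ-≤ (g · s i) (word g ∷ʳ i) (trans (cong (_· s i) (Π-word g)) (sym (Π-∷ʳ (word g) i))))
    (ℕₚ.≤-reflexive (trans (Listₚ.length-++-comm (word g) (i ∷ [])) (cong suc (length-word g))))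

  ℓ≡0 : ∀ g → ℓ g ≡ 0 → g ≡ e
  ℓ≡0 g p with word g | Π-word g | length-word g
  ... | [] | q | _ = q
  ... | _ ∷ _ | _ | l with () ← trans l p

  descent : ∀ g → g ≢ e → ∃ λ i → ℓ (g · s i) < ℓ g
  descent g g≢e with word g | Π-word g | length-word g
  ... | u | q | l with initLast u
  ... | [] = ⊥-elim (g≢e q)
  ... | w ∷ʳ′ i = i , subst (ℓ (g · s i) <_) (trans (sym (Listₚ.length-++-comm w (i ∷ []))) l)
          (s≤s (ℓ-≤ (g · s i) w (trans (cong (_· s i) (trans q (Π-∷ʳ w i))) (s-cancelʳ (Π w) i))))

  -- alternating products of k letters, ending resp. starting with a
  AP BP : Fin n → Fin n → ℕ → G
  AP a b zero    = e
  AP a b (suc k) = AP b a k · s a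
  BP a b zero    = e
  BP a b (suc k) = s a · BP b a k

  inv-AP : ∀ a b k → inv (AP a b k) ≡ BP a b k
  inv-AP a b zero = inv-e
  inv-AP a b (suc k) = trans (inv-· _ _) (cong₂ _·_ (inv-s a) (inv-AP b a k))

  BP-relator : ∀ a b k → BP a b (k ℕ.+ k) ≡ Π (relator a b k)
  BP-relator a b zero = refl
  BP-relator a b (suc k) = trans (cong (BP a b) (cong suc (ℕₚ.+-suc k k))) (cong (λ x → s a · (s b · x)) (BP-relator a b k))

  private
    AP-BP : ∀ a b j k → AP a b j · BP b a k ≡ BP a b (j ℕ.+ k) ⊎ AP a b j · BP b a k ≡ BP b a (j ℕ.+ k)
    AP-BP a b zero k = inj₂ (idˡ _)
    AP-BP a b (suc j) k with AP-BP b a j (suc k)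
    ... | inj₁ p = inj₂ (trans (assoc _ _ _) (trans p (cong (BP b a) (ℕₚ.+-suc j k))))
    ... | inj₂ p = inj₁ (trans (assoc _ _ _) (trans p (cong (BP a b) (ℕₚ.+-suc j k))))

  braid : ∀ a b → AP a b (m a b) ≡ AP b a (m a b)
  braid a b = trans (sym (idʳ _)) (trans (cong (AP a b (m a b) ·_) (sym (invˡ (AP b a (m a b)))))
                (trans (sym (assoc _ _ _)) (trans (cong (_· AP b a (m a b)) eq) (idˡ _))))
    where
    eq : AP a b (m a b) · inv (AP b a (m a b)) ≡ e
    eq with AP-BP a b (m a b) (m a b)
    ... | inj₁ p = trans (cong (AP a b (m a b) ·_) (inv-AP b a (m a b))) (trans p (trans (BP-relator a b (m a b)) (rel a b)))
    ... | inj₂ p = trans (cong (AP a b (m a b) ·_) (inv-AP b a (m a b))) (trans p (trans (BP-relator b a (m a b))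
                     (subst (λ k → Π (relator b a k) ≡ e) (m-sym b a) (rel b a))))

  ℓ-·AP : ∀ v a b k → ℓ (v · AP a b k) ≤ ℓ v ℕ.+ k
  ℓ-·AP v a b zero = ℕₚ.≤-reflexive (trans (cong ℓ (idʳ v)) (sym (ℕₚ.+-identityʳ _)))
  ℓ-·AP v a b (suc k) = subst₂ _≤_ (cong ℓ (assoc v (AP b a k) (s a))) (sym (ℕₚ.+-suc (ℓ v) k))
      (ℕₚ.≤-trans (ℓ-·s (v · AP b a k) a) (s≤s (ℓ-·AP v b a k)))
    where open ≡ using (subst₂)

  -- Splits off the longest alternating suffix in s_a and s_b, leaving an element without right
  -- descents in this dihedral group. As v has no descent at b, the suffix has to end in a.
  strip : ∀ f v a b → ℓ v ≤ f → ℓ v ≤ ℓ (v · s b) →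
          ∃ λ v′ → ∃ λ k → v ≡ v′ · AP a b k × ℓ v′ ℕ.+ k ≤ ℓ v × ℓ v′ ≤ ℓ (v′ · s a) × ℓ v′ ≤ ℓ (v′ · s b)
  strip f v a b le hb with ℕₚ.≤-<-connex (ℓ v) (ℓ (v · s a))
  ... | inj₁ ha = v , 0 , sym (idʳ v) , ℕₚ.≤-reflexive (ℕₚ.+-identityʳ _) , ha , hb
  strip zero v a b le hb | inj₂ lt = ⊥-elim (ℕₚ.n≮0 (ℕₚ.≤-trans lt le))
  strip (suc f) v a b le hb | inj₂ lt
    with strip f (v · s a) b a (ℕₚ.≤-pred (ℕₚ.≤-trans lt le))
           (subst (λ x → ℓ (v · s a) ≤ ℓ x) (sym (s-cancelʳ v a)) (ℕₚ.<⇒≤ lt))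
  ... | v′ , k , p , l , hb′ , ha′ = v′ , suc k
      , trans (sym (s-cancelʳ v a)) (trans (cong (_· s a) p) (assoc v′ _ _))
      , subst (_≤ ℓ v) (sym (ℕₚ.+-suc (ℓ v′) k)) (ℕₚ.≤-trans (s≤s l) lt) , ha′ , hb′

-- The geometric representation

record System : Set₁ where
  field
    C  : Cox
    b  : ℕ
    m≤ : ∀ i j → Cox.m C i j ≤ suc b
    S  : Scalars b

private
  maxEntry : ∀ {k} (f : Fin k → ℕ) → ∃ λ b → ∀ i → f i ≤ b
  maxEntry {zero} f = 0 , λ ()
  maxEntry {suc k} f with maxEntry (f ∘ suc)
  ... | b , p = f zero ℕ.⊔ b , λ { zero → ℕₚ.m≤m⊔n _ _ ; (suc i) → ℕₚ.≤-trans (p i) (ℕₚ.m≤n⊔m _ _) }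

system : Cox → System
system C = record { C = C ; b = proj₁ B ; m≤ = λ i j → ℕₚ.≤-trans (proj₂ (maxEntry (Cox.m C i)) j)
                      (ℕₚ.≤-trans (proj₂ B i) (ℕₚ.n≤1+n _)) ; S = scalars _ }
  where B = maxEntry (λ i → proj₁ (maxEntry (Cox.m C i)))

module Rep (Y : System) where
  open System Y using (C; S)
  open System Y public using (m≤)
  open Groups C public
  open Scalars S public using (Nonneg; nn-resp; nn-0; nn-1; nn-+; nn-*; nn-anti; nn-nontrivial; lam; lam-pos; lam-zero)
  open CommutativeRing (Scalars.R S) public using (_+_; _*_; -_; _-_; 0#; 1#; _≈_; setoid)
    renaming (Carrier to K; refl to ≈-refl; sym to ≈-sym; trans to ≈-trans; reflexive to ≈-reflexive;
              +-cong to +-≈; *-cong to *-≈; -‿cong to neg-≈; zeroˡ to *-zeroˡ; zeroʳ to *-zeroʳ;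
              +-identityˡ to +-idˡ; +-identityʳ to +-idʳ; *-identityˡ to *-idˡ; *-identityʳ to *-idʳ; ring to K-ring;
              *-comm to *-commut; +-comm to +-commut; +-assoc to +-associative)
  open IntegerSolver (Scalars.R S) public using (_:=_; _:+_; _:*_; _:-_; :-_; con) renaming (solve to rsolve)
  open RingProperties K-ring public using () renaming (-0#≈0# to neg-0)

  P : ℕ → K → K
  P = cheb (Scalars.R S)

  V : Set
  V = Fin n → K

  infix 4 _≋_
  _≋_ : V → V → Set
  u ≋ v = ∀ k → u k ≈ v k

  V-setoid : Setoid 0ℓ 0ℓ
  V-setoid = record { Carrier = V ; _≈_ = _≋_ ; isEquivalence = record
    { refl = λ _ → ≈-refl ; sym = λ p k → ≈-sym (p k) ; trans = λ p q k → ≈-trans (p k) (q k) } }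
  open Setoid V-setoid public using () renaming (refl to ≋-refl; sym to ≋-sym; trans to ≋-trans)

  infixl 6 _⊞_
  infixl 7 _•_
  _⊞_ : V → V → V
  (u ⊞ v) k = u k + v k
  _•_ : K → V → V
  (r • v) k = r * v k
  ⊟_ : V → V
  (⊟ v) k = - v k
  0v : V
  0v _ = 0#

  ∑ : ∀ {k} → (Fin k → K) → K
  ∑ {zero}  f = 0#
  ∑ {suc k} f = f zero + ∑ (f ∘ suc)

  ∑-cong : ∀ {k} {f g : Fin k → K} → (∀ i → f i ≈ g i) → ∑ f ≈ ∑ g
  ∑-cong {zero} p = ≈-refl
  ∑-cong {suc k} p = +-≈ (p zero) (∑-cong (p ∘ suc))

  ∑-+ : ∀ {k} (f g : Fin k → K) → ∑ (λ i → f i + g i) ≈ ∑ f + ∑ g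
  ∑-+ {zero} f g = ≈-sym (+-idʳ 0#)
  ∑-+ {suc k} f g = ≈-trans (+-≈ ≈-refl (∑-+ (f ∘ suc) (g ∘ suc)))
    (rsolve 4 (λ a b c d → (a :+ b) :+ (c :+ d) := (a :+ c) :+ (b :+ d)) ≈-refl _ _ _ _)

  ∑-* : ∀ {k} r (f : Fin k → K) → ∑ (λ i → r * f i) ≈ r * ∑ f
  ∑-* {zero} r f = ≈-sym (*-zeroʳ r)
  ∑-* {suc k} r f = ≈-trans (+-≈ ≈-refl (∑-* r (f ∘ suc))) (rsolve 3 (λ r a b → r :* a :+ r :* b := r :* (a :+ b)) ≈-refl _ _ _)

  ∑-0 : ∀ {k} (f : Fin k → K) → (∀ i → f i ≈ 0#) → ∑ f ≈ 0#
  ∑-0 {zero} f p = ≈-refl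
  ∑-0 {suc k} f p = ≈-trans (+-≈ (p zero) (∑-0 (f ∘ suc) (p ∘ suc))) (+-idʳ 0#)

  ∑-single : ∀ {k} (f : Fin k → K) i → (∀ j → j ≢ i → f j ≈ 0#) → ∑ f ≈ f i
  ∑-single {suc k} f zero p = ≈-trans (+-≈ ≈-refl (∑-0 (f ∘ suc) (λ j → p (suc j) (λ ())))) (+-idʳ _)
  ∑-single {suc k} f (suc i) p = ≈-trans (+-≈ (p zero (λ ())) (∑-single (f ∘ suc) i (λ j ne → p (suc j) (ne ∘ Finₚ.suc-injective)))) (+-idˡ _)

  ∑-nn : ∀ {k} (f : Fin k → K) → (∀ i → Nonneg (f i)) → Nonneg (∑ f)
  ∑-nn {zero} f p = nn-0
  ∑-nn {suc k} f p = nn-+ (p zero) (∑-nn (f ∘ suc) (p ∘ suc))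

  α : Fin n → V
  α i k with k Fin.≟ i
  ... | yes _ = 1#
  ... | no  _ = 0#

  α-same : ∀ i → α i i ≈ 1#
  α-same i with i Fin.≟ i
  ... | yes _ = ≈-refl
  ... | no ne = ⊥-elim (ne refl)

  α-diff : ∀ {i k} → k ≢ i → α i k ≈ 0#
  α-diff {i} {k} ne with k Fin.≟ i
  ... | yes p = ⊥-elim (ne p)
  ... | no _ = ≈-refl

  -- The off-diagonal entries play the role of 2cos(π/m).
  adj : Fin n → Fin n → K
  adj i k with i Fin.≟ k
  ... | yes _ = 0#
  ... | no  _ = lam (m i k)

  adj-self : ∀ i → adj i i ≈ 0#
  adj-self i with i Fin.≟ i
  ... | yes _ = ≈-refl
  ... | no ne = ⊥-elim (ne refl)

  adj-off : ∀ {i k} → i ≢ k → adj i k ≡ lam (m i k)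
  adj-off {i} {k} ne with i Fin.≟ k
  ... | yes p = ⊥-elim (ne p)
  ... | no _ = refl

  adj-sym : ∀ i k → adj i k ≡ adj k i
  adj-sym i k with i Fin.≟ k | k Fin.≟ i
  ... | yes _ | yes _ = refl
  ... | yes p | no q = ⊥-elim (q (sym p))
  ... | no p | yes q = ⊥-elim (p (sym q))
  ... | no _ | no _ = cong lam (m-sym i k)

  P-2 : ∀ x → P 2 x ≈ x
  P-2 x = rsolve 1 (λ x → x :* con (ℤ+ 1) :- con (ℤ+ 0) := x) ≈-refl x
    where open import Data.Integer using () renaming (+_ to ℤ+_)

  adj-nn : ∀ i k → Nonneg (adj i k)
  adj-nn i k with i Fin.≟ k
  ... | yes _ = nn-0
  ... | no ne = nn-resp (P-2 _) (lam-pos (m i k) (m-off i k ne) (m≤ i k) 2 (m-off i k ne))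

  N : Fin n → V → K
  N i v = ∑ (λ k → adj i k * v k)

  -- The pairing with the simple coroot i, that is 2 B(α_i, v) for the invariant form normalised by
  -- B(α_i, α_i) = 1.
  y : Fin n → V → K
  y i v = (v i + v i) - N i v

  rf : Fin n → V → V
  rf i v k = v k - y i v * α i k

  N-cong : ∀ i {u v} → u ≋ v → N i u ≈ N i v
  N-cong i {u} {v} p = ∑-cong {n} {λ k → adj i k * u k} {λ k → adj i k * v k} (λ k → *-≈ ≈-refl (p k))

  N-⊞ : ∀ i u v → N i (u ⊞ v) ≈ N i u + N i v
  N-⊞ i u v = ≈-trans (∑-cong {n} {λ k → adj i k * (u k + v k)} {λ k → adj i k * u k + adj i k * v k}
      (λ k → rsolve 3 (λ a u v → a :* (u :+ v) := a :* u :+ a :* v) ≈-refl (adj i k) (u k) (v k)))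
    (∑-+ (λ k → adj i k * u k) (λ k → adj i k * v k))

  N-• : ∀ i r v → N i (r • v) ≈ r * N i v
  N-• i r v = ≈-trans (∑-cong {n} {λ k → adj i k * (r * v k)} {λ k → r * (adj i k * v k)}
      (λ k → rsolve 3 (λ a r v → a :* (r :* v) := r :* (a :* v)) ≈-refl (adj i k) r (v k)))
    (∑-* r (λ k → adj i k * v k))

  N-α : ∀ i j → N i (α j) ≈ adj i j
  N-α i j = ≈-trans (∑-single (λ k → adj i k * α j k) j (λ k ne → ≈-trans (*-≈ ≈-refl (α-diff ne)) (*-zeroʳ _)))
                    (≈-trans (*-≈ ≈-refl (α-same j)) (*-idʳ _))

  y-cong : ∀ i {u v} → u ≋ v → y i u ≈ y i v
  y-cong i p = +-≈ (+-≈ (p i) (p i)) (neg-≈ (N-cong i p))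

  y-⊞ : ∀ i u v → y i (u ⊞ v) ≈ y i u + y i v
  y-⊞ i u v = ≈-trans (+-≈ ≈-refl (neg-≈ (N-⊞ i u v)))
    (rsolve 4 (λ u v a b → (u :+ v :+ (u :+ v)) :- (a :+ b) := (u :+ u :- a) :+ (v :+ v :- b)) ≈-refl _ _ _ _)

  y-• : ∀ i r v → y i (r • v) ≈ r * y i v
  y-• i r v = ≈-trans (+-≈ ≈-refl (neg-≈ (N-• i r v)))
    (rsolve 3 (λ r v a → (r :* v :+ r :* v) :- r :* a := r :* (v :+ v :- a)) ≈-refl _ _ _)

  y-αsame : ∀ i → y i (α i) ≈ 1# + 1#
  y-αsame i = ≈-trans (+-≈ (+-≈ (α-same i) (α-same i)) (neg-≈ (≈-trans (N-α i i) (adj-self i)))) (≈-trans (+-≈ ≈-refl neg-0) (+-idʳ _))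

  y-αdiff : ∀ {i j} → i ≢ j → y i (α j) ≈ - adj i j
  y-αdiff {i} {j} ne = ≈-trans (+-≈ (≈-trans (+-≈ (α-diff ne) (α-diff ne)) (+-idʳ 0#)) (neg-≈ (N-α i j))) (+-idˡ _)

  rf-cong : ∀ i {u v} → u ≋ v → rf i u ≋ rf i v
  rf-cong i p k = +-≈ (p k) (neg-≈ (*-≈ (y-cong i p) ≈-refl))

  rf-⊞ : ∀ i u v → rf i (u ⊞ v) ≋ rf i u ⊞ rf i v
  rf-⊞ i u v k = ≈-trans (+-≈ ≈-refl (neg-≈ (*-≈ (y-⊞ i u v) ≈-refl)))
    (rsolve 5 (λ u v a b c → (u :+ v) :- (a :+ b) :* c := (u :- a :* c) :+ (v :- b :* c)) ≈-refl _ _ _ _ _)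

  rf-• : ∀ i r v → rf i (r • v) ≋ r • rf i v
  rf-• i r v k = ≈-trans (+-≈ ≈-refl (neg-≈ (*-≈ (y-• i r v) ≈-refl)))
    (rsolve 4 (λ r v a c → r :* v :- r :* a :* c := r :* (v :- a :* c)) ≈-refl _ _ _ _)

  rf-off : ∀ {i k} v → k ≢ i → rf i v k ≈ v k
  rf-off v ne = ≈-trans (+-≈ ≈-refl (≈-trans (neg-≈ (≈-trans (*-≈ ≈-refl (α-diff ne)) (*-zeroʳ _))) neg-0)) (+-idʳ _)

  rf-at : ∀ i v → rf i v i ≈ N i v - v i
  rf-at i v = ≈-trans (+-≈ ≈-refl (neg-≈ (≈-trans (*-≈ ≈-refl (α-same i)) (*-idʳ _))))
    (rsolve 2 (λ v a → v :- (v :+ v :- a) := a :- v) ≈-refl _ _)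

  y-rf : ∀ j i v → y j (rf i v) ≈ y j v - y i v * y j (α i)
  y-rf j i v = ≈-trans (y-cong j (λ k → rsolve 3 (λ v c a → v :- c :* a := v :+ (:- c) :* a) ≈-refl _ _ _))
    (≈-trans (y-⊞ j v (- y i v • α i)) (≈-trans (+-≈ ≈-refl (y-• j (- y i v) (α i)))
      (rsolve 3 (λ v c a → v :+ (:- c) :* a := v :- c :* a) ≈-refl _ _ _)))

  rf-rf : ∀ i v → rf i (rf i v) ≋ v
  rf-rf i v k = ≈-trans (+-≈ ≈-refl (neg-≈ (*-≈ (≈-trans (y-rf i i v) (+-≈ ≈-refl (neg-≈ (*-≈ ≈-refl (y-αsame i))))) ≈-refl)))
    (rsolve 4 (λ v c a o → (v :- c :* a) :- (c :- c :* (con (ℤ+ 1) :+ con (ℤ+ 1))) :* a := v) ≈-refl _ _ _ 1#)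
    where open import Data.Integer using () renaming (+_ to ℤ+_)

  -- (s_i s_j)^k v = v − A α_i − B α_j with A, B quadratic in the Chebyshev values
  private
    module Dihedral {i j : Fin n} (i≢j : i ≢ j) (v : V) where
      l = adj i j
      Y₁ = y i v
      Y₂ = y j v
      Aₖ Bₖ : ℕ → K
      Aₖ k = P k l * P (suc k) l * Y₂ + P k l * P k l * Y₁
      Bₖ k = P k l * P k l * Y₂ + (l * (P k l * P k l) - P k l * P (suc k) l) * Y₁

      w : K → K → V
      w a b k = v k - a * α i k - b * α j k

      -- The quadratic invariant of the Chebyshev recursion; for l = 2 cos θ it is the law of
      -- cosines sin² a + sin² (a+θ) - 2 cos θ sin a sin (a+θ) = sin² θ.
      cassini : ∀ k → P k l * P k l + P (suc k) l * P (suc k) l - l * (P k l * P (suc k) l) ≈ 1#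
      cassini zero = rsolve 1 (λ l → con (ℤ+ 0) :* con (ℤ+ 0) :+ con (ℤ+ 1) :* con (ℤ+ 1) :- l :* (con (ℤ+ 0) :* con (ℤ+ 1)) := con (ℤ+ 1)) ≈-refl l
        where open import Data.Integer using () renaming (+_ to ℤ+_)
      cassini (suc k) = ≈-trans
        (rsolve 3 (λ l a b → b :* b :+ (l :* b :- a) :* (l :* b :- a) :- l :* (b :* (l :* b :- a)) := a :* a :+ b :* b :- l :* (a :* b)) ≈-refl l (P k l) (P (suc k) l))
        (cassini k)

      y-w : ∀ c a b → y c (w a b) ≈ y c v - a * y c (α i) - b * y c (α j)
      y-w c a b = ≈-trans (y-cong c (λ k → rsolve 5 (λ v a x b z → v :- a :* x :- b :* z := (v :+ (:- a) :* x) :+ (:- b) :* z) ≈-refl _ _ _ _ _))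
        (≈-trans (y-⊞ c (v ⊞ - a • α i) (- b • α j)) (≈-trans (+-≈ (≈-trans (y-⊞ c v (- a • α i)) (+-≈ ≈-refl (y-• c (- a) (α i)))) (y-• c (- b) (α j)))
          (rsolve 5 (λ v a x b z → (v :+ (:- a) :* x) :+ (:- b) :* z := v :- a :* x :- b :* z) ≈-refl _ _ _ _ _)))

      rf-j : ∀ a b → rf j (w a b) ≋ w a (Y₂ + l * a - b)
      rf-j a b k = ≈-trans (+-≈ ≈-refl (neg-≈ (*-≈ (≈-trans (y-w j a b)
          (+-≈ (+-≈ ≈-refl (neg-≈ (*-≈ ≈-refl (≈-trans (y-αdiff (i≢j ∘ sym)) (neg-≈ (≈-reflexive (adj-sym j i))))))) (neg-≈ (*-≈ ≈-refl (y-αsame j))))) ≈-refl)))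
        (rsolve 7 (λ v a x b z Y l → (v :- a :* x :- b :* z) :- (Y :- a :* (:- l) :- b :* (con (ℤ+ 1) :+ con (ℤ+ 1))) :* z
                      := v :- a :* x :- (Y :+ l :* a :- b) :* z) ≈-refl _ _ _ _ _ _ _)

      rf-i : ∀ a b → rf i (w a b) ≋ w (Y₁ - a + l * b) b
      rf-i a b k = ≈-trans (+-≈ ≈-refl (neg-≈ (*-≈ (≈-trans (y-w i a b)
          (+-≈ (+-≈ ≈-refl (neg-≈ (*-≈ ≈-refl (y-αsame i)))) (neg-≈ (*-≈ ≈-refl (y-αdiff i≢j))))) ≈-refl)))
        (rsolve 7 (λ v a x b z Y l → (v :- a :* x :- b :* z) :- (Y :- a :* (con (ℤ+ 1) :+ con (ℤ+ 1)) :- b :* (:- l)) :* x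
                      := v :- (Y :- a :+ l :* b) :* x :- b :* z) ≈-refl _ _ _ _ _ _ _)

      w-cong : ∀ {a a′ b b′} → a ≈ a′ → b ≈ b′ → w a b ≋ w a′ b′
      w-cong p q k = +-≈ (+-≈ ≈-refl (neg-≈ (*-≈ p ≈-refl))) (neg-≈ (*-≈ q ≈-refl))

      B-step : ∀ k → Y₂ + l * Aₖ k - Bₖ k ≈ Bₖ (suc k)
      B-step k = ≈-trans
        (≈-trans (rsolve 5 (λ p q l Y Z → Y :+ l :* (p :* q :* Y :+ p :* p :* Z) :- (p :* p :* Y :+ (l :* (p :* p) :- p :* q) :* Z)
            := con (ℤ+ 1) :* Y :+ (l :* (p :* q) :- p :* p) :* Y :+ p :* q :* Z) ≈-refl (P k l) (P (suc k) l) l Y₂ Y₁)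
          (+-≈ (+-≈ (*-≈ (≈-sym (cassini k)) ≈-refl) ≈-refl) ≈-refl))
        (rsolve 5 (λ p q l Y Z → (p :* p :+ q :* q :- l :* (p :* q)) :* Y :+ (l :* (p :* q) :- p :* p) :* Y :+ p :* q :* Z
            := q :* q :* Y :+ (l :* (q :* q) :- q :* (l :* q :- p)) :* Z) ≈-refl (P k l) (P (suc k) l) l Y₂ Y₁)

      A-step : ∀ k → Y₁ - Aₖ k + l * Bₖ (suc k) ≈ Aₖ (suc k)
      A-step k = ≈-trans
        (≈-trans (rsolve 5 (λ p q l Y Z → Z :- (p :* q :* Y :+ p :* p :* Z) :+ l :* (q :* q :* Y :+ (l :* (q :* q) :- q :* (l :* q :- p)) :* Z)
            := con (ℤ+ 1) :* Z :+ (l :* (p :* q) :- p :* p) :* Z :+ q :* (l :* q :- p) :* Y) ≈-refl (P k l) (P (suc k) l) l Y₂ Y₁)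
          (+-≈ (+-≈ (*-≈ (≈-sym (cassini k)) ≈-refl) ≈-refl) ≈-refl))
        (rsolve 5 (λ p q l Y Z → (p :* p :+ q :* q :- l :* (p :* q)) :* Z :+ (l :* (p :* q) :- p :* p) :* Z :+ q :* (l :* q :- p) :* Y
            := q :* (l :* q :- p) :* Y :+ q :* q :* Z) ≈-refl (P k l) (P (suc k) l) l Y₂ Y₁)

      power : ℕ → V
      power zero    = v
      power (suc k) = rf i (rf j (power k))

      power-w : ∀ k → power k ≋ w (Aₖ k) (Bₖ k)
      power-w zero k = ≈-sym (rsolve 6 (λ v l x z Y Z → v :- (con (ℤ+ 0) :* con (ℤ+ 1) :* Y :+ con (ℤ+ 0) :* con (ℤ+ 0) :* Z) :* x
          :- (con (ℤ+ 0) :* con (ℤ+ 0) :* Y :+ (l :* (con (ℤ+ 0) :* con (ℤ+ 0)) :- con (ℤ+ 0) :* con (ℤ+ 1)) :* Z) :* z := v) ≈-refl _ _ _ _ _ _)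
      power-w (suc k) = ≋-trans (rf-cong i (≋-trans (rf-cong j (power-w k)) (≋-trans (rf-j _ _) (w-cong ≈-refl (B-step k)))))
        (≋-trans (rf-i _ _) (w-cong (A-step k) ≈-refl))

      -- Every term of `Aₖ` and `Bₖ` contains the factor p_k(l), which vanishes at k = m.
      power-m : power (m i j) ≋ v
      power-m k = ≈-trans (power-w (m i j) k) (≈-trans
          (w-cong {b = Bₖ (m i j)} (≈-trans (+-≈ (*-≈ (≈-trans (*-≈ z ≈-refl) (*-zeroˡ _)) ≈-refl) (*-≈ (≈-trans (*-≈ z ≈-refl) (*-zeroˡ _)) ≈-refl)) (oo _ _))
                  (≈-trans (+-≈ (*-≈ (≈-trans (*-≈ z ≈-refl) (*-zeroˡ _)) ≈-refl) (*-≈ (+-≈ (*-≈ ≈-refl (≈-trans (*-≈ z ≈-refl) (*-zeroˡ _))) (neg-≈ (≈-trans (*-≈ z ≈-refl) (*-zeroˡ _)))) ≈-refl)) (oo′ _ _ _)) k)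
          (rsolve 3 (λ v x z → v :- con (ℤ+ 0) :* x :- con (ℤ+ 0) :* z := v) ≈-refl _ _ _))
        where
        z : P (m i j) l ≈ 0#
        z = subst (λ x → P (m i j) x ≈ 0#) (sym (adj-off i≢j)) (lam-zero (m i j) (m-off i j i≢j) (m≤ i j))
        oo : ∀ a b → 0# * a + 0# * b ≈ 0#
        oo a b = rsolve 2 (λ a b → con (ℤ+ 0) :* a :+ con (ℤ+ 0) :* b := con (ℤ+ 0)) ≈-refl a b
        oo′ : ∀ a b c → 0# * a + (b * 0# - 0#) * c ≈ 0#
        oo′ a b c = rsolve 3 (λ a b c → con (ℤ+ 0) :* a :+ (b :* con (ℤ+ 0) :- con (ℤ+ 0)) :* c := con (ℤ+ 0)) ≈-refl a b c

  actw : List (Fin n) → V → V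
  actw w v = foldr rf v w

  private
    -- Setoid bijections are enough as the target of the universal property; linearity is proved
    -- separately for `actw`.
    record Aut : Set where
      field
        to from : V → V
        to-cong : ∀ {u v} → u ≋ v → to u ≋ to v
        from-cong : ∀ {u v} → u ≋ v → from u ≋ from v
        to-from : ∀ v → to (from v) ≋ v
        from-to : ∀ v → from (to v) ≋ v
    open Aut

    autGroup : Group 0ℓ 0ℓ
    autGroup = record
      { Carrier = Aut
      ; _≈_ = λ p r → ∀ v → to p v ≋ to r v
      ; _∙_ = λ p r → record
          { to = to p ∘ to r ; from = from r ∘ from p
          ; to-cong = to-cong p ∘ to-cong r ; from-cong = from-cong r ∘ from-cong p
          ; to-from = λ v → ≋-trans (to-cong p (to-from r _)) (to-from p v)
          ; from-to = λ v → ≋-trans (from-cong r (from-to p _)) (from-to r v) }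
      ; ε = record { to = id ; from = id ; to-cong = id ; from-cong = id ; to-from = λ _ → ≋-refl ; from-to = λ _ → ≋-refl }
      ; _⁻¹ = λ p → record { to = from p ; from = to p ; to-cong = from-cong p ; from-cong = to-cong p
                           ; to-from = from-to p ; from-to = to-from p }
      ; isGroup = record
        { isMonoid = record
          { isSemigroup = record
            { isMagma = record
              { isEquivalence = record { refl = λ _ → ≋-refl ; sym = λ h v → ≋-sym (h v) ; trans = λ h h′ v → ≋-trans (h v) (h′ v) }
              ; ∙-cong = λ {p} {p′} {r} {r′} h h′ v → ≋-trans (to-cong p (h′ v)) (h (to r′ v)) }
            ; assoc = λ _ _ _ _ → ≋-refl }
          ; identity = (λ _ _ → ≋-refl) , (λ _ _ → ≋-refl) }
        ; inverse = from-to , to-from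
        ; ⁻¹-cong = λ {p} {r} h v → ≋-trans (≋-sym (from-cong p (to-from r v)))
                      (≋-trans (≋-sym (from-cong p (h (from r v)))) (from-to p (from r v))) } }

    aut : Fin n → Aut
    aut i = record { to = rf i ; from = rf i ; to-cong = rf-cong i ; from-cong = rf-cong i ; to-from = rf-rf i ; from-to = rf-rf i }

    autPow : Fin n → Fin n → ℕ → Aut
    autPow i j = pow autGroup (Group._∙_ autGroup (aut i) (aut j))

    autPow-self : ∀ i v k → k ≡ 1 → to (autPow i i k) v ≋ v
    autPow-self i v .1 refl = rf-rf i v

    autPow-power : ∀ {i j} (i≢j : i ≢ j) v k → to (autPow i j k) v ≡ Dihedral.power i≢j v k
    autPow-power i≢j v zero = refl
    autPow-power {i} {j} i≢j v (suc k) = cong (λ u → rf i (rf j u)) (autPow-power i≢j v k)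

    autPow-m : ∀ {i j} v → Dec (i ≡ j) → to (autPow i j (m i j)) v ≋ v
    autPow-m {i} v (yes refl) = autPow-self i v (m i i) (m-diag i)
    autPow-m {i} {j} v (no i≢j) = subst (_≋ v) (sym (autPow-power i≢j v (m i j))) (Dihedral.power-m i≢j v)

    aut-rel : ∀ i j → Group._≈_ autGroup (autPow i j (m i j)) (Group.ε autGroup)
    aut-rel i j v = autPow-m v (i Fin.≟ j)

    to-prod : ∀ w v → to (prod autGroup (map aut w)) v ≡ actw w v
    to-prod [] v = refl
    to-prod (i ∷ w) v = cong (rf i) (to-prod w v)

  actw-≡ : ∀ w w′ → Π w ≡ Π w′ → ∀ v → actw w v ≋ actw w′ v
  actw-≡ w w′ p v k = ≈-trans (≈-reflexive (cong (λ f → f k) (sym (to-prod w v))))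
    (≈-trans (univ autGroup aut aut-rel w w′ p v k) (≈-reflexive (cong (λ f → f k) (to-prod w′ v))))

-- Roots and their signs

module Roots (Y : System) where
  open Rep Y public

  act : G → V → V
  act g = actw (word g)

  actw-cong : ∀ w {u v} → u ≋ v → actw w u ≋ actw w v
  actw-cong [] p = p
  actw-cong (i ∷ w) p = rf-cong i (actw-cong w p)

  act-Π : ∀ {g} w → g ≡ Π w → ∀ v → act g v ≋ actw w v
  act-Π {g} w p = actw-≡ (word g) w (trans (sym (Π-word g)) p)

  act-cong : ∀ g {u v} → u ≋ v → act g u ≋ act g v
  act-cong g = actw-cong (word g)

  act-≡ : ∀ {g h} v → g ≡ h → act g v ≋ act h v
  act-≡ v refl = ≋-refl

  act-e : ∀ v → act e v ≋ v
  act-e = act-Π [] refl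

  act-s : ∀ i v → act (s i) v ≋ rf i v
  act-s i = act-Π (i ∷ []) (sym (idʳ (s i)))

  act-· : ∀ g h v → act (g · h) v ≋ act g (act h v)
  act-· g h v k = ≈-trans (act-Π (word g ++ word h) (trans (cong₂ _·_ (Π-word g) (Π-word h)) (sym (Π-++ (word g) (word h)))) v k)
    (≈-reflexive (cong (λ f → f k) (Listₚ.foldr-++ rf v (word g) (word h))))

  act-s· : ∀ i g v → act (s i · g) v ≋ rf i (act g v)
  act-s· i g v = ≋-trans (act-· (s i) g v) (act-s i (act g v))

  act-inv : ∀ g v → act (inv g) (act g v) ≋ v
  act-inv g v = ≋-trans (≋-sym (act-· (inv g) g v)) (≋-trans (act-≡ v (invˡ g)) (act-e v))

  act-inv′ : ∀ g v → act g (act (inv g) v) ≋ v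
  act-inv′ g v = ≋-trans (≋-sym (act-· g (inv g) v)) (≋-trans (act-≡ v (invʳ g)) (act-e v))

  private
    actw-⊞ : ∀ w u v → actw w (u ⊞ v) ≋ actw w u ⊞ actw w v
    actw-⊞ [] u v = ≋-refl
    actw-⊞ (i ∷ w) u v = ≋-trans (rf-cong i (actw-⊞ w u v)) (rf-⊞ i _ _)
    actw-• : ∀ w r v → actw w (r • v) ≋ r • actw w v
    actw-• [] r v = ≋-refl
    actw-• (i ∷ w) r v = ≋-trans (rf-cong i (actw-• w r v)) (rf-• i r _)

  act-⊞ : ∀ g u v → act g (u ⊞ v) ≋ act g u ⊞ act g v
  act-⊞ g = actw-⊞ (word g)

  act-• : ∀ g r v → act g (r • v) ≋ r • act g v
  act-• g = actw-• (word g)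

  ⊟-• : ∀ v → ⊟ v ≋ (- 1#) • v
  ⊟-• v k = ≈-trans (neg-≈ (≈-sym (*-idˡ (v k)))) (rsolve 2 (λ o v → :- (o :* v) := (:- o) :* v) ≈-refl 1# (v k))

  ⊟-cong : ∀ {u v} → u ≋ v → ⊟ u ≋ ⊟ v
  ⊟-cong p k = neg-≈ (p k)

  ⊟⊟ : ∀ v → ⊟ (⊟ v) ≋ v
  ⊟⊟ v k = rsolve 1 (λ v → :- (:- v) := v) ≈-refl (v k)

  act-⊟ : ∀ g v → act g (⊟ v) ≋ ⊟ act g v
  act-⊟ g v = ≋-trans (act-cong g (⊟-• v)) (≋-trans (act-• g (- 1#) v) (≋-sym (⊟-• (act g v))))

  act-0 : ∀ g → act g 0v ≋ 0v
  act-0 g = ≋-trans (act-cong g (λ k → ≈-sym (*-zeroˡ 0#))) (≋-trans (act-• g 0# 0v) (λ k → *-zeroˡ _))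

  Pos Neg : V → Set
  Pos v = ∀ k → Nonneg (v k)
  Neg v = Pos (⊟ v)

  Pos-resp : ∀ {u v} → u ≋ v → Pos u → Pos v
  Pos-resp p q k = nn-resp (p k) (q k)

  Neg-resp : ∀ {u v} → u ≋ v → Neg u → Neg v
  Neg-resp p = Pos-resp (⊟-cong p)

  Pos⇒Neg⊟ : ∀ {v} → Pos v → Neg (⊟ v)
  Pos⇒Neg⊟ {v} = Pos-resp (≋-sym (⊟⊟ v))

  Pos-• : ∀ {r v} → Nonneg r → Pos v → Pos (r • v)
  Pos-• p q k = nn-* p (q k)

  Pos-⊞ : ∀ {u v} → Pos u → Pos v → Pos (u ⊞ v)
  Pos-⊞ p q k = nn-+ (p k) (q k)

  Pos-0 : Pos 0v
  Pos-0 k = nn-0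

  Pos-anti : ∀ {v} → Pos v → Neg v → v ≋ 0v
  Pos-anti p q k = nn-anti (p k) (q k)

  α-pos : ∀ i → Pos (α i)
  α-pos i k with k Fin.≟ i
  ... | yes _ = nn-1
  ... | no  _ = nn-0

  α≉0 : ∀ i → ¬ (α i ≋ 0v)
  α≉0 i p = nn-nontrivial (≈-trans (≈-sym (α-same i)) (p i))

  posneg⊥ : ∀ g i → Pos (act g (α i)) → Neg (act g (α i)) → ⊥
  posneg⊥ g i p q = α≉0 i (≋-trans (≋-sym (act-inv g (α i))) (≋-trans (act-cong (inv g) (Pos-anti p q)) (act-0 (inv g))))

  act-s-α : ∀ i → act (s i) (α i) ≋ ⊟ α i
  act-s-α i k = ≈-trans (act-s i (α i) k) (≈-trans (+-≈ ≈-refl (neg-≈ (*-≈ (y-αsame i) ≈-refl)))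
    (≈-trans (rsolve 2 (λ o a → a :- (o :+ o) :* a := a :- (o :* a :+ o :* a)) ≈-refl 1# (α i k))
      (≈-trans (+-≈ ≈-refl (neg-≈ (+-≈ (*-idˡ _) (*-idˡ _)))) (rsolve 1 (λ a → a :- (a :+ a) := :- a) ≈-refl (α i k)))))

  act-·s-α : ∀ g i → act (g · s i) (α i) ≋ ⊟ act g (α i)
  act-·s-α g i = ≋-trans (act-· g (s i) (α i)) (≋-trans (act-cong g (act-s-α i)) (act-⊟ g (α i)))

  private
    rf-α : ∀ {a b} → a ≢ b → rf a (α b) ≋ α b ⊞ adj a b • α a
    rf-α {a} {b} ne k = ≈-trans (+-≈ ≈-refl (neg-≈ (*-≈ (y-αdiff ne) ≈-refl)))
      (rsolve 3 (λ x l z → x :- (:- l) :* z := x :+ l :* z) ≈-refl (α b k) (adj a b) (α a k))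

    c : ℕ → Fin n → Fin n → Fin n
    c zero    a b = b
    c (suc k) a b = c k b a

    F : ∀ k → Fin n → Fin n → K → V
    F k a b l = P (suc k) l • α (c k a b) ⊞ P k l • α (c k b a)

    -- The coefficients are consecutive Chebyshev values, hence nonnegative while k < m; `c` only
    -- tracks which of the two simple roots carries which coefficient after k letters.
    act-AP : ∀ k {a b} → a ≢ b → ∀ l → adj a b ≡ l → act (AP a b k) (α b) ≋ F k a b l
    act-AP zero {a} {b} ne l p k = ≈-trans (act-e (α b) k)
      (≈-sym (≈-trans (+-≈ (*-idˡ _) (*-zeroˡ _)) (+-idʳ _)))
    act-AP (suc zero) {a} {b} ne l refl k = ≈-trans (act-· e (s a) (α b) k) (≈-trans (act-e _ k) (≈-trans (act-s a (α b) k) (≈-trans (rf-α ne k)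
      (≈-trans (+-commut _ _) (+-≈ (*-≈ (≈-sym (P-2 _)) ≈-refl) (≈-sym (*-idˡ _)))))))
    act-AP (suc (suc k)) {a} {b} ne l refl x = ≈-trans (act-· (AP a b k · s b) (s a) (α b) x)
      (≈-trans (act-cong g (≋-trans (act-s a (α b)) (rf-α ne)) x)
      (≈-trans (act-⊞ g (α b) (l • α a) x) (≈-trans (+-≈ (≈-trans (act-·s-α (AP a b k) b x) (neg-≈ (act-AP k ne l refl x)))
          (≈-trans (act-• g l (α a) x) (*-≈ ≈-refl (act-AP (suc k) (ne ∘ sym) l (adj-sym b a) x))))
        (rsolve 5 (λ p q l x z → (:- (q :* x :+ p :* z)) :+ l :* ((l :* q :- p) :* x :+ q :* z)
            := (l :* (l :* q :- p) :- q) :* x :+ (l :* q :- p) :* z) ≈-refl (P k l) (P (suc k) l) l (α (c k a b) x) (α (c k b a) x)))))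
      where g = AP a b k · s b

    c-pos : ∀ v k a b → Pos (act v (α a)) → Pos (act v (α b)) → Pos (act v (α (c k a b)))
    c-pos v zero a b p q = q
    c-pos v (suc k) a b p q = c-pos v k b a q p

    AP-+ : ∀ a b j k → ∃ λ x → ∃ λ z → AP a b (k ℕ.+ j) ≡ AP x z j · AP a b k
    AP-+ a b j zero = a , b , sym (idʳ _)
    AP-+ a b j (suc k) with AP-+ b a j k
    ... | x , z , p = x , z , trans (cong (_· s a) p) (assoc _ _ _)

    -- Otherwise the braid relation produces a shorter expression for g s_b.
    short : ∀ g v a b k → g ≡ v · AP a b k → ℓ v ℕ.+ k ≤ ℓ g → ℓ g ≤ ℓ (g · s b) → k < m a b
    short g v a b k p l le with ℕₚ.<-≤-connex k (m a b)
    ... | inj₁ lt = lt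
    ... | inj₂ ge with m a b in eq
    ... | zero = ⊥-elim (ℕₚ.n≮0 (subst (1 ≤_) eq (m-big a b)))
      where m-big : ∀ a b → 1 ≤ m a b
            m-big a b with a Fin.≟ b
            ... | yes refl = ℕₚ.≤-reflexive (sym (m-diag a))
            ... | no ne = ℕₚ.≤-trans (s≤s z≤n) (m-off a b ne)
    ... | suc q with AP-+ a b (k ℕ.∸ suc q) (suc q)
    ... | x , z , r = ⊥-elim (ℕₚ.<-irrefl refl (ℕₚ.≤-trans (s≤s (ℕₚ.≤-trans l le)) (ℕₚ.≤-trans (s≤s bnd) (ℕₚ.≤-reflexive len))))
      where
      j = k ℕ.∸ suc q
      br : AP a b (suc q) ≡ AP b a (suc q)
      br = subst (λ t → AP a b t ≡ AP b a t) eq (braid a b)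
      gs : g · s b ≡ (v · AP x z j) · AP a b q
      gs = trans (cong (_· s b) (trans p (cong (v ·_) (trans (cong (AP a b) (sym (ℕₚ.m+[n∸m]≡n ge))) (trans r (cong (AP x z j ·_) br))))))
        (trans (cong (_· s b) (trans (sym (assoc v (AP x z j) _)) (sym (assoc _ (AP a b q) (s b))))) (s-cancelʳ _ b))
      bnd : ℓ (g · s b) ≤ (ℓ v ℕ.+ j) ℕ.+ q
      bnd = subst (_≤ (ℓ v ℕ.+ j) ℕ.+ q) (cong ℓ (sym gs)) (ℕₚ.≤-trans (ℓ-·AP (v · AP x z j) a b q) (ℕₚ.+-monoˡ-≤ q (ℓ-·AP v x z j)))
      len : suc ((ℓ v ℕ.+ j) ℕ.+ q) ≡ ℓ v ℕ.+ k
      len = trans (sym (ℕₚ.+-suc _ q)) (trans (ℕₚ.+-assoc (ℓ v) j (suc q)) (cong (ℓ v ℕ.+_) (ℕₚ.m∸n+n≡m ge)))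

    -- Induction on length. With s_t a right descent, g = v u where u is an alternating product in
    -- s_t and s_i and v has no descent at either. By `short`, u has fewer letters than the order m,
    -- so it sends α_i to a nonnegative combination of α_t and α_i, and v keeps both positive by
    -- induction. Equal lengths are allowed because no parity of `ℓ` is available yet; `sgn`
    -- excludes that case afterwards.
    pos-act : ∀ f g i → ℓ g ≤ f → ℓ g ≤ ℓ (g · s i) → Pos (act g (α i))
    pos-act f g i lf le with g ≟ e
    ... | yes refl = Pos-resp (≋-sym (act-e (α i))) (α-pos i)
    ... | no g≢e with descent g g≢e
    ... | t , lt with strip (ℓ g) g t i ℕₚ.≤-refl le
    ... | v , zero , p , l , ht , hi = ⊥-elim (ℕₚ.<⇒≱ lt (subst (λ x → ℓ x ≤ ℓ (x · s t)) (sym (trans p (idʳ v))) ht))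
    pos-act zero g i lf le | no g≢e | t , lt | v , suc k , p , l , ht , hi = ⊥-elim (ℕₚ.n≮0 (ℕₚ.≤-trans lt lf))
    pos-act (suc f) g i lf le | no g≢e | t , lt | v , suc k , p , l , ht , hi =
      Pos-resp (≋-sym (≋-trans (act-≡ (α i) p) (≋-trans (act-· v (AP t i (suc k)) (α i)) (≋-trans (act-cong v (act-AP (suc k) t≢i λti (adj-off t≢i)))
                 (≋-trans (act-⊞ v _ _) (λ x → +-≈ (act-• v _ _ x) (act-• v _ _ x)))))))
        (Pos-⊞ (Pos-• (lam-pos (m t i) (m-off t i t≢i) (m≤ t i) (suc (suc k)) lk) (c-pos v (suc k) t i vt vi))
               (Pos-• (lam-pos (m t i) (m-off t i t≢i) (m≤ t i) (suc k) (ℕₚ.<⇒≤ lk)) (c-pos v (suc k) i t vi vt)))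
      where
      t≢i : t ≢ i
      t≢i refl = ℕₚ.<⇒≱ lt le
      λti = lam (m t i)
      lv : ℓ v ≤ f
      lv = ℕₚ.≤-pred (ℕₚ.≤-trans (s≤s (ℕₚ.m≤m+n (ℓ v) k)) (ℕₚ.≤-trans (ℕₚ.≤-reflexive (sym (ℕₚ.+-suc (ℓ v) k))) (ℕₚ.≤-trans l lf)))
      vt = pos-act f v t lv ht
      vi = pos-act f v i lv hi
      lk : suc k < m t i
      lk = short g v t i (suc k) p l le

    neg-act : ∀ g i → ℓ (g · s i) ≤ ℓ g → Neg (act g (α i))
    neg-act g i le = Pos-resp (act-·s-α g i) (pos-act _ (g · s i) i ℕₚ.≤-refl (subst (λ x → ℓ (g · s i) ≤ ℓ x) (sym (s-cancelʳ g i)) le))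

  sgn : ∀ g i → (Pos (act g (α i)) × ℓ g < ℓ (g · s i)) ⊎ (Neg (act g (α i)) × ℓ (g · s i) < ℓ g)
  sgn g i with ℕₚ.<-cmp (ℓ g) (ℓ (g · s i))
  ... | tri< lt _ _ = inj₁ (pos-act _ g i ℕₚ.≤-refl (ℕₚ.<⇒≤ lt) , lt)
  ... | tri≈ _ eq _ = ⊥-elim (posneg⊥ g i (pos-act _ g i ℕₚ.≤-refl (ℕₚ.≤-reflexive eq)) (neg-act g i (ℕₚ.≤-reflexive (sym eq))))
  ... | tri> _ _ gt = inj₂ (neg-act g i (ℕₚ.<⇒≤ gt) , gt)

  noDescent : ∀ g → (∀ i → Pos (act g (α i))) → g ≡ e
  noDescent g p with g ≟ e
  ... | yes q = q
  ... | no g≢e with descent g g≢e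
  ... | i , lt = ⊥-elim (posneg⊥ g i (p i) (neg-act g i (ℕₚ.<⇒≤ lt)))

  -- (h , i) stands for the root h α_i; different pairs may give the same root.
  Rt : Set
  Rt = G × Fin n

  ref : Rt → G
  ref (h , i) = h · s i · inv h

  vec : Rt → V
  vec (h , i) = act h (α i)

  infixr 5 _▷_
  _▷_ : G → Rt → Rt
  g ▷ (h , i) = g · h , i

  flip : Rt → Rt
  flip (h , i) = h · s i , i

  σ : Fin n → Rt
  σ i = e , i

  PosR : Rt → Set
  PosR ρ = Pos (vec ρ)

  ref-▷ : ∀ g ρ → ref (g ▷ ρ) ≡ g · ref ρ · inv g
  ref-▷ g (h , i) = gsolve 3 (λ g h s → (g ⊙ h ⊙ s ⊙ (g ⊙ h) ⁻) ⊜ (g ⊙ (h ⊙ s ⊙ h ⁻) ⊙ g ⁻)) refl g h (s i)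

  vec-▷ : ∀ g ρ → vec (g ▷ ρ) ≋ act g (vec ρ)
  vec-▷ g (h , i) = act-· g h (α i)

  ref-flip : ∀ ρ → ref (flip ρ) ≡ ref ρ
  ref-flip (h , i) = gsolve 2 (λ h s → (h ⊙ s ⊙ s ⊙ (h ⊙ s) ⁻) ⊜ (h ⊙ s ⊙ h ⁻)) refl h (s i)

  vec-flip : ∀ ρ → vec (flip ρ) ≋ ⊟ vec ρ
  vec-flip (h , i) = act-·s-α h i

  ref-σ : ∀ i → ref (σ i) ≡ s i
  ref-σ i = gsolve 1 (λ s → (ε ⊙ s ⊙ ε ⁻) ⊜ s) refl (s i)

  vec-σ : ∀ i → vec (σ i) ≋ α i
  vec-σ i = act-e (α i)

  signR : ∀ ρ → PosR ρ ⊎ Neg (vec ρ)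
  signR (h , i) with sgn h i
  ... | inj₁ (p , _) = inj₁ p
  ... | inj₂ (p , _) = inj₂ p

  sign▷ : ∀ g ρ → Pos (act g (vec ρ)) ⊎ Neg (act g (vec ρ))
  sign▷ g ρ with signR (g ▷ ρ)
  ... | inj₁ p = inj₁ (Pos-resp (vec-▷ g ρ) p)
  ... | inj₂ p = inj₂ (Neg-resp (vec-▷ g ρ) p)

  sign⊥ : ∀ g ρ → Pos (act g (vec ρ)) → Neg (act g (vec ρ)) → ⊥
  sign⊥ g (h , i) p q = posneg⊥ (g · h) i (Pos-resp (≋-sym (act-· g h (α i))) p) (Neg-resp (≋-sym (act-· g h (α i))) q)

  ref-ref : ∀ ρ → ref ρ · ref ρ ≡ e
  ref-ref (h , i) = trans (gsolve 2 (λ h s → (h ⊙ s ⊙ h ⁻ ⊙ (h ⊙ s ⊙ h ⁻)) ⊜ (h ⊙ (s ⊙ s) ⊙ h ⁻)) refl h (s i))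
    (trans (cong (λ x → h · x · inv h) (ss i)) (gsolve 1 (λ h → (h ⊙ ε ⊙ h ⁻) ⊜ ε) refl h))

  inv-ref : ∀ ρ → inv (ref ρ) ≡ ref ρ
  inv-ref ρ = sym (inv-unique (ref ρ) (ref ρ) (ref-ref ρ))

  coef : Rt → V → K
  coef (h , i) v = y i (act (inv h) v)

  act-ref : ∀ ρ v → act (ref ρ) v ≋ v ⊞ (- coef ρ v) • vec ρ
  act-ref (h , i) v = ≋-trans (act-· (h · s i) (inv h) v) (≋-trans (act-· h (s i) _) (≋-trans (act-cong h (≋-trans (act-s i _)
    (λ k → rsolve 3 (λ v c a → v :- c :* a := v :+ (:- c) :* a) ≈-refl (act (inv h) v k) (coef (h , i) v) (α i k))))
    (≋-trans (act-⊞ h _ _) (λ k → +-≈ (act-inv′ h v k) (act-• h _ _ k)))))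

  act-ref-vec : ∀ ρ → act (ref ρ) (vec ρ) ≋ ⊟ vec ρ
  act-ref-vec (h , i) = ≋-trans (act-· (h · s i) (inv h) _) (≋-trans (act-cong (h · s i) (act-inv h (α i))) (act-·s-α h i))

  -- Only coordinate j changes under s_j, so the root is supported at j. Its coefficient a is
  -- inverted by b, a coordinate of α_j pulled back by h. Then `ref ρ · s j` makes no simple root
  -- negative: it fixes α_j and leaves coordinate k of α_k equal to 1, and `noDescent` applies.
  line : ∀ ρ j → PosR ρ → Neg (act (s j) (vec ρ)) → ref ρ ≡ s j
  line ρ@(h , i) j p q = trans (sym (s-cancelʳ (ref ρ) j)) (trans (cong (_· s j) z≡e) (idˡ (s j)))
    where
    γ = vec ρ
    z = ref ρ · s j
    γ-off : ∀ k → k ≢ j → γ k ≈ 0#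
    γ-off k ne = nn-anti (p k) (nn-resp (neg-≈ (≈-trans (act-s j γ k) (rf-off γ ne))) (q k))
    a = γ j
    γ-line : γ ≋ a • α j
    γ-line k with k Fin.≟ j
    ... | yes refl = ≈-sym (*-idʳ _)
    ... | no ne = ≈-trans (γ-off k ne) (≈-sym (*-zeroʳ _))
    b = act (inv h) (α j) i
    ab : a * b ≈ 1#
    ab = ≈-trans (≈-sym (act-• (inv h) a (α j) i)) (≈-trans (act-cong (inv h) (≋-sym γ-line) i) (≈-trans (act-inv h (α i) i) (α-same i)))
    α-line : α j ≋ b • γ
    α-line k = ≈-sym (≈-trans (*-≈ ≈-refl (γ-line k)) (≈-trans (rsolve 3 (λ a b x → b :* (a :* x) := (a :* b) :* x) ≈-refl a b (α j k))
      (≈-trans (*-≈ ab ≈-refl) (*-idˡ _))))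
    z-j : act z (α j) ≋ α j
    z-j = ≋-trans (act-·s-α (ref ρ) j) (≋-trans (⊟-cong (≋-trans (act-cong (ref ρ) α-line) (act-• (ref ρ) b γ)))
      (≋-trans (λ k → ≈-trans (neg-≈ (*-≈ ≈-refl (act-ref-vec ρ k))) (rsolve 2 (λ b g → :- (b :* (:- g)) := b :* g) ≈-refl b (γ k))) (≋-sym α-line)))
    z-k : ∀ k → k ≢ j → act z (α k) k ≈ 1#
    z-k k ne = ≈-trans (act-· (ref ρ) (s j) (α k) k) (≈-trans (act-ref ρ _ k)
      (≈-trans (+-≈ (≈-trans (act-s j (α k) k) (≈-trans (rf-off (α k) ne) (α-same k))) (≈-trans (*-≈ ≈-refl (γ-off k ne)) (*-zeroʳ _))) (+-idʳ _)))
    z-pos : ∀ k → Pos (act z (α k))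
    z-pos k with k Fin.≟ j
    ... | yes refl = Pos-resp (≋-sym z-j) (α-pos j)
    ... | no ne with sgn z k
    ... | inj₁ (r , _) = r
    ... | inj₂ (r , _) = ⊥-elim (nn-nontrivial (nn-anti nn-1 (nn-resp (neg-≈ (z-k k ne)) (r k))))
    z≡e : z ≡ e
    z≡e = noDescent z z-pos

  stays : ∀ ρ j → PosR ρ → ref ρ ≢ s j → Pos (act (s j) (vec ρ))
  stays ρ j p ne with sign▷ (s j) ρ
  ... | inj₁ q = q
  ... | inj₂ q = ⊥-elim (ne (line ρ j p q))

  -- Once the second root is moved to α_j, the first is negated by s_j. Its other coordinates then
  -- equal their own negatives and, all having one sign, vanish.
  scale : ∀ ρ ρ′ → ref ρ ≡ ref ρ′ → PosR ρ → PosR ρ′ → ∃ λ a → Nonneg a × vec ρ ≋ a • vec ρ′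
  scale ρ ρ′@(h , j) eq p p′ = a , nn-a , vec-a
    where
    γ = act (inv h) (vec ρ)
    a = γ j
    s-γ : act (s j) γ ≋ ⊟ γ
    s-γ = ≋-trans (≋-sym (act-· (s j) (inv h) (vec ρ))) (≋-trans (act-≡ (vec ρ) (trans (gsolve 2 (λ h s → (s ⊙ h ⁻) ⊜ (h ⁻ ⊙ (h ⊙ s ⊙ h ⁻))) refl h (s j)) (cong (inv h ·_) (sym eq))))
      (≋-trans (act-· (inv h) (ref ρ) (vec ρ)) (≋-trans (act-cong (inv h) (act-ref-vec ρ)) (act-⊟ (inv h) (vec ρ)))))
    self-neg : ∀ k → k ≢ j → γ k ≈ - γ k
    self-neg k ne = ≈-trans (≈-sym (rf-off γ ne)) (≈-trans (≈-sym (act-s j γ k)) (s-γ k))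
    γ-off : ∀ k → k ≢ j → γ k ≈ 0#
    γ-off k ne with sign▷ (inv h) ρ
    ... | inj₁ q = nn-anti (q k) (nn-resp (self-neg k ne) (q k))
    ... | inj₂ q = nn-anti (nn-resp (≈-sym (self-neg k ne)) (q k)) (q k)
    γ-line : γ ≋ a • α j
    γ-line k with k Fin.≟ j
    ... | yes refl = ≈-sym (*-idʳ _)
    ... | no ne = ≈-trans (γ-off k ne) (≈-sym (*-zeroʳ _))
    vec-a : vec ρ ≋ a • vec ρ′
    vec-a = ≋-trans (≋-sym (act-inv′ h (vec ρ))) (≋-trans (act-cong h γ-line) (act-• h a (α j)))
    nn-a : Nonneg a
    nn-a with sign▷ (inv h) ρ
    ... | inj₁ q = q j
    ... | inj₂ q = ⊥-elim (sign⊥ e ρ (Pos-resp (≋-sym (act-e _)) p) (Neg-resp (≋-trans (≋-sym vec-a) (≋-sym (act-e _)))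
                     (Pos-resp (λ k → rsolve 2 (λ a b → (:- a) :* b := :- (a :* b)) ≈-refl a (vec ρ′ k)) (Pos-• (q j) p′))))

  posRep : ∀ ρ → ∃ λ ρ′ → PosR ρ′ × ref ρ′ ≡ ref ρ
  posRep ρ with signR ρ
  ... | inj₁ p = ρ , p , refl
  ... | inj₂ p = flip ρ , Pos-resp (≋-sym (vec-flip ρ)) p , ref-flip ρ

  sameSign : ∀ ρ ρ′ → ref ρ ≡ ref ρ′ → PosR ρ → PosR ρ′ → ∀ g → Pos (act g (vec ρ)) → Pos (act g (vec ρ′))
  sameSign ρ ρ′ eq p p′ g q with scale ρ′ ρ (sym eq) p′ p
  ... | a , na , va = Pos-resp (≋-sym (≋-trans (act-cong g va) (act-• g a (vec ρ)))) (Pos-• na q)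

-- Reflection subgroups and the exchange condition

module Sub (Y : System) where
  open Roots Y public

  prodG : List G → G
  prodG = foldr _·_ e

  prodG-++ : ∀ xs ys → prodG (xs ++ ys) ≡ prodG xs · prodG ys
  prodG-++ [] ys = sym (idˡ _)
  prodG-++ (x ∷ xs) ys = trans (cong (x ·_) (prodG-++ xs ys)) (sym (assoc x _ _))

  prodG-∷ʳ : ∀ xs y → prodG (xs ∷ʳ y) ≡ prodG xs · y
  prodG-∷ʳ xs y = trans (prodG-++ xs (y ∷ [])) (cong (prodG xs ·_) (idʳ y))

  prodG-s : ∀ w → prodG (map s w) ≡ Π w
  prodG-s [] = refl
  prodG-s (i ∷ w) = cong (s i ·_) (prodG-s w)

  T : G → Set
  T t = ∃ λ ρ → PosR ρ × ref ρ ≡ t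

  T-ref : ∀ ρ → T (ref ρ)
  T-ref = posRep

  T-s : ∀ i → T (s i)
  T-s i = σ i , Pos-resp (≋-sym (vec-σ i)) (α-pos i) , ref-σ i

  T-conj : ∀ g {t} → T t → T (g · t · inv g)
  T-conj g (ρ , _ , refl) = subst T (ref-▷ g ρ) (T-ref (g ▷ ρ))

  T-invol : ∀ {t} → T t → t · t ≡ e
  T-invol (ρ , _ , refl) = ref-ref ρ

  T-inv : ∀ {t} → T t → inv t ≡ t
  T-inv (ρ , _ , refl) = inv-ref ρ

  T-cancelʳ : ∀ {t} → T t → ∀ g → g · t · t ≡ g
  T-cancelʳ {t} p g = trans (assoc g t t) (trans (cong (g ·_) (T-invol p)) (idʳ g))

  T-cancelˡ : ∀ {t} → T t → ∀ g → t · (t · g) ≡ g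
  T-cancelˡ {t} p g = trans (sym (assoc t t g)) (trans (cong (_· g) (T-invol p)) (idˡ g))

  Up Down : G → G → Set
  Up   g t = ∀ ρ → PosR ρ → ref ρ ≡ t → Pos (act g (vec ρ))
  Down g t = ∀ ρ → PosR ρ → ref ρ ≡ t → Neg (act g (vec ρ))

  upDown : ∀ g {t} → T t → Up g t ⊎ Down g t
  upDown g (ρ , p , refl) with sign▷ g ρ
  ... | inj₁ q = inj₁ (λ ρ′ p′ eq → sameSign ρ ρ′ (sym eq) p p′ g q)
  ... | inj₂ q = inj₂ λ ρ′ p′ eq → neg ρ′ p′ eq (sign▷ g ρ′)
    where
    neg : ∀ ρ′ → PosR ρ′ → ref ρ′ ≡ ref ρ → Pos (act g (vec ρ′)) ⊎ Neg (act g (vec ρ′)) → Neg (act g (vec ρ′))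
    neg ρ′ p′ eq (inj₂ r) = r
    neg ρ′ p′ eq (inj₁ r) = ⊥-elim (sign⊥ g ρ (sameSign ρ′ ρ eq p′ p g r) q)

  up⊥down : ∀ g {t} → T t → Up g t → Down g t → ⊥
  up⊥down g (ρ , p , refl) u d = sign⊥ g ρ (u ρ p refl) (d ρ p refl)

  -- Dyer's canonical generators of the reflection subgroup with reflections `Q`: the only root of
  -- `Q` that r can make negative is its own. For `T` the simple reflections qualify, by `Δ-s`.
  Δ : (G → Set) → G → Set
  Δ Q r = Q r × (∀ t → Q t → t ≢ r → Up r t)

  record Closed (Q : G → Set) : Set where
    field
      Q⇒T  : ∀ {t} → Q t → T t
      conj : ∀ {r t} → Q r → Q t → Q (r · t · inv r)

  T-closed : Closed T
  T-closed = record { Q⇒T = id ; conj = λ {r} _ → T-conj r }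

  Δ-s : ∀ i → Δ T (s i)
  Δ-s i = T-s i , λ t _ ne ρ p eq → stays ρ i p (λ q → ne (trans (sym eq) q))

  module _ {Q : G → Set} (cl : Closed Q) where
    open Closed cl

    conj-prod : ∀ ds {t} → All Q ds → Q t → Q (prodG ds · t · inv (prodG ds))
    conj-prod [] {t} [] q = subst Q (gsolve 1 (λ t → t ⊜ (ε ⊙ t ⊙ ε ⁻)) refl t) q
    conj-prod (d ∷ ds) {t} (qd ∷ qds) q = subst Q
      (gsolve 3 (λ d g t → (d ⊙ (g ⊙ t ⊙ g ⁻) ⊙ d ⁻) ⊜ (d ⊙ g ⊙ t ⊙ (d ⊙ g) ⁻)) refl d (prodG ds) t)
      (conj qd (conj-prod ds qds q))

    -- The strong exchange condition. Letters are passed from the left until the remaining suffix B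
    -- keeps the root of t positive; the letter d before B then turns it negative, and a canonical
    -- generator does this only to its own root, so d is the conjugate of t by B.
    exchange : ∀ ds → All (Δ Q) ds → ∀ {t} → Q t → Down (prodG ds) t →
      ∃ λ A → ∃ λ d → ∃ λ B → ds ≡ A ++ d ∷ B × prodG ds · t ≡ prodG (A ++ B) × t ≡ inv (prodG B) · d · prodG B
    exchange [] [] {t} qt down = ⊥-elim (up⊥down e (Q⇒T qt) (λ ρ p eq → Pos-resp (≋-sym (act-e _)) p) down)
    exchange (d ∷ ds) (dd ∷ dds) {t} qt down with upDown (prodG ds) (Q⇒T qt)
    ... | inj₂ dn with exchange ds dds qt dn
    ...   | A , d′ , B , eq , pr , te = d ∷ A , d′ , B , cong (d ∷_) eq , trans (assoc d (prodG ds) t) (cong (d ·_) pr) , te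
    exchange (d ∷ ds) (dd ∷ dds) {t} qt down | inj₁ up = [] , d , ds , refl
      , trans (cong (_· t) (cong (_· g) (sym t′≡d))) (trans (gsolve 2 (λ g t → (g ⊙ t ⊙ g ⁻ ⊙ g ⊙ t) ⊜ (g ⊙ t ⊙ t)) refl g t) (T-cancelʳ (Q⇒T qt) g))
      , trans (gsolve 2 (λ g t → t ⊜ (g ⁻ ⊙ (g ⊙ t ⊙ g ⁻) ⊙ g)) refl g t) (cong (λ x → inv g · x · g) t′≡d)
      where
      g = prodG ds
      t′ = g · t · inv g
      qt′ : Q t′
      qt′ = conj-prod ds (All.map proj₁ dds) qt
      t′≡d : t′ ≡ d
      t′≡d with t′ ≟ d
      ... | yes p = p
      ... | no ne with Q⇒T qt
      ... | ρ , p , refl = ⊥-elim (sign⊥ (d · g) ρ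
              (Pos-resp (≋-trans (act-cong d (vec-▷ g ρ)) (≋-sym (act-· d g (vec ρ))))
                (proj₂ dd t′ qt′ ne (g ▷ ρ) (Pos-resp (≋-sym (vec-▷ g ρ)) (up ρ p refl)) (ref-▷ g ρ)))
              (down ρ p refl))

  down-ℓ : ∀ g {t} → T t → Down g t → ℓ (g · t) < ℓ g
  down-ℓ g {t} tτ dn with exchange T-closed (map s (word g)) (Allₚ.map⁺ (All.universal Δ-s (word g))) tτ
        (subst (λ x → Down x t) (trans (Π-word g) (sym (prodG-s (word g)))) dn)
  ... | A , d , B , eq , pr , _ = lt (split A (word g) eq)
    where
    split : ∀ A w {d B} → map s w ≡ A ++ d ∷ B → ∃ λ w₁ → ∃ λ i → ∃ λ w₂ → w ≡ w₁ ++ i ∷ w₂ × map s w₁ ≡ A × map s w₂ ≡ B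
    split [] (i ∷ w) eq = [] , i , w , refl , refl , Listₚ.∷-injectiveʳ eq
    split (a ∷ A) (i ∷ w) eq with split A w (Listₚ.∷-injectiveʳ eq)
    ... | w₁ , j , w₂ , p , q , r = i ∷ w₁ , j , w₂ , cong (i ∷_) p , cong₂ _∷_ (Listₚ.∷-injectiveˡ eq) q , r
    lt : (∃ λ w₁ → ∃ λ i → ∃ λ w₂ → word g ≡ w₁ ++ i ∷ w₂ × map s w₁ ≡ A × map s w₂ ≡ B) → ℓ (g · t) < ℓ g
    lt (w₁ , i , w₂ , p , q , r) = subst (ℓ (g · t) <_) (trans len (length-word g)) (s≤s (ℓ-≤ (g · t) (w₁ ++ w₂) eqn))
      where
      eqn : g · t ≡ Π (w₁ ++ w₂)
      eqn = trans (cong (_· t) (trans (Π-word g) (sym (prodG-s (word g))))) (trans pr (trans (cong prodG (trans (cong₂ _++_ (sym q) (sym r)) (sym (Listₚ.map-++ s w₁ w₂)))) (prodG-s (w₁ ++ w₂))))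
      len : suc (length (w₁ ++ w₂)) ≡ length (word g)
      len = trans (cong suc (Listₚ.length-++ w₁)) (trans (sym (ℕₚ.+-suc (length w₁) (length w₂))) (trans (sym (Listₚ.length-++ w₁)) (cong length (sym p))))

  up-ℓ : ∀ g {t} → T t → Up g t → ℓ g < ℓ (g · t)
  up-ℓ g {t} tτ u = subst (λ x → ℓ x < ℓ (g · t)) (T-cancelʳ tτ g) (down-ℓ (g · t) tτ dn)
    where
    dn : Down (g · t) t
    dn ρ p refl = Neg-resp (≋-sym (≋-trans (act-· g (ref ρ) (vec ρ)) (≋-trans (act-cong g (act-ref-vec ρ)) (act-⊟ g (vec ρ)))))
                    (Pos-resp (≋-sym (⊟⊟ _)) (u ρ p refl))

  pw : G → ℕ → G
  pw g zero    = e
  pw g (suc k) = g · pw g k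

  pw-+ : ∀ g j k → pw g (j ℕ.+ k) ≡ pw g j · pw g k
  pw-+ g zero k = sym (idˡ _)
  pw-+ g (suc j) k = trans (cong (g ·_) (pw-+ g j k)) (sym (assoc g _ _))

  finOrder : ∀ g → ∃ λ N → pw g (suc N) ≡ e
  finOrder g with Finₚ.pigeonhole (ℕₚ.n<1+n (length elems)) (λ k → Any.index (complete (pw g (toℕ k))))
  ... | i , j , i<j , eq = j′ , trans (sym (idˡ _)) (trans (cong (_· pw g (suc j′)) (sym (invˡ (pw g (toℕ i)))))
          (trans (assoc _ _ _) (trans (cong (inv (pw g (toℕ i)) ·_) (trans (sym (pw-+ g (toℕ i) (suc j′))) (trans (cong (pw g) ar) (sym same)))) (invˡ _))))
    where
    j′ = toℕ j ℕ.∸ suc (toℕ i)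
    ar : toℕ i ℕ.+ suc j′ ≡ toℕ j
    ar = trans (ℕₚ.+-suc (toℕ i) j′) (ℕₚ.m+[n∸m]≡n i<j)
    same : pw g (toℕ i) ≡ pw g (toℕ j)
    same = trans (Anyₚ.lookup-index (complete (pw g (toℕ i)))) (trans (cong (List.lookup elems) eq) (sym (Anyₚ.lookup-index (complete (pw g (toℕ j))))))

  -- The reflections of the dihedral group generated by x and y, listed so that consecutive ones multiply to x y.
  dih : G → G → ℕ → G
  dih x y zero          = y
  dih x y (suc zero)    = x
  dih x y (suc (suc k)) = dih x y (suc k) · dih x y k · inv (dih x y (suc k))

  module _ {x y : G} {Q : G → Set} (cl : Closed Q) (qx : Q x) (qy : Q y) where
    open Closed cl
    private z = dih x y
    z-Q : ∀ k → Q (z k)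
    z-Q zero = qy
    z-Q (suc zero) = qx
    z-Q (suc (suc k)) = conj (z-Q (suc k)) (z-Q k)

    z-prod : ∀ k → z (suc k) · z k ≡ x · y
    z-prod zero = refl
    z-prod (suc k) = trans (gsolve 2 (λ a b → (a ⊙ b ⊙ a ⁻ ⊙ a) ⊜ (a ⊙ b)) refl (z (suc k)) (z k)) (z-prod k)

    z-next : ∀ k → z (suc k) ≡ (x · y) · z k
    z-next k = trans (sym (T-cancelʳ (Q⇒T (z-Q k)) (z (suc k)))) (cong (_· z k) (z-prod k))

    z-pw : ∀ k → z k ≡ pw (x · y) k · y
    z-pw zero = sym (idˡ y)
    z-pw (suc k) = trans (z-next k) (trans (cong ((x · y) ·_) (z-pw k)) (sym (assoc _ _ _)))

    z-period : ∃ λ N → z (suc N) ≡ z 0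
    z-period with finOrder (x · y)
    ... | N , p = N , trans (z-pw (suc N)) (trans (cong (_· y) p) (idˡ y))

    z-ne : x ≢ y → ∀ k → z k ≢ z (suc k)
    z-ne ne zero p = ne (sym p)
    z-ne ne (suc k) p = z-ne ne k (trans (gsolve 2 (λ a b → b ⊜ (a ⁻ ⊙ (a ⊙ b ⊙ a ⁻) ⊙ a)) refl (z (suc k)) (z k))
      (trans (cong (λ t → inv (z (suc k)) · t · z (suc k)) (sym p)) (gsolve 1 (λ a → (a ⁻ ⊙ a ⊙ a) ⊜ a) refl (z (suc k)))))

  private
    -- Conjugating by the simple letters of z 1 reduces to the case where z 1 is simple.
    noDownChain : ∀ w i (z : ℕ → G) → (∀ k → T (z k)) → (∀ k → z (suc (suc k)) ≡ z (suc k) · z k · inv (z (suc k))) →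
      (∃ λ N → z (suc N) ≡ z 0) → (∀ k → z k ≢ z (suc k)) → z 1 ≡ ref (Π w , i) → (∀ k → Down (z (suc k)) (z k)) → ⊥
    noDownChain [] i z zT z-rec per ne eq dn = ne 0 (trans (sl (zT 0)) (sym z1))
      where
      z1 : z 1 ≡ s i
      z1 = trans eq (ref-σ i)
      sl : T (z 0) → z 0 ≡ s i
      sl (ρ , p , q) = trans (sym q) (line ρ i p (subst (λ x → Neg (act x (vec ρ))) z1 (dn 0 ρ p q)))
    noDownChain (a ∷ w) i z zT z-rec per ne eq dn = noDownChain w i z′ zT′ z-rec′ per′ ne′ eq′ dn′
      where
      z′ : ℕ → G
      z′ k = s a · z k · inv (s a)
      zT′ : ∀ k → T (z′ k)
      zT′ k = T-conj (s a) (zT k)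
      z-rec′ : ∀ k → z′ (suc (suc k)) ≡ z′ (suc k) · z′ k · inv (z′ (suc k))
      z-rec′ k = trans (cong (λ t → s a · t · inv (s a)) (z-rec k))
        (gsolve 3 (λ a x y → (a ⊙ (x ⊙ y ⊙ x ⁻) ⊙ a ⁻) ⊜ (a ⊙ x ⊙ a ⁻ ⊙ (a ⊙ y ⊙ a ⁻) ⊙ (a ⊙ x ⊙ a ⁻) ⁻)) refl (s a) (z (suc k)) (z k))
      per′ : ∃ λ N → z′ (suc N) ≡ z′ 0
      per′ = proj₁ per , cong (λ t → s a · t · inv (s a)) (proj₂ per)
      uncj : ∀ {x y} → s a · x · inv (s a) ≡ s a · y · inv (s a) → x ≡ y
      uncj {x} {y} p = trans (gsolve 2 (λ a x → x ⊜ (a ⁻ ⊙ (a ⊙ x ⊙ a ⁻) ⊙ a)) refl (s a) x)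
        (trans (cong (λ t → inv (s a) · t · s a) p) (gsolve 2 (λ a x → (a ⁻ ⊙ (a ⊙ x ⊙ a ⁻) ⊙ a) ⊜ x) refl (s a) y))
      ne′ : ∀ k → z′ k ≢ z′ (suc k)
      ne′ k p = ne k (uncj p)
      eq′ : z′ 1 ≡ ref (Π w , i)
      eq′ = trans (cong₂ (λ t u → s a · t · u) (trans eq refl) (inv-s a))
        (trans (gsolve 3 (λ a g t → (a ⊙ (a ⊙ g ⊙ t ⊙ (a ⊙ g) ⁻) ⊙ a) ⊜ ((a ⊙ a) ⊙ (g ⊙ t ⊙ g ⁻) ⊙ (a ⁻ ⊙ a))) refl (s a) (Π w) (s i))
          (trans (cong₂ (λ p q → p · ref (Π w , i) · q) (ss a) (invˡ (s a))) (trans (idʳ _) (idˡ _))))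
      -- A simple reflection turns only its own root negative, so z_(k+1) = s_a would force z_k =
      -- z_(k+1).
      notsimple-suc : ∀ k → z (suc k) ≢ s a
      notsimple-suc k p with zT k
      ... | ρ , pr , q = ne k (trans (sym q) (trans (line ρ a pr (subst (λ x → Neg (act x (vec ρ))) p (dn k ρ pr q))) (sym p)))
      notsimple : ∀ k → z k ≢ s a
      -- Index 0 is no successor; periodicity identifies z_0 with a later term.
      notsimple zero p = notsimple-suc (proj₁ per) (trans (proj₂ per) p)
      notsimple (suc k) = notsimple-suc k
      -- The negative of z_(k+1) ρ is a positive root of z_(k+2), which differs from s_a, so s_a
      -- preserves its sign as well as that of ρ.
      dn″ : ∀ k → T (z k) → Σ Rt λ ρ → PosR ρ × ref ρ ≡ z′ k × Neg (act (z′ (suc k)) (vec ρ))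
      dn″ k (ρ , p , q) = s a ▷ ρ , Pos-resp (≋-sym (vec-▷ (s a) ρ)) (stays ρ a p (λ r → notsimple k (trans (sym q) r)))
        , trans (ref-▷ (s a) ρ) (cong (λ t → s a · t · inv (s a)) q)
        , Pos-resp (≋-trans (act-cong (s a) (≋-trans (vec-flip (z (suc k) ▷ ρ)) (⊟-cong (vec-▷ (z (suc k)) ρ)))) (≋-trans (act-⊟ (s a) _)
            (⊟-cong (≋-sym (≋-trans (act-cong (z′ (suc k)) (vec-▷ (s a) ρ)) (≋-trans (≋-sym (act-· (z′ (suc k)) (s a) (vec ρ)))
              (≋-trans (act-≡ (vec ρ) (gsolve 2 (λ a x → (a ⊙ x ⊙ a ⁻ ⊙ a) ⊜ (a ⊙ x)) refl (s a) (z (suc k)))) (act-· (s a) (z (suc k)) (vec ρ)))))))))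
            (stays τ a τpos (λ r → notsimple (suc (suc k)) (trans τref r)))
        where
        τ = flip (z (suc k) ▷ ρ)
        τpos : PosR τ
        τpos = Pos-resp (≋-sym (≋-trans (vec-flip (z (suc k) ▷ ρ)) (⊟-cong (vec-▷ (z (suc k)) ρ)))) (dn k ρ p q)
        τref : z (suc (suc k)) ≡ ref τ
        τref = trans (z-rec k) (trans (cong (λ t → z (suc k) · t · inv (z (suc k))) (sym q)) (trans (sym (ref-▷ (z (suc k)) ρ)) (sym (ref-flip (z (suc k) ▷ ρ)))))
      dn′ : ∀ k → Down (z′ (suc k)) (z′ k)
      dn′ k = pick (upDown (z′ (suc k)) (zT′ k)) (dn″ k (zT k))
        where
        pick : Up (z′ (suc k)) (z′ k) ⊎ Down (z′ (suc k)) (z′ k) →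
               (Σ Rt λ ρ → PosR ρ × ref ρ ≡ z′ k × Neg (act (z′ (suc k)) (vec ρ))) → Down (z′ (suc k)) (z′ k)
        pick (inj₂ d) _ = d
        pick (inj₁ u) (ρ , p , q , ng) = ⊥-elim (sign⊥ (z′ (suc k)) ρ (u ρ p q) ng)

  -- If no g z_(k+1) were shorter than the peak g x, then g would keep the root of each z_(k+1)
  -- positive while g z_(k+1) makes that of z_k negative. Hence z_(k+1) would make z_k negative for
  -- all k, which `noDownChain` forbids. So every peak along a factorisation can be lowered by
  -- Hurwitz moves inside one dihedral group.
  noPeak : ∀ {x y} → T x → T y → x ≢ y → ∀ g → ℓ g < ℓ (g · x) → ℓ (g · x · y) < ℓ (g · x) → ∃ λ k → ℓ (g · dih x y (suc k)) < ℓ (g · x)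
  noPeak {x} {y} tx ty ne g up dn = search (Finₚ.any? (λ (k : Fin (suc M)) → ℓ (g · z (suc (toℕ k))) ℕₚ.<? ℓ (g · x)))
    where
    z = dih x y
    M = proj₁ (z-period T-closed tx ty)
    zT : ∀ k → T (z k)
    zT = z-Q T-closed tx ty
    cover : ∀ k → ∃ λ (j : Fin (suc M)) → z (toℕ j) ≡ z k
    cover zero = zero , refl
    cover (suc k) with cover k
    ... | j , p with toℕ j ℕₚ.<? M
    ... | yes lt = Fin.fromℕ< (s≤s lt) , trans (cong z (Finₚ.toℕ-fromℕ< (s≤s lt))) (trans (z-next T-closed tx ty (toℕ j)) (trans (cong ((x · y) ·_) p) (sym (z-next T-closed tx ty k))))
    ... | no nlt = zero , trans (sym (proj₂ (z-period T-closed tx ty))) (trans (cong (z ∘ suc) (sym j≡M)) (trans (z-next T-closed tx ty (toℕ j)) (trans (cong ((x · y) ·_) p) (sym (z-next T-closed tx ty k)))))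
      where
      j≡M : toℕ j ≡ M
      j≡M = ℕₚ.≤-antisym (ℕₚ.≤-pred (Finₚ.toℕ<n j)) (ℕₚ.≮⇒≥ nlt)
    search : Dec (∃ λ (k : Fin (suc M)) → ℓ (g · z (suc (toℕ k))) < ℓ (g · x)) → ∃ λ k → ℓ (g · z (suc k)) < ℓ (g · x)
    search (yes (k , p)) = toℕ k , p
    search (no ¬p) = ⊥-elim (noDownChain (word (proj₁ (proj₁ tx))) (proj₂ (proj₁ tx)) z zT (λ k → refl) (z-period T-closed tx ty) (z-ne T-closed tx ty ne)
        (trans (sym (proj₂ (proj₂ tx))) (cong (λ h → ref (h , proj₂ (proj₁ tx))) (Π-word _))) chain)
      where
      high : ∀ k → ℓ (g · x) ≤ ℓ (g · z (suc k))
      high k with cover k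
      ... | j , p = ℕₚ.≮⇒≥ (λ lt → ¬p (j , subst (λ t → ℓ (g · t) < ℓ (g · x)) (trans (z-next T-closed tx ty k) (trans (cong ((x · y) ·_) (sym p)) (sym (z-next T-closed tx ty (toℕ j))))) lt))
      ups : ∀ k → Up g (z (suc k))
      ups k with upDown g (zT (suc k))
      ... | inj₁ u = u
      ... | inj₂ d = ⊥-elim (ℕₚ.<⇒≱ (ℕₚ.<-trans (down-ℓ g (zT (suc k)) d) up) (high k))
      downs : ∀ k → Down (g · z (suc k)) (z k)
      downs k with upDown (g · z (suc k)) (zT k)
      ... | inj₂ d = d
      ... | inj₁ u = ⊥-elim (ℕₚ.<⇒≱ (ℕₚ.<-trans (up-ℓ (g · z (suc k)) (zT k) u)
              (subst (_< ℓ (g · x)) (cong ℓ (trans (assoc g x y) (trans (cong (g ·_) (sym (z-prod T-closed tx ty k))) (sym (assoc g _ _))))) dn)) (high k))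
      chain : ∀ k → Down (z (suc k)) (z k)
      chain k with upDown (z (suc k)) (zT k)
      ... | inj₂ d = d
      ... | inj₁ u with zT k
      ... | ρ , p , q = ⊥-elim (sign⊥ (g · z (suc k)) ρ
              (Pos-resp (≋-trans (act-cong g (vec-▷ (z (suc k)) ρ)) (≋-sym (act-· g (z (suc k)) (vec ρ))))
                (ups (suc k) (z (suc k) ▷ ρ) (Pos-resp (≋-sym (vec-▷ (z (suc k)) ρ)) (u ρ p q)) (trans (ref-▷ (z (suc k)) ρ) (cong (λ t → z (suc k) · t · inv (z (suc k))) q))))
              (downs k ρ p q))

-- Reflection length

module TLength (Y : System) where
  open Sub Y public

  -- Inverses are not needed, since Σ always consists of involutions.
  Gen : (G → Set) → G → Set
  Gen Σ g = ∃ λ ds → All Σ ds × g ≡ prodG ds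

  Gen-· : ∀ {Σ g h} → Gen Σ g → Gen Σ h → Gen Σ (g · h)
  Gen-· (as , p , refl) (bs , q , refl) = as ++ bs , Allₚ.++⁺ p q , sym (prodG-++ as bs)

  Red : List G → Set
  Red xs = ∀ ys → All T ys → prodG ys ≡ prodG xs → length xs ≤ length ys

  All-reverse : ∀ {P : G → Set} {xs} → All P xs → All P (reverse xs)
  All-reverse [] = []
  All-reverse {P} {x ∷ xs} (p ∷ ps) = subst (All P) (sym (Listₚ.unfold-reverse x xs)) (Allₚ.++⁺ (All-reverse ps) (p ∷ []))

  prodG-reverse : ∀ xs → All T xs → prodG (reverse xs) ≡ inv (prodG xs)
  prodG-reverse [] [] = sym inv-e
  prodG-reverse (x ∷ xs) (p ∷ ps) = trans (cong prodG (Listₚ.unfold-reverse x xs))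
    (trans (prodG-∷ʳ (reverse xs) x) (trans (cong₂ _·_ (prodG-reverse xs ps) (sym (T-inv p))) (sym (inv-· x (prodG xs)))))

  private
    -- The total height of the prefixes, decreased by a Hurwitz move that lowers a peak. The
    -- successor makes it drop also when the last factor is removed.
    pl : G → List G → ℕ
    pl g []       = 0
    pl g (x ∷ xs) = suc (ℓ (g · x)) ℕ.+ pl (g · x) xs

    pl-∷ʳ : ∀ g xs x → pl g xs < pl g (xs ∷ʳ x)
    pl-∷ʳ g [] x = s≤s z≤n
    pl-∷ʳ g (y ∷ xs) x = ℕₚ.+-monoʳ-< (suc (ℓ (g · y))) (pl-∷ʳ (g · y) xs x)

    pl-≡ : ∀ {g h} xs → g ≡ h → pl g xs ≡ pl h xs
    pl-≡ xs = cong (λ g → pl g xs)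

    pl-change : ∀ g A {x y x′ y′} B → x · y ≡ x′ · y′ → ℓ (g · prodG A · x′) < ℓ (g · prodG A · x) →
                pl g (A ++ x′ ∷ y′ ∷ B) < pl g (A ++ x ∷ y ∷ B)
    pl-change g [] {x} {y} {x′} {y′} B eq lt =
      ℕₚ.+-mono-<-≤ (s≤s (subst (λ h → ℓ (h · x′) < ℓ (h · x)) (idʳ g) lt))
        (ℕₚ.+-mono-≤ (ℕₚ.≤-reflexive (cong (suc ∘ ℓ) same)) (ℕₚ.≤-reflexive (pl-≡ B same)))
      where same : g · x′ · y′ ≡ g · x · y
            same = trans (assoc g x′ y′) (trans (cong (g ·_) (sym eq)) (sym (assoc g x y)))
    pl-change g (a ∷ A) {x} {y} {x′} {y′} B eq lt = ℕₚ.+-monoʳ-< (suc (ℓ (g · a)))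
      (pl-change (g · a) A B eq (subst (λ h → ℓ (h · x′) < ℓ (h · x)) (sym (assoc g a (prodG A))) lt))

    Mono : G → List G → Set
    Mono g []       = ℓ g ≡ ℓ g
    Mono g (x ∷ xs) = ℓ g < ℓ (g · x) × Mono (g · x) xs

    Peak : G → List G → Set
    Peak g xs = ∃ λ A → ∃ λ x → ∃ λ y → ∃ λ B → xs ≡ A ++ x ∷ y ∷ B ×
                 ℓ (g · prodG A) < ℓ (g · prodG A · x) × ℓ (g · prodG A · x · y) < ℓ (g · prodG A · x)

    ≢-ℓ : ∀ g {t} → T t → ℓ g < ℓ (g · t) ⊎ ℓ (g · t) < ℓ g
    ≢-ℓ g tτ with upDown g tτ
    ... | inj₁ u = inj₁ (up-ℓ g tτ u)
    ... | inj₂ d = inj₂ (down-ℓ g tτ d)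

    findPeak : ∀ g x xs → All T xs → ℓ g < ℓ (g · x) → Mono (g · x) xs ⊎ Peak g (x ∷ xs)
    findPeak g x [] [] up = inj₁ refl
    findPeak g x (y ∷ xs) (ty ∷ ts) up with ≢-ℓ (g · x) ty
    ... | inj₂ dn = inj₂ ([] , x , y , xs , refl , subst (λ h → ℓ h < ℓ (h · x)) (sym (idʳ g)) up ,
                          subst (λ h → ℓ (h · x · y) < ℓ (h · x)) (sym (idʳ g)) dn)
    ... | inj₁ up′ with findPeak (g · x) y xs ts up′
    ...   | inj₁ mo = inj₁ (up′ , mo)
    ...   | inj₂ (A , a , b , B , eq , u , d) = inj₂ (x ∷ A , a , b , B , cong (x ∷_) eq
              , subst (λ h → ℓ h < ℓ (h · a)) (assoc g x (prodG A)) u , subst (λ h → ℓ (h · a · b) < ℓ (h · a)) (assoc g x (prodG A)) d)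

    monoOrPeak : ∀ xs → All T xs → Mono e xs ⊎ Peak e xs
    monoOrPeak [] ts = inj₁ refl
    monoOrPeak (x ∷ xs) (t ∷ ts) with ≢-ℓ e t
    ... | inj₂ dn = ⊥-elim (ℕₚ.n≮0 (subst (ℓ (e · x) <_) ℓ-e dn))
    ... | inj₁ up with findPeak e x xs ts up
    ...   | inj₁ mo = inj₁ (up , mo)
    ...   | inj₂ pk = inj₂ pk

    mono-last : ∀ g ys x → Mono g (ys ∷ʳ x) → ℓ (g · prodG ys) < ℓ (g · prodG ys · x)
    mono-last g [] x (u , _) = subst (λ h → ℓ h < ℓ (h · x)) (sym (idʳ g)) u
    mono-last g (y ∷ ys) x (_ , mo) = subst (λ h → ℓ h < ℓ (h · x)) (assoc g y (prodG ys)) (mono-last (g · y) ys x mo)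

  Red-∷ʳ : ∀ ys x → T x → Red (ys ∷ʳ x) → Red ys
  Red-∷ʳ ys x tx r zs tzs eq = ℕₚ.≤-pred (subst₂ _≤_ (len ys) (len zs)
      (r (zs ∷ʳ x) (Allₚ.++⁺ tzs (tx ∷ [])) (trans (prodG-∷ʳ zs x) (trans (cong (_· x) eq) (sym (prodG-∷ʳ ys x))))))
    where open ≡ using (subst₂)
          len : ∀ us → length (us ∷ʳ x) ≡ suc (length us)
          len us = Listₚ.length-++-comm us (x ∷ [])

  Red-drop : ∀ A x B → All T (A ++ x ∷ x ∷ B) → ¬ Red (A ++ x ∷ x ∷ B)
  Red-drop A x B ts r = ℕₚ.<⇒≱ (subst (length (A ++ B) <_) (sym (Listₚ.length-++ A)) (subst (ℕ._< length A ℕ.+ suc (suc (length B))) (sym (Listₚ.length-++ A))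
      (ℕₚ.+-monoʳ-< (length A) (ℕₚ.m≤n⇒m≤1+n ℕₚ.≤-refl))))
    (r (A ++ B) (Allₚ.++⁺ (Allₚ.++⁻ˡ A ts) tB) (trans (prodG-++ A B) (trans (cong (prodG A ·_) (sym (T-cancelˡ tx (prodG B)))) (sym (prodG-++ A (x ∷ x ∷ B))))))
    where
    tx : T x
    tx = All.head (Allₚ.++⁻ʳ A ts)
    tB : All T B
    tB = All.tail (All.tail (Allₚ.++⁻ʳ A ts))

  module _ {Q : G → Set} (cl : Closed Q) {Σ : G → Set} (Σ⊂Δ : ∀ {d} → Σ d → Δ Q d) where
    open Closed cl
    private
      ΣT : ∀ {d} → Σ d → T d
      ΣT p = Q⇒T (proj₁ (Σ⊂Δ p))

      -- Hurwitz moves can be undone, so generation by `Σ` passes from the new pair back to the old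
      -- one.
      climb : ∀ {x y} (qx : Q x) (qy : Q y) k → Gen Σ (dih x y (suc k)) → Gen Σ (dih x y k) → Gen Σ x × Gen Σ y
      climb qx qy zero gx gy = gx , gy
      climb {x} {y} qx qy (suc k) ga gb = climb qx qy k gb
        (subst (Gen Σ) (trans (cong (λ t → z (suc k) · (z (suc k) · z k · t) · z (suc k)) (T-inv (zT (suc k))))
             (trans (gsolve 2 (λ a b → (a ⊙ (a ⊙ b ⊙ a) ⊙ a) ⊜ ((a ⊙ a) ⊙ b ⊙ (a ⊙ a))) refl (z (suc k)) (z k))
               (trans (cong (λ t → t · z k · t) (T-invol (zT (suc k)))) (trans (idʳ _) (idˡ _)))))
          (Gen-· (Gen-· gb ga) gb))
        where z = dih x y
              zT : ∀ k → T (z k)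
              zT k = Q⇒T (z-Q cl qx qy k)

      go : ∀ f xs ds → pl e xs ≤ f → Red xs → All Q xs → All Σ ds → prodG xs ≡ prodG ds →
           All (Gen Σ) xs × ∃ λ ds′ → ds′ ⊆ ds × prodG ds′ ≡ e × length ds ≡ length xs ℕ.+ length ds′
      go f xs ds le red qs sd eq with monoOrPeak xs (All.map Q⇒T qs)
      ... | inj₁ mo with initLast xs
      ...   | [] = [] , ds , ⊆-refl , sym eq , refl
      go zero .(ys ∷ʳ x) ds le red qs sd eq | inj₁ mo | ys ∷ʳ′ x = ⊥-elim (ℕₚ.n≮0 (ℕₚ.≤-trans (pl-∷ʳ e ys x) le))
      go (suc f) .(ys ∷ʳ x) ds le red qs sd eq | inj₁ mo | ys ∷ʳ′ x = fin (exchange cl ds (All.map Σ⊂Δ sd) qx dn)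
        where
        qx : Q x
        qx = All.head (Allₚ.++⁻ʳ ys qs)
        w = prodG ds
        w≡ : w ≡ prodG ys · x
        w≡ = trans (sym eq) (prodG-∷ʳ ys x)
        wx : w · x ≡ prodG ys
        wx = trans (cong (_· x) w≡) (T-cancelʳ (Q⇒T qx) (prodG ys))
        dn : Down w x
        dn with upDown w (Q⇒T qx)
        ... | inj₂ d = d
        ... | inj₁ u = ⊥-elim (ℕₚ.<-asym (up-ℓ w (Q⇒T qx) u) (subst (λ h → ℓ (w · x) < ℓ h) (sym w≡)
                (subst (λ h → ℓ h < ℓ (prodG ys · x)) (sym wx) (subst (λ h → ℓ h < ℓ (h · x)) (idˡ (prodG ys)) (mono-last e ys x mo)))))
        fin : (∃ λ A → ∃ λ d → ∃ λ B → ds ≡ A ++ d ∷ B × w · x ≡ prodG (A ++ B) × x ≡ inv (prodG B) · d · prodG B) →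
              All (Gen Σ) (ys ∷ʳ x) × ∃ λ ds′ → ds′ ⊆ ds × prodG ds′ ≡ e × length ds ≡ length (ys ∷ʳ x) ℕ.+ length ds′
        fin (A , d , B , refl , pr , te) = Allₚ.++⁺ (proj₁ rec) (gx ∷ []) , ds′ , ⊆-trans sub (++⁺ (⊆-refl {x = A}) (d ∷ˢ ⊆-refl)) , pe , len
          where
          sA = Allₚ.++⁻ˡ A sd
          sB = All.tail (Allₚ.++⁻ʳ A sd)
          sdd = All.head (Allₚ.++⁻ʳ A sd)
          rec = go f ys (A ++ B) (ℕₚ.≤-pred (ℕₚ.≤-trans (pl-∷ʳ e ys x) le)) (Red-∷ʳ ys x (Q⇒T qx) red) (Allₚ.++⁻ˡ ys qs) (Allₚ.++⁺ sA sB) (trans (sym wx) pr)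
          ds′ = proj₁ (proj₂ rec)
          sub = proj₁ (proj₂ (proj₂ rec))
          pe = proj₁ (proj₂ (proj₂ (proj₂ rec)))
          gx : Gen Σ x
          gx = reverse B ++ d ∷ B , Allₚ.++⁺ (All-reverse sB) (sdd ∷ sB)
             , trans te (trans (assoc _ d (prodG B)) (trans (cong (_· (d · prodG B)) (sym (prodG-reverse B (All.map ΣT sB)))) (sym (prodG-++ (reverse B) (d ∷ B)))))
          len : length (A ++ d ∷ B) ≡ length (ys ∷ʳ x) ℕ.+ length ds′
          len = trans (Listₚ.length-++ A) (trans (ℕₚ.+-suc (length A) (length B)) (trans (cong suc (trans (sym (Listₚ.length-++ A)) (proj₂ (proj₂ (proj₂ (proj₂ rec))))))
                  (cong (ℕ._+ length ds′) (sym (Listₚ.length-++-comm ys (x ∷ []))))))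
      go zero xs ds le red qs sd eq | inj₂ ([] , x , y , B , refl , _) = ⊥-elim (ℕₚ.n≮0 le)
      go zero xs ds le red qs sd eq | inj₂ (_ ∷ _ , x , y , B , refl , _) = ⊥-elim (ℕₚ.n≮0 le)
      go (suc f) .(A ++ x ∷ y ∷ B) ds le red qs sd eq | inj₂ (A , x , y , B , refl , up , dn) = result
        where
        qx = All.head (Allₚ.++⁻ʳ A qs)
        qy = All.head (All.tail (Allₚ.++⁻ʳ A qs))
        qB = All.tail (All.tail (Allₚ.++⁻ʳ A qs))
        x≢y : x ≢ y
        x≢y refl = Red-drop A x B (All.map Q⇒T qs) red
        np = noPeak (Q⇒T qx) (Q⇒T qy) x≢y (e · prodG A) up dn
        k = proj₁ np
        z = dih x y
        xs′ = A ++ z (suc k) ∷ z k ∷ B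
        same : x · y ≡ z (suc k) · z k
        same = sym (z-prod cl qx qy k)
        pr : prodG xs′ ≡ prodG (A ++ x ∷ y ∷ B)
        pr = trans (prodG-++ A _) (trans (cong (prodG A ·_) (trans (sym (assoc _ _ _)) (trans (cong (_· prodG B) (sym same)) (assoc x y _)))) (sym (prodG-++ A _)))
        len : length xs′ ≡ length (A ++ x ∷ y ∷ B)
        len = trans (Listₚ.length-++ A) (sym (Listₚ.length-++ A))
        rec = go f xs′ ds (ℕₚ.≤-pred (ℕₚ.≤-trans (pl-change e A B same (proj₂ np)) le))
                (λ us tus p → subst (_≤ length us) (sym len) (red us tus (trans p pr)))
                (Allₚ.++⁺ (Allₚ.++⁻ˡ A qs) (z-Q cl qx qy (suc k) ∷ z-Q cl qx qy k ∷ qB)) sd (trans pr eq)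
        gens = Allₚ.++⁻ʳ A (proj₁ rec)
        xy = climb qx qy k (All.head gens) (All.head (All.tail gens))
        result : All (Gen Σ) (A ++ x ∷ y ∷ B) × ∃ λ ds′ → ds′ ⊆ ds × prodG ds′ ≡ e × length ds ≡ length (A ++ x ∷ y ∷ B) ℕ.+ length ds′
        result = Allₚ.++⁺ (Allₚ.++⁻ˡ A (proj₁ rec)) (proj₁ xy ∷ proj₂ xy ∷ All.tail (All.tail gens))
               , proj₁ (proj₂ rec) , proj₁ (proj₂ (proj₂ rec)) , proj₁ (proj₂ (proj₂ (proj₂ rec)))
               , trans (proj₂ (proj₂ (proj₂ (proj₂ rec)))) (cong (ℕ._+ length (proj₁ (proj₂ rec))) len)

    parabolic : ∀ xs ds → Red xs → All Q xs → All Σ ds → prodG xs ≡ prodG ds →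
           All (Gen Σ) xs × ∃ λ ds′ → ds′ ⊆ ds × prodG ds′ ≡ e × length ds ≡ length xs ℕ.+ length ds′
    parabolic xs ds = go (pl e xs) xs ds ℕₚ.≤-refl

  prodR : List Rt → G
  prodR = prodG ∘ map ref

  prodR-++ : ∀ xs ys → prodR (xs ++ ys) ≡ prodR xs · prodR ys
  prodR-++ xs ys = trans (cong prodG (Listₚ.map-++ ref xs ys)) (prodG-++ (map ref xs) (map ref ys))

  prodR-▷ : ∀ g xs → prodR (map (g ▷_) xs) ≡ g · prodR xs · inv g
  prodR-▷ g [] = gsolve 1 (λ g → ε ⊜ (g ⊙ ε ⊙ g ⁻)) refl g
  prodR-▷ g (x ∷ xs) = trans (cong₂ _·_ (ref-▷ g x) (prodR-▷ g xs))
    (gsolve 3 (λ g x y → (g ⊙ x ⊙ g ⁻ ⊙ (g ⊙ y ⊙ g ⁻)) ⊜ (g ⊙ (x ⊙ y) ⊙ g ⁻)) refl g (ref x) (prodR xs))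

  rts : ∀ xs → All T xs → ∃ λ ρs → map ref ρs ≡ xs
  rts [] [] = [] , refl
  rts (x ∷ xs) ((ρ , _ , p) ∷ ts) = ρ ∷ proj₁ (rts xs ts) , cong₂ _∷_ p (proj₂ (rts xs ts))

  T-rts : ∀ ρs → All T (map ref ρs)
  T-rts ρs = Allₚ.map⁺ (All.universal T-ref ρs)

  private
    TW : ℕ → G → Set
    TW zero    g = g ≡ e
    TW (suc k) g = Any (λ h → ∃ λ i → TW k (ref (h , i) · g)) elems

    TW? : ∀ k g → Dec (TW k g)
    TW? zero g = g ≟ e
    TW? (suc k) g = Any.any? (λ h → Finₚ.any? (λ i → TW? k (ref (h , i) · g))) elems

    fromTW : ∀ k g → TW k g → ∃ λ ρs → length ρs ≡ k × g ≡ prodR ρs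
    fromTW zero g p = [] , refl , p
    fromTW (suc k) g p with find p
    ... | h , _ , i , q with fromTW k (ref (h , i) · g) q
    ... | ρs , l , r = (h , i) ∷ ρs , cong suc l , trans (sym (T-cancelˡ (T-ref (h , i)) g)) (cong (ref (h , i) ·_) r)

    toTW : ∀ ρs → TW (length ρs) (prodR ρs)
    toTW [] = refl
    toTW ((h , i) ∷ ρs) = lose (complete h) (i , subst (TW (length ρs)) (sym (T-cancelˡ (T-ref (h , i)) (prodR ρs))) (toTW ρs))

    words : ∀ g → ∃ λ ρs → g ≡ prodR ρs
    words g = map σ (word g) , trans (Π-word g) (go (word g))
      where go : ∀ w → Π w ≡ prodR (map σ w)
            go [] = refl
            go (i ∷ w) = cong₂ _·_ (sym (ref-σ i)) (go w)

    leastTW : ∀ g → ∃ λ k → TW k g × (∀ j → TW j g → k ≤ j)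
    leastTW g = least (λ k → TW? k g) (length (proj₁ (words g)) , subst (TW _) (sym (proj₂ (words g))) (toTW (proj₁ (words g))))

  abstract
    lT : G → ℕ
    lT g = proj₁ (leastTW g)

    fact : G → List Rt
    fact g = proj₁ (fromTW _ g (proj₁ (proj₂ (leastTW g))))

    length-fact : ∀ g → length (fact g) ≡ lT g
    length-fact g = proj₁ (proj₂ (fromTW _ g (proj₁ (proj₂ (leastTW g)))))

    prod-fact : ∀ g → g ≡ prodR (fact g)
    prod-fact g = proj₂ (proj₂ (fromTW _ g (proj₁ (proj₂ (leastTW g)))))

    lT-min : ∀ ρs → lT (prodR ρs) ≤ length ρs
    lT-min ρs = proj₂ (proj₂ (leastTW (prodR ρs))) _ (toTW ρs)

  lT-≤ : ∀ g ρs → g ≡ prodR ρs → lT g ≤ length ρs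
  lT-≤ g ρs p = subst (λ x → lT x ≤ length ρs) (sym p) (lT-min ρs)

  lT-e : lT e ≡ 0
  lT-e = ℕₚ.n≤0⇒n≡0 (lT-min [])

  lT≡0 : ∀ g → lT g ≡ 0 → g ≡ e
  lT≡0 g p with fact g | length-fact g | prod-fact g
  ... | [] | _ | q = q
  ... | _ ∷ _ | l | _ with () ← trans l p

  lT-· : ∀ g h → lT (g · h) ≤ lT g ℕ.+ lT h
  lT-· g h = ℕₚ.≤-trans (lT-≤ (g · h) (fact g ++ fact h) (trans (cong₂ _·_ (prod-fact g) (prod-fact h)) (sym (prodR-++ (fact g) (fact h)))))
    (ℕₚ.≤-reflexive (trans (Listₚ.length-++ (fact g)) (cong₂ ℕ._+_ (length-fact g) (length-fact h))))

  lT-conj : ∀ g w → lT (g · w · inv g) ≡ lT w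
  lT-conj g w = ℕₚ.≤-antisym (le g w) (subst (λ x → lT x ≤ lT (g · w · inv g))
      (gsolve 2 (λ g w → (g ⁻ ⊙ (g ⊙ w ⊙ g ⁻) ⊙ (g ⁻) ⁻) ⊜ w) refl g w) (le (inv g) (g · w · inv g)))
    where
    le : ∀ g w → lT (g · w · inv g) ≤ lT w
    le g w = ℕₚ.≤-trans (lT-≤ (g · w · inv g) (map (g ▷_) (fact w)) (trans (cong (λ x → g · x · inv g) (prod-fact w)) (sym (prodR-▷ g (fact w)))))
      (ℕₚ.≤-reflexive (trans (Listₚ.length-map (g ▷_) (fact w)) (length-fact w)))

  lT-ref : ∀ ρ → lT (ref ρ) ≤ 1
  lT-ref ρ = lT-≤ (ref ρ) (ρ ∷ []) (sym (idʳ _))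

  Red-fact : ∀ ρs → length ρs ≡ lT (prodR ρs) → Red (map ref ρs)
  Red-fact ρs len ys ty eq with rts ys ty
  ... | τs , refl = subst₂ _≤_ (sym (trans (Listₚ.length-map ref ρs) (trans len (cong lT (sym eq))))) (sym (Listₚ.length-map ref τs)) (lT-min τs)
    where open ≡ using (subst₂)

  fixes-coord : ∀ {k} w → k ∉ w → ∀ v → actw w v k ≈ v k
  fixes-coord [] nin v = ≈-refl
  fixes-coord (i ∷ w) nin v = ≈-trans (rf-off (actw w v) (λ eq → nin (Any.here eq))) (fixes-coord w (nin ∘ Any.there) v)

  1≉-1 : ¬ (1# ≈ - 1#)
  1≉-1 p = nn-nontrivial (nn-anti nn-1 (nn-resp p nn-1))

  -- Otherwise s_i would be a product of other letters, all of which fix coordinate i, whereas s_i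
  -- changes the sign of that coordinate on α_i.
  distinct≢e : ∀ i w → i ∉ w → Π (i ∷ w) ≢ e
  distinct≢e i w nin p = 1≉-1 (≈-trans (≈-sym (α-same i)) (≈-trans (≈-sym (fixes-coord w nin (α i)))
      (≈-trans (≈-sym (act-Π w q (α i) i)) (≈-trans (act-s-α i i) (neg-≈ (α-same i))))))
    where
    q : s i ≡ Π w
    q = trans (sym (idʳ (s i))) (trans (cong (s i ·_) (sym p)) (s-cancelˡ (Π w) i))

  private
    ⊆-map : ∀ js {ds} → ds ⊆ map s js → ∃ λ is → is ⊆ js × ds ≡ map s is
    ⊆-map [] [] = [] , [] , refl
    ⊆-map (j ∷ js) (.(s j) ∷ˢ p) with ⊆-map js p
    ... | is , q , r = is , j ∷ˢ q , r
    ⊆-map (j ∷ js) (refl ∷ p) with ⊆-map js p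
    ... | is , q , r = j ∷ is , refl ∷ q , cong (s j ∷_) r

    ⊆-∉ : ∀ {js is : List (Fin n)} {i} → is ⊆ js → All (i ≢_) js → i ∉ is
    ⊆-∉ (y ∷ˢ p) (_ ∷ q) mem = ⊆-∉ p q mem
    ⊆-∉ (refl ∷ p) (ne ∷ q) (Any.here eq) = ne eq
    ⊆-∉ (refl ∷ p) (_ ∷ q) (Any.there mem) = ⊆-∉ p q mem

    ⊆-nil : ∀ {js is} → Unique js → is ⊆ js → Π is ≡ e → is ≡ []
    ⊆-nil {is = []} u p q = refl
    ⊆-nil {is = i ∷ is} (_ ∷ u) (y ∷ˢ p) q = ⊆-nil u p q
    ⊆-nil {is = i ∷ is} (ne ∷ u) (refl ∷ p) q = ⊥-elim (distinct≢e i is (⊆-∉ p ne) q)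

  Letter : List (Fin n) → G → Set
  Letter js g = ∃ λ j → j ∈ js × g ≡ s j

  Letter-Δ : ∀ {js d} → Letter js d → Δ T d
  Letter-Δ (j , _ , refl) = Δ-s j

  letters : ∀ js → All (Letter js) (map s js)
  letters js = Allₚ.map⁺ (All.tabulate (λ {j} mem → j , mem , refl))

  -- The letters left over by `parabolic` form a subword with product e, which is empty because the
  -- letters are distinct.
  lT-Π : ∀ js → Unique js → lT (Π js) ≡ length js
  lT-Π js u = len (parabolic T-closed Letter-Δ (map ref ρs) (map s js) (Red-fact ρs (trans (length-fact (Π js)) (cong lT (prod-fact (Π js)))))
                  (T-rts ρs) (letters js) (trans (sym (prod-fact (Π js))) (sym (prodG-s js))))
    where
    ρs = fact (Π js)
    len : All (Gen (Letter js)) (map ref ρs) × (∃ λ ds′ → ds′ ⊆ map s js × prodG ds′ ≡ e × length (map s js) ≡ length (map ref ρs) ℕ.+ length ds′) → lT (Π js) ≡ length js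
    len (_ , ds′ , sub , pe , l) with ⊆-map js sub
    ... | is , sub′ , refl with ⊆-nil u sub′ (trans (sym (prodG-s is)) pe)
    ... | refl = trans (sym (length-fact (Π js))) (trans (sym (Listₚ.length-map ref ρs)) (trans (sym (ℕₚ.+-identityʳ _)) (trans (sym l) (Listₚ.length-map s js))))

  Supp : List (Fin n) → V → Set
  Supp js v = ∀ k → k ∉ js → v k ≈ 0#

  private
    gen-coord : ∀ {js ds} → All (Letter js) ds → ∀ k → k ∉ js → ∀ v → act (prodG ds) v k ≈ v k
    gen-coord [] k nin v = act-e v k
    gen-coord {js} {d ∷ ds} ((j , mem , refl) ∷ ls) k nin v = ≈-trans (act-s· j (prodG ds) v k)
      (≈-trans (rf-off _ (λ eq → nin (subst (_∈ js) (sym eq) mem))) (gen-coord ls k nin v))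

  -- Letters of js leave coordinate k alone, while a reflection negates its root. A coordinate equal
  -- to its own negative is zero because the root has a sign.
  gen-supp : ∀ {js} ρ → Gen (Letter js) (ref ρ) → Supp js (vec ρ)
  gen-supp {js} ρ (ds , ls , eq) k nin = zero′ (signR ρ)
    where
    self : vec ρ k ≈ - vec ρ k
    self = ≈-trans (≈-sym (gen-coord ls k nin (vec ρ))) (≈-trans (act-≡ (vec ρ) (sym eq) k) (act-ref-vec ρ k))
    zero′ : PosR ρ ⊎ Neg (vec ρ) → vec ρ k ≈ 0#
    zero′ (inj₁ p) = nn-anti (p k) (nn-resp self (p k))
    zero′ (inj₂ p) = nn-anti (nn-resp (≈-sym self) (p k)) (p k)

  supp-fact : ∀ w js ρs → w ≡ prodG (map s js) → w ≡ prodR ρs → length ρs ≡ lT w → All (λ ρ → Supp js (vec ρ)) ρs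
  supp-fact w js ρs p q l = All.map (λ {ρ} → gen-supp ρ) (Allₚ.map⁻ (proj₁ (parabolic T-closed Letter-Δ (map ref ρs) (map s js)
      (Red-fact ρs (trans l (cong lT q))) (T-rts ρs) (letters js) (trans (sym q) p))))

-- Rotating a Coxeter word

module Rotation (Y : System) where
  open TLength Y public

  longest : ∃ λ g → ∀ h → ℓ h ≤ ℓ g
  longest with go elems
    where
    go : ∀ xs → ∃ λ g → ∀ h → h ∈ xs → ℓ h ≤ ℓ g
    go [] = e , λ h ()
    go (x ∷ xs) with go xs
    ... | g , p with ℕₚ.≤-total (ℓ x) (ℓ g)
    ... | inj₁ le = g , λ { h (here refl) → le ; h (there m) → p h m }
    ... | inj₂ ge = x , λ { h (here refl) → ℕₚ.≤-refl ; h (there m) → ℕₚ.≤-trans (p h m) ge }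
  ... | g , p = g , λ h → p h (complete h)

  w₀ : G
  w₀ = proj₁ longest

  w₀-neg : ∀ i → Neg (act w₀ (α i))
  w₀-neg i with sgn w₀ i
  ... | inj₁ (_ , lt) = ⊥-elim (ℕₚ.<⇒≱ lt (proj₂ longest (w₀ · s i)))
  ... | inj₂ (ng , _) = ng

  private
    act-∑ : ∀ g {N} (f : Fin N → V) → act g (λ k → ∑ (λ i → f i k)) ≋ (λ k → ∑ (λ i → act g (f i) k))
    act-∑ g {zero} f = act-0 g
    act-∑ g {suc N} f k = ≈-trans (act-⊞ g (f zero) (λ k → ∑ (λ i → f (suc i) k)) k) (+-≈ ≈-refl (act-∑ g (f ∘ suc) k))

  expand : ∀ g v → act g v ≋ (λ k → ∑ (λ i → v i * act g (α i) k))
  expand g v k = ≈-trans (act-cong g {v} {λ k → ∑ (λ i → v i * α i k)} (λ k → ≈-sym (sel k)) k)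
      (≈-trans (act-∑ g (λ i → v i • α i) k) (∑-cong {n} {λ i → act g (v i • α i) k} {λ i → v i * act g (α i) k} (λ i → act-• g (v i) (α i) k)))
    where
    sel : ∀ k → ∑ (λ i → v i * α i k) ≈ v k
    sel k = ≈-trans (∑-single (λ i → v i * α i k) k (λ j ne → ≈-trans (*-≈ ≈-refl (α-diff (ne ∘ sym))) (*-zeroʳ _)))
              (≈-trans (*-≈ ≈-refl (α-same k)) (*-idʳ _))

  neg-act-pos : ∀ g v → Pos v → (∀ i → Neg (act g (α i))) → Neg (act g v)
  neg-act-pos g v p q k = nn-resp (≈-trans (≈-sym (neg∑ (λ i → v i * act g (α i) k))) (neg-≈ (≈-sym (expand g v k))))
      (∑-nn (λ i → - (v i * act g (α i) k)) (λ i → nn-resp (rsolve 2 (λ a b → a :* (:- b) := :- (a :* b)) ≈-refl (v i) (act g (α i) k)) (nn-* (p i) (q i k))))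
    where
    neg∑ : ∀ {N} (f : Fin N → K) → - ∑ f ≈ ∑ (λ i → - f i)
    neg∑ {zero} f = neg-0
    neg∑ {suc N} f = ≈-trans (rsolve 2 (λ a b → :- (a :+ b) := (:- a) :+ (:- b)) ≈-refl (f zero) (∑ (f ∘ suc))) (+-≈ ≈-refl (neg∑ (f ∘ suc)))

  -- An antidominant vector only grows under W, while w₀ makes it negative.
  antidominant : ∀ v → Pos v → (∀ i → Nonneg (- y i v)) → v ≋ 0v
  antidominant v p q = ≋-trans (≋-sym (act-inv w₀ v)) (≋-trans (act-cong (inv w₀) (Pos-anti pos (neg-act-pos w₀ v p w₀-neg))) (act-0 (inv w₀)))
    where
    grows : ∀ f g → ℓ g ≤ f → Pos (act g v ⊞ ⊟ v)
    grows f g le with g ≟ e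
    ... | yes refl = Pos-resp (λ k → ≈-sym (≈-trans (+-≈ (act-e v k) ≈-refl) (rsolve 1 (λ a → a :+ (:- a) := a :- a) ≈-refl (v k)))) (λ k → nn-resp (≈-sym (rsolve 1 (λ a → a :- a := con (ℤ+ 0)) ≈-refl (v k))) nn-0)
      where open import Data.Integer using () renaming (+_ to ℤ+_)
    ... | no ne with descent g ne
    grows zero g le | no ne | i , lt = ⊥-elim (ℕₚ.n≮0 (ℕₚ.≤-trans lt le))
    grows (suc f) g le | no ne | i , lt = Pos-resp eq (Pos-⊞ (grows f g′ (ℕₚ.≤-pred (ℕₚ.≤-trans lt le))) (Pos-• (q i) up))
      where
      g′ = g · s i
      up : Pos (act g′ (α i))
      up with sgn g′ i
      ... | inj₁ (u , _) = u
      ... | inj₂ (_ , l) = ⊥-elim (ℕₚ.<-asym l (subst (λ x → ℓ g′ < ℓ x) (sym (s-cancelʳ g i)) lt))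
      eq : (act g′ v ⊞ ⊟ v) ⊞ (- y i v) • act g′ (α i) ≋ act g v ⊞ ⊟ v
      eq k = ≈-trans (rsolve 3 (λ a b c → (a :+ b) :+ c := (a :+ c) :+ b) ≈-refl (act g′ v k) (- v k) (- y i v * act g′ (α i) k))
        (+-≈ (≈-sym (≈-trans (act-≡ v (sym (s-cancelʳ g i)) k) (≈-trans (act-· g′ (s i) v k) (≈-trans (act-cong g′ (λ x → ≈-trans (act-s i v x)
            (rsolve 3 (λ v c a → v :- c :* a := v :+ (:- c) :* a) ≈-refl (v x) (y i v) (α i x))) k)
          (≈-trans (act-⊞ g′ v ((- y i v) • α i) k) (+-≈ ≈-refl (act-• g′ (- y i v) (α i) k))))))) ≈-refl)
    pos : Pos (act w₀ v)
    pos k = nn-resp (rsolve 2 (λ a b → (a :+ (:- b)) :+ b := a) ≈-refl (act w₀ v k) (v k)) (nn-+ (grows _ w₀ ℕₚ.≤-refl k) (p k))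

  Unique-rot : ∀ {i} {js : List (Fin n)} → Unique (i ∷ js) → Unique (js ∷ʳ i)
  Unique-rot {i} {js} (ne ∷ u) = Uniqueₚ.++⁺ u ([] ∷ []) (λ { (m , here refl) → All.lookup ne m refl })

  ∉-tail : ∀ {i} {js : List (Fin n)} → Unique (i ∷ js) → i ∉ js
  ∉-tail (ne ∷ _) m = All.lookup ne m refl

  Π-rot : ∀ i js → Π (js ∷ʳ i) ≡ s i · Π (i ∷ js) · inv (s i)
  Π-rot i js = trans (Π-∷ʳ js i) (cong₂ _·_ (sym (s-cancelˡ (Π js) i)) (sym (inv-s i)))

  rot-∉ : ∀ {i k} {js : List (Fin n)} → k ∉ js ∷ʳ i → k ∉ i ∷ js
  rot-∉ {js = js} nin (here refl) = nin (∈-++⁺ʳ js (here refl))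
  rot-∉ nin (there m) = nin (∈-++⁺ˡ m)

  Supp-rot : ∀ {i js v} → Supp (i ∷ js) v → Supp (js ∷ʳ i) (rf i v)
  Supp-rot {v = v} p k nin = ≈-trans (rf-off v (λ eq → rot-∉ nin (here eq))) (p k (rot-∉ nin))

  Supp-cong : ∀ {js u v} → u ≋ v → Supp js u → Supp js v
  Supp-cong p q k nin = ≈-trans (≈-sym (p k)) (q k nin)

  Supp-actw : ∀ {js v} w → All (_∈ js) w → Supp js v → Supp js (actw w v)
  Supp-actw [] _ p = p
  Supp-actw {js} {v} (i ∷ w) (m ∷ ms) p k nin = ≈-trans (rf-off (actw w v) (λ eq → nin (subst (_∈ js) (sym eq) m))) (Supp-actw w ms p k nin)

  StayPos : ℕ → List (Fin n) → V → Set
  StayPos zero    js       v = ⊤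
  StayPos (suc f) []       v = ⊤
  StayPos (suc f) (i ∷ js) v = Pos (rf i v) × StayPos f (js ∷ʳ i) (rf i v)

  StayPos-cong : ∀ f js {u v} → u ≋ v → StayPos f js u → StayPos f js v
  StayPos-cong zero js p q = tt
  StayPos-cong (suc f) [] p q = tt
  StayPos-cong (suc f) (i ∷ js) p (q , r) = Pos-resp (rf-cong i p) q , StayPos-cong f (js ∷ʳ i) (rf-cong i p) r

  private
    rotv : List (Fin n) → V → V
    rotv []      v = v
    rotv (i ∷ A) v = rotv A (rf i v)

    rotv-act : ∀ A v → rotv A v ≋ act (inv (Π A)) v
    rotv-act [] v = ≋-sym (≋-trans (act-≡ v inv-e) (act-e v))
    rotv-act (i ∷ A) v = ≋-trans (rotv-act A (rf i v)) (≋-trans (act-cong (inv (Π A)) (≋-sym (act-s i v))) (≋-trans (≋-sym (act-· (inv (Π A)) (s i) v))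
      (act-≡ v (trans (cong (inv (Π A) ·_) (sym (inv-s i))) (sym (inv-· (s i) (Π A)))))))

    stay-prefix : ∀ A B f v → Pos v → StayPos (length A ℕ.+ f) (A ++ B) v → Pos (rotv A v) × StayPos f (B ++ A) (rotv A v)
    stay-prefix [] B f v p sp = p , subst (λ w → StayPos f w v) (sym (Listₚ.++-identityʳ B)) sp
    stay-prefix (i ∷ A) B f v p (q , sp) with stay-prefix A (B ∷ʳ i) f (rf i v) q (subst (λ w → StayPos (length A ℕ.+ f) w (rf i v)) (Listₚ.++-assoc A B (i ∷ [])) sp)
    ... | r , sp′ = r , subst (λ w → StayPos f w (rotv A (rf i v))) (Listₚ.++-assoc B (i ∷ []) A) sp′

    stay-round : ∀ js f v → Pos v → StayPos (length js ℕ.+ f) js v → Pos (act (inv (Π js)) v) × StayPos f js (act (inv (Π js)) v)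
    stay-round js f v p sp with stay-prefix js [] f v p (subst (λ w → StayPos (length js ℕ.+ f) w v) (sym (Listₚ.++-identityʳ js)) sp)
    ... | q , sp′ = Pos-resp (rotv-act js v) q , StayPos-cong f js (rotv-act js v) sp′

    sumPow : G → ℕ → V → V
    sumPow g zero    v = 0v
    sumPow g (suc h) v = v ⊞ sumPow g h (act g v)

    sumPow-pos : ∀ js h v → Pos v → StayPos (h ℕ.* length js) js v → Pos (sumPow (inv (Π js)) h v)
    sumPow-pos js zero v p sp = Pos-0
    sumPow-pos js (suc h) v p sp with stay-round js (h ℕ.* length js) v p sp
    ... | q , sp′ = Pos-⊞ p (sumPow-pos js h _ q sp′)

    sumPow-act : ∀ g h v → act g (sumPow g h v) ⊞ v ≋ sumPow g h v ⊞ act (pw g h) v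
    sumPow-act g zero v k = +-≈ (act-0 g k) (≈-sym (act-e v k))
    sumPow-act g (suc h) v k = ≈-trans (+-≈ (act-⊞ g v (sumPow g h (act g v)) k) ≈-refl)
      (≈-trans (rsolve 3 (λ a b c → (a :+ b) :+ c := c :+ (b :+ a)) ≈-refl (act g v k) (act g (sumPow g h (act g v)) k) (v k))
        (≈-trans (+-≈ ≈-refl (sumPow-act g h (act g v) k)) (≈-trans (rsolve 3 (λ a b c → a :+ (b :+ c) := (a :+ b) :+ c) ≈-refl _ _ _)
          (+-≈ ≈-refl (≈-trans (≈-sym (act-· (pw g h) g v k)) (act-≡ v (comm h) k))))))
      where
      comm : ∀ h → pw g h · g ≡ g · pw g h
      comm zero = trans (idˡ g) (sym (idʳ g))
      comm (suc h) = trans (assoc g (pw g h) g) (cong (g ·_) (comm h))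

    sumPow-supp : ∀ js h v → Supp js v → Supp js (sumPow (inv (Π js)) h v)
    sumPow-supp js zero v p k nin = ≈-refl
    sumPow-supp js (suc h) v p k nin = ≈-trans (+-≈ (p k nin) (sumPow-supp js h _ (Supp-cong (rotv-act js v) (supp-rotv js v (All.tabulate id) p)) k nin)) (+-idʳ 0#)
      where
      supp-rotv : ∀ A v → All (_∈ js) A → Supp js v → Supp js (rotv A v)
      supp-rotv [] v _ q = q
      supp-rotv (i ∷ A) v (m ∷ ms) q = supp-rotv A (rf i v) ms (Supp-actw (i ∷ []) (m ∷ []) q)

    -- As the letters are distinct, coordinate i is moved only by s_i, so the letters cannot cancel
    -- each other's effect.
    fixed-letters : ∀ js v → Unique js → actw js v ≋ v → ∀ j → j ∈ js → rf j v ≋ v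
    fixed-letters (i ∷ js) v u p j m = split m
      where
      w = actw js v
      w≋v : w ≋ v
      w≋v k with k Fin.≟ i
      ... | yes refl = fixes-coord js (∉-tail u) v
      ... | no ne = ≈-trans (≈-sym (rf-off w ne)) (p k)
      tail-u : ∀ {i} {js : List (Fin n)} → Unique (i ∷ js) → Unique js
      tail-u (_ ∷ u) = u
      split : j ∈ i ∷ js → rf j v ≋ v
      split (here refl) = ≋-trans (rf-cong i (≋-sym w≋v)) p
      split (there m) = fixed-letters js v (tail-u u) w≋v j m

    -- Such a v is antidominant: its pairing with a letter of js is zero, and with any other i it is
    -- -N_i v, since v_i = 0 there.
    fixed-zero : ∀ js v → Unique js → Supp js v → Pos v → actw js v ≋ v → v ≋ 0v
    fixed-zero js v u sp p fx = antidominant v p yv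
      where
      yv : ∀ i → Nonneg (- y i v)
      yv i with mem? Fin._≟_ i js
      ... | yes m = nn-resp (≈-sym (≈-trans (neg-≈ y0) neg-0)) nn-0
        where
        y0 : y i v ≈ 0#
        y0 = ≈-trans (rsolve 2 (λ a b → b := a :- (a :- b)) ≈-refl (v i) (y i v)) (≈-trans (+-≈ ≈-refl (neg-≈ (≈-trans (+-≈ ≈-refl (neg-≈ (≈-trans (≈-sym (*-idʳ _)) (*-≈ ≈-refl (≈-sym (α-same i)))))) (fixed-letters js v u fx i m i))))
               (rsolve 1 (λ a → a :- a := con (ℤ+ 0)) ≈-refl (v i)))
          where open import Data.Integer using () renaming (+_ to ℤ+_)
      ... | no nm = nn-resp (≈-sym (≈-trans (neg-≈ (+-≈ (≈-trans (+-≈ (sp i nm) (sp i nm)) (+-idʳ 0#)) ≈-refl)) (≈-trans (neg-≈ (+-idˡ _)) (rsolve 1 (λ a → :- (:- a) := a) ≈-refl (N i v)))))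
                      (∑-nn (λ k → adj i k * v k) (λ k → nn-* (adj-nn i k) (p k)))

  -- A vector staying positive that long vanishes: its sum over the powers of c is fixed by all letters of c.
  rounds : List (Fin n) → ℕ
  rounds js = suc (proj₁ (finOrder (inv (Π js)))) ℕ.* length js

  stay-zero : ∀ js v → Unique js → Supp js v → Pos v → StayPos (rounds js) js v → v ≋ 0v
  -- The vanishing sum is v plus a nonnegative rest, so -v is nonnegative too.
  stay-zero js v u sp p st = λ k → nn-anti (p k) (nn-resp (v-rest k) (rest-pos k))
    where
    g = inv (Π js)
    h = proj₁ (finOrder g)
    S = sumPow g (suc h) v
    S-fixed : act g S ≋ S
    S-fixed k = cancel (≈-trans (sumPow-act g (suc h) v k) (+-≈ ≈-refl (≈-trans (act-≡ v (proj₂ (finOrder g)) k) (act-e v k))))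
      where
      cancel : ∀ {a b c} → a + c ≈ b + c → a ≈ b
      cancel {a} {b} {c} q = ≈-trans (rsolve 2 (λ a c → a := (a :+ c) :- c) ≈-refl a c) (≈-trans (+-≈ q ≈-refl) (rsolve 2 (λ b c → (b :+ c) :- c := b) ≈-refl b c))
    S-c : actw js S ≋ S
    S-c = ≋-trans (≋-sym (act-Π js refl S)) (≋-trans (act-cong (Π js) (≋-sym S-fixed)) (act-inv′ (Π js) S))
    S-pos : Pos S
    S-pos = sumPow-pos js (suc h) v p st
    S-zero : S ≋ 0v
    S-zero = fixed-zero js S u (sumPow-supp js (suc h) v sp) S-pos S-c
    rest = sumPow g h (act g v)
    rest-pos : Pos rest
    rest-pos = sumPow-pos js h (act g v) (proj₁ rnd) (proj₂ rnd)
      where rnd = stay-round js (h ℕ.* length js) v p st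
    v-rest : rest ≋ ⊟ v
    v-rest k = ≈-trans (rsolve 2 (λ a b → b := (a :+ b) :- a) ≈-refl (v k) (rest k)) (≈-trans (+-≈ (S-zero k) ≈-refl) (+-idˡ _))

  data Hits : List (Fin n) → G → Set where
    here : ∀ {i js t} → t ≡ s i → Hits (i ∷ js) t
    step : ∀ {i js t} → t ≢ s i → Hits (js ∷ʳ i) (s i · t · inv (s i)) → Hits (i ∷ js) t

  -- A root is nonzero, so by `stay-zero` it cannot stay positive for `rounds js` steps, and by
  -- `stays` a letter can make it negative only if it is the reflection itself. The refuted
  -- `StayPos` bounds the search.
  hits : ∀ js ρ → Unique js → Supp js (vec ρ) → Hits js (ref ρ)
  hits js ρ₀ u sp₀ = subst (Hits js) (proj₂ (proj₂ (posRep ρ₀))) (go (rounds js) js ρ u spρ (proj₁ (proj₂ (posRep ρ₀)))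
      (λ st → vec≉0 ρ (stay-zero js (vec ρ) u spρ (proj₁ (proj₂ (posRep ρ₀))) st)))
    where
    ρ = proj₁ (posRep ρ₀)
    spρ : Supp js (vec ρ)
    spρ with signR ρ₀
    ... | inj₁ _ = sp₀
    ... | inj₂ _ = λ k nin → ≈-trans (vec-flip ρ₀ k) (≈-trans (neg-≈ (sp₀ k nin)) neg-0)
    vec≉0 : ∀ ρ → ¬ (vec ρ ≋ 0v)
    vec≉0 (h , i) p = α≉0 i (≋-trans (≋-sym (act-inv h (α i))) (≋-trans (act-cong (inv h) p) (act-0 (inv h))))
    go : ∀ f js ρ → Unique js → Supp js (vec ρ) → PosR ρ → ¬ StayPos f js (vec ρ) → Hits js (ref ρ)
    go zero js ρ u sp p ns = ⊥-elim (ns tt)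
    go (suc f) [] ρ u sp p ns = ⊥-elim (ns tt)
    go (suc f) (i ∷ js) ρ u sp p ns with ref ρ ≟ s i
    ... | yes q = here q
    ... | no q = step q (subst (Hits (js ∷ʳ i)) (ref-▷ (s i) ρ) (go f (js ∷ʳ i) (s i ▷ ρ) (Unique-rot u) (Supp-cong (≋-sym eq) (Supp-rot sp)) pos′
          (λ st → ns (Pos-resp eq pos′ , StayPos-cong f (js ∷ʳ i) eq st))))
      where
      eq : vec (s i ▷ ρ) ≋ rf i (vec ρ)
      eq = ≋-trans (vec-▷ (s i) ρ) (act-s i (vec ρ))
      pos′ : PosR (s i ▷ ρ)
      pos′ = Pos-resp (≋-sym (vec-▷ (s i) ρ)) (stays ρ i p q)

-- The Euler form and factorisations of a Coxeter element

module Euler (Y : System) where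
  open Rotation Y public

  Nl : Fin n → List (Fin n) → V → K
  Nl i js z = foldr (λ j a → adj i j * z j + a) 0# js

  -- The (nonsymmetric) Euler form of the Coxeter element Π js; its symmetrisation is the Coxeter form on V_J.
  E : List (Fin n) → V → V → K
  E []       x z = 0#
  E (i ∷ js) x z = x i * (z i - Nl i js z) + E js x z

  Nl-local : ∀ i js {u v} → (∀ k → k ∈ js → u k ≈ v k) → Nl i js u ≈ Nl i js v
  Nl-local i [] p = ≈-refl
  Nl-local i (j ∷ js) p = +-≈ (*-≈ ≈-refl (p j (here refl))) (Nl-local i js (λ k m → p k (there m)))

  E-local : ∀ js {x x′ z z′} → (∀ k → k ∈ js → x k ≈ x′ k) → (∀ k → k ∈ js → z k ≈ z′ k) → E js x z ≈ E js x′ z′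
  E-local [] p q = ≈-refl
  E-local (i ∷ js) p q = +-≈ (*-≈ (p i (here refl)) (+-≈ (q i (here refl)) (neg-≈ (Nl-local i js (λ k m → q k (there m))))))
    (E-local js (λ k m → p k (there m)) (λ k m → q k (there m)))

  E-cong : ∀ js {x x′ z z′} → x ≋ x′ → z ≋ z′ → E js x z ≈ E js x′ z′
  E-cong js p q = E-local js (λ k _ → p k) (λ k _ → q k)

  Nl-⊞ : ∀ i js u v → Nl i js (u ⊞ v) ≈ Nl i js u + Nl i js v
  Nl-⊞ i [] u v = ≈-sym (+-idʳ 0#)
  Nl-⊞ i (j ∷ js) u v = ≈-trans (+-≈ ≈-refl (Nl-⊞ i js u v))
    (rsolve 5 (λ a u v p q → a :* (u :+ v) :+ (p :+ q) := (a :* u :+ p) :+ (a :* v :+ q)) ≈-refl (adj i j) (u j) (v j) (Nl i js u) (Nl i js v))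

  Nl-• : ∀ i js r v → Nl i js (r • v) ≈ r * Nl i js v
  Nl-• i [] r v = ≈-sym (*-zeroʳ r)
  Nl-• i (j ∷ js) r v = ≈-trans (+-≈ ≈-refl (Nl-• i js r v))
    (rsolve 4 (λ a r v p → a :* (r :* v) :+ r :* p := r :* (a :* v :+ p)) ≈-refl (adj i j) r (v j) (Nl i js v))

  E-⊞ʳ : ∀ js x u v → E js x (u ⊞ v) ≈ E js x u + E js x v
  E-⊞ʳ [] x u v = ≈-sym (+-idʳ 0#)
  E-⊞ʳ (i ∷ js) x u v = ≈-trans (+-≈ (*-≈ ≈-refl (+-≈ ≈-refl (neg-≈ (Nl-⊞ i js u v)))) (E-⊞ʳ js x u v))
    (rsolve 7 (λ x u v a b p q → x :* ((u :+ v) :- (a :+ b)) :+ (p :+ q) := (x :* (u :- a) :+ p) :+ (x :* (v :- b) :+ q)) ≈-refl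
      (x i) (u i) (v i) (Nl i js u) (Nl i js v) (E js x u) (E js x v))

  E-•ʳ : ∀ js x r v → E js x (r • v) ≈ r * E js x v
  E-•ʳ [] x r v = ≈-sym (*-zeroʳ r)
  E-•ʳ (i ∷ js) x r v = ≈-trans (+-≈ (*-≈ ≈-refl (+-≈ ≈-refl (neg-≈ (Nl-• i js r v)))) (E-•ʳ js x r v))
    (rsolve 5 (λ x r v a p → x :* (r :* v :- r :* a) :+ r :* p := r :* (x :* (v :- a) :+ p)) ≈-refl (x i) r (v i) (Nl i js v) (E js x v))

  E-•ˡ : ∀ js r x v → E js (r • x) v ≈ r * E js x v
  E-•ˡ [] r x v = ≈-sym (*-zeroʳ r)
  E-•ˡ (i ∷ js) r x v = ≈-trans (+-≈ ≈-refl (E-•ˡ js r x v))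
    (rsolve 4 (λ r x a p → (r :* x) :* a :+ r :* p := r :* (x :* a :+ p)) ≈-refl r (x i) (v i - Nl i js v) (E js x v))

  E-0ʳ : ∀ js x z → (∀ k → k ∈ js → z k ≈ 0#) → E js x z ≈ 0#
  E-0ʳ js x z p = ≈-trans (E-local js {x} {x} {z} {0# • z} (λ _ _ → ≈-refl) (λ k m → ≈-trans (p k m) (≈-sym (*-zeroˡ _)))) (≈-trans (E-•ʳ js x 0# z) (*-zeroˡ _))

  E-0ˡ : ∀ js x z → (∀ k → k ∈ js → x k ≈ 0#) → E js x z ≈ 0#
  E-0ˡ js x z p = ≈-trans (E-local js {x} {0# • x} {z} {z} (λ k m → ≈-trans (p k m) (≈-sym (*-zeroˡ _))) (λ _ _ → ≈-refl)) (≈-trans (E-•ˡ js 0# x z) (*-zeroˡ _))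

  E-∷ʳ : ∀ js i x z → E (js ∷ʳ i) x z ≈ E js x z + (x i - Nl i js x) * z i
  E-∷ʳ [] i x z = rsolve 2 (λ x z → x :* (z :- con (ℤ+ 0)) :+ con (ℤ+ 0) := con (ℤ+ 0) :+ (x :- con (ℤ+ 0)) :* z) ≈-refl (x i) (z i)
  E-∷ʳ (j ∷ js) i x z = ≈-trans (+-≈ (*-≈ ≈-refl (+-≈ ≈-refl (neg-≈ (Nl-∷ʳ js)))) (E-∷ʳ js i x z))
      (≈-trans (rsolve 8 (λ xj zj A a zi E xi X → xj :* (zj :- (A :+ a :* zi)) :+ (E :+ (xi :- X) :* zi)
          := (xj :* (zj :- A) :+ E) :+ (xi :- (a :* xj :+ X)) :* zi) ≈-refl (x j) (z j) (Nl j js z) (adj j i) (z i) (E js x z) (x i) (Nl i js x))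
        (+-≈ ≈-refl (*-≈ (+-≈ ≈-refl (neg-≈ (+-≈ (*-≈ (≈-reflexive (adj-sym j i)) ≈-refl) ≈-refl))) ≈-refl)))
    where
    Nl-∷ʳ : ∀ js → Nl j (js ∷ʳ i) z ≈ Nl j js z + adj j i * z i
    Nl-∷ʳ [] = +-commut _ _
    Nl-∷ʳ (k ∷ js) = ≈-trans (+-≈ ≈-refl (Nl-∷ʳ js)) (≈-sym (+-associative _ _ _))

  private
    ∑-list : ∀ js (f : Fin n → K) → Unique js → (∀ k → k ∉ js → f k ≈ 0#) → ∑ f ≈ foldr (λ j a → f j + a) 0# js
    ∑-list [] f u p = ∑-0 f (λ i → p i (λ ()))
    ∑-list (j ∷ js) f (ne ∷ u) p = ≈-trans (∑-cong {n} {f} {λ k → f k * α j k + f′ k} split) (≈-trans (∑-+ (λ k → f k * α j k) f′)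
        (+-≈ (≈-trans (∑-single (λ k → f k * α j k) j (λ k nk → ≈-trans (*-≈ ≈-refl (α-diff nk)) (*-zeroʳ _))) (≈-trans (*-≈ ≈-refl (α-same j)) (*-idʳ _)))
             (≈-trans (∑-list js f′ u f′-off) (fold-local js (λ k m → f′-≢ (λ eq → All.lookup ne m (sym eq)))))))
      where
      f′ : Fin n → K
      f′ k = f k * (1# - α j k)
      split : ∀ k → f k ≈ f k * α j k + f′ k
      split k = ≈-sym (≈-trans (rsolve 3 (λ f a o → f :* a :+ f :* (o :- a) := f :* o) ≈-refl (f k) (α j k) 1#) (*-idʳ _))
      f′-≢ : ∀ {k} → k ≢ j → f′ k ≈ f k
      f′-≢ {k} nk = ≈-trans (*-≈ ≈-refl (≈-trans (+-≈ ≈-refl (≈-trans (neg-≈ (α-diff nk)) neg-0)) (+-idʳ 1#))) (*-idʳ _)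
      f′-off : ∀ k → k ∉ js → f′ k ≈ 0#
      f′-off k nin with k Fin.≟ j
      ... | yes refl = ≈-trans (*-≈ ≈-refl (rsolve 1 (λ o → o :- o := con (ℤ+ 0)) ≈-refl 1#)) (*-zeroʳ _)
      ... | no nk = ≈-trans (*-≈ (p k (λ { (here eq) → nk eq ; (there m) → nin m })) ≈-refl) (*-zeroˡ _)
      fold-local : ∀ js {f g : Fin n → K} → (∀ k → k ∈ js → f k ≈ g k) → foldr (λ j a → f j + a) 0# js ≈ foldr (λ j a → g j + a) 0# js
      fold-local [] q = ≈-refl
      fold-local (k ∷ js) q = +-≈ (q k (here refl)) (fold-local js (λ k m → q k (there m)))

  Nl-N : ∀ i js z → Unique (i ∷ js) → Supp (i ∷ js) z → N i z ≈ Nl i js z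
  Nl-N i js z u sp = ≈-trans (∑-list (i ∷ js) (λ k → adj i k * z k) u (λ k nin → ≈-trans (*-≈ ≈-refl (sp k nin)) (*-zeroʳ _)))
    (≈-trans (+-≈ (≈-trans (*-≈ (adj-self i) ≈-refl) (*-zeroˡ _)) ≈-refl) (+-idˡ _))

  -- Reflection replaces x_i by N_i x - x_i, and moving i from the first to the last place replaces
  -- the row of i by its column; the term x_i (z_i - N_i z) survives both changes.
  E-rot : ∀ i js x z → Unique (i ∷ js) → Supp (i ∷ js) x → Supp (i ∷ js) z → E (js ∷ʳ i) (rf i x) (rf i z) ≈ E (i ∷ js) x z
  E-rot i js x z u sx sz = ≈-trans (E-∷ʳ js i (rf i x) (rf i z))
      (≈-trans (+-≈ (E-local js {rf i x} {x} {rf i z} {z} (λ k m → rf-off x (ne m)) (λ k m → rf-off z (ne m)))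
          (*-≈ (+-≈ (≈-trans (rf-at i x) (+-≈ (Nl-N i js x u sx) ≈-refl)) (neg-≈ (Nl-local i js {rf i x} {x} (λ k m → rf-off x (ne m))))) (≈-trans (rf-at i z) (+-≈ (Nl-N i js z u sz) ≈-refl))))
        (rsolve 5 (λ E X x Z z → E :+ ((X :- x) :- X) :* (Z :- z) := x :* (z :- Z) :+ E) ≈-refl (E js x z) (Nl i js x) (x i) (Nl i js z) (z i)))
    where
    ne : ∀ {k} → k ∈ js → k ≢ i
    ne m refl = ∉-tail u m

  E-tail : ∀ i js x z → x i ≈ 0# → E (i ∷ js) x z ≈ E js x z
  E-tail i js x z p = ≈-trans (+-≈ (≈-trans (*-≈ p ≈-refl) (*-zeroˡ _)) ≈-refl) (+-idˡ _)

  α-∉ : ∀ {i} {js : List (Fin n)} → i ∉ js → ∀ k → k ∈ js → α i k ≈ 0#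
  α-∉ {i} {js} nin k m = α-diff {i} {k} (λ eq → nin (subst (_∈ js) eq m))

  E-initial : ∀ i js x → i ∉ js → E (i ∷ js) x (α i) ≈ x i
  E-initial i js x nin = ≈-trans (+-≈ (*-≈ ≈-refl (+-≈ (α-same i) (neg-≈ Nl0))) (E-0ʳ js x (α i) (α-∉ nin)))
      (≈-trans (+-idʳ _) (≈-trans (*-≈ ≈-refl (≈-trans (+-≈ ≈-refl neg-0) (+-idʳ 1#))) (*-idʳ _)))
    where
    Nl0 : Nl i js (α i) ≈ 0#
    Nl0 = ≈-trans (Nl-local i js {α i} {0# • α i} (λ k m → ≈-trans (α-∉ nin k m) (≈-sym (*-zeroˡ _)))) (≈-trans (Nl-• i js 0# (α i)) (*-zeroˡ _))

  proportional : ∀ ρ τ → ref ρ ≡ ref τ → ∃ λ a → vec ρ ≋ a • vec τ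
  proportional ρ τ eq with posRep ρ | posRep τ | signs ρ | signs τ
    where
    signs : ∀ ρ → ∃ λ a → vec ρ ≋ a • vec (proj₁ (posRep ρ)) × ∃ λ b → vec (proj₁ (posRep ρ)) ≋ b • vec ρ
    signs ρ with signR ρ
    ... | inj₁ _ = 1# , (λ k → ≈-sym (*-idˡ _)) , 1# , (λ k → ≈-sym (*-idˡ _))
    ... | inj₂ _ = - 1# , (λ k → ≈-trans (≈-sym (⊟⊟ (vec ρ) k)) (≈-trans (neg-≈ (≈-sym (vec-flip ρ k))) (⊟-• (vec (flip ρ)) k))) , - 1# , ≋-trans (vec-flip ρ) (⊟-• (vec ρ))
  ... | ρ′ , p , r | τ′ , q , r′ | a , va , _ | _ , _ , b , vb with scale ρ′ τ′ (trans r (trans eq (sym r′))) p q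
  ... | c , _ , vc = a * (c * b) , λ k → ≈-trans (va k) (≈-trans (*-≈ ≈-refl (≈-trans (vc k) (*-≈ ≈-refl (vb k))))
          (rsolve 4 (λ a c b x → a :* (c :* (b :* x)) := (a :* (c :* b)) :* x) ≈-refl a c b (vec τ k)))

  -- Here ρ precedes τ in a factorisation and the later root is the first argument of the form, as
  -- in the vanishing condition for exceptional sequences.
  Orth : List (Fin n) → Rt → Rt → Set
  Orth js ρ τ = E js (vec τ) (vec ρ) ≈ 0#

  SuppR : List (Fin n) → Rt → Set
  SuppR js ρ = Supp js (vec ρ)

  SuppR-rot : ∀ {i js} ρ → SuppR (i ∷ js) ρ → SuppR (js ∷ʳ i) (s i ▷ ρ)
  SuppR-rot {i} ρ p = Supp-cong (≋-sym (≋-trans (vec-▷ (s i) ρ) (act-s i (vec ρ)))) (Supp-rot p)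

  vec-s▷ : ∀ i ρ → vec (s i ▷ ρ) ≋ rf i (vec ρ)
  vec-s▷ i ρ = ≋-trans (vec-▷ (s i) ρ) (act-s i (vec ρ))

  E-rotR : ∀ i js ρ τ → Unique (i ∷ js) → SuppR (i ∷ js) ρ → SuppR (i ∷ js) τ → E (js ∷ʳ i) (vec (s i ▷ ρ)) (vec (s i ▷ τ)) ≈ E (i ∷ js) (vec ρ) (vec τ)
  E-rotR i js ρ τ u sr st = ≈-trans (E-cong (js ∷ʳ i) (vec-s▷ i ρ) (vec-s▷ i τ)) (E-rot i js (vec ρ) (vec τ) u sr st)

  Supp-tail : ∀ {i js} {v : V} → Supp (i ∷ js) v → v i ≈ 0# → Supp js v
  Supp-tail {i} {js} p q k nin with k Fin.≟ i
  ... | yes refl = q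
  ... | no ne = p k (λ { (here eq) → ne eq ; (there m) → nin m })

  coord-initial : ∀ {i js} ρ τ → i ∉ js → ref ρ ≡ s i → Orth (i ∷ js) ρ τ → vec τ i ≈ 0#
  coord-initial {i} {js} ρ τ nin eq o = ≈-trans (≈-sym (E-initial i js (vec τ) nin)) (≈-trans (E-cong (i ∷ js) {vec τ} ≋-refl (≋-trans (≋-sym (vec-σ i)) va))
                   (≈-trans (E-•ʳ (i ∷ js) (vec τ) a (vec ρ)) (≈-trans (*-≈ ≈-refl o) (*-zeroʳ _))))
    where
    pr = proportional (σ i) ρ (trans (ref-σ i) (sym eq))
    a = proj₁ pr
    va = proj₂ pr

  orth-initial : ∀ {i js} ρ τ → i ∉ js → ref ρ ≡ s i → vec τ i ≈ 0# → Orth (i ∷ js) ρ τ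
  orth-initial {i} {js} ρ τ nin eq z = ≈-trans (E-cong (i ∷ js) {vec τ} ≋-refl (≋-trans va (λ k → *-≈ ≈-refl (vec-σ i k))))
                   (≈-trans (E-•ʳ (i ∷ js) (vec τ) a (α i)) (≈-trans (*-≈ ≈-refl (≈-trans (E-initial i js (vec τ) nin) z)) (*-zeroʳ _)))
    where
    pr = proportional ρ (σ i) (trans eq (sym (ref-σ i)))
    a = proj₁ pr
    va = proj₂ pr

  private
    tailU : ∀ {i} {js : List (Fin n)} → Unique (i ∷ js) → Unique js
    tailU (_ ∷ u) = u

    length-rot : ∀ (i : Fin n) js {N} → length (i ∷ js) ≡ N → length (js ∷ʳ i) ≡ N
    length-rot i js p = trans (Listₚ.length-++-comm js (i ∷ [])) p

    conj-back : ∀ i js {g} → Π (js ∷ʳ i) ≡ g → Π (i ∷ js) ≡ s i · g · inv (s i)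
    conj-back i js {g} p = trans (gsolve 2 (λ a b → b ⊜ (a ⁻ ⊙ (a ⊙ b ⊙ a ⁻) ⊙ a)) refl (s i) (Π (i ∷ js)))
      (trans (cong (λ x → inv (s i) · x · s i) (trans (sym (Π-rot i js)) p)) (cong₂ (λ a b → a · g · b) (inv-s i) (sym (inv-s i))))

  -- Rotation turns the first reflection into the initial letter i. Orthogonality to it says that
  -- the other roots have coordinate i equal to zero, so they live on the word without i, where the
  -- induction continues.
  orth⇒prefix : ∀ N js xs → length js ≡ N → Unique js → All (SuppR js) xs → AllPairs (Orth js) xs →
         ∃ λ zs → Π js ≡ prodR xs · prodR zs × length xs ℕ.+ length zs ≡ length js
  orth⇒prefix N js [] len u sp ap = map σ js , trans (words js) (sym (idˡ _)) , Listₚ.length-map σ js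
    where
    words : ∀ js → Π js ≡ prodR (map σ js)
    words [] = refl
    words (i ∷ js) = cong₂ _·_ (sym (ref-σ i)) (words js)
  orth⇒prefix N js (x ∷ xs) len u (sx ∷ sxs) (o ∷ ap) = hit N js x xs (hits js x u sx) refl len u sx sxs o ap
    where
    hit : ∀ N js x xs {t} → Hits js t → ref x ≡ t → length js ≡ N → Unique js → SuppR js x → All (SuppR js) xs → All (Orth js x) xs → AllPairs (Orth js) xs →
          ∃ λ zs → Π js ≡ prodR (x ∷ xs) · prodR zs × length (x ∷ xs) ℕ.+ length zs ≡ length js
    hit zero (i ∷ js) x xs h te () u sx sxs o ap
    hit (suc N) (i ∷ js) x xs (here eq₀) te len u sx sxs o ap = proj₁ ih , trans (cong₂ _·_ (sym eq) (proj₁ (proj₂ ih))) (sym (assoc _ _ _)) , cong suc (proj₂ (proj₂ ih))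
      where
      eq : ref x ≡ s i
      eq = trans te eq₀
      coords : All (λ τ → vec τ i ≈ 0#) xs
      coords = All.map (λ {τ} → coord-initial x τ (∉-tail u) eq) o
      sxs′ : All (SuppR js) xs
      sxs′ = All.zipWith (λ (p , q) → Supp-tail p q) (sxs , coords)
      down : ∀ ys → All (λ τ → vec τ i ≈ 0#) ys → AllPairs (Orth (i ∷ js)) ys → AllPairs (Orth js) ys
      down [] _ [] = []
      down (y ∷ ys) (c ∷ cs) (p ∷ ps) = All.zipWith (λ {τ} (c , p) → ≈-trans (≈-sym (E-tail i js (vec τ) (vec y) c)) p) (cs , p) ∷ down ys cs ps
      ih = orth⇒prefix N js xs (ℕₚ.suc-injective len) (tailU u) sxs′ (down xs coords ap)
    hit N (i ∷ js) x xs (step ne h) te len u sx sxs o ap = map (s i ▷_) zs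
        , trans (conj-back i js (proj₁ (proj₂ ih))) (trans (gsolve 3 (λ a p q → (a ⊙ (p ⊙ q) ⊙ a ⁻) ⊜ (a ⊙ p ⊙ a ⁻ ⊙ (a ⊙ q ⊙ a ⁻))) refl (s i) (prodR (map (s i ▷_) (x ∷ xs))) (prodR zs))
            (cong₂ _·_ (trans (cong (λ g → s i · g · inv (s i)) (prodR-▷ (s i) (x ∷ xs)))
               (trans (cong₂ (λ a b → s i · (a · prodR (x ∷ xs) · b) · inv (s i)) (sym (inv-s i)) refl) (trans (cong (λ b → s i · (inv (s i) · prodR (x ∷ xs) · b) · inv (s i)) (inv-s i))
                 (gsolve 2 (λ a p → (a ⊙ (a ⁻ ⊙ p ⊙ a) ⊙ a ⁻) ⊜ p) refl (s i) (prodR (x ∷ xs)))))) (sym (prodR-▷ (s i) zs))))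
        , trans (cong₂ ℕ._+_ (sym (Listₚ.length-map (s i ▷_) (x ∷ xs))) (Listₚ.length-map (s i ▷_) zs)) (trans (proj₂ (proj₂ ih)) (Listₚ.length-++-comm js (i ∷ [])))
      where
      rotS : ∀ ys → All (SuppR (i ∷ js)) ys → All (SuppR (js ∷ʳ i)) (map (s i ▷_) ys)
      rotS ys p = Allₚ.map⁺ (All.map (λ {ρ} → SuppR-rot ρ) p)
      rotO : ∀ y ys → SuppR (i ∷ js) y → All (SuppR (i ∷ js)) ys → All (Orth (i ∷ js) y) ys → All (Orth (js ∷ʳ i) (s i ▷ y)) (map (s i ▷_) ys)
      rotO y ys sy p q = Allₚ.map⁺ (All.zipWith (λ {τ} (p , q) → ≈-trans (E-rotR i js τ y u p sy) q) (p , q))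
      rotP : ∀ ys → All (SuppR (i ∷ js)) ys → AllPairs (Orth (i ∷ js)) ys → AllPairs (Orth (js ∷ʳ i)) (map (s i ▷_) ys)
      rotP [] _ [] = []
      rotP (y ∷ ys) (p ∷ ps) (q ∷ qs) = rotO y ys p ps q ∷ rotP ys ps qs
      ih = hit N (js ∷ʳ i) (s i ▷ x) (map (s i ▷_) xs) h (trans (ref-▷ (s i) x) (cong (λ t → s i · t · inv (s i)) te)) (length-rot i js len) (Unique-rot u)
             (SuppR-rot x sx) (rotS xs sxs) (rotO x xs sx sxs o) (rotP xs sxs ap)
      zs = proj₁ ih

  reduced-supp : ∀ js xs → Unique js → Π js ≡ prodR xs → length xs ≡ length js → All (SuppR js) xs
  reduced-supp js xs u eq len = supp-fact (Π js) js xs (sym (prodG-s js)) eq (trans len (sym (lT-Π js u)))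

  -- The same rotation read backwards: after the initial factor is cancelled, `reduced-supp` shows
  -- that the remaining roots avoid coordinate i.
  reduced⇒orth : ∀ N js xs → length js ≡ N → Unique js → Π js ≡ prodR xs → length xs ≡ length js → AllPairs (Orth js) xs
  reduced⇒orth N js [] l u eq len = []
  reduced⇒orth N js (x ∷ xs) l u eq len = hit N js x xs (hits js x u (All.head (reduced-supp js (x ∷ xs) u eq len))) refl l u eq len
    where
    hit : ∀ N js x xs {t} → Hits js t → ref x ≡ t → length js ≡ N → Unique js → Π js ≡ prodR (x ∷ xs) → length (x ∷ xs) ≡ length js → AllPairs (Orth js) (x ∷ xs)
    hit zero (i ∷ js) x xs h te () u eq len
    hit (suc N) (i ∷ js) x xs (here q₀) te l u eq len = All.map (λ {τ} sp → orth-initial x τ (∉-tail u) q (sp i (∉-tail u))) sxs ∷ up xs sxs ih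
      where
      q : ref x ≡ s i
      q = trans te q₀
      eq′ : Π js ≡ prodR xs
      eq′ = trans (sym (s-cancelˡ (Π js) i)) (trans (cong (s i ·_) (trans eq (cong (_· prodR xs) q))) (s-cancelˡ (prodR xs) i))
      sxs = reduced-supp js xs (tailU u) eq′ (ℕₚ.suc-injective len)
      ih = reduced⇒orth N js xs (ℕₚ.suc-injective l) (tailU u) eq′ (ℕₚ.suc-injective len)
      up : ∀ ys → All (SuppR js) ys → AllPairs (Orth js) ys → AllPairs (Orth (i ∷ js)) ys
      up [] _ [] = []
      up (y ∷ ys) (p ∷ ps) (q ∷ qs) = All.zipWith (λ {τ} (p , q) → ≈-trans (E-tail i js (vec τ) (vec y) (p i (∉-tail u))) q) (ps , q) ∷ up ys ps qs
    hit N (i ∷ js) x xs (step ne h) te l u eq len = back (x ∷ xs) (reduced-supp (i ∷ js) (x ∷ xs) u eq len)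
        (hit N (js ∷ʳ i) (s i ▷ x) (map (s i ▷_) xs) h (trans (ref-▷ (s i) x) (cong (λ t → s i · t · inv (s i)) te)) (length-rot i js l) (Unique-rot u)
          (trans (Π-rot i js) (trans (cong (λ g → s i · g · inv (s i)) eq) (sym (prodR-▷ (s i) (x ∷ xs)))))
          (trans (cong suc (Listₚ.length-map (s i ▷_) xs)) (trans len (sym (Listₚ.length-++-comm js (i ∷ []))))))
      where
      back : ∀ ys → All (SuppR (i ∷ js)) ys → AllPairs (Orth (js ∷ʳ i)) (map (s i ▷_) ys) → AllPairs (Orth (i ∷ js)) ys
      back [] _ [] = []
      back (y ∷ ys) (p ∷ ps) (q ∷ qs) = All.zipWith (λ {τ} (p′ , q) → ≈-trans (≈-sym (E-rotR i js τ y u p′ p)) q) (ps , Allₚ.map⁻ q) ∷ back ys ps qs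

  infix 4 _≼_
  _≼_ : G → G → Set
  u ≼ w = lT (w · inv u) ℕ.+ lT u ≡ lT w

  lT-comm : ∀ u w → lT (inv u · w) ≡ lT (w · inv u)
  lT-comm u w = trans (sym (lT-conj u (inv u · w))) (cong lT (gsolve 2 (λ u w → (u ⊙ (u ⁻ ⊙ w) ⊙ u ⁻) ⊜ (w ⊙ u ⁻)) refl u w))

  -- A reduced factorisation of the Coxeter element through u; orthogonality to the roots of zs will
  -- cut out the reflections below u.
  record Fac (js : List (Fin n)) (u : G) : Set where
    field
      xs zs : List Rt
      eq-u  : u ≡ prodR xs
      eq-c  : Π js ≡ prodR xs · prodR zs
      len   : length xs ℕ.+ length zs ≡ length js

  fac : ∀ {js u} → Unique js → u ≼ Π js → Fac js u
  fac {js} {u} uq le = record { xs = fact u ; zs = fact (inv u · Π js) ; eq-u = prod-fact u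
    ; eq-c = trans (gsolve 2 (λ u w → w ⊜ (u ⊙ (u ⁻ ⊙ w))) refl u (Π js)) (cong₂ _·_ (prod-fact u) (prod-fact (inv u · Π js)))
    ; len = trans (cong₂ ℕ._+_ (length-fact u) (trans (length-fact (inv u · Π js)) (lT-comm u (Π js))))
              (trans (ℕₚ.+-comm (lT u) _) (trans le (lT-Π js uq))) }

  -- Subadditivity of `lT` forces both upper bounds to be attained.
  ≼-intro : ∀ {u v w} a b → w ≡ u · v → lT u ≤ a → lT v ≤ b → a ℕ.+ b ≤ lT w → u ≼ w × lT u ≡ a × lT v ≡ b
  ≼-intro {u} {v} {w} a b refl pa pb le = trans (cong (ℕ._+ lT u) (trans (sym (lT-comm u (u · v))) (cong lT v≡))) (trans (ℕₚ.+-comm (lT v) (lT u)) total) , ea , eb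
    where
    v≡ : inv u · (u · v) ≡ v
    v≡ = gsolve 2 (λ u v → (u ⁻ ⊙ (u ⊙ v)) ⊜ v) refl u v
    sub : lT (u · v) ≤ lT u ℕ.+ lT v
    sub = lT-· u v
    total : lT u ℕ.+ lT v ≡ lT (u · v)
    total = ℕₚ.≤-antisym (ℕₚ.≤-trans (ℕₚ.+-mono-≤ pa pb) le) sub
    ea : lT u ≡ a
    ea = ℕₚ.≤-antisym pa (ℕₚ.+-cancelʳ-≤ b a (lT u) (ℕₚ.≤-trans le (ℕₚ.≤-trans sub (ℕₚ.+-monoʳ-≤ (lT u) pb))))
    eb : lT v ≡ b
    eb = ℕₚ.≤-antisym pb (ℕₚ.+-cancelˡ-≤ a b (lT v) (ℕₚ.≤-trans le (ℕₚ.≤-trans sub (ℕₚ.+-monoˡ-≤ (lT v) pa))))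

  module _ {js u} (uq : Unique js) (F : Fac js u) where
    open Fac F

    unfac : u ≼ Π js × lT u ≡ length xs × lT (prodR zs) ≡ length zs
    unfac = ≼-intro (length xs) (length zs) (trans eq-c (cong (_· prodR zs) (sym eq-u))) (lT-≤ u xs eq-u) (lT-min zs) (ℕₚ.≤-reflexive (trans len (sym (lT-Π js uq))))

    Fac-orth : AllPairs (Orth js) (xs ++ zs)
    Fac-orth = reduced⇒orth _ js (xs ++ zs) refl uq (trans eq-c (sym (prodR-++ xs zs))) (trans (Listₚ.length-++ xs) len)

    Fac-supp : All (SuppR js) (xs ++ zs)
    Fac-supp = reduced-supp js (xs ++ zs) uq (trans eq-c (sym (prodR-++ xs zs))) (trans (Listₚ.length-++ xs) len)

  AllPairs-++ʳ : ∀ {A : Set} {R : A → A → Set} xs {ys} → AllPairs R (xs ++ ys) → AllPairs R ys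
  AllPairs-++ʳ [] p = p
  AllPairs-++ʳ (x ∷ xs) (_ ∷ p) = AllPairs-++ʳ xs p

  AllPairs-++ˡ : ∀ {A : Set} {R : A → A → Set} xs {ys} → AllPairs R (xs ++ ys) → AllPairs R xs
  AllPairs-++ˡ [] p = []
  AllPairs-++ˡ (x ∷ xs) (q ∷ p) = Allₚ.++⁻ˡ xs q ∷ AllPairs-++ˡ xs p

  module _ {js u} (uq : Unique js) (F : Fac js u) where
    open Fac F

    -- ws ++ zs satisfies the criterion of orth⇒prefix.
    orth⇒≼ : ∀ ws → All (SuppR js) ws → AllPairs (Orth js) ws → All (λ w → All (Orth js w) zs) ws → prodR ws ≼ u × lT (prodR ws) ≡ length ws
    orth⇒≼ ws sw aw o with orth⇒prefix _ js (ws ++ zs) refl uq (Allₚ.++⁺ sw (Allₚ.++⁻ʳ xs (Fac-supp uq F)))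
                              (AllPairsₚ.++⁺ aw (AllPairs-++ʳ xs (Fac-orth uq F)) o)
    ... | vs , eq , l = proj₁ res , proj₁ (proj₂ res)
      where
      -- The remaining factors vs are moved to the left across zs, so that zs can be cancelled on
      -- the right.
      v = prodR zs · prodR vs · inv (prodR zs)
      u≡ : u ≡ prodR ws · v
      u≡ = trans eq-u (trans (gsolve 2 (λ a b → a ⊜ (a ⊙ b ⊙ b ⁻)) refl (prodR xs) (prodR zs)) (trans (cong (_· inv (prodR zs)) (trans (sym eq-c) (trans eq (cong (_· prodR vs) (prodR-++ ws zs)))))
             (gsolve 3 (λ w z v → (w ⊙ z ⊙ v ⊙ z ⁻) ⊜ (w ⊙ (z ⊙ v ⊙ z ⁻))) refl (prodR ws) (prodR zs) (prodR vs))))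
      count : length ws ℕ.+ length vs ≡ length xs
      count = ℕₚ.+-cancelʳ-≡ (length zs) _ _ (trans (trans (ℕₚ.+-assoc (length ws) _ _) (trans (cong (length ws ℕ.+_) (ℕₚ.+-comm (length vs) (length zs))) (sym (ℕₚ.+-assoc (length ws) _ _))))
                (trans (cong (ℕ._+ length vs) (sym (Listₚ.length-++ ws))) (trans l (sym len))))
      res = ≼-intro (length ws) (length vs) u≡ (lT-min ws) (ℕₚ.≤-trans (ℕₚ.≤-reflexive (lT-conj (prodR zs) (prodR vs))) (lT-min vs))
              (ℕₚ.≤-reflexive (trans count (sym (proj₁ (proj₂ (unfac uq F))))))

    orth⇒below : ∀ ρ → SuppR js ρ → All (Orth js ρ) zs → ref ρ ≼ u
    orth⇒below ρ sp o = subst (_≼ u) (idʳ (ref ρ)) (proj₁ (orth⇒≼ (ρ ∷ []) (sp ∷ []) ([] ∷ []) (o ∷ [])))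

    -- The factors of u are replaced by ones starting with ρ while zs stays the same, so that
    -- orthogonality to this very zs can be read off in `below⇒orth`.
    lT-below : ∀ ρ → ref ρ ≼ u → lT (ref ρ) ≡ 1 → Fac js u
    lT-below ρ le l1 = record { xs = ρ ∷ fact (inv (ref ρ) · u) ; zs = zs
      ; eq-u = eqn ; eq-c = trans eq-c (cong (_· prodR zs) (trans (sym eq-u) eqn))
      ; len = trans (cong (ℕ._+ length zs) cnt) len }
      where
      eqn : u ≡ prodR (ρ ∷ fact (inv (ref ρ) · u))
      eqn = trans (gsolve 2 (λ r u → u ⊜ (r ⊙ (r ⁻ ⊙ u))) refl (ref ρ) u) (cong (ref ρ ·_) (prod-fact (inv (ref ρ) · u)))
      cnt : suc (length (fact (inv (ref ρ) · u))) ≡ length xs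
      cnt = trans (cong suc (trans (length-fact _) (lT-comm (ref ρ) u))) (trans (ℕₚ.+-comm 1 _) (trans (cong (lT (u · inv (ref ρ)) ℕ.+_) (sym l1)) (trans le (proj₁ (proj₂ (unfac uq F))))))

  lT-refl : ∀ ρ → lT (ref ρ) ≡ 1
  lT-refl ρ@(h , i) = trans (lT-conj h (s i)) (trans (cong lT (sym (idʳ (s i)))) (lT-Π (i ∷ []) ([] ∷ [])))

  below⇒orth : ∀ {js u} (uq : Unique js) (F : Fac js u) ρ → ref ρ ≼ u → SuppR js ρ × All (Orth js ρ) (Fac.zs F)
  below⇒orth {u = u} uq F ρ le = All.head (Fac-supp uq F′) , Allₚ.++⁻ʳ (fact (inv (ref ρ) · u)) (AllPairs-head (Fac-orth uq F′))
    where
    F′ = lT-below uq F ρ le (lT-refl ρ)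
    AllPairs-head : ∀ {A : Set} {R : A → A → Set} {x xs} → AllPairs R (x ∷ xs) → All (R x) xs
    AllPairs-head (p ∷ _) = p

-- The absolute order below a Coxeter element

module Order (Y : System) where
  open Euler Y public

  _≼?_ : ∀ u w → Dec (u ≼ w)
  u ≼? w = (lT (w · inv u) ℕ.+ lT u) ℕₚ.≟ lT w

  ≼-refl : ∀ {u} → u ≼ u
  ≼-refl {u} = trans (cong (ℕ._+ lT u) (trans (cong lT (invʳ u)) lT-e)) refl

  e≼ : ∀ u → e ≼ u
  e≼ u = trans (cong₂ ℕ._+_ (cong lT (trans (cong (u ·_) inv-e) (idʳ u))) lT-e) (ℕₚ.+-identityʳ _)

  ≼-≤ : ∀ {u w} → u ≼ w → lT u ≤ lT w
  ≼-≤ {u} {w} p = subst (lT u ≤_) p (ℕₚ.m≤n+m _ _)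

  ≼-trans : ∀ {u v w} → u ≼ v → v ≼ w → u ≼ w
  ≼-trans {u} {v} {w} p q = ℕₚ.≤-antisym (ℕₚ.≤-trans (ℕₚ.+-monoˡ-≤ (lT u) sub) (ℕₚ.≤-reflexive total)) low
    where
    sub : lT (w · inv u) ≤ lT (w · inv v) ℕ.+ lT (v · inv u)
    sub = subst (_≤ lT (w · inv v) ℕ.+ lT (v · inv u)) (cong lT (gsolve 3 (λ u v w → (w ⊙ v ⁻ ⊙ (v ⊙ u ⁻)) ⊜ (w ⊙ u ⁻)) refl u v w)) (lT-· (w · inv v) (v · inv u))
    total : (lT (w · inv v) ℕ.+ lT (v · inv u)) ℕ.+ lT u ≡ lT w
    total = trans (ℕₚ.+-assoc (lT (w · inv v)) _ _) (trans (cong (lT (w · inv v) ℕ.+_) p) q)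
    low : lT w ≤ lT (w · inv u) ℕ.+ lT u
    low = subst (_≤ lT (w · inv u) ℕ.+ lT u) (cong lT (gsolve 2 (λ u w → (w ⊙ u ⁻ ⊙ u) ⊜ w) refl u w)) (lT-· (w · inv u) u)

  ≼-conj : ∀ g {u w} → u ≼ w → (g · u · inv g) ≼ (g · w · inv g)
  ≼-conj g {u} {w} p = trans (cong₂ ℕ._+_ (trans (cong lT (gsolve 3 (λ g u w → (g ⊙ w ⊙ g ⁻ ⊙ (g ⊙ u ⊙ g ⁻) ⁻) ⊜ (g ⊙ (w ⊙ u ⁻) ⊙ g ⁻)) refl g u w)) (lT-conj g (w · inv u))) (lT-conj g u))
    (trans p (sym (lT-conj g w)))

  ≼-unconj : ∀ g {u w} → (g · u · inv g) ≼ (g · w · inv g) → u ≼ w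
  ≼-unconj g {u} {w} p = subst₂ _≼_ (un u) (un w) (≼-conj (inv g) p)
    where un : ∀ u → inv g · (g · u · inv g) · inv (inv g) ≡ u
          un u = gsolve 2 (λ g u → (g ⁻ ⊙ (g ⊙ u ⊙ g ⁻) ⊙ (g ⁻) ⁻) ⊜ u) refl g u

  ≼-same : ∀ {u w} → u ≼ w → lT u ≡ lT w → u ≡ w
  ≼-same {u} {w} p q = sym (trans (gsolve 2 (λ u w → w ⊜ (w ⊙ u ⁻ ⊙ u)) refl u w) (trans (cong (_· u) (lT≡0 (w · inv u) z)) (idˡ u)))
    where z : lT (w · inv u) ≡ 0
          z = ℕₚ.+-cancelʳ-≡ (lT u) _ 0 (trans p (sym q))

  ≼-e : ∀ {u} → u ≼ e → u ≡ e
  ≼-e {u} p = lT≡0 u (ℕₚ.n≤0⇒n≡0 (subst (lT u ≤_) lT-e (≼-≤ p)))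

  lT-s : ∀ i → lT (s i) ≡ 1
  lT-s i = trans (cong lT (sym (ref-σ i))) (lT-refl (σ i))

  s-lT : ∀ {i u} → s i ≼ u → suc (lT (s i · u)) ≡ lT u
  s-lT {i} {u} p = trans (ℕₚ.+-comm 1 _) (trans (cong₂ ℕ._+_ (trans (cong (λ x → lT (x · u)) (sym (inv-s i))) (lT-comm (s i) u)) (sym (lT-s i))) p)

  s·≼ : ∀ {i u} → s i ≼ u → (s i · u) ≼ u
  s·≼ {i} {u} p = trans (cong (ℕ._+ lT (s i · u)) (trans (cong lT eq) (lT-s i))) (s-lT p)
    where eq : u · inv (s i · u) ≡ s i
          eq = trans (gsolve 2 (λ u a → (u ⊙ (a ⊙ u) ⁻) ⊜ (a ⁻)) refl u (s i)) (inv-s i)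

  ≼-·ʳ : ∀ {u v} → lT (u · v) ≡ lT u ℕ.+ lT v → u ≼ u · v
  ≼-·ʳ {u} {v} p = trans (cong (ℕ._+ lT u) (trans (cong lT (gsolve 2 (λ u v → (u ⊙ v ⊙ u ⁻) ⊜ (u ⊙ v ⊙ u ⁻)) refl u v)) (lT-conj u v))) (trans (ℕₚ.+-comm (lT v) (lT u)) (sym p))

  initial-down : ∀ {i js u} → Unique (i ∷ js) → s i ≼ u → u ≼ Π (i ∷ js) → (s i · u) ≼ Π js
  initial-down {i} {js} {u} (ne ∷ uq) p q = ℕₚ.suc-injective (trans (sym (ℕₚ.+-suc (lT (Π js · inv (s i · u))) _)) (trans (cong₂ ℕ._+_ (trans (sym (lT-conj (s i) _)) (cong lT eq)) (s-lT p))
      (trans q (trans (lT-Π (i ∷ js) (ne ∷ uq)) (cong suc (sym (lT-Π js uq)))))))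
    where
    eq : s i · (Π js · inv (s i · u)) · inv (s i) ≡ Π (i ∷ js) · inv u
    eq = gsolve 3 (λ a c u → (a ⊙ (c ⊙ (a ⊙ u) ⁻) ⊙ a ⁻) ⊜ (a ⊙ c ⊙ u ⁻ ⊙ (a ⁻ ⊙ a ⁻))) refl (s i) (Π js) u
       ∙ trans (cong (λ x → Π (i ∷ js) · inv u · x) (trans (cong₂ _·_ (inv-s i) (inv-s i)) (ss i))) (idʳ _)
      where _∙_ = trans

  initial-up : ∀ {i js v} → Unique (i ∷ js) → v ≼ Π js → (s i · v) ≼ Π (i ∷ js) × lT (s i · v) ≡ suc (lT v)
  initial-up {i} {js} {v} (ne ∷ uq) p = proj₁ res , proj₁ (proj₂ res)
    where
    r = inv v · Π js
    lr : lT r ≡ lT (Π js · inv v)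
    lr = lT-comm v (Π js)
    res = ≼-intro (suc (lT v)) (lT r) (gsolve 3 (λ a v c → (a ⊙ c) ⊜ (a ⊙ v ⊙ (v ⁻ ⊙ c))) refl (s i) v (Π js))
            (ℕₚ.≤-trans (lT-· (s i) v) (ℕₚ.≤-reflexive (cong (ℕ._+ lT v) (lT-s i)))) ℕₚ.≤-refl
            (ℕₚ.≤-reflexive (trans (cong suc (trans (ℕₚ.+-comm (lT v) (lT r)) (trans (cong (ℕ._+ lT v) lr) (trans p (lT-Π js uq))))) (sym (lT-Π (i ∷ js) (ne ∷ uq)))))

  s≼s· : ∀ {i v} → lT (s i · v) ≡ suc (lT v) → s i ≼ s i · v
  s≼s· {i} {v} p = ≼-·ʳ (trans p (cong (ℕ._+ lT v) (sym (lT-s i))))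

  s·-mono : ∀ {i u v} → lT (s i · u) ≡ suc (lT u) → lT (s i · v) ≡ suc (lT v) → u ≼ v → (s i · u) ≼ (s i · v)
  s·-mono {i} {u} {v} p q r = trans (cong₂ ℕ._+_ (trans (cong lT (gsolve 3 (λ a u v → (a ⊙ v ⊙ (a ⊙ u) ⁻) ⊜ (a ⊙ (v ⊙ u ⁻) ⊙ a ⁻)) refl (s i) u v)) (lT-conj (s i) (v · inv u))) p)
    (trans (ℕₚ.+-suc _ _) (trans (cong suc r) (sym q)))

  rot-≼ : ∀ js {i u} → u ≼ Π (i ∷ js) → (s i · u · inv (s i)) ≼ Π (js ∷ʳ i)
  rot-≼ js {i} p = subst (_ ≼_) (sym (Π-rot i js)) (≼-conj (s i) p)

  s-conj-s : ∀ i → s i · s i · inv (s i) ≡ s i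
  s-conj-s i = gsolve 1 (λ a → (a ⊙ a ⊙ a ⁻) ⊜ a) refl (s i)

  cc : ∀ i t → s i · (s i · t · inv (s i)) · inv (s i) ≡ t
  cc i t = trans (gsolve 2 (λ a t → (a ⊙ (a ⊙ t ⊙ a ⁻) ⊙ a ⁻) ⊜ ((a ⊙ a) ⊙ t ⊙ (a ⊙ a) ⁻)) refl (s i) t)
    (trans (cong (λ x → x · t · inv x) (ss i)) (gsolve 1 (λ t → (ε ⊙ t ⊙ ε ⁻) ⊜ t) refl t))

  s≼conj : ∀ {i u} → s i ≼ u → s i ≼ (s i · u · inv (s i))
  s≼conj {i} {u} p = subst (_≼ (s i · u · inv (s i))) (s-conj-s i) (≼-conj (s i) p)

  s≼unconj : ∀ {i u} → s i ≼ (s i · u · inv (s i)) → s i ≼ u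
  s≼unconj {i} {u} p = subst (s i ≼_) (cc i u) (s≼conj p)

  -- Conjugating the factors before it, as Hurwitz moves do, brings any factor to the front.
  factor-≼ : ∀ xs → length xs ≡ lT (prodR xs) → All (λ x → ref x ≼ prodR xs) xs
  factor-≼ xs len = All.tabulate λ {x} m → go x (∈-∃++ m)
    where
    go : ∀ x → (∃ λ A → ∃ λ B → xs ≡ A ++ x ∷ B) → ref x ≼ prodR xs
    go x (A , B , refl) = proj₁ (≼-intro 1 (length A ℕ.+ length B) eq (lT-ref x)
        (ℕₚ.≤-trans (lT-min (map (ref x ▷_) A ++ B)) (ℕₚ.≤-reflexive (trans (Listₚ.length-++ (map (ref x ▷_) A)) (cong (ℕ._+ length B) (Listₚ.length-map (ref x ▷_) A)))))
        (ℕₚ.≤-reflexive (trans (sym (ℕₚ.+-suc (length A) (length B))) (trans (sym (Listₚ.length-++ A)) len))))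
      where
      eq : prodR (A ++ x ∷ B) ≡ ref x · prodR (map (ref x ▷_) A ++ B)
      eq = trans (prodR-++ A (x ∷ B)) (trans (trans (cong (λ r → prodR A · (r · prodR B)) (sym (inv-ref x))) (trans (cong (_· (inv (ref x) · prodR B)) (sym (trans (cong (_· prodR A) (ref-ref x)) (idˡ _))))
              (gsolve 3 (λ x a b → (x ⊙ x ⊙ a ⊙ (x ⁻ ⊙ b)) ⊜ (x ⊙ (x ⊙ a ⊙ x ⁻ ⊙ b))) refl (ref x) (prodR A) (prodR B))))
            (cong (ref x ·_) (sym (trans (prodR-++ (map (ref x ▷_) A) B) (cong (_· prodR B) (prodR-▷ (ref x) A))))))

  Below : G → G → Set
  Below u t = T t × t ≼ u

  below-supp : ∀ {js u} → Unique js → u ≼ Π js → ∀ ρ → ref ρ ≼ u → SuppR js ρ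
  below-supp uq le ρ p = proj₁ (below⇒orth uq (fac uq le) ρ p)

  Supp-⊞ : ∀ {js u v} → Supp js u → Supp js v → Supp js (u ⊞ v)
  Supp-⊞ p q k nin = ≈-trans (+-≈ (p k nin) (q k nin)) (+-idʳ 0#)

  Supp-• : ∀ {js} r {v} → Supp js v → Supp js (r • v)
  Supp-• r p k nin = ≈-trans (*-≈ ≈-refl (p k nin)) (*-zeroʳ r)

  -- Being orthogonal to the roots of zs is a linear condition, and reflecting τ in ρ adds a
  -- multiple of ρ.
  below-conj : ∀ {js u} → Unique js → u ≼ Π js → ∀ ρ τ → ref ρ ≼ u → ref τ ≼ u → ref (ref ρ ▷ τ) ≼ u
  below-conj {js} {u} uq le ρ τ p q = orth⇒below uq F (ref ρ ▷ τ) (Supp-cong (≋-sym lin) (Supp-⊞ (proj₁ bτ) (Supp-• _ (proj₁ bρ))))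
      (All.zipWith (λ {y} (o , o′) → ≈-trans (E-cong js {vec y} ≋-refl lin) (≈-trans (E-⊞ʳ js (vec y) (vec τ) ((- coef ρ (vec τ)) • vec ρ))
          (≈-trans (+-≈ o (≈-trans (E-•ʳ js (vec y) (- coef ρ (vec τ)) (vec ρ)) (≈-trans (*-≈ ≈-refl o′) (*-zeroʳ _)))) (+-idʳ 0#)))) (proj₂ bτ , proj₂ bρ))
    where
    F = fac uq le
    bρ = below⇒orth uq F ρ p
    bτ = below⇒orth uq F τ q
    lin : vec (ref ρ ▷ τ) ≋ vec τ ⊞ (- coef ρ (vec τ)) • vec ρ
    lin = ≋-trans (vec-▷ (ref ρ) τ) (act-ref ρ (vec τ))

  below-closed : ∀ {js u} → Unique js → u ≼ Π js → Closed (Below u)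
  below-closed {js} {u} uq le = record { Q⇒T = proj₁ ; conj = cj }
    where
    cj : ∀ {r t} → Below u r → Below u t → Below u (r · t · inv r)
    cj ((ρ , _ , refl) , p) (tτ@(τ , _ , refl) , q) = T-conj (ref ρ) tτ , subst (_≼ u) (ref-▷ (ref ρ) τ) (below-conj uq le ρ τ p q)

  s-below-conj : ∀ {js u i} → Unique js → u ≼ Π js → s i ≼ u → ∀ {t} → T t → t ≼ u → (s i · t · inv (s i)) ≼ u
  s-below-conj uq le p tτ q = proj₂ (Closed.conj (below-closed uq le) (T-s _ , p) (tτ , q))

  -- Canonical generators are irredundant. The last letter d of a word for r is r itself if r makes
  -- its root negative; otherwise the word without d makes it negative, and `exchange` produces a
  -- shorter word for r.
  deltaWord : ∀ {Q Σ : G → Set} (cl : Closed Q) (Σ⊂Δ : ∀ {d} → Σ d → Δ Q d) → ∀ f ds → length ds ≤ f → All Σ ds → ∀ r → Δ Q r → r ≡ prodG ds → Σ r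
  deltaWord {Q} {Σ} cl Σ⊂Δ f ds le sd r dr eq with initLast ds
  ... | [] = ⊥-elim (notone (Closed.Q⇒T cl (proj₁ dr)) eq)
    where notone : ∀ {t} → T t → t ≢ e
          notone (ρ , _ , refl) q with () ← trans (sym (lT-refl ρ)) (trans (cong lT q) lT-e)
  ... | ds′ ∷ʳ′ d = pick (upDown r (Closed.Q⇒T cl qd))
    where
    sd′ = Allₚ.++⁻ˡ ds′ sd
    sdd = All.head (Allₚ.++⁻ʳ ds′ sd)
    qd : Q d
    qd = proj₁ (Σ⊂Δ sdd)
    rd : r · d ≡ prodG ds′
    rd = trans (cong (_· d) (trans eq (prodG-∷ʳ ds′ d))) (T-cancelʳ (Closed.Q⇒T cl qd) (prodG ds′))
    pick : Up r d ⊎ Down r d → Σ r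
    pick (inj₂ dn) with d ≟ r
    ... | yes refl = sdd
    ... | no ne = ⊥-elim (up⊥down r (Closed.Q⇒T cl qd) (proj₂ dr d qd ne) dn)
    pick (inj₁ up) = rest f le (exchange cl ds′ (All.map Σ⊂Δ sd′) qd dn)
      where
      dn : Down (prodG ds′) d
      dn ρ p refl = subst (λ x → Neg (act x (vec ρ))) rd (Neg-resp (≋-sym (≋-trans (act-· r (ref ρ) (vec ρ)) (≋-trans (act-cong r (act-ref-vec ρ)) (act-⊟ r (vec ρ)))))
                      (Pos⇒Neg⊟ (up ρ p refl)))
      rest : ∀ f → length (ds′ ∷ʳ d) ≤ f → (∃ λ A → ∃ λ x → ∃ λ B → ds′ ≡ A ++ x ∷ B × prodG ds′ · d ≡ prodG (A ++ B) × d ≡ inv (prodG B) · x · prodG B) → Σ r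
      rest zero l _ = ⊥-elim (ℕₚ.n≮0 (ℕₚ.≤-trans (ℕₚ.≤-reflexive (sym (Listₚ.length-++-comm ds′ (d ∷ [])))) l))
      rest (suc f) l (A , x , B , refl , pr , _) = deltaWord cl Σ⊂Δ f (A ++ B) bound (Allₚ.++⁺ (Allₚ.++⁻ˡ A sd′) (All.tail (Allₚ.++⁻ʳ A sd′))) r dr
          (trans (trans eq (prodG-∷ʳ (A ++ x ∷ B) d)) pr)
        where
        bound : length (A ++ B) ≤ f
        bound = ℕₚ.≤-pred (ℕₚ.≤-trans (s≤s (ℕₚ.≤-trans (ℕₚ.≤-reflexive (Listₚ.length-++ A)) (ℕₚ.≤-trans (ℕₚ.+-monoʳ-≤ (length A) (ℕₚ.n≤1+n _)) (ℕₚ.≤-reflexive (sym (Listₚ.length-++ A))))))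
                   (ℕₚ.≤-trans (ℕₚ.≤-reflexive (sym (Listₚ.length-++-comm (A ++ x ∷ B) (d ∷ [])))) l))

-- The simple reflections below an element u

module SimpleSystem (Y : System) where
  open Order Y public

  _^_ : G → G → G
  g ^ t = g · t · inv g

  -- Abstracts a chain of rotations of the pair (js, u). The element g collects only the letters
  -- that are not below the current u: a letter below u permutes the reflections below u, and
  -- leaving it out of g is what keeps the positive roots below u positive.
  record Frame (js : List (Fin n)) (u : G) (js* : List (Fin n)) (u* g : G) : Set where
    field
      uq*  : Unique js*
      le*  : u* ≼ Π js*
      fwd  : ∀ {t} → T t → t ≼ u → (g ^ t) ≼ u*
      bwd  : ∀ {t} → T t → t ≼ u* → (inv g ^ t) ≼ u
      pos* : ∀ ρ → PosR ρ → ref ρ ≼ u → Pos (act g (vec ρ))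
  open Frame

  ^-e : ∀ t → e ^ t ≡ t
  ^-e t = gsolve 1 (λ t → (ε ⊙ t ⊙ ε ⁻) ⊜ t) refl t

  ^-· : ∀ g h t → (g · h) ^ t ≡ g ^ (h ^ t)
  ^-· g h t = gsolve 3 (λ g h t → (g ⊙ h ⊙ t ⊙ (g ⊙ h) ⁻) ⊜ (g ⊙ (h ⊙ t ⊙ h ⁻) ⊙ g ⁻)) refl g h t

  ^-inv : ∀ g t → inv g ^ (g ^ t) ≡ t
  ^-inv g t = gsolve 2 (λ g t → (g ⁻ ⊙ (g ⊙ t ⊙ g ⁻) ⊙ (g ⁻) ⁻) ⊜ t) refl g t

  ^-inv′ : ∀ g t → g ^ (inv g ^ t) ≡ t
  ^-inv′ g t = gsolve 2 (λ g t → (g ⊙ (g ⁻ ⊙ t ⊙ (g ⁻) ⁻) ⊙ g ⁻) ⊜ t) refl g t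

  frame-id : ∀ {js u} → Unique js → u ≼ Π js → Frame js u js u e
  frame-id {u = u} uq le = record { uq* = uq ; le* = le ; fwd = λ {t} _ p → subst (_≼ u) (sym (^-e t)) p
    ; bwd = λ {t} _ p → subst (_≼ u) (sym (trans (cong (_^ t) inv-e) (^-e t))) p ; pos* = λ ρ p _ → Pos-resp (≋-sym (act-e _)) p }

  frame-∘ : ∀ {js u js₁ u₁ g₁ js₂ u₂ g₂} → Frame js u js₁ u₁ g₁ → Frame js₁ u₁ js₂ u₂ g₂ → Frame js u js₂ u₂ (g₂ · g₁)
  frame-∘ {u = u} {u₁ = u₁} {g₁} {u₂ = u₂} {g₂} F₁ F₂ = record
    { uq* = uq* F₂ ; le* = le* F₂
    ; fwd = λ {t} tτ p → subst (_≼ u₂) (sym (^-· g₂ g₁ t)) (fwd F₂ (T-conj g₁ tτ) (fwd F₁ tτ p))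
    ; bwd = λ {t} tτ p → subst (_≼ u) (trans (sym (^-· (inv g₁) (inv g₂) t)) (cong (_^ t) (sym (inv-· g₂ g₁)))) (bwd F₁ (T-conj (inv g₂) tτ) (bwd F₂ tτ p))
    ; pos* = λ ρ p q → Pos-resp (≋-trans (act-cong g₂ (vec-▷ g₁ ρ)) (≋-sym (act-· g₂ g₁ (vec ρ))))
        (pos* F₂ (g₁ ▷ ρ) (Pos-resp (≋-sym (vec-▷ g₁ ρ)) (pos* F₁ ρ p q)) (subst (_≼ u₁) (sym (ref-▷ g₁ ρ)) (fwd F₁ (T-ref ρ) q))) }

  -- Conjugation by s_i permutes the reflections below u, so these are also the reflections below
  -- the rotated element, and g = e changes no sign.
  frame-skip : ∀ {i js u} → Unique (i ∷ js) → u ≼ Π (i ∷ js) → s i ≼ u → Frame (i ∷ js) u (js ∷ʳ i) (s i ^ u) e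
  frame-skip {i} {js} {u} uq le p = record { uq* = Unique-rot uq ; le* = rot-≼ js le
    ; fwd = λ {t} tτ q → subst (_≼ (s i ^ u)) (trans (cc i t) (sym (^-e t))) (≼-conj (s i) (s-below-conj uq le p tτ q))
    ; bwd = λ {t} tτ q → subst (_≼ u) (sym (trans (cong (_^ t) inv-e) (^-e t))) (subst₂ _≼_ (cc i t) (cc i u) (≼-conj (s i) (s-below-conj (Unique-rot uq) (rot-≼ js le) (s≼conj p) tτ q)))
    ; pos* = λ ρ p _ → Pos-resp (≋-sym (act-e _)) p }

  frame-conj : ∀ {i js u} → Unique (i ∷ js) → u ≼ Π (i ∷ js) → ¬ s i ≼ u → Frame (i ∷ js) u (js ∷ʳ i) (s i ^ u) (s i)
  frame-conj {i} {js} {u} uq le np = record { uq* = Unique-rot uq ; le* = rot-≼ js le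
    ; fwd = λ tτ q → ≼-conj (s i) q
    ; bwd = λ {t} tτ q → subst₂ _≼_ (cong (_^ t) (sym (inv-s i))) (cc i u) (≼-conj (s i) q)
    ; pos* = λ ρ p q → stays ρ i p (λ r → np (subst (_≼ u) r q)) }

  pos-back : ∀ {js u js* u* g} → Frame js u js* u* g → ∀ τ → PosR τ → ref τ ≼ u* → Pos (act (inv g) (vec τ))
  pos-back {u = u} {g = g} F τ p q = pick (sign▷ (inv g) τ)
    where
    ρ = flip (inv g ▷ τ)
    pick : Pos (act (inv g) (vec τ)) ⊎ Neg (act (inv g) (vec τ)) → Pos (act (inv g) (vec τ))
    pick (inj₁ r) = r
    pick (inj₂ r) = ⊥-elim (sign⊥ e τ (Pos-resp (≋-sym (act-e _)) p) (Neg-resp (≋-sym (act-e _)) (Pos-resp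
        (≋-trans (act-cong g (≋-trans (vec-flip (inv g ▷ τ)) (⊟-cong (vec-▷ (inv g) τ)))) (≋-trans (act-⊟ g _) (⊟-cong (act-inv′ g (vec τ)))))
        (pos* F ρ (Pos-resp (≋-sym (≋-trans (vec-flip (inv g ▷ τ)) (⊟-cong (vec-▷ (inv g) τ)))) r)
          (subst (_≼ u) (sym (trans (ref-flip (inv g ▷ τ)) (ref-▷ (inv g) τ))) (bwd F (T-ref τ) q))))))

  -- r becomes an initial letter after rotating the Coxeter word.
  record Rec (js : List (Fin n)) (u r : G) : Set where
    field
      {i} : Fin n
      {js*} : List (Fin n)
      {u*} : G
      g  : G
      F  : Frame js u (i ∷ js*) u* g
      s≼ : s i ≼ u*
      r≡ : r ≡ inv g ^ s i

  rec-lift : ∀ {js u js₁ u₁ g₁} → Frame js u js₁ u₁ g₁ → ∀ {r} → Rec js₁ u₁ r → Rec js u (inv g₁ ^ r)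
  rec-lift {g₁ = g₁} F₁ {r} R = record { g = g · g₁ ; F = frame-∘ F₁ F ; s≼ = s≼
      ; r≡ = trans (cong (inv g₁ ^_) r≡) (trans (sym (^-· (inv g₁) (inv g) _)) (cong (_^ _) (sym (inv-· g g₁)))) }
    where open Rec R

  transport-Δ : ∀ {js u js* u* g} → Unique js → u ≼ Π js → Frame js u js* u* g → ∀ {r} → Δ (Below u) r → Δ (Below u*) (g ^ r)
  transport-Δ {u = u} {u* = u*} {g} uq le F {r} ((tr , p) , up) = (T-conj g tr , fwd F tr p) , λ t (tτ , q) ne ρ pr eq →
    let τ = inv g ▷ ρ
        τpos = Pos-resp (≋-sym (vec-▷ (inv g) ρ)) (pos-back F ρ pr (subst (_≼ u*) (sym eq) q))
        τref = trans (ref-▷ (inv g) ρ) (cong (inv g ^_) eq)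
        rτ = up (inv g ^ t) (T-conj (inv g) tτ , bwd F tτ q) (λ z → ne (trans (sym (^-inv′ g t)) (cong (g ^_) z))) τ τpos τref
        rτ≼ : ref (r ▷ τ) ≼ u
        rτ≼ = subst (_≼ u) (trans (cong (r ^_) (sym τref)) (sym (ref-▷ r τ))) (proj₂ (Closed.conj (below-closed uq le) (tr , p) (T-conj (inv g) tτ , bwd F tτ q)))
    in Pos-resp (≋-trans (act-cong g (≋-trans (vec-▷ r τ) (act-cong r (vec-▷ (inv g) ρ))))
         (≋-trans (≋-sym (act-· g r _)) (≋-sym (act-· (g · r) (inv g) (vec ρ)))))
         (pos* F (r ▷ τ) (Pos-resp (≋-sym (vec-▷ r τ)) rτ) rτ≼)

  Δ-simple : ∀ {u i} → s i ≼ u → Δ (Below u) (s i)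
  Δ-simple {i = i} p = (T-s i , p) , λ t (tτ , _) ne → proj₂ (Δ-s i) t tτ ne

  frame-inv : ∀ {js u js* u* g} → Unique js → u ≼ Π js → Frame js u js* u* g → Frame js* u* js u (inv g)
  frame-inv {u = u} {u* = u*} {g} uq le F = record { uq* = uq ; le* = le ; fwd = bwd F
    ; bwd = λ {t} tτ p → subst (λ x → (x ^ t) ≼ u*) (sym (inv-inv g)) (fwd F tτ p) ; pos* = pos-back F }

  rec-Δ : ∀ {js u} → Unique js → u ≼ Π js → ∀ {r} → Rec js u r → Δ (Below u) r
  rec-Δ uq le R = subst (Δ (Below _)) (sym r≡) (transport-Δ (uq* F) (le* F) (frame-inv uq le F) (Δ-simple s≼))
    where open Rec R

  -- Stands in for the fact that every reflection is conjugate to a simple one by simple ones;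
  -- `below-Conj` shows that all reflections below u arise.
  data Conj (js : List (Fin n)) (u : G) : G → Set where
    base : ∀ {r} → Rec js u r → Conj js u r
    step : ∀ {r t} → Rec js u r → Conj js u t → Conj js u (r ^ t)

  conj-lift : ∀ {js u js₁ u₁ g₁} → Frame js u js₁ u₁ g₁ → ∀ {t} → Conj js₁ u₁ t → Conj js u (inv g₁ ^ t)
  conj-lift F (base R) = base (rec-lift F R)
  conj-lift {g₁ = g₁} F (step {r} {t} R c) = subst (Conj _ _) (gsolve 3 (λ g r t → (g ⊙ r ⊙ g ⁻ ⊙ (g ⊙ t ⊙ g ⁻) ⊙ (g ⊙ r ⊙ g ⁻) ⁻) ⊜ (g ⊙ (r ⊙ t ⊙ r ⁻) ⊙ g ⁻)) refl (inv g₁) r t)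
    (step (rec-lift F R) (conj-lift F c))

  rec-here : ∀ {i js u} → Unique (i ∷ js) → u ≼ Π (i ∷ js) → s i ≼ u → Rec (i ∷ js) u (s i)
  rec-here {i} uq le p = record { g = e ; F = frame-id uq le ; s≼ = p ; r≡ = sym (trans (cong (_^ s i) inv-e) (^-e (s i))) }

  -- Along the rotations that bring t to the front, a letter below u contributes a conjugation by a
  -- reflection of `Rec`, and any other letter only changes the frame.
  hits-conj : ∀ {js u t} → Hits js t → Unique js → u ≼ Π js → T t → t ≼ u → Conj js u t
  hits-conj {u = u} (Hits.here refl) uq le tτ p = base (rec-here uq le p)
  hits-conj {i ∷ js} {u} {t} (Hits.step ne h) uq le tτ p = pick (s i ≼? u)
    where
    ih : Conj (js ∷ʳ i) (s i ^ u) (s i ^ t)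
    ih = hits-conj h (Unique-rot uq) (rot-≼ js le) (T-conj (s i) tτ) (≼-conj (s i) p)
    pick : Dec (s i ≼ u) → Conj (i ∷ js) u t
    pick (yes q) = subst (Conj (i ∷ js) u) (trans (cong (s i ^_) (trans (cong (_^ (s i ^ t)) inv-e) (^-e _))) (cc i t))
                     (step (rec-here uq le q) (conj-lift (frame-skip uq le q) ih))
    pick (no q) = subst (Conj (i ∷ js) u) (^-inv (s i) t) (conj-lift (frame-conj uq le q) ih)

  below-Conj : ∀ {js u t} → Unique js → u ≼ Π js → T t → t ≼ u → Conj js u t
  below-Conj {js} {u} uq le tτ@(ρ , pr , refl) p = hits-conj (hits js ρ uq (below-supp uq le ρ p)) uq le tτ p

  conj-gen : ∀ {js u} {Σ : G → Set} → (∀ {r} → Rec js u r → Σ r) → (∀ {r} → Rec js u r → T r) → ∀ {t} → Conj js u t → Gen Σ t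
  conj-gen f g (base {r} R) = r ∷ [] , f R ∷ [] , sym (idʳ r)
  conj-gen f g (step {r} {t} R c) = subst (Gen _) (cong (r · t ·_) (sym (T-inv (g R)))) (Gen-· (Gen-· gr (conj-gen f g c)) gr)
    where gr = r ∷ [] , f R ∷ [] , sym (idʳ r)

  Gen-prod : ∀ {Σ} xs → All (Gen Σ) (map ref xs) → Gen Σ (prodR xs)
  Gen-prod [] [] = [] , [] , refl
  Gen-prod (x ∷ xs) (p ∷ ps) = Gen-· p (Gen-prod xs ps)

  -- Only one simple reflection of the positive system below u involves the initial letter: u lies in the
  -- standard parabolic subgroup generated by s_i and the simple reflections below s_i u.
  initial-simple : ∀ {i js u r} → Unique (i ∷ js) → u ≼ Π (i ∷ js) → s i ≼ u → Δ (Below u) r → r ≢ s i → r ≼ (s i · u)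
  initial-simple {i} {js} {u} {r} uq le p dr@((tr , r≼u) , _) ne = pick (deltaWord cl Σ⊂Δ _ (proj₁ gr) ℕₚ.≤-refl (proj₁ (proj₂ gr)) r dr (proj₂ (proj₂ gr)))
    where
    cl = below-closed uq le
    u′ = s i · u
    uq′ : Unique js
    uq′ = AllPairs.tail uq
    le′ : u′ ≼ Π js
    le′ = initial-down uq p le
    -- Σ′ is shown to generate u, hence by `parabolic` every reflection below u; `deltaWord` then
    -- puts r itself into Σ′.
    Σ′ : G → Set
    Σ′ d = d ≡ s i ⊎ (Δ (Below u) d × d ≼ u′)
    Σ⊂Δ : ∀ {d} → Σ′ d → Δ (Below u) d
    Σ⊂Δ (inj₁ refl) = Δ-simple p
    Σ⊂Δ (inj₂ (d , _)) = d
    recΣ : ∀ {d} → Rec js u′ d → Σ′ d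
    recΣ {d} R = inj₂ (((proj₁ (proj₁ dd) , ≼-trans d≼u′ (s·≼ p)) , up) , d≼u′)
      where
      dd = rec-Δ uq′ le′ R
      d≼u′ = proj₂ (proj₁ dd)
      up : ∀ t → Below u t → t ≢ d → Up d t
      up t (tτ , t≼u) ned ρ pr refl = pick (sign▷ d ρ)
        where
        pick : Pos (act d (vec ρ)) ⊎ Neg (act d (vec ρ)) → Pos (act d (vec ρ))
        pick (inj₁ q) = q
        -- Since d preserves coordinate i, a positive root made negative by d has coordinate i equal
        -- to zero and thus already lies below `u′`, where d is known to be simple.
        pick (inj₂ q) = proj₂ dd (ref ρ) (tτ , ρ≼u′) ned ρ pr refl
          where
          dcoord : act d (vec ρ) i ≈ vec ρ i
          dcoord with proj₁ (proj₁ dd)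
          ... | τ , _ , refl = ≈-trans (act-ref τ (vec ρ) i) (≈-trans (+-≈ ≈-refl (≈-trans (*-≈ ≈-refl (below-supp uq′ le′ τ d≼u′ i (∉-tail uq))) (*-zeroʳ _))) (+-idʳ _))
          zero-i : vec ρ i ≈ 0#
          zero-i = nn-anti (pr i) (nn-resp (neg-≈ dcoord) (q i))
          F₀ = fac uq le
          o = below⇒orth uq F₀ ρ t≼u
          F′ : Fac js u′
          F′ = record { xs = fact u′ ; zs = Fac.zs F₀ ; eq-u = prod-fact u′
            ; eq-c = trans (sym (s-cancelˡ (Π js) i)) (trans (cong (s i ·_) (trans (Fac.eq-c F₀) (cong (_· prodR (Fac.zs F₀)) (sym (Fac.eq-u F₀))))) (trans (sym (assoc _ _ _)) (cong (_· prodR (Fac.zs F₀)) (prod-fact u′))))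
            ; len = ℕₚ.suc-injective (trans (cong (ℕ._+ length (Fac.zs F₀)) (trans (cong suc (length-fact u′)) (trans (s-lT p) (trans (cong lT (Fac.eq-u F₀)) (trans (cong lT (sym (Fac.eq-u F₀))) (proj₁ (proj₂ (unfac uq F₀)))))))) (Fac.len F₀)) }
          zsupp : All (SuppR js) (Fac.zs F₀)
          zsupp = Allₚ.++⁻ʳ (fact u′) (Fac-supp uq′ F′)
          ρ≼u′ : ref ρ ≼ u′
          ρ≼u′ = orth⇒below uq′ F′ ρ (Supp-tail (proj₁ o) zero-i) (All.zipWith (λ {τ} (sp , q) → ≈-trans (≈-sym (E-tail i js (vec τ) (vec ρ) (sp i (∉-tail uq)))) q) (zsupp , proj₂ o))
    gu′ : Gen Σ′ (prodR (fact u′))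
    gu′ = Gen-prod (fact u′) (Allₚ.map⁺ (All.map (λ {x} x≼ → conj-gen recΣ (λ R → proj₁ (proj₁ (rec-Δ uq′ le′ R)))
            (below-Conj uq′ le′ (T-ref x) (subst (ref x ≼_) (sym (prod-fact u′)) x≼))) (factor-≼ (fact u′) (trans (length-fact u′) (cong lT (prod-fact u′))))))
    gu : Gen Σ′ u
    gu = subst (Gen Σ′) (trans (cong (s i ·_) (sym (prod-fact u′))) (s-cancelˡ u i)) (Gen-· (s i ∷ [] , inj₁ refl ∷ [] , sym (idʳ (s i))) gu′)
    genBelow : ∀ {r} → T r → r ≼ u → Gen Σ′ r
    genBelow (ρ , _ , refl) r≼u = All.head (proj₁ (parabolic cl Σ⊂Δ (map ref xs) (proj₁ gu) (Red-fact xs (trans len (cong lT eq))) (Allₚ.map⁺ (All.map (λ {x} q → T-ref x , subst (ref x ≼_) (sym eq) q) (factor-≼ xs (trans len (cong lT eq))))) (proj₁ (proj₂ gu)) (trans (sym eq) (proj₂ (proj₂ gu)))))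
      where
      xs = ρ ∷ fact (inv (ref ρ) · u)
      eq : u ≡ prodR xs
      eq = trans (gsolve 2 (λ r u → u ⊜ (r ⊙ (r ⁻ ⊙ u))) refl (ref ρ) u) (cong (ref ρ ·_) (prod-fact (inv (ref ρ) · u)))
      len : length xs ≡ lT u
      len = trans (cong suc (trans (length-fact _) (lT-comm (ref ρ) u))) (trans (ℕₚ.+-comm 1 _) (trans (cong (lT (u · inv (ref ρ)) ℕ.+_) (sym (lT-refl ρ))) r≼u))
    gr : Gen Σ′ r
    gr = genBelow tr r≼u
    pick : Σ′ r → r ≼ u′
    pick (inj₁ q) = ⊥-elim (ne q)
    pick (inj₂ (_ , q)) = q

-- Cones, meets and the existence of joins

module Meet (Y : System) where
  open SimpleSystem Y public

  module _ {js : List (Fin n)} {u : G} (uq : Unique js) (le : u ≼ Π js) where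
    private
      RD : Set
      RD = Σ G (Rec js u)

      tau : RD → Rt
      tau (r , R) = inv (Rec.g R) ▷ σ (Rec.i R)

      ref-tau : ∀ R → ref (tau R) ≡ proj₁ R
      ref-tau (r , R) = trans (ref-▷ (inv (Rec.g R)) (σ (Rec.i R))) (trans (cong (inv (Rec.g R) ^_) (ref-σ (Rec.i R))) (sym (Rec.r≡ R)))

      -- Functionals dual to the simple roots `tau`, by `phi-self` and `phi-other`; they do the work
      -- of linear independence.
      phi : RD → V → K
      phi (r , R) x = act (Rec.g R) x (Rec.i R)

      phi-cong : ∀ R {x z} → x ≋ z → phi R x ≈ phi R z
      phi-cong (r , R) p = act-cong (Rec.g R) p (Rec.i R)

      phi-lin : ∀ R c x z → phi R (c • x ⊞ z) ≈ c * phi R x + phi R z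
      phi-lin (r , R) c x z = ≈-trans (act-⊞ (Rec.g R) (c • x) z (Rec.i R)) (+-≈ (act-• (Rec.g R) c x (Rec.i R)) ≈-refl)

      g-tau : ∀ R → act (Rec.g (proj₂ R)) (vec (tau R)) ≋ α (Rec.i (proj₂ R))
      g-tau (r , R) = ≋-trans (act-cong (Rec.g R) (≋-trans (vec-▷ (inv (Rec.g R)) (σ (Rec.i R))) (act-cong (inv (Rec.g R)) (vec-σ (Rec.i R))))) (act-inv′ (Rec.g R) (α (Rec.i R)))

      phi-self : ∀ R → phi R (vec (tau R)) ≈ 1#
      phi-self R@(r , R′) = ≈-trans (g-tau R (Rec.i R′)) (α-same (Rec.i R′))

      tau-pos : ∀ R → PosR (tau R)
      tau-pos R@(r , R′) = Pos-resp (≋-sym (vec-▷ (inv (Rec.g R′)) (σ (Rec.i R′))))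
        (pos-back (Rec.F R′) (σ (Rec.i R′)) (Pos-resp (≋-sym (vec-σ _)) (α-pos _)) (subst (_≼ Rec.u* R′) (sym (ref-σ (Rec.i R′))) (Rec.s≼ R′)))

      phi-other : ∀ R R′ → proj₁ R′ ≢ proj₁ R → phi R (vec (tau R′)) ≈ 0#
      phi-other (r , R) R′@(r′ , _) ne = ≈-trans (≈-sym (vec-▷ g (tau R′) i)) (below-supp uq₁ le₁ (g ▷ tau R′) (subst (_≼ s i · Rec.u* R) (sym rf≡) r*≼) i (∉-tail (Frame.uq* F)))
        where
        open Rec R
        uq₁ = AllPairs.tail (Frame.uq* F)
        le₁ = initial-down (Frame.uq* F) s≼ (Frame.le* F)
        rf≡ : ref (g ▷ tau R′) ≡ g ^ r′
        rf≡ = trans (ref-▷ g (tau R′)) (cong (g ^_) (ref-tau R′))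
        r*≼ : (g ^ r′) ≼ (s i · Rec.u* R)
        r*≼ = initial-simple (Frame.uq* F) (Frame.le* F) s≼ (transport-Δ uq le F (rec-Δ uq le (proj₂ R′)))
                (λ q → ne (trans (sym (^-inv g r′)) (trans (cong (inv g ^_) q) (sym r≡))))

      lin : List (K × RD) → V
      lin = foldr (λ (c , R) v → c • vec (tau R) ⊞ v) 0v

      -- Undoing one conjugation by a simple reflection changes the root by a multiple of one simple
      -- root.
      conj-span : ∀ {t} → Conj js u t → ∀ ρ → ref ρ ≡ t → ∃ λ L → vec ρ ≋ lin L
      conj-span (base {r} R) ρ eq = (proj₁ pa , r , R) ∷ [] , λ k → ≈-trans (proj₂ pa k) (≈-sym (+-idʳ _))
        where pa = proportional ρ (tau (r , R)) (trans eq (sym (ref-tau (r , R))))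
      conj-span (step {r} {t} R c) ρ eq = (- coef τ (vec ρ′) , r , R) ∷ proj₁ ih , λ k → ≈-trans (vecρ k) (≈-trans (+-≈ (proj₂ ih k) ≈-refl) (+-commut _ _))
        where
        τ = tau (r , R)
        rT : T r
        rT = proj₁ (proj₁ (rec-Δ uq le R))
        ρ′ = r ▷ ρ
        ih = conj-span c ρ′ (trans (ref-▷ r ρ) (trans (cong (r ^_) eq) (trans (gsolve 2 (λ r t → (r ⊙ (r ⊙ t ⊙ r ⁻) ⊙ r ⁻) ⊜ ((r ⊙ r) ⊙ t ⊙ (r ⊙ r) ⁻)) refl r t)
               (trans (cong (_^ t) (T-invol rT)) (^-e t)))))
        vecρ : vec ρ ≋ vec ρ′ ⊞ (- coef τ (vec ρ′)) • vec τ
        vecρ = ≋-trans (≋-sym (≋-trans (act-cong r (vec-▷ r ρ)) (≋-trans (≋-sym (act-· r r (vec ρ))) (≋-trans (act-≡ (vec ρ) (T-invol rT)) (act-e (vec ρ))))))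
                 (≋-trans (act-≡ (vec ρ′) (sym (ref-tau (r , R)))) (act-ref τ (vec ρ′)))

      phi-lin0 : ∀ R L → All (λ (_ , R′) → proj₁ R′ ≢ proj₁ R) L → phi R (lin L) ≈ 0#
      phi-lin0 (r , R) [] [] = act-0 (Rec.g R) (Rec.i R)
      phi-lin0 R ((c , R′) ∷ L) (p ∷ ps) = ≈-trans (phi-lin R c (vec (tau R′)) (lin L)) (≈-trans (+-≈ (≈-trans (*-≈ ≈-refl (phi-other R R′ p)) (*-zeroʳ c)) (phi-lin0 R L ps)) (+-idʳ 0#))

      extract : ∀ (R : RD) L → ∃ λ C → ∃ λ L₂ → lin L ≋ C • vec (tau R) ⊞ lin L₂ × All (λ (_ , R′) → proj₁ R′ ≢ proj₁ R) L₂ × length L₂ ≤ length L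
      extract R [] = 0# , [] , (λ k → ≈-sym (≈-trans (+-≈ (*-zeroˡ _) ≈-refl) (+-idʳ 0#))) , [] , z≤n
      extract R ((c , R′) ∷ L) = cases (proj₁ R′ ≟ proj₁ R)
        where
        ih = extract R L
        C = proj₁ ih
        L₂ = proj₁ (proj₂ ih)
        p = proj₁ (proj₂ (proj₂ ih))
        q = proj₁ (proj₂ (proj₂ (proj₂ ih)))
        l = proj₂ (proj₂ (proj₂ (proj₂ ih)))
        cases : Dec (proj₁ R′ ≡ proj₁ R) → ∃ λ C → ∃ λ L₂ → lin ((c , R′) ∷ L) ≋ C • vec (tau R) ⊞ lin L₂ × All (λ (_ , R′) → proj₁ R′ ≢ proj₁ R) L₂ × length L₂ ≤ suc (length L)
        cases (no ne) = C , (c , R′) ∷ L₂ , (λ k → ≈-trans (+-≈ ≈-refl (p k)) (rsolve 3 (λ a b c → a :+ (b :+ c) := b :+ (a :+ c)) ≈-refl _ _ _)) , ne ∷ q , s≤s l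
        cases (yes eq) = c * a + C , L₂ , (λ k → ≈-trans (+-≈ (*-≈ ≈-refl (proj₂ pa k)) (p k)) (rsolve 5 (λ c a x C z → c :* (a :* x) :+ (C :* x :+ z) := (c :* a :+ C) :* x :+ z) ≈-refl c a (vec (tau R) k) C (lin L₂ k))) , q , ℕₚ.m≤n⇒m≤1+n l
          where
          pa = proportional (tau R′) (tau R) (trans (ref-tau R′) (trans eq (sym (ref-tau R))))
          a = proj₁ pa

      -- Coefficients in the list may have any sign and a simple root may occur repeatedly. Once
      -- `extract` has collected its occurrences, the total coefficient is the value of the dual
      -- functional, which is nonnegative.
      posit : ∀ f L → length L ≤ f → (∀ R → Nonneg (phi R (lin L))) → ∃ λ L′ → All (Nonneg ∘ proj₁) L′ × lin L ≋ lin L′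
      posit f [] l ph = [] , [] , ≋-refl
      posit (suc f) ((c , R) ∷ L) (s≤s l) ph = (c + C , R) ∷ proj₁ ih , nnC ∷ proj₁ (proj₂ ih) , λ k → ≈-trans (whole k) (+-≈ ≈-refl (proj₂ (proj₂ ih) k))
        where
        ex = extract R L
        C = proj₁ ex
        L₂ = proj₁ (proj₂ ex)
        others = proj₁ (proj₂ (proj₂ (proj₂ ex)))
        whole : lin ((c , R) ∷ L) ≋ (c + C) • vec (tau R) ⊞ lin L₂
        whole k = ≈-trans (+-≈ ≈-refl (proj₁ (proj₂ (proj₂ ex)) k)) (rsolve 4 (λ c C x z → c :* x :+ (C :* x :+ z) := (c :+ C) :* x :+ z) ≈-refl c C (vec (tau R) k) (lin L₂ k))
        value : ∀ R′ → phi R′ (lin ((c , R) ∷ L)) ≈ (c + C) * phi R′ (vec (tau R)) + phi R′ (lin L₂)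
        value R′ = ≈-trans (phi-cong R′ whole) (phi-lin R′ (c + C) (vec (tau R)) (lin L₂))
        nnC : Nonneg (c + C)
        nnC = nn-resp (≈-trans (value R) (≈-trans (+-≈ (≈-trans (*-≈ ≈-refl (phi-self R)) (*-idʳ _)) (phi-lin0 R L₂ others)) (+-idʳ _))) (ph R)
        ph₂ : ∀ R′ → Dec (proj₁ R′ ≡ proj₁ R) → Nonneg (phi R′ (lin L₂))
        ph₂ R′ (yes eq) = nn-resp (≈-sym (phi-lin0 R′ L₂ (All.map (λ ne q → ne (trans q eq)) others))) nn-0
        ph₂ R′ (no ne) = nn-resp (≈-trans (value R′) (≈-trans (+-≈ (≈-trans (*-≈ ≈-refl (phi-other R′ R (ne ∘ sym))) (*-zeroʳ _)) ≈-refl) (+-idˡ _))) (ph R′)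
        ih = posit f L₂ (ℕₚ.≤-trans (proj₂ (proj₂ (proj₂ (proj₂ ex)))) l) (λ R′ → ph₂ R′ (proj₁ R′ ≟ proj₁ R))

    -- The dual functionals are nonnegative on positive roots below u, being coordinates after a
    -- frame that keeps those roots positive.
    simple-span : ∀ ρ → PosR ρ → ref ρ ≼ u → ∃ λ (L : List (K × Rt)) →
      All (λ (c , τ) → Nonneg c × PosR τ × Δ (Below u) (ref τ)) L × vec ρ ≋ foldr (λ (c , τ) v → c • vec τ ⊞ v) 0v L
    simple-span ρ p q = conv (proj₁ po) (proj₁ (proj₂ po)) (≋-trans (proj₂ sp) (proj₂ (proj₂ po)))
      where
      sp = conj-span (below-Conj uq le (T-ref ρ) q) ρ refl
      po = posit _ (proj₁ sp) ℕₚ.≤-refl (λ R@(r , R′) → nn-resp (phi-cong R (proj₂ sp)) (Frame.pos* (Rec.F R′) ρ p q (Rec.i R′)))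
      conv : ∀ L {v} → All (Nonneg ∘ proj₁) L → v ≋ lin L → ∃ λ (L : List (K × Rt)) → All (λ (c , τ) → Nonneg c × PosR τ × Δ (Below u) (ref τ)) L × v ≋ foldr (λ (c , τ) v → c • vec τ ⊞ v) 0v L
      conv [] [] eq = [] , [] , eq
      conv ((c , R) ∷ L) (nc ∷ ns) eq = (c , tau R) ∷ proj₁ ih , (nc , tau-pos R , subst (Δ (Below u)) (sym (ref-tau R)) (rec-Δ uq le (proj₂ R))) ∷ proj₁ (proj₂ ih) , λ k → ≈-trans (eq k) (+-≈ ≈-refl (proj₂ (proj₂ ih) k))
        where ih = conv L {lin L} ns ≋-refl

  data Cone (u : G) : V → Set where
    c0 : ∀ {v} → v ≋ 0v → Cone u v
    c+ : ∀ {v w} ρ a → PosR ρ → ref ρ ≼ u → Nonneg a → Cone u v → w ≋ a • vec ρ ⊞ v → Cone u w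

  Cone-resp : ∀ {u v w} → v ≋ w → Cone u v → Cone u w
  Cone-resp p (c0 q) = c0 (≋-trans (≋-sym p) q)
  Cone-resp p (c+ ρ a x y z c q) = c+ ρ a x y z c (≋-trans (≋-sym p) q)

  Cone-⊞ : ∀ {u v w} → Cone u v → Cone u w → Cone u (v ⊞ w)
  Cone-⊞ (c0 p) d = Cone-resp (λ k → ≈-sym (≈-trans (+-≈ (p k) ≈-refl) (+-idˡ _))) d
  Cone-⊞ (c+ ρ a x y z c q) d = c+ ρ a x y z (Cone-⊞ c d) (λ k → ≈-trans (+-≈ (q k) ≈-refl) (+-associative _ _ _))

  Cone-• : ∀ {u v} r → Nonneg r → Cone u v → Cone u (r • v)
  Cone-• r n (c0 p) = c0 (λ k → ≈-trans (*-≈ ≈-refl (p k)) (*-zeroʳ r))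
  Cone-• r n (c+ {v} ρ a x y z c q) = c+ ρ (r * a) x y (nn-* n z) (Cone-• r n c) (λ k → ≈-trans (*-≈ ≈-refl (q k)) (rsolve 4 (λ r a b v → r :* (a :* b :+ v) := r :* a :* b :+ r :* v) ≈-refl r a (vec ρ k) (v k)))

  Cone-root : ∀ {u} ρ → PosR ρ → ref ρ ≼ u → Cone u (vec ρ)
  Cone-root ρ p q = c+ ρ 1# p q nn-1 (c0 {v = 0v} ≋-refl) (λ k → ≈-sym (≈-trans (+-idʳ _) (*-idˡ _)))

  record Linear (f : V → V) : Set where
    field
      f-cong : ∀ {u v} → u ≋ v → f u ≋ f v
      f-⊞    : ∀ u v → f (u ⊞ v) ≋ f u ⊞ f v
      f-•    : ∀ r v → f (r • v) ≋ r • f v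

  Cone-map : ∀ {u u′} {f : V → V} → Linear f → (∀ ρ → PosR ρ → ref ρ ≼ u → Cone u′ (f (vec ρ))) → ∀ {v} → Cone u v → Cone u′ (f v)
  Cone-map {f = f} l g (c0 {v} p) = c0 (≋-trans (f-cong (λ k → ≈-trans (p k) (≈-sym (*-zeroˡ (v k))))) (≋-trans (f-• 0# v) (λ k → *-zeroˡ _)))
    where open Linear l
  Cone-map {f = f} l g (c+ {v} ρ a p q n c w) = Cone-resp (≋-sym (≋-trans (f-cong w) (≋-trans (f-⊞ (a • vec ρ) v) (λ k → +-≈ (f-• a (vec ρ) k) ≈-refl)))) (Cone-⊞ (Cone-• a n (g ρ p q)) (Cone-map l g c))
    where open Linear l

  rf-linear : ∀ i → Linear (rf i)
  rf-linear i = record { f-cong = rf-cong i ; f-⊞ = rf-⊞ i ; f-• = rf-• i }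

  Cone-mono : ∀ {u w v} → (∀ ρ → ref ρ ≼ u → ref ρ ≼ w) → Cone u v → Cone w v
  Cone-mono f (c0 p) = c0 p
  Cone-mono f (c+ ρ a x y z c q) = c+ ρ a x (f ρ y) z (Cone-mono f c) q

  Cone-pos : ∀ {u v} → Cone u v → Pos v
  Cone-pos (c0 p) = Pos-resp (≋-sym p) Pos-0
  Cone-pos (c+ ρ a x y z c q) = Pos-resp (≋-sym q) (Pos-⊞ (Pos-• z x) (Cone-pos c))

  pr : Fin n → V → V
  pr i v = v ⊞ (- v i) • α i

  pr-linear : ∀ i → Linear (pr i)
  pr-linear i = record
    { f-cong = λ p k → +-≈ (p k) (*-≈ (neg-≈ (p i)) ≈-refl)
    ; f-⊞ = λ u v k → rsolve 5 (λ u v a b c → (u :+ v) :+ (:- (a :+ b)) :* c := (u :+ (:- a) :* c) :+ (v :+ (:- b) :* c)) ≈-refl (u k) (v k) (u i) (v i) (α i k)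
    ; f-• = λ r v k → rsolve 4 (λ r v a c → r :* v :+ (:- (r :* a)) :* c := r :* (v :+ (:- a) :* c)) ≈-refl r (v k) (v i) (α i k) }

  pr-add : ∀ i v → v ≋ (v i) • α i ⊞ pr i v
  pr-add i v k = rsolve 3 (λ v a c → v := a :* c :+ (v :+ (:- a) :* c)) ≈-refl (v k) (v i) (α i k)

  pr-rf : ∀ i v → rf i v ≋ (rf i v i) • α i ⊞ pr i v
  pr-rf i v k = cases (k Fin.≟ i)
    where
    cases : Dec (k ≡ i) → rf i v k ≈ (rf i v i) * α i k + pr i v k
    cases (yes refl) = ≈-sym (≈-trans (+-≈ (≈-trans (*-≈ ≈-refl (α-same i)) (*-idʳ _)) (≈-trans (+-≈ ≈-refl (≈-trans (*-≈ ≈-refl (α-same i)) (*-idʳ _))) (rsolve 1 (λ a → a :+ (:- a) := con (ℤ+ 0)) ≈-refl (v k)))) (+-idʳ _))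
    cases (no ne) = ≈-trans (rf-off v ne) (≈-sym (≈-trans (+-≈ (≈-trans (*-≈ ≈-refl (α-diff ne)) (*-zeroʳ _)) (≈-trans (+-≈ ≈-refl (≈-trans (*-≈ ≈-refl (α-diff ne)) (*-zeroʳ _))) (+-idʳ _))) (+-idˡ _)))

  σ-pos : ∀ i → PosR (σ i)
  σ-pos i = Pos-resp (≋-sym (vec-σ i)) (α-pos i)

  Cone-α : ∀ {u} i a {v} → s i ≼ u → Nonneg a → Cone u v → Cone u (a • α i ⊞ v)
  Cone-α {u} i a p n c = c+ (σ i) a (σ-pos i) (subst (_≼ u) (sym (ref-σ i)) p) n c (λ k → +-≈ (*-≈ ≈-refl (≈-sym (vec-σ i k))) ≈-refl)

  -- It suffices to project the simple roots below u: α_i is killed, and the others lie below s_i u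
  -- by `initial-simple` with coordinate i already zero.
  project : ∀ {i js u} → Unique (i ∷ js) → u ≼ Π (i ∷ js) → s i ≼ u → ∀ {v} → Cone u v → Cone (s i · u) (pr i v)
  project {i} {js} {u} uq le p = Cone-map (pr-linear i) λ ρ pr′ q → let (L , al , eq) = simple-span uq le ρ pr′ q in root L al eq
    where
    open Linear (pr-linear i)
    le′ = initial-down uq p le
    one : ∀ τ → PosR τ → Δ (Below u) (ref τ) → Cone (s i · u) (pr i (vec τ))
    one τ pt dt = cases (ref τ ≟ s i)
      where
      cases : Dec (ref τ ≡ s i) → Cone (s i · u) (pr i (vec τ))
      cases (yes eq) = c0 (≋-trans (f-cong (≋-trans (proj₂ pb) (λ k → *-≈ ≈-refl (vec-σ i k)))) (≋-trans (f-• (proj₁ pb) (α i)) (λ k → ≈-trans (*-≈ ≈-refl (pr-α k)) (*-zeroʳ _))))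
        where
        pb = proportional τ (σ i) (trans eq (sym (ref-σ i)))
        pr-α : ∀ k → pr i (α i) k ≈ 0#
        pr-α k = ≈-trans (+-≈ (≈-sym (*-idˡ _)) (*-≈ (neg-≈ (α-same i)) ≈-refl)) (rsolve 2 (λ o a → o :* a :+ (:- o) :* a := con (ℤ+ 0)) ≈-refl 1# (α i k))
      cases (no ne) = Cone-resp (λ k → ≈-sym (≈-trans (+-≈ ≈-refl (≈-trans (*-≈ (≈-trans (neg-≈ z) neg-0) ≈-refl) (*-zeroˡ _))) (+-idʳ _))) (Cone-root τ pt τ≼)
        where
        τ≼ : ref τ ≼ (s i · u)
        τ≼ = initial-simple uq le p dt ne
        z : vec τ i ≈ 0#
        z = below-supp (AllPairs.tail uq) le′ τ τ≼ i (∉-tail uq)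
    root : ∀ (L : List (K × Rt)) {v} → All (λ (c , τ) → Nonneg c × PosR τ × Δ (Below u) (ref τ)) L → v ≋ foldr (λ (c , τ) v → c • vec τ ⊞ v) 0v L → Cone (s i · u) (pr i v)
    root [] [] eq = c0 (≋-trans (f-cong eq) (λ k → ≈-trans (+-≈ ≈-refl (≈-trans (*-≈ neg-0 ≈-refl) (*-zeroˡ _))) (+-idʳ 0#)))
    root ((c , τ) ∷ L) ((nc , pt , dt) ∷ al) eq = Cone-resp (≋-sym (≋-trans (f-cong eq) (≋-trans (f-⊞ _ _) (λ k → +-≈ (f-• c (vec τ) k) ≈-refl))))
      (Cone-⊞ (Cone-• c nc (one τ pt dt)) (root L al ≋-refl))

  rotate-out : ∀ {i u} → ¬ s i ≼ u → ∀ {v} → Cone u v → Cone (s i ^ u) (rf i v)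
  rotate-out {i} {u} np = Cone-map (rf-linear i) λ ρ p q → Cone-resp (vec-s▷ i ρ)
    (Cone-root (s i ▷ ρ) (Pos-resp (≋-sym (vec-▷ (s i) ρ)) (stays ρ i p (λ r → np (subst (_≼ u) r q)))) (subst (_≼ (s i ^ u)) (sym (ref-▷ (s i) ρ)) (≼-conj (s i) q)))

  -- By `pr-rf` the reflected vector is its projection plus a multiple of α_i, and the extra
  -- assumption is that this multiple is nonnegative.
  rotate-in : ∀ {i js u} → Unique (i ∷ js) → u ≼ Π (i ∷ js) → s i ≼ u → ∀ {v} → Nonneg (rf i v i) → Cone u v → Cone (s i ^ u) (rf i v)
  rotate-in {i} {js} {u} uq le p {v} nn c = Cone-resp (≋-sym (pr-rf i v)) (Cone-α i _ (s≼conj p) nn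
    (Cone-mono (λ ρ q → subst (_≼ (s i ^ u)) (^-e _) (Frame.fwd (frame-skip uq le p) (T-ref ρ) (≼-trans q (s·≼ p)))) (project uq le p c)))

  MeetResult : List (Fin n) → G → G → {I : Set} → (I → V) → Set
  MeetResult js v₁ v₂ X = ∃ λ z → z ≼ Π js × z ≼ v₁ × z ≼ v₂ × (∀ ι → Cone z (X ι))

  -- A common lower bound z whose cone contains a family of vectors lying in both cones. If the
  -- initial letter is below both elements, it is split off and the vectors are projected, leaving a
  -- shorter word. Otherwise everything is rotated: some cone moves by `rotate-out`, which keeps the
  -- vectors positive, and that positivity is what `rotate-in` needs for the other cone. If the
  -- first case does not occur within `rounds` steps, `stay-zero` makes all vectors zero and z = e
  -- works.
  meet : ∀ N js → length js ≡ N → Unique js → ∀ {v₁ v₂} → v₁ ≼ Π js → v₂ ≼ Π js → {I : Set} (X : I → V) →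
         (∀ ι → Cone v₁ (X ι)) → (∀ ι → Cone v₂ (X ι)) → MeetResult js v₁ v₂ X
  meet N [] len uq {v₁} {v₂} l₁ l₂ X c₁ c₂ = v₁ , l₁ , ≼-refl , subst (_≼ v₂) (sym (≼-e l₁)) (e≼ v₂) , c₁
  meet zero (i ∷ js) () uq l₁ l₂ X c₁ c₂
  meet (suc N) js₀@(_ ∷ _) len uq l₁ l₂ X c₁ c₂ = go (rounds js₀) js₀ len uq l₁ l₂ X c₁ c₂
      (λ st ι → stay-zero js₀ (X ι) uq (supp (c₁ ι)) (Cone-pos (c₁ ι)) (st ι))
    where
    supp : ∀ {v} → Cone _ v → Supp js₀ v
    supp (c0 p) k nin = p k
    supp (c+ ρ a x y z c q) k nin = ≈-trans (q k) (≈-trans (+-≈ (≈-trans (*-≈ ≈-refl (below-supp uq l₁ ρ y k nin)) (*-zeroʳ a)) (supp c k nin)) (+-idʳ 0#))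
    go : ∀ f js → length js ≡ suc N → Unique js → ∀ {v₁ v₂} → v₁ ≼ Π js → v₂ ≼ Π js → {I : Set} (X : I → V) →
         (∀ ι → Cone v₁ (X ι)) → (∀ ι → Cone v₂ (X ι)) → ((∀ ι → StayPos f js (X ι)) → ∀ ι → X ι ≋ 0v) → MeetResult js v₁ v₂ X
    go zero js len uq {v₁} {v₂} l₁ l₂ X c₁ c₂ H = e , e≼ _ , e≼ v₁ , e≼ v₂ , λ ι → c0 (H (λ _ → tt) ι)
    go (suc f) (i ∷ js) len uq {v₁} {v₂} l₁ l₂ X c₁ c₂ H = cases (s i ≼? v₁) (s i ≼? v₂)
      where
      rotated : (∀ ι → Cone (s i ^ v₁) (rf i (X ι))) → (∀ ι → Cone (s i ^ v₂) (rf i (X ι))) → (∀ {z} → z ≼ (s i ^ v₁) → z ≼ (s i ^ v₂) → ¬ s i ≼ z) → MeetResult (i ∷ js) v₁ v₂ X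
      rotated d₁ d₂ ns = back (go f (js ∷ʳ i) (trans (Listₚ.length-++-comm js (i ∷ [])) len) (Unique-rot uq) (rot-≼ js l₁) (rot-≼ js l₂) (λ ι → rf i (X ι)) d₁ d₂
          (λ st ι → ≋-trans (rf-cong i (H (λ ι → Cone-pos (d₁ ι) , st ι) ι)) (λ k → ≈-trans (≈-sym (act-s i 0v k)) (act-0 (s i) k))))
        where
        back : MeetResult (js ∷ʳ i) (s i ^ v₁) (s i ^ v₂) (λ ι → rf i (X ι)) → MeetResult (i ∷ js) v₁ v₂ X
        back (z , zc , z₁ , z₂ , cz) = s i ^ z
          , subst ((s i ^ z) ≼_) (trans (cong (s i ^_) (Π-rot i js)) (cc i _)) (≼-conj (s i) zc)
          , subst ((s i ^ z) ≼_) (cc i v₁) (≼-conj (s i) z₁) , subst ((s i ^ z) ≼_) (cc i v₂) (≼-conj (s i) z₂)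
          , λ ι → Cone-resp (rf-rf i (X ι)) (rotate-out (ns z₁ z₂) (cz ι))
      cases : Dec (s i ≼ v₁) → Dec (s i ≼ v₂) → MeetResult (i ∷ js) v₁ v₂ X
      cases (yes p₁) (yes p₂) = up (meet N js (ℕₚ.suc-injective len) (AllPairs.tail uq) (initial-down uq p₁ l₁) (initial-down uq p₂ l₂) (λ ι → pr i (X ι))
            (λ ι → project uq l₁ p₁ (c₁ ι)) (λ ι → project uq l₂ p₂ (c₂ ι)))
        where
        up : MeetResult js (s i · v₁) (s i · v₂) (λ ι → pr i (X ι)) → MeetResult (i ∷ js) v₁ v₂ X
        up (z , zc , z₁ , z₂ , cz) = s i · z , proj₁ iu , below p₁ z₁ , below p₂ z₂ ,
            λ ι → Cone-resp (≋-sym (pr-add i (X ι))) (Cone-α i _ (s≼s· (proj₂ iu)) (Cone-pos (c₁ ι) i) (Cone-mono (λ ρ q → ≼-trans q z≼sz) (cz ι)))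
          where
          iu = initial-up uq zc
          below : ∀ {v} → s i ≼ v → z ≼ (s i · v) → (s i · z) ≼ v
          below {v} p q = subst ((s i · z) ≼_) (s-cancelˡ v i) (s·-mono (proj₂ iu) (trans (cong lT (s-cancelˡ v i)) (sym (s-lT p))) q)
          z≼sz : z ≼ (s i · z)
          z≼sz = subst (_≼ (s i · z)) (s-cancelˡ z i) (s·≼ (s≼s· (proj₂ iu)))
      cases (no n₁) (no n₂) = rotated (λ ι → rotate-out n₁ (c₁ ι)) (λ ι → rotate-out n₂ (c₂ ι)) (λ z₁ z₂ q → n₁ (s≼unconj (≼-trans q z₁)))
      cases (no n₁) (yes p₂) = rotated (λ ι → rotate-out n₁ (c₁ ι)) (λ ι → rotate-in uq l₂ p₂ (Cone-pos (rotate-out n₁ (c₁ ι)) i) (c₂ ι)) (λ z₁ z₂ q → n₁ (s≼unconj (≼-trans q z₁)))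
      cases (yes p₁) (no n₂) = rotated (λ ι → rotate-in uq l₁ p₁ (Cone-pos (rotate-out n₂ (c₂ ι)) i) (c₁ ι)) (λ ι → rotate-out n₂ (c₂ ι)) (λ z₁ z₂ q → n₂ (s≼unconj (≼-trans q z₂)))

  cone-below : ∀ {js u} → Unique js → u ≼ Π js → ∀ ρ → SuppR js ρ → Cone u (vec ρ) → ref ρ ≼ u
  cone-below {js} {u} uq le ρ sp c = orth⇒below uq F ρ sp (All.tabulate (λ {z} m → orth z m c))
    where
    F = fac uq le
    orth : ∀ z → z ∈ Fac.zs F → ∀ {v} → Cone u v → E js (vec z) v ≈ 0#
    orth z m (c0 p) = ≈-trans (E-cong js {vec z} ≋-refl p) (E-0ʳ js (vec z) 0v (λ _ _ → ≈-refl))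
    orth z m (c+ {v} τ a x y n c q) = ≈-trans (E-cong js {vec z} ≋-refl q) (≈-trans (E-⊞ʳ js (vec z) (a • vec τ) v)
      (≈-trans (+-≈ (≈-trans (E-•ʳ js (vec z) a (vec τ)) (≈-trans (*-≈ ≈-refl (All.lookup (proj₂ (below⇒orth uq F τ y)) m)) (*-zeroʳ a))) (orth z m c)) (+-idʳ 0#)))

  Dominates : G → G → Set
  Dominates w u = ∀ ρ → ref ρ ≼ w → ref ρ ≼ u

  Dominates? : ∀ w u → Dec (Dominates w u)
  Dominates? w u with All.all? (λ h → Finₚ.all? (λ i → (ref (h , i) ≼? w) →-dec (ref (h , i) ≼? u))) elems
  ... | yes p = yes (λ (h , i) → All.lookup p (complete h) i)
  ... | no np = no (λ f → np (All.tabulate (λ {h} _ i → f (h , i))))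

  Full : List (Fin n) → Set
  Full js = ∀ k → k ∈ js

  full-supp : ∀ {js} → Full js → ∀ v → Supp js v
  full-supp f v k nin = ⊥-elim (nin (f k))

  supp-below : ∀ js → Unique js → ∀ ρ → SuppR js ρ → ref ρ ≼ Π js
  supp-below js uq ρ sp = orth⇒below uq (record { xs = map σ js ; zs = [] ; eq-u = words js ; eq-c = trans (words js) (sym (idʳ _))
                                                ; len = trans (ℕₚ.+-identityʳ _) (Listₚ.length-map σ js) }) ρ sp []
    where
    words : ∀ js → Π js ≡ prodR (map σ js)
    words [] = refl
    words (i ∷ js) = cong₂ _·_ (sym (ref-σ i)) (words js)

  all-below : ∀ js → Unique js → Full js → ∀ ρ → ref ρ ≼ Π js
  all-below js uq f ρ = supp-below js uq ρ (full-supp f _)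

  -- Take a dominating element of least reflection length. Its meet with another dominating u
  -- contains the roots below w in its cone, so by `cone-below` it dominates again and by minimality
  -- is the chosen element.
  π-exists : ∀ js → Unique js → Full js → ∀ w → ∃ λ p → p ≼ Π js × Dominates w p × (∀ u → u ≼ Π js → Dominates w u → p ≼ u)
  π-exists js uq f w = build (least (λ k → Any.any? (λ u → (u ≼? Π js) ×-dec Dominates? w u ×-dec (lT u ℕₚ.≟ k)) elems)
      -- The Coxeter element itself dominates w and starts the search.
      (lT (Π js) , lose (complete (Π js)) (≼-refl , (λ ρ _ → all-below js uq f ρ) , refl)))
    where
    Val : ℕ → Set
    Val k = Any (λ u → u ≼ Π js × Dominates w u × lT u ≡ k) elems
    build : (∃ λ k → Val k × (∀ j → Val j → k ≤ j)) → ∃ λ p → p ≼ Π js × Dominates w p × (∀ u → u ≼ Π js → Dominates w u → p ≼ u)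
    build (k , v , mn) with find v
    ... | p , _ , pc , dp , lp = p , pc , dp , λ u uc du → minimal u (meet _ js refl uq pc uc X (λ (ρ , pr , q) → Cone-root ρ pr (dp ρ q)) (λ (ρ , pr , q) → Cone-root ρ pr (du ρ q)))
      where
      X : (Σ Rt λ ρ → PosR ρ × ref ρ ≼ w) → V
      X (ρ , _) = vec ρ
      minimal : ∀ u → MeetResult js p u X → p ≼ u
      minimal u (z , zc , zp , zu , cz) = subst (_≼ u) (≼-same zp (ℕₚ.≤-antisym (≼-≤ zp) (subst (_≤ lT z) (sym lp) (mn (lT z) (lose (complete z) (zc , dz , refl)))))) zu
        where
        dz : Dominates w z
        dz ρ q with posRep ρ
        ... | τ , pr , eq = subst (_≼ z) eq (cone-below uq zc τ (full-supp f _) (cz (τ , pr , subst (_≼ w) (sym eq) q)))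

-- Reduced words, inversions and blocks of commuting letters

∉-prefix : ∀ {A : Set} {x : A} xs {ys} → Unique (xs ++ x ∷ ys) → x ∉ xs
∉-prefix (a ∷ xs) (ne ∷ uq) (here refl) = All.lookup ne (∈-++⁺ʳ xs (here refl)) refl
∉-prefix (a ∷ xs) (ne ∷ uq) (there q) = ∉-prefix xs uq q

nots : ℕ → Bool → Bool
nots zero    b = b
nots (suc k) b = not (nots k b)

nots-not : ∀ k b → nots k (not b) ≡ not (nots k b)
nots-not zero b = refl
nots-not (suc k) b = cong not (nots-not k b)

nots-invol : ∀ k b → nots k (nots k b) ≡ b
nots-invol zero b = refl
nots-invol (suc k) b = trans (cong not (nots-not k (nots k b))) (trans (Boolₚ.not-involutive _) (nots-invol k b))

b≢not : ∀ b → b ≢ not b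
b≢not true ()
b≢not false ()

module Words (Y : System) where
  open Meet Y public

  Reduced : List (Fin n) → Set
  Reduced w = ℓ (Π w) ≡ length w

  reduced-snoc : ∀ w i → Reduced w → Pos (act (Π w) (α i)) → Reduced (w ∷ʳ i)
  reduced-snoc w i r p = trans (cong ℓ (Π-∷ʳ w i)) (trans (ℕₚ.≤-antisym (ℕₚ.≤-trans (ℓ-·s (Π w) i) (s≤s (ℕₚ.≤-reflexive r))) up) (sym (Listₚ.length-++-comm w (i ∷ []))))
    where
    up : suc (length w) ≤ ℓ (Π w · s i)
    up with sgn (Π w) i
    ... | inj₁ (_ , lt) = subst (λ k → suc k ≤ ℓ (Π w · s i)) r lt
    ... | inj₂ (q , _) = ⊥-elim (posneg⊥ (Π w) i p q)

  ℓ-++ : ∀ g w → ℓ (g · Π w) ≤ ℓ g ℕ.+ length w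
  ℓ-++ g w = ℕₚ.≤-trans (ℓ-≤ (g · Π w) (word g ++ w) (trans (cong (_· Π w) (Π-word g)) (sym (Π-++ (word g) w)))) (ℕₚ.≤-reflexive (trans (Listₚ.length-++ (word g)) (cong (ℕ._+ length w) (length-word g))))

  reduced-prefix : ∀ w z → Reduced (w ++ z) → Reduced w
  reduced-prefix w z r = ℕₚ.≤-antisym (ℓ-min w) (ℕₚ.+-cancelʳ-≤ (length z) (length w) (ℓ (Π w))
    (ℕₚ.≤-trans (ℕₚ.≤-reflexive (trans (sym (Listₚ.length-++ w)) (trans (sym r) (cong ℓ (Π-++ w z))))) (ℓ-++ (Π w) z)))

  reduced-pos : ∀ w i z → Reduced (w ++ i ∷ z) → Pos (act (Π w) (α i))
  reduced-pos w i z r with sgn (Π w) i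
  ... | inj₁ (p , _) = p
  ... | inj₂ (_ , lt) = ⊥-elim (ℕₚ.<-asym lt (subst₂ _<_ (sym (reduced-prefix w (i ∷ z) r)) (trans (sym len) (trans (sym r₁) (cong ℓ (Π-∷ʳ w i)))) (ℕₚ.n<1+n _)))
    where
    r₁ : Reduced (w ∷ʳ i)
    r₁ = reduced-prefix (w ∷ʳ i) z (subst Reduced (sym (Listₚ.++-assoc w (i ∷ []) z)) r)
    len : length (w ∷ʳ i) ≡ suc (length w)
    len = Listₚ.length-++-comm w (i ∷ [])

  AllNeg : G → Set
  AllNeg g = ∀ i → Neg (act g (α i))

  allNeg-inv : ∀ g → AllNeg g → AllNeg (inv g)
  allNeg-inv g p i with sgn (inv g) i
  ... | inj₂ (q , _) = q
  ... | inj₁ (q , _) = ⊥-elim (α≉0 i (Pos-anti (α-pos i) (Neg-resp (act-inv′ g (α i)) (neg-act-pos g _ q p))))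

  allNeg-unique : ∀ g h → AllNeg g → AllNeg h → g ≡ h
  allNeg-unique g h p q = trans (gsolve 2 (λ g h → g ⊜ (g ⊙ h ⁻ ⊙ h)) refl g h) (trans (cong (_· h) (noDescent (g · inv h) pos)) (idˡ h))
    where
    pos : ∀ i → Pos (act (g · inv h) (α i))
    pos i = Pos-resp (≋-trans (⊟-cong (act-⊟ g _)) (≋-trans (⊟⊟ _) (≋-sym (act-· g (inv h) (α i)))))
              (neg-act-pos g (⊟ act (inv h) (α i)) (allNeg-inv h q i) p)

  -- the left inversions of w, if w is reduced
  refs : List (Fin n) → List G
  refs []      = []
  refs (i ∷ w) = s i ∷ map (s i ^_) (refs w)

  refs-delete : ∀ w t → t ∈ refs w → ∃ λ w⁻ → length w ≡ suc (length w⁻) × t · Π w ≡ Π w⁻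
  refs-delete (i ∷ w) t (here refl) = w , refl , s-cancelˡ (Π w) i
  refs-delete (i ∷ w) t (there m) with ∈-map⁻ (s i ^_) m
  ... | t′ , m′ , refl with refs-delete w t′ m′
  ... | w⁻ , l , p = i ∷ w⁻ , cong suc l , trans (gsolve 3 (λ a t w → (a ⊙ t ⊙ a ⁻ ⊙ (a ⊙ w)) ⊜ (a ⊙ (t ⊙ w))) refl (s i) t′ (Π w)) (cong (s i ·_) p)

  refs-unique : ∀ w → Reduced w → Unique (refs w)
  refs-unique [] r = []
  refs-unique (i ∷ w) r = Allₚ.map⁺ (All.tabulate (λ {t} m eq → notin (subst (_∈ refs w) (fixed t eq) m))) ∷ Uniqueₚ.map⁺ inj (refs-unique w rw)
    where
    inj : ∀ {x y} → s i ^ x ≡ s i ^ y → x ≡ y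
    inj {x} {y} p = trans (sym (cc i x)) (trans (cong (s i ^_) p) (cc i y))
    fixed : ∀ t → s i ≡ s i ^ t → t ≡ s i
    fixed t eq = inj (trans (sym eq) (sym (s-conj-s i)))
    ℓ-s· : ∀ g → ℓ (s i · g) ≤ suc (ℓ g)
    ℓ-s· g = ℕₚ.≤-trans (ℓ-≤ (s i · g) (i ∷ word g) (cong (s i ·_) (Π-word g))) (ℕₚ.≤-reflexive (cong suc (length-word g)))
    rw : Reduced w
    rw = ℕₚ.≤-antisym (ℓ-min w) (ℕₚ.≤-pred (ℕₚ.≤-trans (ℕₚ.≤-reflexive (sym r)) (ℓ-s· (Π w))))
    notin : s i ∉ refs w
    notin m with refs-delete w (s i) m
    ... | w⁻ , l , p = ℕₚ.<⇒≱ (ℕₚ.≤-trans (s≤s (ℓ-≤ (s i · Π w) w⁻ p)) (ℕₚ.≤-reflexive (sym l))) (ℕₚ.≤-trans (ℕₚ.n≤1+n _) (ℕₚ.≤-reflexive (sym r)))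

  refs-complete : ∀ w ρ → PosR ρ → Neg (act (inv (Π w)) (vec ρ)) → ref ρ ∈ refs w
  refs-complete [] ρ p q = ⊥-elim (sign⊥ (inv e) ρ (Pos-resp (≋-sym (≋-trans (act-≡ (vec ρ) inv-e) (act-e _))) p) q)
  refs-complete (i ∷ w) ρ p q = cases (ref ρ ≟ s i)
    where
    cases : Dec (ref ρ ≡ s i) → ref ρ ∈ refs (i ∷ w)
    cases (yes eq) = here eq
    cases (no ne) = there (subst (_∈ map (s i ^_) (refs w)) (trans (cong (s i ^_) (ref-▷ (s i) ρ)) (cc i (ref ρ)))
      (∈-map⁺ (s i ^_) (refs-complete w (s i ▷ ρ) (Pos-resp (≋-sym (vec-▷ (s i) ρ)) (stays ρ i p ne))
        (Neg-resp (≋-trans (act-≡ (vec ρ) (trans (inv-· (s i) (Π w)) (cong (inv (Π w) ·_) (inv-s i)))) (≋-trans (act-· (inv (Π w)) (s i) (vec ρ)) (act-cong (inv (Π w)) (≋-sym (vec-▷ (s i) ρ))))) q))))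

  extend : ∀ w → Reduced w → ∃ λ z → Reduced (w ++ z) × AllNeg (Π (w ++ z))
  extend w r = go (ℓ w₀) w r (ℕₚ.m≤m+n _ _)
    where
    go : ∀ f w → Reduced w → ℓ w₀ ≤ f ℕ.+ length w → ∃ λ z → Reduced (w ++ z) × AllNeg (Π (w ++ z))
    go f w r b with Finₚ.any? (λ i → ℓ (Π w) ℕₚ.<? ℓ (Π w · s i))
    ... | no np = [] , subst Reduced (sym (Listₚ.++-identityʳ w)) r , subst (AllNeg ∘ Π) (sym (Listₚ.++-identityʳ w)) neg
      where
      neg : AllNeg (Π w)
      neg i with sgn (Π w) i
      ... | inj₁ (_ , lt) = ⊥-elim (np (i , lt))
      ... | inj₂ (q , _) = q
    go zero w r b | yes (i , lt) = ⊥-elim (ℕₚ.<⇒≱ lt (ℕₚ.≤-trans (proj₂ longest _) (ℕₚ.≤-trans b (ℕₚ.≤-reflexive (sym r)))))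
    go (suc f) w r b | yes (i , lt) with go f (w ∷ʳ i) (reduced-snoc w i r pos) (ℕₚ.≤-trans b (ℕₚ.≤-reflexive (trans (sym (ℕₚ.+-suc f (length w))) (cong (f ℕ.+_) (sym (Listₚ.length-++-comm w (i ∷ [])))))))
      where
      pos : Pos (act (Π w) (α i))
      pos with sgn (Π w) i
      ... | inj₁ (p , _) = p
      ... | inj₂ (_ , gt) = ⊥-elim (ℕₚ.<-asym lt gt)
    ... | z , rz , nz = i ∷ z , subst Reduced (Listₚ.++-assoc w (i ∷ []) z) rz , subst (AllNeg ∘ Π) (Listₚ.++-assoc w (i ∷ []) z) nz

  -- Coordinate i of s_j s_i α_j is `adj i j` and that of s_i s_j α_j is its negative. A nonnegative
  -- scalar equal to its negative vanishes, so m i j need not be determined.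
  commuting-adj : ∀ {i j} → i ≢ j → s i · s j ≡ s j · s i → adj i j ≈ 0#
  commuting-adj {i} {j} ne eq = nn-anti (adj-nn i j) (nn-resp (≈-trans (≈-sym lhs) (≈-trans (≈-trans (≈-sym (act-· (s j) (s i) (α j) i)) (≈-trans (act-≡ (α j) (sym eq) i) (act-· (s i) (s j) (α j) i))) rhs)) (adj-nn i j))
    where
    at-i : act (s i) (α j) i ≈ adj i j
    at-i = ≈-trans (act-s i (α j) i) (≈-trans (rf-at i (α j)) (≈-trans (+-≈ (N-α i j) (≈-trans (neg-≈ (α-diff ne)) neg-0)) (+-idʳ _)))
    lhs : act (s j) (act (s i) (α j)) i ≈ adj i j
    lhs = ≈-trans (act-s j _ i) (≈-trans (rf-off _ ne) at-i)
    rhs : act (s i) (act (s j) (α j)) i ≈ - adj i j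
    rhs = ≈-trans (act-cong (s i) (act-s-α j) i) (≈-trans (act-⊟ (s i) (α j) i) (neg-≈ at-i))

  actw-fix : ∀ w i → i ∉ w → All (λ j → adj j i ≈ 0#) w → actw w (α i) ≋ α i
  actw-fix [] i nin p = ≋-refl
  actw-fix (j ∷ w) i nin (p ∷ ps) k = ≈-trans (rf-cong j (actw-fix w i (nin ∘ there) ps) k)
    (≈-trans (+-≈ ≈-refl (≈-trans (neg-≈ (≈-trans (*-≈ (≈-trans (y-αdiff {j} {i} (λ eq → nin (here (sym eq)))) (≈-trans (neg-≈ p) neg-0)) ≈-refl) (*-zeroˡ _))) neg-0)) (+-idʳ _))

  Nonadjacent : List (Fin n) → Set
  Nonadjacent w = ∀ {i j} → i ∈ w → j ∈ w → adj i j ≈ 0#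

  -- The letters of a block do not see each other, so their product changes all coordinates of the
  -- block simultaneously.
  block-on : ∀ w → Nonadjacent w → Unique w → ∀ v k → k ∈ w → actw w v k ≈ N k v - v k
  block-on (i ∷ w) na uq v .i (here refl) = ≈-trans (rf-at i (actw w v)) (+-≈ (∑-cong {n} {λ j → adj i j * actw w v j} {λ j → adj i j * v j} (λ j → term j (mem? Fin._≟_ j w))) (neg-≈ (fixes-coord w (∉-tail uq) v)))
    where
    term : ∀ j → Dec (j ∈ w) → adj i j * actw w v j ≈ adj i j * v j
    term j (yes q) = ≈-trans (*-≈ (na (here refl) (there q)) ≈-refl) (≈-trans (*-zeroˡ _) (≈-sym (≈-trans (*-≈ (na (here refl) (there q)) ≈-refl) (*-zeroˡ _))))
    term j (no nq) = *-≈ ≈-refl (fixes-coord w nq v)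
  block-on (i ∷ w) na uq v k (there q) = ≈-trans (rf-off (actw w v) (λ eq → ∉-tail uq (subst (_∈ w) eq q))) (block-on w (λ a b → na (there a) (there b)) (AllPairs.tail uq) v k q)

  block-flip : ∀ w → Nonadjacent w → Unique w → ∀ i → i ∈ w → act (Π w) (α i) ≋ ⊟ α i
  block-flip w na uq i q k = ≈-trans (act-Π w refl (α i) k) (cases (mem? Fin._≟_ k w))
    where
    cases : Dec (k ∈ w) → actw w (α i) k ≈ - α i k
    cases (yes p) = ≈-trans (block-on w na uq (α i) k p) (≈-trans (+-≈ (≈-trans (N-α k i) (na p q)) ≈-refl) (+-idˡ _))
    cases (no np) = ≈-trans (fixes-coord w np (α i)) (≈-trans z (≈-sym (≈-trans (neg-≈ z) neg-0)))
      where z = α-diff {i} {k} (λ eq → np (subst (_∈ w) (sym eq) q))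

  -- No letter after i is adjacent to i, so the row of i in the form consists of its diagonal entry.
  E-block : ∀ w₁ i w₂ z → i ∉ w₁ → i ∉ w₂ → All (λ k → adj i k ≈ 0#) w₂ → E (w₁ ++ i ∷ w₂) (α i) z ≈ z i
  E-block [] i w₂ z n₁ n₂ p = ≈-trans (+-≈ (≈-trans (*-≈ (α-same i) ≈-refl) (≈-trans (*-idˡ _) (≈-trans (+-≈ ≈-refl (≈-trans (neg-≈ (nl w₂ p)) neg-0)) (+-idʳ _)))) (E-0ˡ w₂ (α i) z (α-∉ n₂))) (+-idʳ _)
    where
    nl : ∀ w → All (λ k → adj i k ≈ 0#) w → Nl i w z ≈ 0#
    nl [] [] = ≈-refl
    nl (k ∷ w) (p ∷ ps) = ≈-trans (+-≈ (≈-trans (*-≈ p ≈-refl) (*-zeroˡ _)) (nl w ps)) (+-idʳ 0#)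
  E-block (k ∷ w₁) i w₂ z n₁ n₂ p = ≈-trans (E-tail k (w₁ ++ i ∷ w₂) (α i) z (α-diff (λ eq → n₁ (here (sym eq))))) (E-block w₁ i w₂ z (n₁ ∘ there) n₂ p)

  preserves : ∀ w i → (∀ ρ → ref ρ ≼ w → vec ρ i ≈ 0#) → ∀ v → act w v i ≈ v i
  preserves w i z v = ≈-trans (act-≡ v (prod-fact w) i) (go (fact w) coords v)
    where
    coords : All (λ ρ → vec ρ i ≈ 0#) (fact w)
    coords = All.map (λ {ρ} le → z ρ (subst (ref ρ ≼_) (sym (prod-fact w)) le)) (factor-≼ (fact w) (trans (length-fact w) (cong lT (prod-fact w))))
    go : ∀ ρs → All (λ ρ → vec ρ i ≈ 0#) ρs → ∀ v → act (prodR ρs) v i ≈ v i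
    go [] [] v = act-e v i
    go (ρ ∷ ρs) (p ∷ ps) v = ≈-trans (act-· (ref ρ) (prodR ρs) v i) (≈-trans (act-ref ρ _ i)
      (≈-trans (+-≈ (go ρs ps v) (≈-trans (*-≈ ≈-refl p) (*-zeroʳ _))) (+-idʳ _)))

  -- Unlike `supp-fact`, this takes an arbitrary word for w and an arbitrary reflection below w, put
  -- first in a reduced factorisation to which `parabolic` applies.
  word-gen : ∀ {w} js → w ≡ Π js → ∀ ρ → ref ρ ≼ w → Gen (Letter js) (ref ρ)
  word-gen {w} js eq ρ le = All.head (proj₁ (parabolic T-closed Letter-Δ (map ref ρs) (map s js)
      (Red-fact ρs (trans (trans (cong suc (trans (length-fact _) (lT-comm (ref ρ) w))) (trans (ℕₚ.+-comm 1 _) (trans (cong (lT (w · inv (ref ρ)) ℕ.+_) (sym (lT-refl ρ))) le))) (cong lT eqn)))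
      (T-rts ρs) (letters js) (trans (sym eqn) (trans eq (sym (prodG-s js))))))
    where
    ρs = ρ ∷ fact (inv (ref ρ) · w)
    eqn : w ≡ prodR ρs
    eqn = trans (gsolve 2 (λ r u → u ⊜ (r ⊙ (r ⁻ ⊙ u))) refl (ref ρ) w) (cong (ref ρ ·_) (prod-fact (inv (ref ρ) · w)))

  word-supp : ∀ {w} js → w ≡ Π js → ∀ ρ → ref ρ ≼ w → Supp js (vec ρ)
  word-supp js eq ρ le = gen-supp ρ (word-gen js eq ρ le)

  gen-word : ∀ {js g} → Gen (Letter js) g → ∃ λ w → All (_∈ js) w × g ≡ Π w
  gen-word {js} (ds , ls , refl) = go ds ls
    where
    go : ∀ ds → All (Letter js) ds → ∃ λ w → All (_∈ js) w × prodG ds ≡ Π w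
    go [] [] = [] , [] , refl
    go (d ∷ ds) ((j , q , refl) ∷ ls) = j ∷ proj₁ (go ds ls) , q ∷ proj₁ (proj₂ (go ds ls)) , cong (s j ·_) (proj₂ (proj₂ (go ds ls)))

  gen-dominated : ∀ js w → (∀ ρ → ref ρ ≼ w → Gen (Letter js) (ref ρ)) → Gen (Letter js) w
  gen-dominated js w g = subst (Gen (Letter js)) (sym (prod-fact w)) (go (fact w) (All.map (λ {ρ} le → g ρ (subst (ref ρ ≼_) (sym (prod-fact w)) le)) (factor-≼ (fact w) (trans (length-fact w) (cong lT (prod-fact w))))))
    where
    go : ∀ ρs → All (λ ρ → Gen (Letter js) (ref ρ)) ρs → Gen (Letter js) (prodR ρs)
    go [] [] = [] , [] , refl
    go (ρ ∷ ρs) (p ∷ ps) = Gen-· p (go ρs ps)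

-- Alternating products of the two bipartite blocks

module Bipartite (Y : System) (col : Fin (Words.n Y) → Bool) (L : Bool → List (Fin (Words.n Y)))
  (L-unique : ∀ b → Unique (L b)) (L-col : ∀ b → All (λ i → col i ≡ b) (L b)) (L-mem : ∀ i → i ∈ L (col i))
  (adj0 : ∀ i j → col i ≡ col j → Words._≈_ Y (Words.adj Y i j) (Words.0# Y))
  (connected : ∀ i j → Star (λ i j → 3 ≤ Words.m Y i j) i j) where
  open Words Y

  cb : Bool → G
  cb b = Π (L b)

  altw : Bool → ℕ → List (Fin n)
  altw b zero    = []
  altw b (suc k) = L b ++ altw (not b) k

  Alt : Bool → ℕ → G
  Alt b k = Π (altw b k)

  Alt-suc : ∀ b k → Alt b (suc k) ≡ cb b · Alt (not b) k
  Alt-suc b k = Π-++ (L b) (altw (not b) k)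

  altw-snoc : ∀ b k → altw b (suc k) ≡ altw b k ++ L (nots k b)
  altw-snoc b zero = Listₚ.++-identityʳ (L b)
  altw-snoc b (suc k) = trans (cong (L b ++_) (trans (altw-snoc (not b) k) (cong (λ c → altw (not b) k ++ L c) (nots-not k b)))) (sym (Listₚ.++-assoc (L b) (altw (not b) k) (L (not (nots k b)))))

  Col : Bool → V → Set
  Col b v = ∀ k → col k ≢ b → v k ≈ 0#

  A : V → V
  A v k = N k v

  N-col : ∀ {b v} k → col k ≡ b → Col b v → N k v ≈ 0#
  N-col {b} {v} k ck p = ∑-0 (λ j → adj k j * v j) term
    where
    term : ∀ j → adj k j * v j ≈ 0#
    term j with col j Boolₚ.≟ b
    ... | yes q = ≈-trans (*-≈ (adj0 k j (trans ck (sym q))) ≈-refl) (*-zeroˡ _)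
    ... | no nq = ≈-trans (*-≈ ≈-refl (p j nq)) (*-zeroʳ _)

  ≢not : ∀ {a b : Bool} → a ≢ b → a ≡ not b
  ≢not {a} {b} = Boolₚ.¬-not

  A-col : ∀ {b v} → Col b v → Col (not b) (A v)
  A-col {b} {v} p k ne = N-col k (trans (≢not ne) (Boolₚ.not-involutive b)) p

  L-nonadjacent : ∀ b → Nonadjacent (L b)
  L-nonadjacent b p q = adj0 _ _ (trans (All.lookup (L-col b) p) (sym (All.lookup (L-col b) q)))

  cb-on : ∀ b v k → col k ≡ b → act (cb b) v k ≈ N k v - v k
  cb-on b v k ck = ≈-trans (act-Π (L b) refl v k) (block-on (L b) (L-nonadjacent b) (L-unique b) v k (subst (λ c → k ∈ L c) ck (L-mem k)))

  cb-off : ∀ b v k → col k ≢ b → act (cb b) v k ≈ v k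
  cb-off b v k ne = ≈-trans (act-Π (L b) refl v k) (fixes-coord (L b) (λ m → ne (All.lookup (L-col b) m)) v)

  -- The Chebyshev polynomial p_k evaluated at the adjacency operator `A` of the whole diagram.
  Pv : ℕ → V → V
  Pv zero          v = 0v
  Pv (suc zero)    v = v
  Pv (suc (suc k)) v = A (Pv (suc k) v) ⊞ ⊟ Pv k v

  α-col : ∀ i → Col (col i) (α i)
  α-col i k ne = α-diff (λ eq → ne (cong col eq))

  Pv-col : ∀ k i → Col (nots k (col i)) (Pv (suc k) (α i))
  Pv-col zero i = α-col i
  Pv-col (suc zero) i j ne = ≈-trans (+-≈ (A-col (α-col i) j ne) neg-0) (+-idʳ 0#)
  Pv-col (suc (suc k)) i j ne = ≈-trans (+-≈ (A-col (Pv-col (suc k) i) j ne) (≈-trans (neg-≈ (Pv-col k i j (λ q → ne (trans q (sym (Boolₚ.not-involutive _)))))) neg-0)) (+-idʳ 0#)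

  Pv-col′ : ∀ k i → Col (not (nots k (col i))) (Pv k (α i))
  Pv-col′ zero i j ne = ≈-refl
  Pv-col′ (suc k) i j ne = Pv-col k i j (λ q → ne (trans q (sym (Boolₚ.not-involutive _))))

  -- The letter i has the colour of the block that would come next. A block put in front replaces
  -- the coordinates of its colour by those of `A` minus themselves and fixes the rest; as
  -- consecutive Chebyshev terms live on opposite colours, this is one step of the recursion.
  act-Alt : ∀ k b i → col i ≡ nots k b → act (Alt b k) (α i) ≋ Pv (suc k) (α i) ⊞ Pv k (α i)
  act-Alt zero b i ci j = ≈-trans (act-e (α i) j) (≈-sym (+-idʳ _))
  act-Alt (suc k) b i ci j = ≈-trans (act-≡ (α i) (Alt-suc b k) j) (≈-trans (act-· (cb b) (Alt (not b) k) (α i) j) (≈-trans (act-cong (cb b) (act-Alt k (not b) i (trans ci (sym (nots-not k b)))) j) (cases (col j Boolₚ.≟ b))))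
    where
    x = Pv (suc k) (α i)
    z = Pv k (α i)
    cx : nots k (col i) ≡ not b
    cx = trans (cong (nots k) ci) (trans (nots-not k (nots k b)) (cong not (nots-invol k b)))
    x-col : Col (not b) x
    x-col = subst (λ c → Col c x) cx (Pv-col k i)
    z-col : Col b z
    z-col = subst (λ c → Col c z) (trans (cong not cx) (Boolₚ.not-involutive b)) (Pv-col′ k i)
    cases : Dec (col j ≡ b) → act (cb b) (x ⊞ z) j ≈ Pv (suc (suc k)) (α i) j + x j
    cases (yes q) = ≈-trans (cb-on b (x ⊞ z) j q) (≈-trans (+-≈ (≈-trans (N-⊞ j x z) (≈-trans (+-≈ ≈-refl (N-col j q z-col)) (+-idʳ _))) (neg-≈ (≈-trans (+-≈ xj0 ≈-refl) (+-idˡ _))))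
        (≈-sym (≈-trans (+-≈ ≈-refl xj0) (+-idʳ _))))
      where xj0 = x-col j (λ r → b≢not b (trans (sym q) r))
    cases (no nq) = ≈-trans (cb-off b (x ⊞ z) j nq) (≈-trans (+-≈ ≈-refl (z-col j nq)) (≈-trans (+-commut _ _)
        (+-≈ (≈-sym (Pv-col (suc k) i j (λ r → nq (trans r (trans (cong not cx) (Boolₚ.not-involutive b)))))) ≈-refl)))

  -- The two terms live on opposite colours, so each coordinate of the sum belongs to only one of
  -- them.
  sep : ∀ k i (S : K → Set) → (∀ {a c} → a ≈ c → S a → S c) → S 0# → (∀ j → S ((Pv (suc k) (α i) ⊞ Pv k (α i)) j)) → (∀ j → S (Pv (suc k) (α i) j)) × (∀ j → S (Pv k (α i) j))
  sep k i S resp S0 p = (λ j → one j (col j Boolₚ.≟ nots k (col i))) , (λ j → two j (col j Boolₚ.≟ nots k (col i)))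
    where
    one : ∀ j → Dec (col j ≡ nots k (col i)) → S (Pv (suc k) (α i) j)
    one j (yes q) = resp (≈-trans (+-≈ ≈-refl (Pv-col′ k i j (λ r → b≢not _ (trans (sym q) r)))) (+-idʳ _)) (p j)
    one j (no nq) = resp (≈-sym (Pv-col k i j nq)) S0
    two : ∀ j → Dec (col j ≡ nots k (col i)) → S (Pv k (α i) j)
    two j (yes q) = resp (≈-sym (Pv-col′ k i j (λ r → b≢not _ (trans (sym q) r)))) S0
    two j (no nq) = resp (≈-trans (+-≈ (Pv-col k i j nq) ≈-refl) (+-idˡ _)) (p j)

  -- The first colour for which i belongs to the block following k blocks.
  start : ℕ → Fin n → Bool
  start k i = nots k (col i)

  start-ok : ∀ k i → col i ≡ nots k (start k i)
  start-ok k i = sym (nots-invol k (col i))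

  Bad : ℕ → Set
  Bad k = ∃ λ i → ℓ (Alt (start k i) k · s i) < ℓ (Alt (start k i) k)

  Bad? : ∀ k → Dec (Bad k)
  Bad? k = Finₚ.any? (λ i → ℓ (Alt (start k i) k · s i) ℕₚ.<? ℓ (Alt (start k i) k))

  notBad-pos : ∀ k → ¬ Bad k → ∀ b i → col i ≡ nots k b → Pos (act (Alt b k) (α i))
  notBad-pos k nb b i ci with sgn (Alt b k) i
  ... | inj₁ (p , _) = p
  ... | inj₂ (_ , lt) = ⊥-elim (nb (i , subst (λ c → ℓ (Alt c k · s i) < ℓ (Alt c k)) (sym (trans (cong (nots k) ci) (nots-invol k b))) lt))

  reduced-block : ∀ b k → Reduced (altw b k) → (∀ i → col i ≡ nots k b → Pos (act (Alt b k) (α i))) →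
                  Reduced (altw b k ++ L (nots k b))
  reduced-block b k r pos = go [] (L (nots k b)) refl (subst Reduced (sym (Listₚ.++-identityʳ (altw b k))) r)
    where
    go : ∀ w w₂ → L (nots k b) ≡ w ++ w₂ → Reduced (altw b k ++ w) → Reduced (altw b k ++ L (nots k b))
    go w [] eq r = subst (λ x → Reduced (altw b k ++ x)) (sym (trans eq (Listₚ.++-identityʳ w))) r
    go w (i ∷ w₂) eq r = go (w ∷ʳ i) w₂ (trans eq (sym (Listₚ.++-assoc w (i ∷ []) w₂))) (subst Reduced (Listₚ.++-assoc (altw b k) w (i ∷ [])) (reduced-snoc (altw b k ++ w) i r
        (Pos-resp (≋-sym (≋-trans (act-≡ (α i) (Π-++ (altw b k) w)) (≋-trans (act-· (Alt b k) (Π w) (α i)) (act-cong (Alt b k) (≋-trans (act-Π w refl (α i)) (actw-fix w i i∉w adjs)))))) (pos i ci))))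
      where
      cols : All (λ j → col j ≡ nots k b) (w ++ i ∷ w₂)
      cols = subst (All (λ j → col j ≡ nots k b)) eq (L-col (nots k b))
      ci : col i ≡ nots k b
      ci = All.head (Allₚ.++⁻ʳ w cols)
      adjs : All (λ j → adj j i ≈ 0#) w
      adjs = All.map (λ {j} cj → adj0 j i (trans cj (sym ci))) (Allₚ.++⁻ˡ w cols)
      uniq : Unique (w ++ i ∷ w₂)
      uniq = subst Unique eq (L-unique (nots k b))
      i∉w : i ∉ w
      i∉w = ∉-prefix w uniq

  reduced-alt : ∀ k → (∀ j → j < k → ¬ Bad j) → ∀ b → Reduced (altw b k)
  reduced-alt zero nb b = ℓ-e
  reduced-alt (suc k) nb b = subst Reduced (sym (altw-snoc b k)) (reduced-block b k (reduced-alt k (λ j lt → nb j (ℕₚ.m≤n⇒m≤1+n lt)) b) (notBad-pos k (nb k ℕₚ.≤-refl) b))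

  module _ (i₀ : Fin n) where
    private
      length-alt : ∀ k b → k ≤ length (altw b k) ℕ.+ length (altw (not b) k)
      length-alt zero b = z≤n
      length-alt (suc k) b = ℕₚ.≤-trans (ℕₚ.+-mono-≤ one (length-alt k (not b))) (ℕₚ.≤-reflexive (trans (ar (length (L b)) (length (L (not b))) _ _) (sym (cong₂ ℕ._+_ (Listₚ.length-++ (L b)) (Listₚ.length-++ (L (not b)))))))
        where
        ar : ∀ a b c d → (a ℕ.+ b) ℕ.+ (c ℕ.+ d) ≡ (a ℕ.+ c) ℕ.+ (b ℕ.+ d)
        ar a b c d = trans (ℕₚ.+-assoc a b _) (trans (cong (a ℕ.+_) (trans (sym (ℕₚ.+-assoc b c d)) (trans (cong (ℕ._+ d) (ℕₚ.+-comm b c)) (ℕₚ.+-assoc c b d)))) (sym (ℕₚ.+-assoc a c _)))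
        nonempty : ∀ {l : List (Fin n)} → i₀ ∈ l → 1 ≤ length l
        nonempty (here _) = s≤s z≤n
        nonempty (there _) = s≤s z≤n
        one : 1 ≤ length (L b) ℕ.+ length (L (not b))
        one with col i₀ Boolₚ.≟ b
        ... | yes q = ℕₚ.≤-trans (nonempty (subst (λ c → i₀ ∈ L c) q (L-mem i₀))) (ℕₚ.m≤m+n _ _)
        ... | no nq = ℕₚ.≤-trans (nonempty (subst (λ c → i₀ ∈ L c) (≢not nq) (L-mem i₀))) (ℕₚ.m≤n+m _ _)

      -- Without a bad index all alternating words would be reduced, hence no longer than `w₀`,
      -- although two of them with k blocks have at least k letters together.
      someBad : ∃ Bad
      someBad with scan (suc (ℓ w₀ ℕ.+ ℓ w₀))
        where
        scan : ∀ k → (∃ Bad) ⊎ (∀ j → j < k → ¬ Bad j)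
        scan zero = inj₂ (λ j ())
        scan (suc k) with scan k | Bad? k
        ... | inj₁ b | _ = inj₁ b
        ... | inj₂ _ | yes b = inj₁ (k , b)
        ... | inj₂ f | no nb = inj₂ λ j lt → pick j (ℕₚ.m≤n⇒m<n∨m≡n (ℕₚ.≤-pred lt))
          where pick : ∀ j → j < k ⊎ j ≡ k → ¬ Bad j
                pick j (inj₁ l) = f j l
                pick j (inj₂ refl) = nb
      ... | inj₁ b = b
      ... | inj₂ f = ⊥-elim (ℕₚ.<⇒≱ (length-alt _ true) (ℕₚ.+-mono-≤ (bnd true) (bnd false)))
        where
        bnd : ∀ b → length (altw b (suc (ℓ w₀ ℕ.+ ℓ w₀))) ≤ ℓ w₀
        bnd b = ℕₚ.≤-trans (ℕₚ.≤-reflexive (sym (reduced-alt _ f b))) (proj₂ longest _)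

      leastBad = least Bad? someBad

    -- Plays the part of the Coxeter number: by `alt-h-neg` both alternating products of h blocks
    -- are the longest element.
    h : ℕ
    h = proj₁ leastBad

    below-h : ∀ k → k < h → ¬ Bad k
    below-h k lt b = ℕₚ.<⇒≱ lt (proj₂ (proj₂ leastBad) k b)

    notBad0 : ¬ Bad 0
    notBad0 (i , lt) = ℕₚ.n≮0 (subst (ℓ (e · s i) <_) ℓ-e lt)

    h≥1 : 1 ≤ h
    h≥1 = ℕₚ.n≢0⇒n>0 (λ q → notBad0 (subst Bad q (proj₁ (proj₂ leastBad))))

    good : ∀ k → k < h → ∀ i → Pos (Pv (suc k) (α i)) × Pos (Pv k (α i))
    good k lt i = sep k i Nonneg nn-resp nn-0 (Pos-resp (act-Alt k (start k i) i (start-ok k i)) (notBad-pos k (below-h k lt) (start k i) i (start-ok k i)))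

    goodh : ∀ i → Pos (Pv h (α i))
    goodh i = subst (λ k → Pos (Pv k (α i))) (ℕₚ.suc-pred h ⦃ ℕ.>-nonZero h≥1 ⦄) (proj₁ (good (ℕ.pred h) (ℕₚ.≤-reflexive (ℕₚ.suc-pred h ⦃ ℕ.>-nonZero h≥1 ⦄)) i))

    private
      Pv-cong : ∀ k {u v} → u ≋ v → Pv k u ≋ Pv k v
      Pv-cong zero p = ≋-refl
      Pv-cong (suc zero) p = p
      Pv-cong (suc (suc k)) p j = +-≈ (N-cong j (Pv-cong (suc k) p)) (neg-≈ (Pv-cong k p j))

      Pv-⊞ : ∀ k u v → Pv k (u ⊞ v) ≋ Pv k u ⊞ Pv k v
      Pv-⊞ zero u v j = ≈-sym (+-idʳ 0#)
      Pv-⊞ (suc zero) u v j = ≈-refl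
      Pv-⊞ (suc (suc k)) u v j = ≈-trans (+-≈ (≈-trans (N-cong j (Pv-⊞ (suc k) u v)) (N-⊞ j _ _)) (neg-≈ (Pv-⊞ k u v j)))
        (rsolve 4 (λ a b c d → (a :+ b) :+ (:- (c :+ d)) := (a :+ (:- c)) :+ (b :+ (:- d))) ≈-refl (N j (Pv (suc k) u)) (N j (Pv (suc k) v)) (Pv k u j) (Pv k v j))

      Pv-• : ∀ k r v → Pv k (r • v) ≋ r • Pv k v
      Pv-• zero r v j = ≈-sym (*-zeroʳ r)
      Pv-• (suc zero) r v j = ≈-refl
      Pv-• (suc (suc k)) r v j = ≈-trans (+-≈ (≈-trans (N-cong j (Pv-• (suc k) r v)) (N-• j r _)) (neg-≈ (Pv-• k r v j)))
        (rsolve 3 (λ r a b → r :* a :+ (:- (r :* b)) := r :* (a :+ (:- b))) ≈-refl r (N j (Pv (suc k) v)) (Pv k v j))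

      A-0 : ∀ j → N j 0v ≈ 0#
      A-0 j = ∑-0 (λ k → adj j k * 0#) (λ k → *-zeroʳ _)

      A-⊟ : ∀ v → A (⊟ v) ≋ ⊟ A v
      A-⊟ v j = ≈-trans (N-cong j (⊟-• v)) (≈-trans (N-• j (- 1#) v) (≈-sym (⊟-• (A v) j)))

      Pv-A : ∀ k v → Pv k (A v) ≋ A (Pv k v)
      Pv-A zero v j = ≈-sym (A-0 j)
      Pv-A (suc zero) v j = ≈-refl
      Pv-A (suc (suc k)) v j = ≈-trans (+-≈ (N-cong j (Pv-A (suc k) v)) (neg-≈ (Pv-A k v j)))
        (≈-sym (≈-trans (N-⊞ j (A (Pv (suc k) v)) (⊟ Pv k v)) (+-≈ ≈-refl (A-⊟ (Pv k v) j))))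

      Pv-∑ : ∀ k {M} (f : Fin M → V) → Pv k (λ j → ∑ (λ i → f i j)) ≋ (λ j → ∑ (λ i → Pv k (f i) j))
      Pv-∑ k {zero} f j = ≈-trans (Pv-cong k {0v} {0# • 0v} (λ _ → ≈-sym (*-zeroˡ 0#)) j) (≈-trans (Pv-• k 0# 0v j) (*-zeroˡ _))
      Pv-∑ k {suc M} f j = ≈-trans (Pv-⊞ k (f zero) (λ j → ∑ (λ i → f (suc i) j)) j) (+-≈ ≈-refl (Pv-∑ k (f ∘ suc) j))

      sum-zero : ∀ {M} (f : Fin M → K) → (∀ i → Nonneg (f i)) → ∑ f ≈ 0# → ∀ i → f i ≈ 0#
      sum-zero {suc M} f p q zero = nn-anti (p zero) (nn-resp (≈-trans (rsolve 2 (λ a b → b := (a :+ b) :+ (:- a)) ≈-refl (f zero) (∑ (f ∘ suc))) (≈-trans (+-≈ q ≈-refl) (+-idˡ _))) (∑-nn (f ∘ suc) (p ∘ suc)))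
      sum-zero {suc M} f p q (suc i) = sum-zero (f ∘ suc) (p ∘ suc) (≈-trans (≈-sym (+-idˡ _)) (≈-trans (+-≈ (≈-sym (sum-zero f p q zero)) ≈-refl) q)) i

      -- λ x = 0 with x ≥ 0 forces x = 0, because (λ² − 1) x = −x is nonnegative
      lam-cancel : ∀ {i j} → 3 ≤ m i j → ∀ x → Nonneg x → adj j i * x ≈ 0# → x ≈ 0#
      lam-cancel {i} {j} m3 x nx eq = nn-anti nx (nn-resp eq′ (nn-* (lam-pos (m j i) 2≤ (m≤ j i) 3 3≤) nx))
        where
        3≤ : 3 ≤ m j i
        3≤ = subst (3 ≤_) (m-sym i j) m3
        2≤ : 2 ≤ m j i
        2≤ = ℕₚ.≤-trans (s≤s (s≤s z≤n)) 3≤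
        i≢j : j ≢ i
        i≢j refl = ℕₚ.<⇒≱ (s≤s (s≤s z≤n)) (ℕₚ.≤-trans 3≤ (ℕₚ.≤-reflexive (m-diag i)))
        l = lam (m j i)
        lx : l * x ≈ 0#
        lx = ≈-trans (*-≈ (≈-reflexive (sym (adj-off i≢j))) ≈-refl) eq
        eq′ : P 3 l * x ≈ - x
        eq′ = ≈-trans (rsolve 2 (λ l x → (l :* (l :* con (ℤ+ 1) :- con (ℤ+ 0)) :- con (ℤ+ 1)) :* x := l :* (l :* x) :- x) ≈-refl l x) (≈-trans (+-≈ (≈-trans (*-≈ ≈-refl lx) (*-zeroʳ l)) ≈-refl) (+-idˡ _))

      A-α : ∀ i → A (α i) ≋ (λ k → ∑ (λ j → (adj j i • α j) k))
      A-α i k = ≈-trans (N-α k i) (≈-sym (≈-trans (∑-single (λ j → adj j i * α j k) k (λ j ne → ≈-trans (*-≈ ≈-refl (α-diff (ne ∘ sym))) (*-zeroʳ _))) (≈-trans (*-≈ ≈-refl (α-same k)) (*-idʳ _))))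

      -- Apply p_h(A) to A α_i, a combination of the α_j with coefficients `adj j i`. The result is
      -- zero and its terms are nonnegative, so each term vanishes.
      spread : ∀ {i j} → 3 ≤ m i j → Pv h (α i) ≋ 0v → Pv h (α j) ≋ 0v
      spread {i} {j} m3 z k = lam-cancel m3 (Pv h (α j) k) (goodh j k) (≈-trans (≈-sym (Pv-• h (adj j i) (α j) k))
          (sum-zero (λ j → Pv h (adj j i • α j) k) (λ j → nn-resp (≈-sym (Pv-• h (adj j i) (α j) k)) (nn-* (adj-nn j i) (goodh j k)))
            (≈-trans (≈-sym (Pv-∑ h (λ j → adj j i • α j) k)) (≈-trans (Pv-cong h (≋-sym (A-α i)) k) (≈-trans (Pv-A h (α i) k) (≈-trans (N-cong k z) (A-0 k))))) j))

      spread* : ∀ {i j} → Star (λ i j → 3 ≤ m i j) i j → Pv h (α i) ≋ 0v → Pv h (α j) ≋ 0v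
      spread* ◾ z = z
      spread* (x ◅ xs) z = spread* xs (spread x z)

      -- At a bad i the sum of p_(h+1) α_i and p_h α_i is negative, so by `sep` p_h α_i has both
      -- signs and vanishes. Connectedness of the diagram carries this to every j.
      Pvh-0 : ∀ j → Pv h (α j) ≋ 0v
      Pvh-0 j = spread* (connected i j) (Pos-anti (goodh i) (proj₂ (sep h i (λ a → Nonneg (- a)) (λ p q → nn-resp (neg-≈ p) q) (nn-resp (≈-sym neg-0) nn-0) (Pos-resp (⊟-cong (act-Alt h (start h i) i (start-ok h i))) ng))))
        where
        bad = proj₁ (proj₂ leastBad)
        i = proj₁ bad
        ng : Neg (act (Alt (start h i) h) (α i))
        ng with sgn (Alt (start h i) h) i
        ... | inj₁ (_ , lt) = ⊥-elim (ℕₚ.<-asym lt (proj₂ bad))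
        ... | inj₂ (q , _) = q

      -- With p_h α_j = 0 the recursion gives p_(h+1) α_j = -p_(h-1) α_j.
      Pvh+1 : ∀ k → suc k ≡ h → ∀ j → Neg (Pv (suc (suc k)) (α j))
      Pvh+1 k eq j c = nn-resp (≈-sym (≈-trans (neg-≈ (≈-trans (+-≈ (≈-trans (N-cong c z) (A-0 c)) ≈-refl) (+-idˡ _))) (rsolve 1 (λ a → :- (:- a) := a) ≈-refl (Pv k (α j) c)))) (proj₂ (good k (ℕₚ.≤-reflexive eq) j) c)
        where z : Pv (suc k) (α j) ≋ 0v
              z = subst (λ x → Pv x (α j) ≋ 0v) (sym eq) (Pvh-0 j)

    alt-last : ∀ k b i → col i ≡ nots k b → act (Alt b (suc k)) (α i) ≋ ⊟ act (Alt b k) (α i)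
    alt-last k b i ci = ≋-trans (act-≡ (α i) (trans (cong Π (altw-snoc b k)) (Π-++ (altw b k) (L (nots k b))))) (≋-trans (act-· (Alt b k) (cb (nots k b)) (α i))
        (≋-trans (act-cong (Alt b k) flipped) (act-⊟ (Alt b k) (α i))))
      where
      flipped : act (cb (nots k b)) (α i) ≋ ⊟ α i
      flipped = block-flip (L (nots k b)) (L-nonadjacent _) (L-unique _) i (subst (λ c → i ∈ L c) ci (L-mem i))

    -- A simple root of the next colour is sent to -p_(h-1) α_i. One of the last block's colour is
    -- flipped by that block, and the preceding h - 1 blocks keep it positive up to this sign.
    alt-h-neg : ∀ b → AllNeg (Alt b h)
    alt-h-neg b i = cases h refl (col i Boolₚ.≟ nots h b)
      where
      cases : ∀ k → k ≡ h → Dec (col i ≡ nots h b) → Neg (act (Alt b h) (α i))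
      cases zero eq _ = ⊥-elim (ℕₚ.<⇒≱ h≥1 (ℕₚ.≤-reflexive (sym eq)))
      cases (suc k) eq (yes q) = Pos-resp (≋-sym (⊟-cong (act-Alt h b i q)))
          (subst (λ x → Neg (Pv (suc x) (α i) ⊞ Pv x (α i))) eq (Pos-resp (λ c → ≈-sym (≈-trans (neg-≈ (≈-trans (+-≈ ≈-refl (subst (λ x → Pv x (α i) ≋ 0v) (sym eq) (Pvh-0 i) c)) (+-idʳ _))) ≈-refl)) (Pvh+1 k eq i)))
      cases (suc k) eq (no nq) = subst (λ x → Neg (act (Alt b x) (α i))) eq (Pos-resp (≋-sym (≋-trans (⊟-cong (alt-last k b i ck)) (⊟⊟ _))) (notBad-pos k (below-h k (ℕₚ.≤-reflexive eq)) b i ck))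
        where
        ck : col i ≡ nots k b
        ck = trans (≢not nq) (trans (cong (λ x → not (nots x b)) (sym eq)) (Boolₚ.not-involutive _))

    reduced-h : ∀ b → Reduced (altw b h)
    reduced-h = reduced-alt h below-h

    -- One product keeps the simple root of i₀ positive, since i₀ belongs to its next block; for the
    -- other product i₀ belongs to the last block, and the root becomes negative.
    alt-distinct : ∀ k → 1 ≤ k → k < h → Alt true k ≢ Alt false k
    alt-distinct (suc k) _ lt eq = go (start (suc k) i₀) refl
      where
      go : ∀ b → start (suc k) i₀ ≡ b → ⊥
      go b q = posneg⊥ (Alt b (suc k)) i₀ (notBad-pos (suc k) (below-h (suc k) lt) b i₀ ci)
          (subst (λ g → Neg (act g (α i₀))) (other b) (Pos-resp (≋-sym (≋-trans (⊟-cong (alt-last k (not b) i₀ ci′)) (⊟⊟ _))) (notBad-pos k (below-h k (ℕₚ.<⇒≤ lt)) (not b) i₀ ci′)))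
        where
        ci : col i₀ ≡ nots (suc k) b
        ci = subst (λ c → col i₀ ≡ nots (suc k) c) q (start-ok (suc k) i₀)
        ci′ : col i₀ ≡ nots k (not b)
        ci′ = trans ci (sym (nots-not k b))
        other : ∀ b → Alt (not b) (suc k) ≡ Alt b (suc k)
        other true = sym eq
        other false = eq

-- Folding: unfolded words stay reduced

sum-⊆ : ∀ {A : Set} (f : A → ℕ) xs ys → Unique xs → (∀ {x} → x ∈ xs → x ∈ ys) → sum (map f xs) ≤ sum (map f ys)
sum-⊆ f [] ys uq sub = z≤n
sum-⊆ {A} f (x ∷ xs) ys (ne ∷ uq) sub with ∈-∃++ (sub (here refl))
... | as , bs , refl = ℕₚ.≤-trans (ℕₚ.+-monoʳ-≤ (f x) (sum-⊆ f xs (as ++ bs) uq sub′)) (ℕₚ.≤-reflexive (shuffle as))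
  where
  sub′ : ∀ {z} → z ∈ xs → z ∈ as ++ bs
  sub′ q with ∈-++⁻ as (sub (there q))
  ... | inj₁ p = ∈-++⁺ˡ p
  ... | inj₂ (here refl) = ⊥-elim (All.lookup ne q refl)
  ... | inj₂ (there p) = ∈-++⁺ʳ as p
  shuffle : ∀ as → f x ℕ.+ sum (map f (as ++ bs)) ≡ sum (map f (as ++ x ∷ bs))
  shuffle [] = refl
  shuffle (a ∷ as) = trans (sym (ℕₚ.+-assoc (f x) (f a) _)) (trans (cong (ℕ._+ sum (map f (as ++ bs))) (ℕₚ.+-comm (f x) (f a))) (trans (ℕₚ.+-assoc (f a) (f x) _) (cong (f a ℕ.+_) (shuffle as))))

record FoldingData (Y Y′ : System) : Set where
  private
    module W  = Words Y
    module W′ = Words Y′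
  field
    fold         : Fin W.n → Fin W′.n
    fold-surj    : ∀ j → ∃ λ i → fold i ≡ j
    fold-commute : ∀ i k → fold i ≡ fold k → W.s i W.· W.s k ≡ W.s k W.· W.s i
    U            : W′.G → W.G
    U-·          : ∀ x y → U (x W′.· y) ≡ U x W.· U y
    U-inj        : ∀ {x y} → U x ≡ U y → x ≡ y
    U-s          : ∀ j → U (W′.s j) ≡ W.Π (filter (λ i → fold i Fin.≟ j) (allFin W.n))
    side         : Fin W′.n → Bool
    side-commute : ∀ j k → side j ≡ side k → W′.s j W′.· W′.s k ≡ W′.s k W′.· W′.s j
    connected    : ∀ i k → Star (λ i k → 3 ≤ W.m i k) i k
    connected′   : ∀ i k → Star (λ i k → 3 ≤ W′.m i k) i k

module Folded {Y Y′ : System} (D : FoldingData Y Y′) where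
  open FoldingData D public
  open Words Y public
  module W′ = Words Y′

  fib : Fin W′.n → List (Fin n)
  fib j = filter (λ i → fold i Fin.≟ j) (allFin n)

  fib-∈ : ∀ {i j} → fold i ≡ j → i ∈ fib j
  fib-∈ {i} {j} eq = ∈-filter⁺ (λ i → fold i Fin.≟ j) (∈-allFin i) eq

  ∈-fib : ∀ {i j} → i ∈ fib j → fold i ≡ j
  ∈-fib {i} {j} q = proj₂ (∈-filter⁻ (λ i → fold i Fin.≟ j) {xs = allFin n} q)

  fib-unique : ∀ j → Unique (fib j)
  fib-unique j = Uniqueₚ.filter⁺ (λ i → fold i Fin.≟ j) (Uniqueₚ.allFin⁺ n)

  uw : List (Fin W′.n) → List (Fin n)
  uw = concatMap fib

  uw-++ : ∀ u v → uw (u ++ v) ≡ uw u ++ uw v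
  uw-++ u v = Listₚ.concatMap-++ fib u v

  uw-∷ʳ : ∀ u j → uw (u ∷ʳ j) ≡ uw u ++ fib j
  uw-∷ʳ u j = trans (uw-++ u (j ∷ [])) (cong (uw u ++_) (Listₚ.++-identityʳ (fib j)))

  uw-∈ : ∀ {i} w → fold i ∈ w → i ∈ uw w
  uw-∈ (j ∷ w) (here eq) = ∈-++⁺ˡ (fib-∈ eq)
  uw-∈ (j ∷ w) (there q) = ∈-++⁺ʳ (fib j) (uw-∈ w q)

  ∈-uw : ∀ {i} w → i ∈ uw w → fold i ∈ w
  ∈-uw (j ∷ w) q with ∈-++⁻ (fib j) q
  ... | inj₁ p = here (∈-fib p)
  ... | inj₂ p = there (∈-uw w p)

  uw-unique : ∀ {w} → Unique w → Unique (uw w)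
  uw-unique [] = []
  uw-unique {j ∷ w} uq@(_ ∷ uw′) = Uniqueₚ.++⁺ (fib-unique j) (uw-unique uw′) (λ (p , q) → W′.∉-tail uq (subst (_∈ w) (∈-fib p) (∈-uw w q)))

  uw-full : ∀ {w} → W′.Full w → Full (uw w)
  uw-full f i = uw-∈ _ (f (fold i))

  U-e : U W′.e ≡ e
  U-e = trans (gsolve 1 (λ a → a ⊜ (a ⁻ ⊙ (a ⊙ a))) refl (U W′.e)) (trans (cong (inv (U W′.e) ·_) (trans (sym (U-· W′.e W′.e)) (cong U (W′.idˡ W′.e)))) (invˡ (U W′.e)))

  U-inv : ∀ x → U (W′.inv x) ≡ inv (U x)
  U-inv x = trans (gsolve 2 (λ a b → b ⊜ (a ⁻ ⊙ (a ⊙ b))) refl (U x) (U (W′.inv x))) (trans (cong (inv (U x) ·_) (trans (sym (U-· x (W′.inv x))) (trans (cong U (W′.invʳ x)) U-e))) (idʳ _))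

  U-^ : ∀ g x → U (g W′.^ x) ≡ U g ^ U x
  U-^ g x = trans (U-· (g W′.· x) (W′.inv g)) (cong₂ _·_ (U-· g x) (U-inv g))

  Π-uw : ∀ w → Π (uw w) ≡ U (W′.Π w)
  Π-uw [] = sym U-e
  Π-uw (j ∷ w) = trans (Π-++ (fib j) (uw w)) (trans (cong₂ _·_ (sym (U-s j)) (Π-uw w)) (sym (U-· (W′.s j) (W′.Π w))))

  fib-nonadjacent : ∀ j → Nonadjacent (fib j)
  fib-nonadjacent j {i} {k} p q = cases (i Fin.≟ k)
    where
    cases : Dec (i ≡ k) → adj i k ≈ 0#
    cases (yes refl) = adj-self i
    cases (no ne) = commuting-adj ne (fold-commute i k (trans (∈-fib p) (sym (∈-fib q))))

  U-s-flip : ∀ i j → fold i ≡ j → act (U (W′.s j)) (α i) ≋ ⊟ α i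
  U-s-flip i j eq = ≋-trans (act-≡ (α i) (U-s j)) (block-flip (fib j) (fib-nonadjacent j) (fib-unique j) i (fib-∈ eq))

  U-s-off : ∀ {i j} → fold i ≢ j → ∀ v → act (U (W′.s j)) v i ≈ v i
  U-s-off {i} {j} ne v = ≈-trans (act-≡ v (U-s j) i) (≈-trans (act-Π (fib j) refl v i) (fixes-coord (fib j) (ne ∘ ∈-fib) v))

  col : Fin n → Bool
  col i = side (fold i)

  adj0′ : ∀ j k → side j ≡ side k → W′.adj j k W′.≈ W′.0#
  adj0′ j k eq = cases (j Fin.≟ k)
    where
    cases : Dec (j ≡ k) → W′.adj j k W′.≈ W′.0#
    cases (yes refl) = W′.adj-self j
    cases (no ne) = W′.commuting-adj ne (side-commute j k eq)

  -- Generators of W′ of one colour commute, hence so do their images under `U`. The coordinate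
  -- comparison of `commuting-adj` is then repeated with whole fibres in place of single letters.
  adj0 : ∀ i k → col i ≡ col k → adj i k ≈ 0#
  adj0 i k eq = cases (fold i Fin.≟ fold k)
    where
    A = U (W′.s (fold i))
    B = U (W′.s (fold k))
    comm : A · B ≡ B · A
    comm = trans (sym (U-· _ _)) (trans (cong U (side-commute (fold i) (fold k) eq)) (U-· _ _))
    cases : Dec (fold i ≡ fold k) → adj i k ≈ 0#
    cases (yes p) = fib-nonadjacent (fold i) (fib-∈ refl) (fib-∈ (sym p))
    cases (no np) = nn-anti (adj-nn i k) (nn-resp (≈-trans (≈-sym lhs) (≈-trans (≈-sym (act-· B A (α k) i)) (≈-trans (act-≡ (α k) (sym comm) i) (≈-trans (act-· A B (α k) i) rhs)))) (adj-nn i k))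
      where
      at-i : act A (α k) i ≈ adj i k
      at-i = ≈-trans (act-≡ (α k) (U-s (fold i)) i) (≈-trans (act-Π (fib (fold i)) refl (α k) i) (≈-trans (block-on (fib (fold i)) (fib-nonadjacent (fold i)) (fib-unique (fold i)) (α k) i (fib-∈ refl))
               (≈-trans (+-≈ (N-α i k) (≈-trans (neg-≈ (α-diff (λ q → np (cong fold (q))))) neg-0)) (+-idʳ _))))
      lhs : act B (act A (α k)) i ≈ adj i k
      lhs = ≈-trans (U-s-off np (act A (α k))) at-i
      rhs : act A (act B (α k)) i ≈ - adj i k
      rhs = ≈-trans (act-cong A (U-s-flip k (fold k) refl) i) (≈-trans (act-⊟ A (α k) i) (neg-≈ at-i))

  L′ : Bool → List (Fin W′.n)
  L′ b = filter (λ j → side j Boolₚ.≟ b) (allFin W′.n)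

  L′-col : ∀ b → All (λ j → side j ≡ b) (L′ b)
  L′-col b = Allₚ.all-filter (λ j → side j Boolₚ.≟ b) (allFin W′.n)

  L′-mem : ∀ j → j ∈ L′ (side j)
  L′-mem j = ∈-filter⁺ (λ k → side k Boolₚ.≟ side j) (∈-allFin j) refl

  L′-unique : ∀ b → Unique (L′ b)
  L′-unique b = Uniqueₚ.filter⁺ (λ j → side j Boolₚ.≟ b) (Uniqueₚ.allFin⁺ W′.n)

  L : Bool → List (Fin n)
  L b = uw (L′ b)

  module B′ = Bipartite Y′ side L′ L′-unique L′-col L′-mem adj0′ connected′
  module B = Bipartite Y col L (λ b → uw-unique (L′-unique b)) (λ b → All.tabulate (λ q → All.lookup (L′-col b) (∈-uw (L′ b) q))) (λ i → uw-∈ (L′ (col i)) (L′-mem (fold i))) adj0 connected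

  uw-altw : ∀ b k → uw (B′.altw b k) ≡ B.altw b k
  uw-altw b zero = refl
  uw-altw b (suc k) = trans (uw-++ (L′ b) (B′.altw (not b) k)) (cong (L b ++_) (uw-altw (not b) k))

  U-Alt : ∀ b k → U (B′.Alt b k) ≡ B.Alt b k
  U-Alt b k = trans (sym (Π-uw (B′.altw b k))) (cong Π (uw-altw b k))

  -- On reflections it is invariant under conjugation and at s_j equals the size of the fibre, so it
  -- counts how many letters an inversion contributes after unfolding.
  wt : W′.G → ℕ
  wt t = lT (U t)

  wt-^ : ∀ g t → wt (g W′.^ t) ≡ wt t
  wt-^ g t = trans (cong lT (U-^ g t)) (lT-conj (U g) (U t))

  wt-s : ∀ j → wt (W′.s j) ≡ length (fib j)
  wt-s j = trans (cong lT (U-s j)) (lT-Π (fib j) (fib-unique j))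

  length-uw : ∀ w → length (uw w) ≡ sum (map wt (W′.refs w))
  length-uw [] = refl
  length-uw (j ∷ w) = trans (Listₚ.length-++ (fib j)) (cong₂ ℕ._+_ (sym (wt-s j)) (trans (length-uw w) (sym (go (W′.refs w)))))
    where
    go : ∀ ts → sum (map wt (map (W′.s j W′.^_) ts)) ≡ sum (map wt ts)
    go [] = refl
    go (t ∷ ts) = cong₂ ℕ._+_ (wt-^ (W′.s j) t) (go ts)

  T-refs : ∀ w {t} → t ∈ W′.refs w → W′.T t
  T-refs (j ∷ w) (here refl) = W′.T-s j
  T-refs (j ∷ w) (there q) with ∈-map⁻ (W′.s j W′.^_) q
  ... | t , q′ , refl = W′.T-conj (W′.s j) (T-refs w q′)

  module _ (i₀ : Fin n) where
    private
      h = B.h i₀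
      h′ = B′.h (fold i₀)

      -- On either side, h is the first positive number of blocks at which the two alternating
      -- products agree, and the injective map `U` preserves and reflects this agreement.
      h≡h′ : h ≡ h′
      h≡h′ = ℕₚ.≤-antisym (ℕₚ.≮⇒≥ (λ lt → B.alt-distinct i₀ h′ (B′.h≥1 (fold i₀)) lt (trans (sym (U-Alt true h′)) (trans (cong U (W′.allNeg-unique _ _ (B′.alt-h-neg (fold i₀) true) (B′.alt-h-neg (fold i₀) false))) (U-Alt false h′)))))
        (ℕₚ.≮⇒≥ (λ lt → B′.alt-distinct (fold i₀) h (B.h≥1 i₀) lt (U-inj (trans (U-Alt true h) (trans (allNeg-unique _ _ (B.alt-h-neg i₀ true) (B.alt-h-neg i₀ false)) (sym (U-Alt false h)))))))

    -- Both longest elements are alternating products with the same number of blocks, and the weights of the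
    -- inversions of a reduced word of W′ add up to the length of the unfolded word.
    reduced-uw : ∀ u → W′.Reduced u → Reduced (uw u)
    reduced-uw u r = reduced-prefix (uw u) (uw z) (subst Reduced (uw-++ u z) (ℕₚ.≤-antisym (ℓ-min (uw x)) long))
      where
      z = proj₁ (W′.extend u r)
      x = u ++ z
      a = B′.altw true h′
      same : W′.Π x ≡ W′.Π a
      same = W′.allNeg-unique _ _ (proj₂ (proj₂ (W′.extend u r))) (B′.alt-h-neg (fold i₀) true)
      sub : ∀ {t} → t ∈ W′.refs x → t ∈ W′.refs a
      sub {t} q = subst (_∈ W′.refs a) (proj₂ (proj₂ tρ)) (W′.refs-complete a (proj₁ tρ) (proj₁ (proj₂ tρ))
        (W′.neg-act-pos (W′.inv (W′.Π a)) _ (proj₁ (proj₂ tρ)) (W′.allNeg-inv (W′.Π a) (B′.alt-h-neg (fold i₀) true))))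
        where tρ = T-refs x q
      long : length (uw x) ≤ ℓ (Π (uw x))
      long = ℕₚ.≤-trans (ℕₚ.≤-reflexive (length-uw x)) (ℕₚ.≤-trans (sum-⊆ wt (W′.refs x) (W′.refs a) (W′.refs-unique x (proj₁ (proj₂ (W′.extend u r)))) sub)
               (ℕₚ.≤-reflexive (trans (sym (length-uw a)) (trans (cong length eq-a) (trans (sym (B.reduced-h i₀ true)) (cong ℓ (trans (sym (cong Π eq-a)) (trans (Π-uw a) (trans (cong U (sym same)) (sym (Π-uw x)))))))))))
        where
        eq-a : uw a ≡ B.altw true h
        eq-a = trans (uw-altw true h′) (cong (B.altw true) (sym h≡h′))

  -- The word of g followed by s_(fold i) is reduced, and so is its unfolding, which ends in the
  -- fibre; the letters of the fibre before i fix α_i.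
  fold-up : ∀ g i → W′.ℓ g < W′.ℓ (g W′.· W′.s (fold i)) → Pos (act (U g) (α i))
  fold-up g i lt = split (∈-∃++ (fib-∈ {i} {j} refl))
    where
    j = fold i
    w = W′.word g
    rw : W′.Reduced w
    rw = trans (cong W′.ℓ (sym (W′.Π-word g))) (sym (W′.length-word g))
    pos : W′.Pos (W′.act (W′.Π w) (W′.α j))
    pos with W′.sgn (W′.Π w) j
    ... | inj₁ (p , _) = p
    ... | inj₂ (_ , gt) = ⊥-elim (ℕₚ.<-asym lt (subst (λ g → W′.ℓ (g W′.· W′.s j) < W′.ℓ g) (sym (W′.Π-word g)) gt))
    red : Reduced (uw w ++ fib j)
    red = subst Reduced (uw-∷ʳ w j) (reduced-uw i (w ∷ʳ j) (W′.reduced-snoc w j rw pos))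
    split : (∃ λ w₁ → ∃ λ w₂ → fib j ≡ w₁ ++ i ∷ w₂) → Pos (act (U g) (α i))
    split (w₁ , w₂ , eq) = Pos-resp (≋-trans (act-≡ (α i) (Π-++ (uw w) w₁)) (≋-trans (act-· (Π (uw w)) (Π w₁) (α i))
          (≋-trans (act-cong (Π (uw w)) (≋-trans (act-Π w₁ refl (α i)) (actw-fix w₁ i i∉ adjs))) (act-≡ (α i) (trans (Π-uw w) (cong U (sym (W′.Π-word g))))))))
        (reduced-pos (uw w ++ w₁) i w₂ (subst Reduced (trans (cong (uw w ++_) eq) (sym (Listₚ.++-assoc (uw w) w₁ (i ∷ w₂)))) red))
      where
      mem : ∀ {k} → k ∈ w₁ → k ∈ fib j
      mem q = subst (_ ∈_) (sym eq) (∈-++⁺ˡ q)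
      adjs : All (λ k → adj k i ≈ 0#) w₁
      adjs = All.tabulate (λ q → fib-nonadjacent j (mem q) (fib-∈ refl))
      i∉ : i ∉ w₁
      i∉ = ∉-prefix w₁ (subst Unique eq (fib-unique j))

  -- A right descent k of w cannot be `fold i`: otherwise U (w s_k) α_i would be positive by
  -- `fold-up`, although its coordinate i is that of -α_i. So s_k preserves coordinate i after
  -- unfolding and can be split off.
  avoids : ∀ w i → (∀ v → act (U w) v i ≈ v i) → ∃ λ u → fold i ∉ u × w ≡ W′.Π u
  avoids w i = go (W′.ℓ w) w ℕₚ.≤-refl
    where
    go : ∀ f w → W′.ℓ w ≤ f → (∀ v → act (U w) v i ≈ v i) → ∃ λ u → fold i ∉ u × w ≡ W′.Π u
    go f w le fix = cases f le (w W′.≟ W′.e)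
      where
      cases : ∀ f → W′.ℓ w ≤ f → Dec (w ≡ W′.e) → ∃ λ u → fold i ∉ u × w ≡ W′.Π u
      cases f le (yes eq) = [] , (λ ()) , eq
      cases zero le (no ne) = ⊥-elim (ne (W′.ℓ≡0 w (ℕₚ.n≤0⇒n≡0 le)))
      cases (suc f) le (no ne) = proj₁ ih ∷ʳ k , nin , trans (sym (W′.s-cancelʳ w k)) (trans (cong (W′._· W′.s k) (proj₂ (proj₂ ih))) (sym (W′.Π-∷ʳ (proj₁ ih) k)))
        where
        k = proj₁ (W′.descent w ne)
        lt = proj₂ (W′.descent w ne)
        g = w W′.· W′.s k
        split : ∀ v → act (U g) v ≋ act (U w) (act (U (W′.s k)) v)
        split v = ≋-trans (act-≡ v (U-· w (W′.s k))) (act-· (U w) (U (W′.s k)) v)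
        k≢ : fold i ≢ k
        k≢ eq = α≉0 i (λ c → at c (c Fin.≟ i))
          where
          gup : Pos (act (U g) (α i))
          gup = fold-up g i (subst (λ k → W′.ℓ g < W′.ℓ (g W′.· W′.s k)) (sym eq) (subst (λ x → W′.ℓ g < W′.ℓ x) (sym (W′.s-cancelʳ w k)) lt))
          flipped : act (U g) (α i) i ≈ - α i i
          flipped = ≈-trans (split (α i) i) (≈-trans (fix (act (U (W′.s k)) (α i))) (U-s-flip i k eq i))
          at : ∀ c → Dec (c ≡ i) → α i c ≈ 0#
          at c (yes refl) = nn-anti (α-pos i i) (nn-resp flipped (gup i))
          at c (no ne) = α-diff ne
        ih = go f g (ℕₚ.≤-pred (ℕₚ.≤-trans lt le)) (λ v → ≈-trans (split v i) (≈-trans (fix (act (U (W′.s k)) v)) (U-s-off k≢ v)))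
        nin : fold i ∉ proj₁ ih ∷ʳ k
        nin q with ∈-++⁻ (proj₁ ih) q
        ... | inj₁ p = proj₁ (proj₂ ih) p
        ... | inj₂ (here eq) = k≢ eq

-- Unfolding commutes with joins

∈-∷ʳ : ∀ {A : Set} {x y : A} xs → x ∈ xs ∷ʳ y → x ∉ xs → x ≡ y
∈-∷ʳ xs q nin with ∈-++⁻ xs q
... | inj₁ r = ⊥-elim (nin r)
... | inj₂ (here eq) = eq

record IsJoin (Y : System) (js : List (Fin (Words.n Y))) (w p : Words.G Y) : Set where
  open Words Y
  field
    below     : p ≼ Π js
    dominates : Dominates w p
    minimal   : ∀ u → u ≼ Π js → Dominates w u → p ≼ u

join : ∀ Y js → Unique js → Words.Full Y js → ∀ w → ∃ (IsJoin Y js w)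
join Y js uq f w = p , record { below = le ; dominates = dom ; minimal = mn }
  where
  π = Words.π-exists Y js uq f w
  p = proj₁ π
  le = proj₁ (proj₂ π)
  dom = proj₁ (proj₂ (proj₂ π))
  mn = proj₂ (proj₂ (proj₂ π))

module Unfolding {Y Y′ : System} (D : FoldingData Y Y′) where
  open Folded D

  wts : List W′.Rt → ℕ
  wts xs = sum (map (wt ∘ W′.ref) xs)

  wts-▷ : ∀ g xs → wts (map (g W′.▷_) xs) ≡ wts xs
  wts-▷ g [] = refl
  wts-▷ g (x ∷ xs) = cong₂ ℕ._+_ (trans (cong wt (W′.ref-▷ g x)) (wt-^ g (W′.ref x))) (wts-▷ g xs)

  wts-++ : ∀ xs ys → wts (xs ++ ys) ≡ wts xs ℕ.+ wts ys
  wts-++ [] ys = refl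
  wts-++ (x ∷ xs) ys = trans (cong (wt (W′.ref x) ℕ.+_) (wts-++ xs ys)) (sym (ℕₚ.+-assoc (wt (W′.ref x)) _ _))

  lT-wts : ∀ xs → lT (U (W′.prodR xs)) ≤ wts xs
  lT-wts [] = ℕₚ.≤-reflexive (trans (cong lT U-e) lT-e)
  lT-wts (x ∷ xs) = ℕₚ.≤-trans (ℕₚ.≤-reflexive (cong lT (U-· (W′.ref x) (W′.prodR xs)))) (ℕₚ.≤-trans (lT-· _ _) (ℕₚ.+-monoʳ-≤ (wt (W′.ref x)) (lT-wts xs)))

  length-uw-rot : ∀ j js → length (uw (js ∷ʳ j)) ≡ length (uw (j ∷ js))
  length-uw-rot j js = trans (cong length (uw-∷ʳ js j)) (Listₚ.length-++-comm (uw js) (fib j))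

  -- Rotation makes the first factor a simple reflection s_j, whose weight is the size of the fibre
  -- of j. Rotation changes neither side, and dropping j removes that size from both.
  weight : ∀ N js xs → length js ≡ N → Unique js → W′.Π js ≡ W′.prodR xs → length xs ≡ length js → wts xs ≡ length (uw js)
  weight N [] [] l uq eq len = refl
  weight N (j ∷ js) [] l uq eq ()
  weight N js (x ∷ xs) l uq eq len = hit N js x xs (W′.hits js x uq (All.head (W′.reduced-supp js (x ∷ xs) uq eq len))) refl l uq eq len
    where
    hit : ∀ N js x xs {t} → W′.Hits js t → W′.ref x ≡ t → length js ≡ N → Unique js → W′.Π js ≡ W′.prodR (x ∷ xs) → length (x ∷ xs) ≡ length js → wts (x ∷ xs) ≡ length (uw js)
    hit zero (j ∷ js) x xs h te () uq eq len
    hit (suc N) (j ∷ js) x xs (W′.here q) te l uq eq len = trans (cong₂ ℕ._+_ (trans (cong wt (trans te q)) (wt-s j)) ih) (sym (Listₚ.length-++ (fib j)))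
      where
      eq′ : W′.Π js ≡ W′.prodR xs
      eq′ = trans (sym (W′.s-cancelˡ (W′.Π js) j)) (trans (cong₂ W′._·_ (trans (sym q) (sym te)) eq) (W′.T-cancelˡ (W′.T-ref x) (W′.prodR xs)))
      ih = weight N js xs (ℕₚ.suc-injective l) (AllPairs.tail uq) eq′ (ℕₚ.suc-injective len)
    hit N (j ∷ js) x xs (W′.step ne h) te l uq eq len = trans (sym (wts-▷ (W′.s j) (x ∷ xs))) (trans ih (length-uw-rot j js))
      where
      ih = hit N (js ∷ʳ j) (W′.s j W′.▷ x) (map (W′.s j W′.▷_) xs) h (trans (W′.ref-▷ (W′.s j) x) (cong (W′.s j W′.^_) te)) (trans (Listₚ.length-++-comm js (j ∷ [])) l) (W′.Unique-rot uq)
             (trans (W′.Π-rot j js) (trans (cong (W′.s j W′.^_) eq) (sym (W′.prodR-▷ (W′.s j) (x ∷ xs))))) (trans (Listₚ.length-map (W′.s j W′.▷_) (x ∷ xs)) (trans len (sym (Listₚ.length-++-comm js (j ∷ [])))))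

  -- The weights of the two parts of a factorisation bound the reflection lengths of their images
  -- and add up to that of the unfolded Coxeter element, so both bounds are sharp.
  U-≼ : ∀ {js p} → Unique js → p W′.≼ W′.Π js → U p ≼ Π (uw js)
  U-≼ {js} {p} uq le = proj₁ (≼-intro (wts xs) (wts zs) eqn (ℕₚ.≤-trans (ℕₚ.≤-reflexive (cong (lT ∘ U) eq-u)) (lT-wts xs)) (lT-wts zs)
      (ℕₚ.≤-reflexive (trans (sym (wts-++ xs zs)) (trans (weight _ js (xs ++ zs) refl uq (trans eq-c (sym (W′.prodR-++ xs zs))) (trans (Listₚ.length-++ xs) len)) (sym (lT-Π (uw js) (uw-unique uq)))))))
    where
    open W′.Fac (W′.fac uq le)
    eqn : Π (uw js) ≡ U p · U (W′.prodR zs)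
    eqn = trans (Π-uw js) (trans (cong U (trans eq-c (cong (W′._· W′.prodR zs) (sym eq-u)))) (U-· p (W′.prodR zs)))

  -- The version of `Hits` that rotates whole fibres at once, so that every rotation comes from W′;
  -- the hit may be any letter of the initial fibre.
  data BHits : List (Fin W′.n) → G → Set where
    here : ∀ {i j js t} → fold i ≡ j → t ≡ s i → BHits (j ∷ js) t
    step : ∀ {j js t} → BHits (js ∷ʳ j) (U (W′.s j) ^ t) → BHits (j ∷ js) t

  fib-cons : ∀ j → ∃ λ i → ∃ λ w → fib j ≡ i ∷ w
  fib-cons j = go (fib j) (fib-∈ (proj₂ (fold-surj j)))
    where
    go : ∀ l {i} → i ∈ l → ∃ λ i → ∃ λ w → l ≡ i ∷ w
    go (i ∷ w) _ = i , w , refl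

  U-s-inv : ∀ j → inv (U (W′.s j)) ≡ U (W′.s j)
  U-s-inv j = trans (sym (U-inv (W′.s j))) (cong U (W′.inv-s j))

  commutes : ∀ w i → All (λ k → s k · s i ≡ s i · s k) w → Π w · s i ≡ s i · Π w
  commutes [] i [] = trans (idˡ (s i)) (sym (idʳ (s i)))
  commutes (k ∷ w) i (p ∷ ps) = trans (assoc _ _ _) (trans (cong (s k ·_) (commutes w i ps)) (trans (sym (assoc _ _ _)) (trans (cong (_· Π w) p) (assoc _ _ _))))

  fib-commutes : ∀ w i {j} → fold i ≡ j → All (λ k → fold k ≡ j) w → Π w ^ s i ≡ s i
  fib-commutes w i eq p = trans (cong (_· inv (Π w)) (commutes w i (All.map (λ {k} q → fold-commute k i (trans q (sym eq))) p))) (gsolve 2 (λ a b → (a ⊙ b ⊙ b ⁻) ⊜ a) refl (s i) (Π w))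

  -- If the hit occurs after a part w₁ of the fibre has been rotated away, the letters of w₁ commute
  -- with the letter hit, so undoing their conjugation does not change it.
  blockwise : ∀ js t → Hits (uw js) t → BHits js t
  blockwise [] t ()
  blockwise (j ∷ js) t h = whole h j js t refl refl
    where
    -- w₁ lists the letters of the fibre of j that have been rotated to the end already
    conv : ∀ {w t} → Hits w t → ∀ j js w₁ i w₂ t₀ → fib j ≡ w₁ ++ i ∷ w₂ → w ≡ (i ∷ w₂) ++ uw js ++ w₁ → t ≡ inv (Π w₁) ^ t₀ → BHits (j ∷ js) t₀
    whole : ∀ {w t} → Hits w t → ∀ j js t₀ → w ≡ uw (j ∷ js) → t ≡ t₀ → BHits (j ∷ js) t₀
    whole h j js t₀ eq te with fib-cons j
    ... | i , w , q = conv h j js [] i w t₀ q (trans eq (trans (cong (_++ uw js) q) (cong (λ x → i ∷ w ++ x) (sym (Listₚ.++-identityʳ (uw js)))))) (trans te (gsolve 1 (λ t → t ⊜ (ε ⁻ ⊙ t ⊙ ε ⁻ ⁻)) refl t₀))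
    conv (here q) j js w₁ i w₂ t₀ fq refl te = here fi (trans (gsolve 2 (λ w t → t ⊜ (w ⊙ (w ⁻ ⊙ t ⊙ w ⁻ ⁻) ⊙ w ⁻)) refl (Π w₁) t₀)
        (trans (cong (Π w₁ ^_) (trans (sym te) q)) (fib-commutes w₁ i fi (All.tabulate (λ m → ∈-fib (subst (_ ∈_) (sym fq) (∈-++⁺ˡ m)))))))
      where
      fi : fold i ≡ j
      fi = ∈-fib (subst (i ∈_) (sym fq) (∈-++⁺ʳ w₁ (here refl)))
    conv (step ne h) j js w₁ i [] t₀ fq refl te = step (next js refl)
      where
      conj : s i ^ _ ≡ U (W′.s j) ^ t₀
      conj = trans (cong (s i ^_) te) (trans (cong (λ a → a · (inv (Π w₁) · t₀ · inv (inv (Π w₁))) · inv a) (sym (inv-s i)))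
               (trans (gsolve 3 (λ a w t → (a ⁻ ⊙ (w ⁻ ⊙ t ⊙ w ⁻ ⁻) ⊙ a ⁻ ⁻) ⊜ ((w ⊙ a) ⁻ ⊙ t ⊙ (w ⊙ a) ⁻ ⁻)) refl (s i) (Π w₁) t₀)
                 (cong (_^ t₀) (trans (cong inv (trans (sym (Π-∷ʳ w₁ i)) (trans (cong Π (sym fq)) (sym (U-s j))))) (U-s-inv j)))))
      weq : (uw js ++ w₁) ∷ʳ i ≡ uw (js ∷ʳ j)
      weq = trans (Listₚ.++-assoc (uw js) w₁ (i ∷ [])) (trans (cong (uw js ++_) (sym fq)) (sym (uw-∷ʳ js j)))
      -- `whole` wants a word in the form of a head and a tail, which for the rotated word depends
      -- on whether js is empty.
      next : ∀ js′ → js′ ≡ js → BHits (js′ ∷ʳ j) (U (W′.s j) ^ t₀)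
      next [] refl = whole h j [] _ weq conj
      next (k ∷ js′) refl = whole h k (js′ ∷ʳ j) _ weq conj
    conv (step ne h) j js w₁ i (i′ ∷ w₂) t₀ fq refl te = conv h j js (w₁ ∷ʳ i) i′ w₂ t₀ (trans fq (sym (Listₚ.++-assoc w₁ (i ∷ []) (i′ ∷ w₂))))
        (cong (i′ ∷_) (trans (Listₚ.++-assoc w₂ (uw js ++ w₁) (i ∷ [])) (cong (w₂ ++_) (Listₚ.++-assoc (uw js) w₁ (i ∷ [])))))
        (trans (cong (s i ^_) te) (trans (cong (λ a → a · (inv (Π w₁) · t₀ · inv (inv (Π w₁))) · inv a) (sym (inv-s i)))
               (trans (gsolve 3 (λ a w t → (a ⁻ ⊙ (w ⁻ ⊙ t ⊙ w ⁻ ⁻) ⊙ a ⁻ ⁻) ⊜ ((w ⊙ a) ⁻ ⊙ t ⊙ (w ⊙ a) ⁻ ⁻)) refl (s i) (Π w₁) t₀)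
                 (cong (λ x → inv x ^ t₀) (sym (Π-∷ʳ w₁ i))))))

  E-rotw : ∀ w₁ w₂ x z → Unique (w₁ ++ w₂) → Full (w₁ ++ w₂) → E (w₂ ++ w₁) (act (inv (Π w₁)) x) (act (inv (Π w₁)) z) ≈ E (w₁ ++ w₂) x z
  E-rotw [] w₂ x z uq f = ≈-trans (≈-reflexive (cong (λ w → E w (act (inv e) x) (act (inv e) z)) (Listₚ.++-identityʳ w₂))) (E-cong w₂ (≋-trans (act-≡ x inv-e) (act-e x)) (≋-trans (act-≡ z inv-e) (act-e z)))
  E-rotw (i ∷ w₁) w₂ x z uq f = ≈-trans (≈-reflexive (cong (λ w → E w (act g x) (act g z)) (sym (Listₚ.++-assoc w₂ (i ∷ []) w₁))))
      (≈-trans (E-cong ((w₂ ∷ʳ i) ++ w₁) (pull x) (pull z)) (≈-trans (E-rotw w₁ (w₂ ∷ʳ i) (rf i x) (rf i z) (subst Unique (Listₚ.++-assoc w₁ w₂ (i ∷ [])) (Unique-rot uq)) full)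
        (≈-trans (≈-reflexive (cong (λ w → E w (rf i x) (rf i z)) (sym (Listₚ.++-assoc w₁ w₂ (i ∷ []))))) (E-rot i (w₁ ++ w₂) x z uq (full-supp f x) (full-supp f z)))))
    where
    g = inv (Π (i ∷ w₁))
    pull : ∀ v → act g v ≋ act (inv (Π w₁)) (rf i v)
    pull v = ≋-trans (act-≡ v (trans (inv-· (s i) (Π w₁)) (cong (inv (Π w₁) ·_) (inv-s i)))) (≋-trans (act-· (inv (Π w₁)) (s i) v) (act-cong (inv (Π w₁)) (act-s i v)))
    full : Full (w₁ ++ (w₂ ∷ʳ i))
    full k = subst (k ∈_) (Listₚ.++-assoc w₁ w₂ (i ∷ [])) (rot (f k))
      where
      rot : k ∈ i ∷ (w₁ ++ w₂) → k ∈ (w₁ ++ w₂) ∷ʳ i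
      rot (here q) = ∈-++⁺ʳ (w₁ ++ w₂) (here q)
      rot (there q) = ∈-++⁺ˡ q

  full-rot : ∀ {j js} → W′.Full (j ∷ js) → W′.Full (js ∷ʳ j)
  full-rot {j} {js} f k with f k
  ... | here q = ∈-++⁺ʳ js (here q)
  ... | there q = ∈-++⁺ˡ q

  E-rotU : ∀ j js x z → Unique (j ∷ js) → W′.Full (j ∷ js) → E (uw (js ∷ʳ j)) (act (U (W′.s j)) x) (act (U (W′.s j)) z) ≈ E (uw (j ∷ js)) x z
  E-rotU j js x z uq f = ≈-trans (≈-reflexive (cong (λ w → E w (act (U (W′.s j)) x) (act (U (W′.s j)) z)) (uw-∷ʳ js j)))
      (≈-trans (E-cong (uw js ++ fib j) (act-≡ x eq) (act-≡ z eq)) (E-rotw (fib j) (uw js) x z (uw-unique uq) (uw-full f)))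
    where
    eq : U (W′.s j) ≡ inv (Π (fib j))
    eq = trans (sym (U-s-inv j)) (cong inv (U-s j))

  -- Rotating by W′ makes the root y final; pairing with it then reads off one coordinate.
  record Final (js : List (Fin W′.n)) (y : Rt) : Set where
    field
      g       : W′.G
      rest    : List (Fin W′.n)
      i       : Fin n
      uniq    : Unique (rest ∷ʳ fold i)
      full    : W′.Full (rest ∷ʳ fold i)
      conj-c  : W′.Π (rest ∷ʳ fold i) ≡ g W′.^ W′.Π js
      to-0    : ∀ v → E (uw js) (vec y) v ≈ 0# → act (U g) v i ≈ 0#
      from-0  : ∀ v → act (U g) v i ≈ 0# → E (uw js) (vec y) v ≈ 0#

  final : ∀ js y → Unique js → W′.Full js → Final js y
  final js y uq f = go (blockwise js (ref y) (hits (uw js) y (uw-unique uq) (full-supp (uw-full f) (vec y)))) y refl uq f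
    where
    go : ∀ {js t} → BHits js t → ∀ y → ref y ≡ t → Unique js → W′.Full js → Final js y
    -- One more rotation moves the fibre from the front to the end: the root y is the first argument
    -- of the form, and for that argument `E-block` reads off a coordinate in the last block.
    go (here {i} {j} {js} refl q) y te uq f = record { g = W′.s j ; rest = js ; i = i ; uniq = W′.Unique-rot uq ; full = full-rot f ; conj-c = W′.Π-rot j js
        ; to-0 = λ v p → ≈-trans (≈-sym (at-i v)) (≈-trans (E-cong (uw (js ∷ʳ j)) (proj₂ a) ≋-refl) (≈-trans (E-•ˡ (uw (js ∷ʳ j)) (proj₁ a) (act A (vec y)) (act A v)) (≈-trans (*-≈ ≈-refl (≈-trans (E-rotU j js (vec y) v uq f) p)) (*-zeroʳ _))))
        ; from-0 = λ v p → ≈-trans (≈-sym (E-rotU j js (vec y) v uq f)) (≈-trans (E-cong (uw (js ∷ʳ j)) (proj₂ b) ≋-refl) (≈-trans (E-•ˡ (uw (js ∷ʳ j)) (proj₁ b) (α i) (act A v)) (≈-trans (*-≈ ≈-refl (≈-trans (at-i v) p)) (*-zeroʳ _)))) }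
      where
      A = U (W′.s j)
      y≡ : ref (A ▷ y) ≡ ref (σ i)
      y≡ = trans (ref-▷ A y) (trans (cong (A ^_) (trans te q)) (trans (trans (cong (_^ s i) (U-s j)) (fib-commutes (fib j) i refl (All.tabulate ∈-fib))) (sym (ref-σ i))))
      a : ∃ λ a → α i ≋ a • act A (vec y)
      a = proj₁ pq , ≋-trans (≋-sym (vec-σ i)) (≋-trans (proj₂ pq) (λ k → *-≈ ≈-refl (vec-▷ A y k)))
        where pq = proportional (σ i) (A ▷ y) (sym y≡)
      b : ∃ λ b → act A (vec y) ≋ b • α i
      b = proj₁ pq , ≋-trans (≋-sym (vec-▷ A y)) (≋-trans (proj₂ pq) (λ k → *-≈ ≈-refl (vec-σ i k)))
        where pq = proportional (A ▷ y) (σ i) y≡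
      at-i : ∀ v → E (uw (js ∷ʳ j)) (α i) (act A v) ≈ act A v i
      at-i v = split (∈-∃++ (fib-∈ {i} {j} refl))
        where
        split : (∃ λ w₁ → ∃ λ w₂ → fib j ≡ w₁ ++ i ∷ w₂) → E (uw (js ∷ʳ j)) (α i) (act A v) ≈ act A v i
        split (w₁ , w₂ , eq) = ≈-trans (≈-reflexive (cong (λ w → E w (α i) (act A v)) wq)) (E-block (uw js ++ w₁) i w₂ (act A v) (∉-prefix (uw js ++ w₁) uqw) (∉-tail (AllPairs-++ʳ (uw js ++ w₁) uqw))
              (All.tabulate (λ q → fib-nonadjacent j (fib-∈ refl) (subst (_ ∈_) (sym eq) (∈-++⁺ʳ w₁ (there q))))))
          where
          wq : uw (js ∷ʳ j) ≡ (uw js ++ w₁) ++ i ∷ w₂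
          wq = trans (uw-∷ʳ js j) (trans (cong (uw js ++_) eq) (sym (Listₚ.++-assoc (uw js) w₁ (i ∷ w₂))))
          uqw : Unique ((uw js ++ w₁) ++ i ∷ w₂)
          uqw = subst Unique wq (uw-unique (W′.Unique-rot uq))
    go (step {j} {js} {t} h) y te uq f = record { g = g W′.· W′.s j ; rest = rest ; i = i ; uniq = uniq ; full = full
        ; conj-c = trans conj-c (trans (cong (g W′.^_) (W′.Π-rot j js)) (W′.gsolve 3 (λ g a c → (g W′.⊙ (a W′.⊙ c W′.⊙ a W′.⁻) W′.⊙ g W′.⁻) W′.⊜ (g W′.⊙ a W′.⊙ c W′.⊙ (g W′.⊙ a) W′.⁻)) refl g (W′.s j) (W′.Π (j ∷ js))))
        ; to-0 = λ v p → ≈-trans (split v i) (to-0 (act A v) (≈-trans (rot v) p))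
        ; from-0 = λ v p → ≈-trans (≈-sym (rot v)) (from-0 (act A v) (≈-trans (≈-sym (split v i)) p)) }
      where
      A = U (W′.s j)
      open Final (go h (A ▷ y) (trans (ref-▷ A y) (cong (A ^_) te)) (W′.Unique-rot uq) (full-rot f))
      rot : ∀ v → E (uw (js ∷ʳ j)) (vec (A ▷ y)) (act A v) ≈ E (uw (j ∷ js)) (vec y) v
      rot v = ≈-trans (E-cong (uw (js ∷ʳ j)) (vec-▷ A y) ≋-refl) (E-rotU j js (vec y) v uq f)
      split : ∀ v → act (U (g W′.· W′.s j)) v ≋ act (U g) (act A v)
      split v = ≋-trans (act-≡ v (U-· g (W′.s j))) (act-· (U g) A v)

  pull : ∀ g w i → (∀ ρ → ref ρ ≼ U w → act (U g) (vec ρ) i ≈ 0#) → ∀ r → ref r ≼ U (g W′.^ w) → vec r i ≈ 0#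
  pull g w i z r le = ≈-trans (≈-sym (≈-trans (act-cong (U g) (vec-▷ (inv (U g)) r) i) (act-inv′ (U g) (vec r) i)))
      (z ρ (≼-unconj (U g) (subst₂ _≼_ (sym back) (U-^ g w) le)))
    where
    ρ = inv (U g) ▷ r
    back : U g ^ ref ρ ≡ ref r
    back = trans (cong (U g ^_) (ref-▷ (inv (U g)) r)) (gsolve 2 (λ g r → (g ⊙ (g ⁻ ⊙ r ⊙ g ⁻ ⁻) ⊙ g ⁻) ⊜ r) refl (U g) (ref r))

  push : ∀ g w i → (∀ r → ref r ≼ U (g W′.^ w) → vec r i ≈ 0#) → ∀ ρ → ref ρ ≼ U w → act (U g) (vec ρ) i ≈ 0#
  push g w i z ρ le = ≈-trans (≈-sym (vec-▷ (U g) ρ i)) (z (U g ▷ ρ) (subst₂ _≼_ (sym (ref-▷ (U g) ρ)) (sym (U-^ g w)) (≼-conj (U g) le)))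

  dominates-conj : ∀ g {w u} → W′.Dominates w u → W′.Dominates (g W′.^ w) (g W′.^ u)
  dominates-conj g {w} {u} d ρ le = subst (W′._≼ (g W′.^ u)) back (W′.≼-conj g (d τ (W′.≼-unconj g (subst (W′._≼ (g W′.^ w)) (sym back) le))))
    where
    τ = W′.inv g W′.▷ ρ
    back : g W′.^ W′.ref τ ≡ W′.ref ρ
    back = trans (cong (g W′.^_) (W′.ref-▷ (W′.inv g) ρ)) (W′.gsolve 2 (λ g r → (g W′.⊙ (g W′.⁻ W′.⊙ r W′.⊙ g W′.⁻ W′.⁻) W′.⊙ g W′.⁻) W′.⊜ r) refl g (W′.ref ρ))

  module _ {js : List (Fin W′.n)} (uq : Unique js) (f : W′.Full js) {w p : W′.G} (J : IsJoin Y′ js w p) where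
    open IsJoin J renaming (below to p≼; dominates to dom)
    private
      uqu = uw-unique uq
      fullu = uw-full f
      P≼ : U p ≼ Π (uw js)
      P≼ = U-≼ uq p≼

    -- For each complementary root y, `Final` turns orthogonality to y into the vanishing of
    -- coordinate i after rotation by g. As the image of g p g⁻¹ preserves that coordinate, `avoids`
    -- puts g p g⁻¹ into the parabolic subgroup without `fold i`. It dominates g w g⁻¹, which
    -- therefore lies there too, and translating back shows that the roots below `U w` are
    -- orthogonal to y.
    U-dominates : Dominates (U w) (U p)
    U-dominates ρ le = orth⇒below uqu F ρ (full-supp fullu (vec ρ)) (All.tabulate orth)
      where
      F = fac uqu P≼
      orth : ∀ {y} → y ∈ Fac.zs F → Orth (uw js) ρ y
      orth {y} mem = from-0 (vec ρ) (push g w i avoid-w ρ le)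
        where
        open Final (final js y uq f)
        u : ∃ λ u → fold i ∉ u × g W′.^ p ≡ W′.Π u
        u = avoids (g W′.^ p) i (preserves (U (g W′.^ p)) i (pull g p i (λ r le → to-0 (vec r) (All.lookup (proj₂ (below⇒orth uqu F r le)) mem))))
        wd : ∃ λ v → All (_∈ proj₁ u) v × g W′.^ w ≡ W′.Π v
        wd = W′.gen-word (W′.gen-dominated (proj₁ u) (g W′.^ w) (λ τ le → W′.word-gen (proj₁ u) (proj₂ (proj₂ u)) τ (dominates-conj g dom τ le)))
        avoid-w : ∀ r → ref r ≼ U (g W′.^ w) → vec r i ≈ 0#
        avoid-w r le = word-supp (uw (proj₁ wd)) (trans (cong U (proj₂ (proj₂ wd))) (sym (Π-uw (proj₁ wd)))) r le i
          (λ q → proj₁ (proj₂ u) (All.lookup (proj₁ (proj₂ wd)) (∈-uw (proj₁ wd) q)))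

    -- The same translation from w to p: every reflection below `U w` lies below u, so g w g⁻¹
    -- avoids `fold i` and w is dominated by `coatom`. Minimality of p puts p below `coatom`, so the
    -- factors of `U p` are orthogonal to the complement of u, and `orth⇒≼` combines them.
    U-minimal : ∀ u → u ≼ Π (uw js) → Dominates (U w) u → U p ≼ u
    U-minimal u u≼ du = subst (_≼ u) (sym (prod-fact (U p))) (proj₁ (orth⇒≼ uqu F (fact (U p)) (All.tabulate (λ {ρ} _ → full-supp fullu (vec ρ)))
        (AllPairs-++ˡ (fact (U p)) (Fac-orth uqu (fac uqu P≼))) (All.tabulate (λ {ρ} mρ → All.tabulate (λ {y} my → orth my ρ (below-p mρ))))))
      where
      F = fac uqu u≼
      below-p : ∀ {ρ} → ρ ∈ fact (U p) → ref ρ ≼ U p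
      below-p {ρ} q = subst (ref ρ ≼_) (sym (prod-fact (U p))) (All.lookup (factor-≼ (fact (U p)) (trans (length-fact (U p)) (cong lT (prod-fact (U p))))) q)
      orth : ∀ {y} → y ∈ Fac.zs F → ∀ ρ → ref ρ ≼ U p → Orth (uw js) ρ y
      orth {y} mem ρ le = from-0 (vec ρ) (push g p i avoid-p ρ le)
        where
        open Final (final js y uq f)
        uq-rest : Unique rest
        uq-rest = AllPairs-++ˡ rest uniq
        v : ∃ λ v → fold i ∉ v × g W′.^ w ≡ W′.Π v
        v = avoids (g W′.^ w) i (preserves (U (g W′.^ w)) i (pull g w i (λ r le → to-0 (vec r) (All.lookup (proj₂ (below⇒orth uqu F r (du r le))) mem))))
        full-rest : ∀ k → k ∉ rest → k ≡ fold i
        full-rest k nin = ∈-∷ʳ rest (full k) nin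
        dom-rest : W′.Dominates (g W′.^ w) (W′.Π rest)
        dom-rest τ le = W′.supp-below rest uq-rest τ (λ k nin → W′.word-supp (proj₁ v) (proj₂ (proj₂ v)) τ le k (subst (_∉ proj₁ v) (sym (full-rest k nin)) (proj₁ (proj₂ v))))
        -- The Coxeter element of the parabolic subgroup omitting `fold i`, conjugated back below
        -- `Π js`.
        coatom : W′.G
        coatom = W′.inv g W′.^ W′.Π rest
        back : ∀ x → W′.inv g W′.^ (g W′.^ x) ≡ x
        back x = W′.gsolve 2 (λ g x → (g W′.⁻ W′.⊙ (g W′.⊙ x W′.⊙ g W′.⁻) W′.⊙ g W′.⁻ W′.⁻) W′.⊜ x) refl g x
        forth : ∀ x → g W′.^ (W′.inv g W′.^ x) ≡ x
        forth x = W′.gsolve 2 (λ g x → (g W′.⊙ (g W′.⁻ W′.⊙ x W′.⊙ g W′.⁻ W′.⁻) W′.⊙ g W′.⁻) W′.⊜ x) refl g x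
        rest≼ : W′.Π rest W′.≼ W′.Π (rest ∷ʳ fold i)
        rest≼ = proj₁ (W′.≼-intro (length rest) 1 (W′.Π-∷ʳ rest (fold i)) (ℕₚ.≤-reflexive (W′.lT-Π rest uq-rest)) (ℕₚ.≤-reflexive (W′.lT-s (fold i)))
                  (ℕₚ.≤-reflexive (sym (trans (W′.lT-Π (rest ∷ʳ fold i) uniq) (Listₚ.length-++ rest)))))
        p≼coatom : p W′.≼ coatom
        p≼coatom = minimal coatom (subst (coatom W′.≼_) (trans (cong (W′.inv g W′.^_) conj-c) (back (W′.Π js))) (W′.≼-conj (W′.inv g) rest≼))
                     (subst (λ x → W′.Dominates x coatom) (back w) (dominates-conj (W′.inv g) dom-rest))
        avoid-p : ∀ r → ref r ≼ U (g W′.^ p) → vec r i ≈ 0#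
        avoid-p r le = below-supp (uw-unique uq-rest) (U-≼ uq-rest (subst ((g W′.^ p) W′.≼_) (forth (W′.Π rest)) (W′.≼-conj g p≼coatom))) r le i
                         (λ q → ∉-prefix rest uniq (∈-uw rest q))

    unfold-join : IsJoin Y (uw js) (U w) (U p)
    unfold-join = record { below = P≼ ; dominates = U-dominates ; minimal = U-minimal }

-- Transfer to the groups of the statement

filterᵇ≡filter : ∀ {A : Set} {P : A → Set} {p : A → Bool} (P? : ∀ x → Dec (P x)) → (∀ x → p x ≡ does (P? x)) → ∀ xs → filterᵇ p xs ≡ filter P? xs
filterᵇ≡filter P? eq [] = refl
filterᵇ≡filter {p = p} P? eq (x ∷ xs) with p x | does (P? x) | eq x
... | true  | .true  | refl = cong (x ∷_) (filterᵇ≡filter P? eq xs)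
... | false | .false | refl = filterᵇ≡filter P? eq xs

module _ {a ℓ : Level} (C : CoxeterSystem a ℓ) where
  open CoxeterNotions C using (rank; gen; group; Carrier; prodGenWhere)

  -- The list-valued local function of prodGenWhere is recovered by unification.
  private mutual
    chosen : (Fin rank → Bool) → List (Fin rank) → List Carrier
    chosen A is = _

    prodGenWhere-chosen : ∀ A → prodGenWhere A ≡ prod group (chosen A (allFin rank))
    prodGenWhere-chosen A with prod group | allFin rank
    -- With the list abstracted to a variable, the placeholder in `chosen` is determined by pattern
    -- unification.
    ... | f | l = refl {x = f (chosen A l)}

    chosen-filter : ∀ A l → chosen A l ≡ map gen (filterᵇ A l)
    chosen-filter A [] = refl
    chosen-filter A (i ∷ is) with A i
    ... | true  = cong (gen i ∷_) (chosen-filter A is)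
    ... | false = chosen-filter A is

  prodGenWhere-filter : ∀ A → prodGenWhere A ≡ prod group (map gen (filterᵇ A (allFin rank)))
  prodGenWhere-filter A = trans (prodGenWhere-chosen A) (cong (prod group) (chosen-filter A (allFin rank)))

module Transport {a ℓ : Level} (C : CoxeterSystem a ℓ) (fin : CoxeterNotions.IsFinite C) where
  open FiniteSystem C fin public
  private
    module N = CoxeterNotions C
  Y : System
  Y = system cox
  module G = Words Y

  mk-⁻¹ : ∀ w → mk (w N.⁻¹) ≡ G.inv (mk w)
  mk-⁻¹ w = mk-cong (N.⁻¹-cong (N.sym (un-mk w)))

  mk-prod : ∀ ts → mk (prod N.group ts) ≡ G.prodG (map mk ts)
  mk-prod [] = refl
  mk-prod (t ∷ ts) = trans (mk-∙ t (prod N.group ts)) (cong (mk t G.·_) (mk-prod ts))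

  mk-refl : ∀ {t} → N.IsReflection t → ∃ λ ρ → G.ref ρ ≡ mk t
  mk-refl {t} (g , i , eq) = (mk g , i) , sym (trans (mk-cong eq) (trans (mk-∙ _ _) (cong₂ G._·_ (mk-∙ g (N.gen i)) (mk-⁻¹ g))))

  un-refl : ∀ ρ → N.IsReflection (un (G.ref ρ))
  un-refl (h , i) = un h , i , mk-inj (trans (mk-un _) (sym (trans (mk-∙ _ _) (cong₂ G._·_ (trans (mk-∙ (un h) (N.gen i)) (cong (G._· G.s i) (mk-un h))) (trans (mk-⁻¹ (un h)) (cong G.inv (mk-un h)))))))

  mk-refls : ∀ {ts} → All N.IsReflection ts → ∃ λ ρs → map G.ref ρs ≡ map mk ts
  mk-refls [] = [] , refl
  mk-refls (p ∷ ps) = proj₁ (mk-refl p) ∷ proj₁ (mk-refls ps) , cong₂ _∷_ (proj₂ (mk-refl p)) (proj₂ (mk-refls ps))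

  reflLength : ∀ w → N.ReflLength w (G.lT (mk w))
  reflLength w = (map (un ∘ G.ref) ρs , Allₚ.map⁺ (All.universal un-refl ρs) , trans (Listₚ.length-map _ ρs) (G.length-fact (mk w)) ,
      mk-inj (trans (G.prod-fact (mk w)) (sym (trans (mk-prod (map (un ∘ G.ref) ρs)) (cong G.prodG (trans (sym (Listₚ.map-∘ {g = mk} {f = un ∘ G.ref} ρs)) (Listₚ.map-cong (mk-un ∘ G.ref) ρs)))))))
      , λ ts rs eq → ℕₚ.≤-trans (G.lT-≤ (mk w) (proj₁ (mk-refls rs)) (trans (mk-cong eq) (trans (mk-prod ts) (cong G.prodG (sym (proj₂ (mk-refls rs)))))))
          (ℕₚ.≤-reflexive (trans (sym (Listₚ.length-map G.ref (proj₁ (mk-refls rs)))) (trans (cong length (proj₂ (mk-refls rs))) (Listₚ.length-map mk ts))))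
    where ρs = G.fact (mk w)

  reflLength-unique : ∀ {w k} → N.ReflLength w k → k ≡ G.lT (mk w)
  reflLength-unique {w} ((ts , rs , refl , eq) , mn) = ℕₚ.≤-antisym (mn _ (proj₁ (proj₂ best)) (proj₂ (proj₂ (proj₂ best))) |≤| proj₁ (proj₂ (proj₂ best))) (proj₂ (reflLength w) ts rs eq)
    where
    best = proj₁ (reflLength w)
    _|≤|_ : ∀ {x y z} → x ≤ y → y ≡ z → x ≤ z
    p |≤| q = ℕₚ.≤-trans p (ℕₚ.≤-reflexive q)

  ≤T⇒≼ : ∀ {v w} → v N.≤T w → mk v G.≼ mk w
  ≤T⇒≼ {v} {w} (lw , lv , lq , rw , rv , rq , eq) = trans (cong₂ ℕ._+_ (trans (cong G.lT (sym (trans (mk-∙ w (v N.⁻¹)) (cong (mk w G.·_) (mk-⁻¹ v))))) (sym (reflLength-unique rq))) (sym (reflLength-unique rv))) (trans eq (reflLength-unique rw))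

  ≼⇒≤T : ∀ {v w} → mk v G.≼ mk w → v N.≤T w
  ≼⇒≤T {v} {w} le = _ , _ , _ , reflLength w , reflLength v , reflLength (w N.∙ v N.⁻¹) , trans (cong (λ x → G.lT x ℕ.+ G.lT (mk v)) (trans (mk-∙ w (v N.⁻¹)) (cong (mk w G.·_) (mk-⁻¹ v)))) le

  -- `Dominates` quantifies over pairs (h, i) and `IsPi` over reflections of the given group;
  -- `mk-refl` and `un-refl` pass between them.
  isPi : ∀ {js} w d p → mk d ≡ G.Π js → IsJoin Y js (mk w) (mk p) → N.IsPi w d p
  isPi w d p d≡ J = ≼⇒≤T (subst (mk p G.≼_) (sym d≡) below)
    , (λ t (r , t≤) → ≼⇒≤T (subst (G._≼ mk p) (proj₂ (mk-refl r)) (dominates (proj₁ (mk-refl r)) (subst (G._≼ mk w) (sym (proj₂ (mk-refl r))) (≤T⇒≼ t≤)))))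
    , (λ u u≤ below → ≼⇒≤T (minimal (mk u) (subst (mk u G.≼_) d≡ (≤T⇒≼ u≤)) (λ ρ ρ≼ → subst (G._≼ mk u) (mk-un (G.ref ρ)) (≤T⇒≼ (below (un (G.ref ρ)) (un-refl ρ , ≼⇒≤T (subst (G._≼ mk w) (sym (mk-un (G.ref ρ))) ρ≼)))))))
    where open IsJoin J

module _ {a ℓ a' ℓ' : Level} {W : CoxeterSystem a ℓ} {W' : CoxeterSystem a' ℓ'}
         (fin : CoxeterNotions.IsFinite W) (irr : CoxeterNotions.IsIrreducible W)
         (fin' : CoxeterNotions.IsFinite W') (irr' : CoxeterNotions.IsIrreducible W') (F : Folding W W') where
  private
    module N  = CoxeterNotions W
    module N′ = CoxeterNotions W'
    module X  = Transport W fin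
    module X′ = Transport W' fin'
    open Folding F
    module H = GroupMorphisms.IsGroupHomomorphism unfold-hom

    U₀ : X′.G.G → X.G.G
    U₀ x = X.mk (unfold (X′.un x))

    U₀-mk : ∀ w → U₀ (X′.mk w) ≡ X.mk (unfold w)
    U₀-mk w = X.mk-cong (H.⟦⟧-cong (X′.un-mk w))

  module _ (side₀ : Fin N′.rank → Bool) (comm : ∀ i j → side₀ i ≡ side₀ j → N′.gen i N′.∙ N′.gen j N′.≈ N′.gen j N′.∙ N′.gen i) where
    foldingData : FoldingData X.Y X′.Y
    foldingData = record
      { fold = fold ; fold-surj = fold-surj
      ; fold-commute = λ i k eq → trans (sym (X.mk-∙ _ _)) (trans (X.mk-cong (fold-commute i k eq)) (X.mk-∙ _ _))
      ; U = U₀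
      ; U-· = λ x y → trans (U₀-mk (X′.un x N′.∙ X′.un y)) (trans (X.mk-cong (H.homo _ _)) (X.mk-∙ _ _))
      ; U-inj = λ {x} {y} eq → trans (sym (X′.mk-un x)) (trans (X′.mk-cong (unfold-inj _ _ (X.mk-inj eq))) (X′.mk-un y))
      ; U-s = λ j → trans (U₀-mk (N′.gen j)) (trans (X.mk-cong (unfold-gen j)) (trans (cong X.mk (trans (prodGenWhere-filter W _) (cong (prod N.group ∘ map N.gen) (filterᵇ≡filter (λ i → fold i Fin.≟ j) (λ i → isYes≗does (fold i Fin.≟ j)) (allFin N.rank))))) (sym (X.word-mk (filter (λ i → fold i Fin.≟ j) (allFin N.rank))))))
      ; side = side₀
      ; side-commute = λ i k eq → trans (sym (X′.mk-∙ _ _)) (trans (X′.mk-cong (comm i k eq)) (X′.mk-∙ _ _))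
      ; connected = irr ; connected′ = irr' }

    private
      module FD = Folded foldingData
      module UF = Unfolding foldingData

      js : List (Fin N′.rank)
      js = FD.L′ true ++ FD.L′ false

      js-unique : Unique js
      js-unique = Uniqueₚ.++⁺ (FD.L′-unique true) (FD.L′-unique false) (λ (p , q) → b≢not true (trans (sym (All.lookup (FD.L′-col true) p)) (All.lookup (FD.L′-col false) q)))

      js-full : FD.W′.Full js
      js-full k with side₀ k in eq
      ... | true  = ∈-++⁺ˡ (subst (λ b → k ∈ FD.L′ b) eq (FD.L′-mem k))
      ... | false = ∈-++⁺ʳ (FD.L′ true) (subst (λ b → k ∈ FD.L′ b) eq (FD.L′-mem k))

    module _ (c : N′.Carrier) (c≈ : c N′.≈ N′.prodGenWhere side₀ N′.∙ N′.prodGenWhere (λ i → not (side₀ i))) where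
      private
        colour : ∀ b A → (∀ i → A i ≡ does (side₀ i Boolₚ.≟ b)) → X′.mk (N′.prodGenWhere A) ≡ X′.G.Π (FD.L′ b)
        colour b A eq = trans (cong X′.mk (trans (prodGenWhere-filter W' A) (cong (prod N′.group ∘ map N′.gen) (filterᵇ≡filter (λ i → side₀ i Boolₚ.≟ b) eq (allFin N′.rank))))) (sym (X′.word-mk (FD.L′ b)))

        is-true : ∀ b → b ≡ does (b Boolₚ.≟ true)
        is-true true = refl
        is-true false = refl

        is-false : ∀ b → not b ≡ does (b Boolₚ.≟ false)
        is-false true = refl
        is-false false = refl

        c-word : X′.mk c ≡ X′.G.Π js
        c-word = trans (X′.mk-cong c≈) (trans (X′.mk-∙ _ _) (trans (cong₂ X′.G._·_ (colour true side₀ (is-true ∘ side₀)) (colour false _ (is-false ∘ side₀))) (sym (X′.G.Π-++ (FD.L′ true) (FD.L′ false)))))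

        Uc-word : X.mk (unfold c) ≡ X.G.Π (FD.uw js)
        Uc-word = trans (sym (U₀-mk c)) (trans (cong U₀ c-word) (sym (FD.Π-uw js)))

      -- One y serves both sides: p is the join in W′, and by `unfold-join` its image is the join in
      -- W.
      popStep : ∀ z → ∃ λ y → N′.IsPop z c y × N.IsPop (unfold z) (unfold c) (unfold y)
      popStep z = z N′.∙ p N′.⁻¹
          , (p , X′.isPi z c p c-word (subst (IsJoin X′.Y js (X′.mk z)) (sym (X′.mk-un q)) J) , N′.refl)
          , (unfold p , X.isPi (unfold z) (unfold c) (unfold p) Uc-word (subst (λ x → IsJoin X.Y (FD.uw js) x (U₀ q)) (U₀-mk z) (UF.unfold-join js-unique js-full J))
              , N.trans (H.homo z (p N′.⁻¹)) (N.∙-cong N.refl (H.⁻¹-homo p)))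
        where
        q = proj₁ (join X′.Y js js-unique js-full (X′.mk z))
        J = proj₂ (join X′.Y js js-unique js-full (X′.mk z))
        p = X′.un q

-- `IsPopIter` is a relation, so the equality of the two iterates is expressed by a single y′ that
-- is the k-th iterate in W′ and whose unfolding is the k-th iterate in W.
theorem4p8 : {a ℓ a' ℓ' : Level} (W : CoxeterSystem a ℓ) (W' : CoxeterSystem a' ℓ') →
    CoxeterNotions.IsFinite W → CoxeterNotions.IsIrreducible W →
    CoxeterNotions.IsFinite W' → CoxeterNotions.IsIrreducible W' →
    (F : Folding W W') →
    (c' : CoxeterNotions.Carrier W') → CoxeterNotions.IsBipartiteCoxeterElement W' c' →
    (w' : CoxeterNotions.Carrier W') (k : ℕ) →
    ∃ λ (y' : CoxeterNotions.Carrier W') →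
      CoxeterNotions.IsPopIter W' k w' c' y'
      × CoxeterNotions.IsPopIter W k (Folding.unfold F w') (Folding.unfold F c') (Folding.unfold F y')
theorem4p8 W W' fin irr fin' irr' F c' bip w' zero = w' , lift (CoxeterNotions.refl W') , lift (CoxeterNotions.refl W)
theorem4p8 W W' fin irr fin' irr' F c' bip@(side , comm , c≈) w' (suc k) = proj₁ next , (z' , proj₁ (proj₂ ih) , proj₁ (proj₂ next)) , (Folding.unfold F z' , proj₂ (proj₂ ih) , proj₂ (proj₂ next))
  where
  ih = theorem4p8 W W' fin irr fin' irr' F c' bip w' k
  z' = proj₁ ih
  next = popStep fin irr fin' irr' F side comm c' c≈ z'
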